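{- For all integers $n$ (with $\overline{\mathrm{spt}}_\omega(m)=0$ for $m\le 0$), $\overline{\mathrm{spt}}_\omega(3n)\equiv 0\pmod 3$, $\overline{\mathrm{spt}}_\omega(3n+2)\equiv 0\pmod 3$, $\overline{\mathrm{spt}}_\omega(10n+6)\equiv 0\pmod 5$, and $\overline{\mathrm{spt}}_\omega(6n+5)\equiv 0\pmod 6$.
   Context: $\overline{\mathrm{spt}}_{\omega}(n)$ is the number of smallest parts in the overpartitions of $n$ in which the smallest part is always overlined and all odd parts are less than twice the smallest part; equivalently $\sum_{n\ge1}\overline{\mathrm{spt}}_{\omega}(n)q^n=\sum_{n\ge1}\frac{q^{n}(-q^{n+1};q)_{n}(-q^{2n+2};q^2)_{\infty}}{(1-q^n)^2(q^{n+1};q)_n(q^{2n+2};q^2)_{\infty}}$, where $(a;q)_n=\prod_{k=0}^{n-1}(1-aq^k)$, $(a;q)_\infty=\prod_{k\ge0}(1-aq^k)$. -}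

module Defs where

open import Data.Nat using (ℕ; zero; suc; _+_; _*_; _∸_; _<ᵇ_; _≤ᵇ_)
open import Data.Nat.Base using (_%_)
open import Data.Bool using (Bool; true; false; if_then_else_; _∧_; _∨_; not)
open import Data.List using (List; []; _∷_; _++_; map; concatMap; filterᵇ; upTo)
open import Data.Nat.ListAction using (sum)
open import Data.List using (all)
open import Data.Product using (_×_; _,_)
open import Data.Integer using (ℤ; +_; -[1+_])

-- A block (v , k , b) of an overpartition: part value v occurring k ≥ 1 times,
-- b = true iff the first occurrence of v is overlined.
Block : Set
Block = ℕ × ℕ × Bool

-- ovps m n : all overpartitions of n with all parts ≤ m, each given as a list of
-- blocks with strictly decreasing part values (each overpartition listed once).
ovps : ℕ → ℕ → List (List Block)
ovps zero    zero    = [] ∷ []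
ovps zero    (suc _) = []
ovps (suc m) n =
  ovps m n ++
  concatMap
    (λ k → concatMap
      (λ b → map ((suc m , suc k , b) ∷_) (ovps m (n ∸ suc k * suc m)))
      (true ∷ false ∷ []))
    (filterᵇ (λ k → suc k * suc m ≤ᵇ n) (upTo n))

overpartitions : ℕ → List (List Block)
overpartitions n = ovps n n

isOdd : ℕ → Bool
isOdd v = (v % 2) Data.Nat.≡ᵇ 1

-- Contribution of an overpartition: if its smallest part s is overlined and all odd
-- parts are < 2s, the number of occurrences of the smallest part; otherwise 0.
-- (The smallest part is the last block.)
weight : List Block → ℕ
weight π = go π
  where
  ok : ℕ → List Block → Bool
  ok s = all (λ { (v , _ , _) → not (isOdd v) ∨ (v <ᵇ 2 * s) })
  go : List Block → ℕ
  go [] = 0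
  go ((s , k , b) ∷ []) = if b ∧ ok s π then k else 0
  go (_ ∷ rest@(_ ∷ _)) = go rest

sptω : ℕ → ℕ
sptω n = sum (map weight (overpartitions n))

sptωℤ : ℤ → ℕ
sptωℤ (+ n)    = sptω n
sptωℤ -[1+ _ ] = 0

{-# OPTIONS --safe #-}

-- Let F be the generating function of the numbers in question and φ = Σ (−1)ᵏ q^(2k²). A Bailey pair, found
-- by creative telescoping, gives φ F = Σ_s L(s) + 2 Σ_r (−1)ʳ q^(2r²) L(2r) with L(s) = q^s / (1 − q^s)².
-- Modulo 2 one has φ = 1, and F reduces to a divisor sum. As φ is even, the even and the odd part of F
-- times φ are explicit double sums as well.
--
-- Put θ = q d/dq. If s = φ t then φ θ s − (θ φ) s = φ² θ t, so a relation t₁ + θ t₂ ≡ 0 (mod p) between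
-- series with known φ tᵢ is equivalent to the vanishing modulo p of a sum over the triples (n , k , d)
-- with k² + n d = M (2 k² + n d = N in the odd case), weighted by (−1)ᵏ times an elementary function of n,
-- k and d. The terms that involve n < d are odd in d − n, and Liouville's substitutions between the
-- triples x² + y² − h² = M and the triples w² + 2 u c = M (or reflections, in the odd case) turn them into
-- polynomial weights, which then vanish modulo p after symmetrization in n ↔ d and k ↔ −k. For p = 3 this
-- yields (1 + 2 θ) F ≡ 0 on the even part and (θ − 1) F ≡ 0 on the odd part; for p = 5 it yields
-- F + (θ − 1) t ≡ 0 for some t, on the even part. Hence the coefficient at N vanishes modulo 3 unless
-- N ≡ 1 (mod 3), and modulo 5 for even N ≡ 1 (mod 5).
module Submission where

open import Defs
import Algebra.Solver.Ring
open import Data.Bool using (Bool; true; false; if_then_else_; _∧_; _∨_; not)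
import Data.Bool.Properties as Bool
open import Data.Empty using (⊥-elim)
open import Data.Integer as ℤ using (ℤ; +_; 0ℤ; 1ℤ; -[1+_]; -1ℤ; ∣_∣)
import Data.Integer.DivMod as ℤ
import Data.Integer.Properties as ℤ
open import Data.Integer.Tactic.RingSolver using (solve-∀)
open import Data.List using (List; []; _∷_; _++_; map; filter; cartesianProduct)
open import Data.List.Membership.Propositional using (_∈_)
open import Data.List.Membership.Propositional.Properties using (∈-filter⁺; ∈-filter⁻; ∈-map⁺; ∈-map⁻; ∈-cartesianProduct⁺; ∈-cartesianProduct⁻)
open import Data.List.Relation.Unary.All as All using (All; []; _∷_)
import Data.List.Relation.Unary.All.Properties as All
open import Data.List.Relation.Unary.AllPairs using ([]; _∷_)
open import Data.List.Relation.Unary.Any using (here; there)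
open import Data.List.Relation.Unary.Unique.Propositional using (Unique)
open import Data.List.Relation.Unary.Unique.Propositional.Properties using (filter⁺; cartesianProduct⁺)
open import Data.Nat as ℕ using (ℕ; zero; suc; _≤_; z≤n; s≤s; _≤ᵇ_; _<ᵇ_; _≡ᵇ_)
import Data.Nat.DivMod as ℕ
import Data.Nat.Divisibility as ℕ
import Data.Nat.Properties as ℕ
open import Data.Nat.Tactic.RingSolver using () renaming (solve-∀ to ℕ-solve)
open import Data.Product using (_,_; ∃; _×_; proj₁; proj₂)
open import Data.Sum using (inj₁; inj₂; _⊎_)
open import Data.Unit using (tt)
open import Function using (_∘_; id)
open import Relation.Binary.PropositionalEquality using (_≡_; _≗_; refl; sym; trans; cong; cong₂; module ≡-Reasoning; subst; _≢_)
import Relation.Binary.Reasoning.Setoid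
open import Relation.Nullary using (yes; no; ¬?; Dec; ¬_)

-- The obstacle is that the coefficients of φ F involve the sign (-1)ⁿ and the condition n < d,
-- which no symmetrization of a polynomial weight removes. Put j = d - n and X = n d - k². In the
-- even part, t₁ and t₂ with φ tᵢ of weight cᵢ produce the weight c₁ + 2 X c₂. If the terms with n <
-- d are proportional to j² f(j) in c₁ and 2 f(j) in c₂, with f odd, they combine to f(j) (j² + 4
-- X), and j² + 4 X = (d + n)² - 4 k² becomes 4 (x² - y²) for x = (n + d)/2 and y = k. This changes
-- sign under x ↔ y, which is what the substitutions exploit. Hence the conditions on f: j² f(j) ≡ j
-- for p = 3, solved by f(j) = j, and (j² + 2) f(j) ≡ 2 j for p = 5, solved by f(j) = j³ + 3 j. An
-- auxiliary polynomial g (zero for p = 3), whose own contributions cancel up to boundary terms,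
-- gives the freedom to make the rest vanish. Boundary terms occur when M is a square; they
-- telescope. All series are cut off at a degree B, finally the index of the coefficient in
-- question, so that inverses, infinite products and the limit in the Bailey lemma become finite
-- computations.

-- Formal power series, truncated and with coefficients modulo p.

module PowerSeries where
  open import Data.Integer using (_+_; _*_; -_)
  open import Algebra using (CommutativeRing)
  open import Level using (0ℓ)
  open import Data.Maybe using (Maybe; just; nothing)
  open import Algebra.Solver.Ring.AlmostCommutativeRing using (fromCommutativeRing; _-Raw-AlmostCommutative⟶_)

  Series : Set
  Series = ℕ → ℤ

  infixl 7 _⊛_
  -- The Cauchy product, read as (a₀ + q a′) b: only the left factor is peeled off, so the ring laws
  -- follow by induction on the degree without sums over splittings of n.
  _⊛_ : Series → Series → Series
  (a ⊛ b) zero    = a 0 * b 0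
  (a ⊛ b) (suc n) = a 0 * b (suc n) + ((a ∘ suc) ⊛ b) n

  const : ℤ → Series
  const c zero    = c
  const c (suc _) = 0ℤ

  -- Opaque, so that sums of series unify structurally.
  opaque
    infixl 6 _⊕_
    infix 8 ⊝_
    _⊕_ : Series → Series → Series
    (a ⊕ b) n = a n + b n

    ⊝_ : Series → Series
    (⊝ a) n = - a n

    ⊕-at : ∀ a b n → (a ⊕ b) n ≡ a n + b n
    ⊕-at a b n = refl

    ⊝-at : ∀ a n → (⊝ a) n ≡ - a n
    ⊝-at a n = refl

  θ : Series → Series
  θ a n = + n * a n

  ⊛-distribʳ : ∀ a b c n → ((λ i → a i + b i) ⊛ c) n ≡ (a ⊛ c) n + (b ⊛ c) n
  ⊛-distribʳ a b c zero    = ℤ.*-distribʳ-+ (c 0) (a 0) (b 0)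
  ⊛-distribʳ a b c (suc n) =
    trans (cong (λ z → (a 0 + b 0) * c (suc n) + z) (⊛-distribʳ (a ∘ suc) (b ∘ suc) c n))
          (lem (a 0) (b 0) (c (suc n)) _ _)
    where
    lem : ∀ x y z u v → (x + y) * z + (u + v) ≡ x * z + u + (y * z + v)
    lem = solve-∀

  ⊛-scaleˡ : ∀ t a c n → ((λ i → t * a i) ⊛ c) n ≡ t * (a ⊛ c) n
  ⊛-scaleˡ t a c zero    = ℤ.*-assoc t (a 0) (c 0)
  ⊛-scaleˡ t a c (suc n) =
    trans (cong (λ z → t * a 0 * c (suc n) + z) (⊛-scaleˡ t (a ∘ suc) c n))
          (lem t (a 0) (c (suc n)) _)
    where
    lem : ∀ t x z u → t * x * z + t * u ≡ t * (x * z + u)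
    lem = solve-∀

  ⊛-sucʳ : ∀ a b n → (a ⊛ b) (suc n) ≡ (a ⊛ (b ∘ suc)) n + a (suc n) * b 0
  ⊛-sucʳ a b zero    = refl
  ⊛-sucʳ a b (suc n) =
    trans (cong (λ z → a 0 * b (suc (suc n)) + z) (⊛-sucʳ (a ∘ suc) b n))
          (sym (ℤ.+-assoc (a 0 * b (suc (suc n))) _ _))

  ⊛-comm : ∀ a b n → (a ⊛ b) n ≡ (b ⊛ a) n
  ⊛-comm a b zero    = ℤ.*-comm (a 0) (b 0)
  ⊛-comm a b (suc n) = begin
    a 0 * b (suc n) + ((a ∘ suc) ⊛ b) n ≡⟨ cong₂ _+_ (ℤ.*-comm (a 0) _) (⊛-comm (a ∘ suc) b n) ⟩
    b (suc n) * a 0 + (b ⊛ (a ∘ suc)) n ≡⟨ ℤ.+-comm _ ((b ⊛ (a ∘ suc)) n) ⟩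
    (b ⊛ (a ∘ suc)) n + b (suc n) * a 0 ≡⟨ ⊛-sucʳ b a n ⟨
    (b ⊛ a) (suc n)                     ∎
    where open ≡-Reasoning

  ⊛-assoc : ∀ a b c n → ((a ⊛ b) ⊛ c) n ≡ (a ⊛ (b ⊛ c)) n
  ⊛-assoc a b c zero    = ℤ.*-assoc (a 0) (b 0) (c 0)
  ⊛-assoc a b c (suc n) = begin
    a 0 * b 0 * c (suc n) + ((λ i → a 0 * b (suc i) + ((a ∘ suc) ⊛ b) i) ⊛ c) n
      ≡⟨ cong (λ z → a 0 * b 0 * c (suc n) + z) (⊛-distribʳ (λ i → a 0 * b (suc i)) _ c n) ⟩
    a 0 * b 0 * c (suc n) + (((λ i → a 0 * b (suc i)) ⊛ c) n + (((a ∘ suc) ⊛ b) ⊛ c) n)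
      ≡⟨ cong₂ (λ x y → a 0 * b 0 * c (suc n) + (x + y))
           (⊛-scaleˡ (a 0) (b ∘ suc) c n) (⊛-assoc (a ∘ suc) b c n) ⟩
    a 0 * b 0 * c (suc n) + (a 0 * ((b ∘ suc) ⊛ c) n + ((a ∘ suc) ⊛ (b ⊛ c)) n)
      ≡⟨ lem (a 0) (b 0) (c (suc n)) _ _ ⟩
    a 0 * (b 0 * c (suc n) + ((b ∘ suc) ⊛ c) n) + ((a ∘ suc) ⊛ (b ⊛ c)) n ∎
    where
    open ≡-Reasoning
    lem : ∀ x y z u v → x * y * z + (x * u + v) ≡ x * (y * z + u) + v
    lem = solve-∀

  ⊛-zeroˡ : ∀ b n → ((λ _ → 0ℤ) ⊛ b) n ≡ 0ℤ
  ⊛-zeroˡ b zero    = ℤ.*-zeroˡ (b 0)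
  ⊛-zeroˡ b (suc n) = trans (cong₂ _+_ (ℤ.*-zeroˡ (b (suc n))) (⊛-zeroˡ b n)) refl

  ⊛-const : ∀ t b n → (const t ⊛ b) n ≡ t * b n
  ⊛-const t b zero    = refl
  ⊛-const t b (suc n) = trans (cong (λ z → t * b (suc n) + z) (⊛-zeroˡ b n)) (ℤ.+-identityʳ _)

  θ-⊛ : ∀ a b n → θ (a ⊛ b) n ≡ (θ a ⊛ b) n + (a ⊛ θ b) n
  θ-⊛ a b zero    = lem (a 0) (b 0)
    where
    lem : ∀ x y → 0ℤ * (x * y) ≡ 0ℤ * x * y + x * (0ℤ * y)
    lem = solve-∀
  θ-⊛ a b (suc n) = begin
    + suc n * (a 0 * b (suc n) + w)
      ≡⟨ lem (+ n) (a 0) (b (suc n)) w ⟩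
    a 0 * (+ suc n * b (suc n)) + (+ n * w + w)
      ≡⟨ cong (λ z → a 0 * (+ suc n * b (suc n)) + (z + w)) (θ-⊛ (a ∘ suc) b n) ⟩
    a 0 * (+ suc n * b (suc n)) + (u + v + w)
      ≡⟨ lem₂ (a 0) (b (suc n)) (+ suc n * b (suc n)) u v w ⟩
    0ℤ * a 0 * b (suc n) + (u + w) + (a 0 * (+ suc n * b (suc n)) + v)
      ≡⟨ cong (λ z → 0ℤ * a 0 * b (suc n) + z + (a 0 * (+ suc n * b (suc n)) + v))
           (trans (sym (⊛-distribʳ (θ (a ∘ suc)) (a ∘ suc) b n)) (sym (⊛-congˡ n tail))) ⟩
    0ℤ * a 0 * b (suc n) + ((θ a ∘ suc) ⊛ b) n + (a 0 * (+ suc n * b (suc n)) + v) ∎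
    where
    open ≡-Reasoning
    u v w : ℤ
    u = (θ (a ∘ suc) ⊛ b) n
    v = ((a ∘ suc) ⊛ θ b) n
    w = ((a ∘ suc) ⊛ b) n
    ⊛-congˡ : ∀ {a c b : Series} n → a ≗ c → (a ⊛ b) n ≡ (c ⊛ b) n
    ⊛-congˡ {b = b} zero    p = cong (_* b 0) (p 0)
    ⊛-congˡ {b = b} (suc n) p = cong₂ _+_ (cong (_* b (suc n)) (p 0)) (⊛-congˡ n (p ∘ suc))
    tail : ∀ i → + suc i * a (suc i) ≡ + i * a (suc i) + a (suc i)
    tail i = suc-* (+ i) (a (suc i))
      where
      suc-* : ∀ m x → (1ℤ + m) * x ≡ m * x + x
      suc-* = solve-∀
    lem : ∀ m x y u → (1ℤ + m) * (x * y + u) ≡ x * ((1ℤ + m) * y) + (m * u + u)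
    lem = solve-∀
    lem₂ : ∀ x y p u v w → x * p + (u + v + w) ≡ 0ℤ * x * y + (u + w) + (x * p + v)
    lem₂ = solve-∀

  -- Series up to degree B with coefficients modulo p; p = 0 gives exact integer coefficients.
  module Truncated (B p : ℕ) where

    infix 4 _≋_ _≈_
    record _≋_ (a b : ℤ) : Set where
      constructor by
      field
        quot  : ℤ
        proof : a ≡ b + quot * + p

    ≡⇒≋ : ∀ {a b} → a ≡ b → a ≋ b
    ≡⇒≋ {b = b} eq = by 0ℤ (trans eq (lem b (+ p)))
      where
      lem : ∀ b p → b ≡ b + 0ℤ * p
      lem = solve-∀

    ≋-sym : ∀ {a b} → a ≋ b → b ≋ a
    ≋-sym {b = b} (by t refl) = by (- t) (lem b t (+ p))
      where
      lem : ∀ b t p → b ≡ b + t * p + - t * p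
      lem = solve-∀

    ≋-trans : ∀ {a b c} → a ≋ b → b ≋ c → a ≋ c
    ≋-trans {c = c} (by t refl) (by s refl) = by (s + t) (lem c s t (+ p))
      where
      lem : ∀ c s t p → c + s * p + t * p ≡ c + (s + t) * p
      lem = solve-∀

    +-cong≋ : ∀ {a b c d} → a ≋ b → c ≋ d → a + c ≋ b + d
    +-cong≋ {b = b} {d = d} (by t refl) (by s refl) = by (t + s) (lem b d t s (+ p))
      where
      lem : ∀ b d t s p → b + t * p + (d + s * p) ≡ b + d + (t + s) * p
      lem = solve-∀

    *-cong≋ : ∀ {a b c d} → a ≋ b → c ≋ d → a * c ≋ b * d
    *-cong≋ {b = b} {d = d} (by t refl) (by s refl) =
      by (t * d + b * s + t * s * + p) (lem b d t s (+ p))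
      where
      lem : ∀ b d t s p → (b + t * p) * (d + s * p) ≡ b * d + (t * d + b * s + t * s * p) * p
      lem = solve-∀

    neg-cong≋ : ∀ {a b} → a ≋ b → - a ≋ - b
    neg-cong≋ {b = b} (by t refl) = by (- t) (lem b t (+ p))
      where
      lem : ∀ b t p → - (b + t * p) ≡ - b + - t * p
      lem = solve-∀

    record _≈_ (a b : Series) : Set where
      constructor upTo
      field
        at : ∀ n → n ≤ B → a n ≋ b n
    open _≈_ public

    ≗⇒≈ : ∀ {a b} → a ≗ b → a ≈ b
    ≗⇒≈ eq = upTo λ n _ → ≡⇒≋ (eq n)

    ≈-refl : ∀ {a} → a ≈ a
    ≈-refl = ≗⇒≈ λ _ → refl

    -- A coefficient of a product depends only on coefficients of at most the same degree. This is
    -- why cutting off at degree B gives a ring.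
    ⊛-cong≋ : ∀ {a b c d} n → (∀ i → i ≤ n → a i ≋ c i) → (∀ i → i ≤ n → b i ≋ d i) →
              (a ⊛ b) n ≋ (c ⊛ d) n
    ⊛-cong≋ zero    f g = *-cong≋ (f 0 z≤n) (g 0 z≤n)
    ⊛-cong≋ (suc n) f g = +-cong≋ (*-cong≋ (f 0 z≤n) (g (suc n) ℕ.≤-refl))
      (⊛-cong≋ n (λ i i≤n → f (suc i) (s≤s i≤n)) (λ i i≤n → g i (ℕ.m≤n⇒m≤1+n i≤n)))

    opaque
      unfolding _⊕_ ⊝_

      ⊕-cong : ∀ {a b c d} → a ≈ b → c ≈ d → a ⊕ c ≈ b ⊕ d
      ⊕-cong e f = upTo λ n l → +-cong≋ (at e n l) (at f n l)

      ⊕-assoc : ∀ a b c → a ⊕ b ⊕ c ≈ a ⊕ (b ⊕ c)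
      ⊕-assoc a b c = ≗⇒≈ λ n → ℤ.+-assoc (a n) (b n) (c n)

      ⊕-identityˡ : ∀ a → (λ _ → 0ℤ) ⊕ a ≈ a
      ⊕-identityˡ a = ≗⇒≈ λ n → ℤ.+-identityˡ (a n)

      ⊕-identityʳ : ∀ a → a ⊕ (λ _ → 0ℤ) ≈ a
      ⊕-identityʳ a = ≗⇒≈ λ n → ℤ.+-identityʳ (a n)

      ⊕-inverseˡ : ∀ a → ⊝ a ⊕ a ≈ (λ _ → 0ℤ)
      ⊕-inverseˡ a = ≗⇒≈ λ n → ℤ.+-inverseˡ (a n)

      ⊕-inverseʳ : ∀ a → a ⊕ ⊝ a ≈ (λ _ → 0ℤ)
      ⊕-inverseʳ a = ≗⇒≈ λ n → ℤ.+-inverseʳ (a n)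

      ⊝-cong : ∀ {a b} → a ≈ b → ⊝ a ≈ ⊝ b
      ⊝-cong e = upTo λ n l → neg-cong≋ (at e n l)

      ⊕-comm : ∀ a b → a ⊕ b ≈ b ⊕ a
      ⊕-comm a b = ≗⇒≈ λ n → ℤ.+-comm (a n) (b n)

      ⊛-distribˡ-⊕ : ∀ a b c → a ⊛ (b ⊕ c) ≈ a ⊛ b ⊕ a ⊛ c
      ⊛-distribˡ-⊕ a b c = ≗⇒≈ λ n → trans (⊛-comm a (b ⊕ c) n)
        (trans (⊛-distribʳ b c a n) (cong₂ _+_ (⊛-comm b a n) (⊛-comm c a n)))

      ⊛-distribʳ-⊕ : ∀ a b c → (b ⊕ c) ⊛ a ≈ b ⊛ a ⊕ c ⊛ a
      ⊛-distribʳ-⊕ a b c = ≗⇒≈ (⊛-distribʳ b c a)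

      const-+ : ∀ x y → const (x + y) ≈ const x ⊕ const y
      const-+ x y = ≗⇒≈ λ { zero → refl ; (suc _) → refl }

      const-neg : ∀ x → const (- x) ≈ ⊝ const x
      const-neg x = ≗⇒≈ λ { zero → refl ; (suc _) → refl }

    seriesRing : CommutativeRing 0ℓ 0ℓ
    seriesRing = record
      { Carrier = Series
      ; _≈_ = _≈_
      ; _+_ = _⊕_
      ; _*_ = _⊛_
      ; -_ = ⊝_
      ; 0# = λ _ → 0ℤ
      ; 1# = const 1ℤ
      ; isCommutativeRing = record
        { isRing = record
          { +-isAbelianGroup = record
            { isGroup = record
              { isMonoid = record
                { isSemigroup = record
                  { isMagma = record
                    { isEquivalence = record
                      { refl = ≈-refl
                      ; sym = λ e → upTo λ n l → ≋-sym (at e n l)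
                      ; trans = λ e f → upTo λ n l → ≋-trans (at e n l) (at f n l)
                      }
                    ; ∙-cong = ⊕-cong
                    }
                  ; assoc = ⊕-assoc
                  }
                ; identity = ⊕-identityˡ , ⊕-identityʳ
                }
              ; inverse = ⊕-inverseˡ , ⊕-inverseʳ
              ; ⁻¹-cong = ⊝-cong
              }
            ; comm = ⊕-comm
            }
          ; *-cong = λ e f → upTo λ n l → ⊛-cong≋ n
              (λ i i≤n → at e i (ℕ.≤-trans i≤n l)) (λ i i≤n → at f i (ℕ.≤-trans i≤n l))
          ; *-assoc = λ a b c → ≗⇒≈ (⊛-assoc a b c)
          ; *-identity = (λ a → ≗⇒≈ (one a))
                       , (λ a → ≗⇒≈ λ n → trans (⊛-comm a (const 1ℤ) n) (one a n))
          ; distrib = ⊛-distribˡ-⊕ , ⊛-distribʳ-⊕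
          }
        ; *-comm = λ a b → ≗⇒≈ (⊛-comm a b)
        }
      }
      where
      one : ∀ a n → (const 1ℤ ⊛ a) n ≡ a n
      one a n = trans (⊛-const 1ℤ a n) (ℤ.*-identityˡ (a n))

    open CommutativeRing seriesRing public
      using (setoid; zeroˡ; zeroʳ; +-cong; +-identityʳ; +-congˡ; +-congʳ; *-cong; *-congˡ; *-congʳ; *-assoc; *-comm; *-identityˡ; *-identityʳ)
      renaming (_-_ to _⊖_; 0# to 𝟘; 1# to 𝟙; sym to ≈-sym; trans to ≈-trans)

    private
      morphism : CommutativeRing.rawRing ℤ.+-*-commutativeRing -Raw-AlmostCommutative⟶ fromCommutativeRing seriesRing
      morphism = record
        { ⟦_⟧ = const
        ; +-homo = const-+
        ; *-homo = λ x y → ≗⇒≈ λ { zero → refl ; (suc n) → sym (trans (⊛-const x (const y) (suc n)) (ℤ.*-zeroʳ x)) }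
        ; -‿homo = const-neg
        ; 0-homo = const-0
        ; 1-homo = ≈-refl
        }
        where
        const-0 : const 0ℤ ≈ (λ _ → 0ℤ)
        const-0 = ≗⇒≈ λ { zero → refl ; (suc _) → refl }
      dec : ∀ x y → Maybe (const x ≈ const y)
      dec x y with x ℤ.≟ y
      ... | yes refl = just ≈-refl
      ... | no _     = nothing
    module Solver = Algebra.Solver.Ring (CommutativeRing.rawRing ℤ.+-*-commutativeRing)
      (fromCommutativeRing seriesRing) morphism dec

-- Units, creative telescoping and the Bailey pair.

module BaileyPair where
  open PowerSeries
  open import Data.Nat using (_+_; _*_; _∸_; _<_)

  shift : ℕ → Series → Series
  shift zero    a n       = a n
  shift (suc k) a zero    = 0ℤ
  shift (suc k) a (suc n) = shift k a n

  mono : ℕ → Series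
  mono k = shift k (const 1ℤ)

  shift-⊛ : ∀ k a b n → (shift k a ⊛ b) n ≡ shift k (a ⊛ b) n
  shift-⊛ zero    a b zero    = refl
  shift-⊛ zero    a b (suc n) = refl
  shift-⊛ (suc k) a b zero    = ℤ.*-zeroˡ (b 0)
  shift-⊛ (suc k) a b (suc n) = trans (ℤ.+-identityˡ _) (shift-⊛ k a b n)

  shift-cong : ∀ k {a b} → a ≗ b → shift k a ≗ shift k b
  shift-cong zero    e n       = e n
  shift-cong (suc k) e zero    = refl
  shift-cong (suc k) e (suc n) = shift-cong k e n

  shift-+ : ∀ j k a → shift (j + k) a ≗ shift j (shift k a)
  shift-+ zero    k a n       = refl
  shift-+ (suc j) k a zero    = refl
  shift-+ (suc j) k a (suc n) = shift-+ j k a n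

  mono-⊛ : ∀ k a n → (mono k ⊛ a) n ≡ shift k a n
  mono-⊛ k a n = trans (shift-⊛ k (const 1ℤ) a n)
    (shift-cong k (λ i → trans (⊛-const 1ℤ a i) (ℤ.*-identityˡ (a i))) n)

  shift-< : ∀ k a {n} → n < k → shift k a n ≡ 0ℤ
  shift-< (suc k) a {zero}  _         = refl
  shift-< (suc k) a {suc n} (s≤s n<k) = shift-< k a n<k

  shift-at : ∀ k a n → shift k a (k + n) ≡ a n
  shift-at zero    a n = refl
  shift-at (suc k) a n = shift-at k a n

  module Units (B p : ℕ) where
    open Truncated B p
    open Solver
    open Relation.Binary.Reasoning.Setoid setoid

    mono-+ : ∀ j k → mono (j + k) ≈ mono j ⊛ mono k
    mono-+ j k = ≗⇒≈ λ n → trans (shift-+ j k (const 1ℤ) n) (sym (mono-⊛ j (mono k) n))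

    mono-vanish : ∀ {k} → B < k → mono k ≈ 𝟘
    mono-vanish {k} B<k = upTo λ n n≤B → ≡⇒≋ (shift-< k (const 1ℤ) (ℕ.≤-<-trans n≤B B<k))

    ⊖-at : ∀ a b n → (a ⊖ b) n ≡ a n ℤ.+ ℤ.- b n
    ⊖-at a b n = trans (⊕-at a (⊝ b) n) (cong (λ z → a n ℤ.+ z) (⊝-at b n))

    ⊖-𝟘 : ∀ a → a ⊖ 𝟘 ≈ a
    ⊖-𝟘 a = ≗⇒≈ λ n → trans (⊖-at a 𝟘 n) (ℤ.+-identityʳ (a n))

    VanishesBelow : ℕ → Series → Set
    VanishesBelow k a = ∀ n → n < k → n ≤ B → a n ≋ 0ℤ

    private
      geometric : Series → ℕ → Series
      geometric a zero    = 𝟙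
      geometric a (suc k) = 𝟙 ⊕ (𝟙 ⊖ a) ⊛ geometric a k

      ⊛-vanishes : ∀ {k} t e → t 0 ≡ 0ℤ → VanishesBelow k e → VanishesBelow (suc k) (t ⊛ e)
      ⊛-vanishes t e t₀ v zero    _         _ = ≡⇒≋ (trans (cong (ℤ._* e 0) t₀) (ℤ.*-zeroˡ (e 0)))
      ⊛-vanishes t e t₀ v (suc n) (s≤s n<k) l =
        ≋-trans (+-cong≋ (≡⇒≋ (trans (cong (ℤ._* e (suc n)) t₀) (ℤ.*-zeroˡ (e (suc n)))))
                  (⊛-cong≋ n (λ _ _ → ≡⇒≋ refl)
                    (λ i i≤n → v i (ℕ.≤-<-trans i≤n n<k) (ℕ.≤-trans i≤n (ℕ.<⇒≤ l)))))
                (≡⇒≋ (trans (ℤ.+-identityˡ _) (trans (⊛-comm (t ∘ suc) (λ _ → 0ℤ) n) (⊛-zeroˡ (t ∘ suc) n))))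

      -- The error is (1 - a)^(k+1), and 1 - a has no constant term. Hence B steps of the geometric
      -- series invert a up to degree B.
      geometric-error : ∀ a → a 0 ≡ 1ℤ → ∀ k → VanishesBelow (suc k) (𝟙 ⊖ a ⊛ geometric a k)
      geometric-error a a₀ zero    zero (s≤s z≤n) _ = ≡⇒≋ (trans (⊖-at 𝟙 (a ⊛ 𝟙) 0) (cong (λ z → 1ℤ ℤ.+ ℤ.- (z ℤ.* 1ℤ)) a₀))
      geometric-error a a₀ (suc k) n n< l = ≋-trans (at rearrange n l)
        (⊛-vanishes (𝟙 ⊖ a) _ (trans (⊖-at 𝟙 a 0) (cong (λ z → 1ℤ ℤ.+ ℤ.- z) a₀)) (geometric-error a a₀ k) n n< l)
        where
        rearrange : 𝟙 ⊖ a ⊛ (𝟙 ⊕ (𝟙 ⊖ a) ⊛ geometric a k) ≈ (𝟙 ⊖ a) ⊛ (𝟙 ⊖ a ⊛ geometric a k)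
        rearrange = solve 2 (λ a g → con 1ℤ :- a :* (con 1ℤ :+ (con 1ℤ :- a) :* g)
                                  := (con 1ℤ :- a) :* (con 1ℤ :- a :* g)) ≈-refl a (geometric a k)

    inv : Series → Series
    inv a = geometric a B

    inv-inverse : ∀ a → a 0 ≡ 1ℤ → a ⊛ inv a ≈ 𝟙
    inv-inverse a a₀ = begin
      a ⊛ inv a                ≈⟨ solve 1 (λ x → x := con 1ℤ :- (con 1ℤ :- x)) ≈-refl (a ⊛ inv a) ⟩
      𝟙 ⊖ (𝟙 ⊖ a ⊛ inv a)      ≈⟨ +-congˡ (⊝-cong (upTo λ n l → geometric-error a a₀ B n (s≤s l) l)) ⟩
      𝟙 ⊖ 𝟘                    ≈⟨ ⊖-𝟘 𝟙 ⟩
      𝟙                        ∎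

    inv-constant : ∀ a → a 0 ≡ 1ℤ → inv a 0 ≡ 1ℤ
    inv-constant a a₀ = go B
      where
      go : ∀ k → geometric a k 0 ≡ 1ℤ
      go zero    = refl
      go (suc k) = trans (⊕-at 𝟙 _ 0) (cong (λ z → 1ℤ ℤ.+ z ℤ.* geometric a k 0)
                     (trans (⊖-at 𝟙 a 0) (cong (λ z → 1ℤ ℤ.+ ℤ.- z) a₀)))

    -- A series with constant term 1 is a unit modulo every p. All identities between quotients of
    -- products below are proved after clearing denominators of this kind.
    cancel : ∀ a {x y} → a 0 ≡ 1ℤ → a ⊛ x ≈ a ⊛ y → x ≈ y
    cancel a {x} {y} a₀ e = begin
      x               ≈⟨ unit x ⟩
      inv a ⊛ (a ⊛ x) ≈⟨ *-congˡ e ⟩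
      inv a ⊛ (a ⊛ y) ≈⟨ unit y ⟨
      y               ∎
      where
      unit : ∀ x → x ≈ inv a ⊛ (a ⊛ x)
      unit x = begin
        x               ≈⟨ *-identityˡ x ⟨
        𝟙 ⊛ x           ≈⟨ *-congʳ (inv-inverse a a₀) ⟨
        a ⊛ inv a ⊛ x   ≈⟨ solve 3 (λ a b x → a :* b :* x := b :* (a :* x)) ≈-refl a (inv a) x ⟩
        inv a ⊛ (a ⊛ x) ∎

    infix 6 Σ<
    Σ< : ℕ → (ℕ → Series) → Series
    Σ< zero    f = 𝟘
    Σ< (suc n) f = Σ< n f ⊕ f n

    Σ<-cong : ∀ n {f g} → (∀ i → i < n → f i ≈ g i) → Σ< n f ≈ Σ< n g
    Σ<-cong zero    e = ≈-refl
    Σ<-cong (suc n) e = +-cong (Σ<-cong n λ i i<n → e i (ℕ.m<n⇒m<1+n i<n)) (e n ℕ.≤-refl)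

    Σ<-⊛ : ∀ n c f → c ⊛ Σ< n f ≈ Σ< n (λ i → c ⊛ f i)
    Σ<-⊛ zero    c f = zeroʳ c
    Σ<-⊛ (suc n) c f = begin
      c ⊛ (Σ< n f ⊕ f n)               ≈⟨ solve 3 (λ c x y → c :* (x :+ y) := c :* x :+ c :* y) ≈-refl c (Σ< n f) (f n) ⟩
      c ⊛ Σ< n f ⊕ c ⊛ f n             ≈⟨ +-congʳ (Σ<-⊛ n c f) ⟩
      Σ< n (λ i → c ⊛ f i) ⊕ c ⊛ f n   ∎

    Σ<-⊖ : ∀ n f g → Σ< n (λ i → f i ⊖ g i) ≈ Σ< n f ⊖ Σ< n g
    Σ<-⊖ zero    f g = ≈-sym (⊕-inverseʳ 𝟘)
    Σ<-⊖ (suc n) f g = begin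
      Σ< n (λ i → f i ⊖ g i) ⊕ (f n ⊖ g n) ≈⟨ +-congʳ (Σ<-⊖ n f g) ⟩
      Σ< n f ⊖ Σ< n g ⊕ (f n ⊖ g n)
        ≈⟨ solve 4 (λ x y u v → x :- y :+ (u :- v) := x :+ u :- (y :+ v)) ≈-refl (Σ< n f) (Σ< n g) (f n) (g n) ⟩
      Σ< n f ⊕ f n ⊖ (Σ< n g ⊕ g n)        ∎

    Σ<-telescope : ∀ n (h : ℕ → Series) → Σ< n (λ i → h i ⊖ h (suc i)) ≈ h 0 ⊖ h n
    Σ<-telescope zero    h = ≈-sym (⊕-inverseʳ (h 0))
    Σ<-telescope (suc n) h = begin
      Σ< n (λ i → h i ⊖ h (suc i)) ⊕ (h n ⊖ h (suc n)) ≈⟨ +-congʳ (Σ<-telescope n h) ⟩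
      h 0 ⊖ h n ⊕ (h n ⊖ h (suc n))
        ≈⟨ solve 3 (λ x y z → x :- y :+ (y :- z) := x :- z) ≈-refl (h 0) (h n) (h (suc n)) ⟩
      h 0 ⊖ h (suc n)                                  ∎

    sg : ℕ → Series
    sg zero    = 𝟙
    sg (suc r) = ⊝ sg r

    two : Series
    two = const (+ 2)

    -- Creative telescoping for sums of the shape 1 + 2 (e₁ + e₂ + …): h certifies that the
    -- combination α e − β e′ is a difference, up to the unit c.
    wz : ∀ N (c x α β : Series) (e e′ h : ℕ → Series) → c 0 ≡ 1ℤ →
         (∀ r → r < N → c ⊛ (α ⊛ e r ⊖ β ⊛ e′ r) ≈ x ⊛ (h r ⊖ h (suc r))) →
         c ⊛ (α ⊖ β) ⊕ two ⊛ (x ⊛ h 0) ≈ 𝟘 → h N ≈ 𝟘 →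
         α ⊛ (𝟙 ⊕ two ⊛ Σ< N e) ≈ β ⊛ (𝟙 ⊕ two ⊛ Σ< N e′)
    wz N c x α β e e′ h c₀ step base end = cancel c c₀ (begin
      c ⊛ (α ⊛ (𝟙 ⊕ two ⊛ Σ< N e))
        ≈⟨ solve 5 (λ c α β S S′ → c :* (α :* (con 1ℤ :+ con (+ 2) :* S))
             := c :* (β :* (con 1ℤ :+ con (+ 2) :* S′)) :+ (c :* (α :- β) :+ con (+ 2) :* (c :* (α :* S :- β :* S′))))
             ≈-refl c α β (Σ< N e) (Σ< N e′) ⟩
      c ⊛ (β ⊛ (𝟙 ⊕ two ⊛ Σ< N e′)) ⊕ (c ⊛ (α ⊖ β) ⊕ two ⊛ (c ⊛ (α ⊛ Σ< N e ⊖ β ⊛ Σ< N e′)))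
        ≈⟨ +-congˡ (+-congˡ (*-congˡ telescoped)) ⟩
      c ⊛ (β ⊛ (𝟙 ⊕ two ⊛ Σ< N e′)) ⊕ (c ⊛ (α ⊖ β) ⊕ two ⊛ (x ⊛ h 0))
        ≈⟨ +-congˡ base ⟩
      c ⊛ (β ⊛ (𝟙 ⊕ two ⊛ Σ< N e′)) ⊕ 𝟘
        ≈⟨ +-identityʳ _ ⟩
      c ⊛ (β ⊛ (𝟙 ⊕ two ⊛ Σ< N e′)) ∎)
      where
      telescoped : c ⊛ (α ⊛ Σ< N e ⊖ β ⊛ Σ< N e′) ≈ x ⊛ h 0
      telescoped = begin
        c ⊛ (α ⊛ Σ< N e ⊖ β ⊛ Σ< N e′)
          ≈⟨ *-congˡ (≈-trans (+-cong (Σ<-⊛ N α e) (⊝-cong (Σ<-⊛ N β e′)))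
                              (≈-sym (Σ<-⊖ N (λ r → α ⊛ e r) (λ r → β ⊛ e′ r)))) ⟩
        c ⊛ Σ< N (λ r → α ⊛ e r ⊖ β ⊛ e′ r)        ≈⟨ Σ<-⊛ N c _ ⟩
        Σ< N (λ r → c ⊛ (α ⊛ e r ⊖ β ⊛ e′ r))      ≈⟨ Σ<-cong N step ⟩
        Σ< N (λ r → x ⊛ (h r ⊖ h (suc r)))         ≈⟨ Σ<-⊛ N x _ ⟨
        x ⊛ Σ< N (λ r → h r ⊖ h (suc r))           ≈⟨ *-congˡ (Σ<-telescope N h) ⟩
        x ⊛ (h 0 ⊖ h N)                            ≈⟨ *-congˡ (+-congˡ (⊝-cong end)) ⟩
        x ⊛ (h 0 ⊖ 𝟘)                              ≈⟨ *-congˡ (⊖-𝟘 (h 0)) ⟩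
        x ⊛ h 0                                    ∎

  -- U n r stands for (q)ₙ² / ((q)ₙ₋ᵣ (q)ₙ₊ᵣ), where Q m is the m-th power of the base q.
  module Bailey (B p : ℕ) (Q : ℕ → Series) (Q-low : ∀ m → Q (suc m) 0 ≡ 0ℤ)
                (Q-0 : Truncated._≈_ B p (Q 0) (const 1ℤ))
                (Q-+ : ∀ m n → Truncated._≈_ B p (Q (m + n)) (Q m ⊛ Q n))
                (Q-vanish : ∀ m → B < m → Truncated._≈_ B p (Q m) (λ _ → 0ℤ)) where
    open Truncated B p
    open Units B p
    open Solver
    open Relation.Binary.Reasoning.Setoid setoid

    q- q+ : ℕ → Series
    q- m = 𝟙 ⊖ Q m
    q+ m = 𝟙 ⊕ Q m

    q-₀ : ∀ m → q- (suc m) 0 ≡ 1ℤ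
    q-₀ m = trans (⊖-at 𝟙 (Q (suc m)) 0) (cong (λ z → 1ℤ ℤ.+ ℤ.- z) (Q-low m))

    q+₀ : ∀ m → q+ (suc m) 0 ≡ 1ℤ
    q+₀ m = trans (⊕-at 𝟙 (Q (suc m)) 0) (cong (λ z → 1ℤ ℤ.+ z) (Q-low m))

    Q-≡ : ∀ {m n} → m ≡ n → Q m ≈ Q n
    Q-≡ refl = ≈-refl

    q-≡ : ∀ {m n} → m ≡ n → q- m ≈ q- n
    q-≡ refl = ≈-refl

    q-0 : q- 0 ≈ 𝟘
    q-0 = ≈-trans (+-congˡ (⊝-cong Q-0)) (⊕-inverseʳ 𝟙)

    U : ℕ → ℕ → Series
    U n zero    = 𝟙
    U n (suc r) = U n r ⊛ (q- (n ∸ r) ⊛ inv (q- (suc n + r)))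

    U-suc : ∀ n r → U n (suc r) ⊛ q- (suc n + r) ≈ U n r ⊛ q- (n ∸ r)
    U-suc n r = begin
      U n r ⊛ (a ⊛ inv b) ⊛ b     ≈⟨ solve 4 (λ u a i b → u :* (a :* i) :* b := u :* a :* (b :* i)) ≈-refl (U n r) a (inv b) b ⟩
      U n r ⊛ a ⊛ (b ⊛ inv b)     ≈⟨ *-congˡ (inv-inverse b (q-₀ (n + r))) ⟩
      U n r ⊛ a ⊛ 𝟙               ≈⟨ *-identityʳ _ ⟩
      U n r ⊛ a                   ∎
      where
      a b : Series
      a = q- (n ∸ r)
      b = q- (suc n + r)

    -- At r = n the recursion multiplies by 1 - q⁰ = 0, and for larger r the zero persists; the
    -- truncated subtraction n ∸ r therefore never matters.
    U-vanish : ∀ n r → n < r → U n r ≈ 𝟘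
    U-vanish n (suc r) (s≤s n≤r) with ℕ.m≤n⇒m<n∨m≡n n≤r
    ... | inj₁ n<r = ≈-trans (*-congʳ (U-vanish n r n<r)) (zeroˡ _)
    ... | inj₂ refl = begin
      U n n ⊛ (q- (n ∸ n) ⊛ i) ≈⟨ *-congˡ (*-congʳ (≈-trans (q-≡ (ℕ.n∸n≡0 n)) q-0)) ⟩
      U n n ⊛ (𝟘 ⊛ i)          ≈⟨ *-congˡ (zeroˡ i) ⟩
      U n n ⊛ 𝟘                ≈⟨ zeroʳ _ ⟩
      𝟘                        ∎
      where
      i : Series
      i = inv (q- (suc n + n))

    -- The quotient of the values at n and n + 1, cleared of denominators: passing to n + 1
    -- multiplies (q)ₙ² by (1 - q^(n+1))² and the two lower products by one factor each.
    U-step : ∀ n r → U n r ⊛ (q- (suc n) ⊛ q- (suc n)) ≈ U (suc n) r ⊛ (q- (suc n ∸ r) ⊛ q- (suc n + r))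
    U-step n zero    = *-congˡ (*-congˡ (q-≡ (sym (ℕ.+-identityʳ (suc n)))))
    U-step n (suc r) = begin
      u ⊛ (c ⊛ inv d) ⊛ (a ⊛ a)   ≈⟨ solve 4 (λ u c i a → u :* (c :* i) :* (a :* a) := u :* (a :* a) :* (c :* i)) ≈-refl u c (inv d) a ⟩
      u ⊛ (a ⊛ a) ⊛ (c ⊛ inv d)   ≈⟨ *-congʳ (U-step n r) ⟩
      u′ ⊛ (e ⊛ d) ⊛ (c ⊛ inv d)  ≈⟨ solve 5 (λ u e d c i → u :* (e :* d) :* (c :* i) := u :* (e :* c) :* (d :* i)) ≈-refl u′ e d c (inv d) ⟩
      u′ ⊛ (e ⊛ c) ⊛ (d ⊛ inv d)  ≈⟨ *-congˡ (inv-inverse d (q-₀ (n + r))) ⟩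
      u′ ⊛ (e ⊛ c) ⊛ 𝟙            ≈⟨ *-congˡ (inv-inverse g (q-₀ (suc n + r))) ⟨
      u′ ⊛ (e ⊛ c) ⊛ (g ⊛ inv g)  ≈⟨ solve 5 (λ u e c g i → u :* (e :* c) :* (g :* i) := u :* (e :* i) :* (c :* g)) ≈-refl u′ e c g (inv g) ⟩
      u′ ⊛ (e ⊛ inv g) ⊛ (c ⊛ g)  ≈⟨ *-congˡ (*-congˡ (q-≡ (cong suc (sym (ℕ.+-suc n r))))) ⟩
      u′ ⊛ (e ⊛ inv g) ⊛ (c ⊛ q- (suc n + suc r)) ∎
      where
      u u′ a c d e g : Series
      u = U n r
      u′ = U (suc n) r
      a = q- (suc n)
      c = q- (n ∸ r)
      d = q- (suc n + r)
      e = q- (suc n ∸ r)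
      g = q- (suc (suc n) + r)

    -- With y = q^(n-r) and w = q^r as independent variables, qⁿ = y w and q^(n+r) = y w². The
    -- telescoping identities then become polynomial identities in y and w.
    record Split (n r : ℕ) : Set where
      constructor splits
      field
        Qn≈  : Q n ≈ Q (n ∸ r) ⊛ Q r
        Qn+≈ : Q (n + r) ≈ Q (n ∸ r) ⊛ (Q r ⊛ Q r)

    split : ∀ {n r} → r ≤ n → Split n r
    split {n} {r} r≤n = splits e (begin
      Q (n + r)                 ≈⟨ Q-+ n r ⟩
      Q n ⊛ Q r                 ≈⟨ *-congʳ e ⟩
      Q (n ∸ r) ⊛ Q r ⊛ Q r     ≈⟨ *-assoc _ _ _ ⟩
      Q (n ∸ r) ⊛ (Q r ⊛ Q r)   ∎)
      where
      e : Q n ≈ Q (n ∸ r) ⊛ Q r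
      e = ≈-trans (Q-≡ (sym (ℕ.m∸n+n≡m r≤n))) (Q-+ (n ∸ r) r)

    -- Σₙ qⁿ/(1−qⁿ)² Uₙ(r) telescopes to qʳ/(1−qʳ)² U_N(r).
    lambert-step : ∀ n r → q- r ⊛ (q- r ⊛ (Q (suc n) ⊛ U (suc n) r))
                           ≈ Q r ⊛ (q- (suc n) ⊛ (q- (suc n) ⊛ (U (suc n) r ⊖ U n r)))
    lambert-step n r with r ℕ.≤? suc n
    ... | no r≰n = ≈-trans (vanish₁ (U-vanish (suc n) r (ℕ.≰⇒> r≰n)))
                     (≈-sym (vanish₂ (U-vanish (suc n) r (ℕ.≰⇒> r≰n)) (U-vanish n r (ℕ.<-trans ℕ.≤-refl (ℕ.≰⇒> r≰n)))))
      where
      vanish₁ : ∀ {u} → u ≈ 𝟘 → q- r ⊛ (q- r ⊛ (Q (suc n) ⊛ u)) ≈ 𝟘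
      vanish₁ e = ≈-trans (*-congˡ (≈-trans (*-congˡ (≈-trans (*-congˡ e) (zeroʳ _))) (zeroʳ _))) (zeroʳ _)
      vanish₂ : ∀ {u v} → u ≈ 𝟘 → v ≈ 𝟘 → Q r ⊛ (q- (suc n) ⊛ (q- (suc n) ⊛ (u ⊖ v))) ≈ 𝟘
      vanish₂ e f = ≈-trans (*-congˡ (≈-trans (*-congˡ (≈-trans (*-congˡ
        (≈-trans (+-cong e (⊝-cong f)) (⊕-inverseʳ 𝟘))) (zeroʳ _))) (zeroʳ _))) (zeroʳ _)
    ... | yes r≤n = begin
      q- r ⊛ (q- r ⊛ (x ⊛ u))                ≈⟨ *-congˡ (*-congˡ (*-congʳ Qn≈)) ⟩
      (𝟙 ⊖ w) ⊛ ((𝟙 ⊖ w) ⊛ (y ⊛ w ⊛ u))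
        -- The whole step is (1 - y w)² - (1 - y)(1 - y w²) = y (1 - w)².
        ≈⟨ solve 3 (λ w y u → (con 1ℤ :- w) :* ((con 1ℤ :- w) :* (y :* w :* u))
             := w :* (u :* ((con 1ℤ :- y :* w) :* (con 1ℤ :- y :* w))
                      :- u :* ((con 1ℤ :- y) :* (con 1ℤ :- y :* (w :* w))))) ≈-refl w y u ⟩
      w ⊛ (u ⊛ ((𝟙 ⊖ y ⊛ w) ⊛ (𝟙 ⊖ y ⊛ w)) ⊖ u ⊛ ((𝟙 ⊖ y) ⊛ (𝟙 ⊖ y ⊛ (w ⊛ w))))
        ≈⟨ *-congˡ (+-cong (*-congˡ (*-cong q-n≈ q-n≈)) (⊝-cong (*-congˡ (*-congˡ (+-congˡ (⊝-cong Qn+≈)))))) ⟨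
      w ⊛ (u ⊛ (q- (suc n) ⊛ q- (suc n)) ⊖ u ⊛ (q- (suc n ∸ r) ⊛ q- (suc n + r)))
        ≈⟨ *-congˡ (+-congˡ (⊝-cong (U-step n r))) ⟨
      w ⊛ (u ⊛ (q- (suc n) ⊛ q- (suc n)) ⊖ U n r ⊛ (q- (suc n) ⊛ q- (suc n)))
        ≈⟨ solve 4 (λ w u v a → w :* (u :* (a :* a) :- v :* (a :* a)) := w :* (a :* (a :* (u :- v)))) ≈-refl w u (U n r) (q- (suc n)) ⟩
      w ⊛ (q- (suc n) ⊛ (q- (suc n) ⊛ (u ⊖ U n r))) ∎
      where
      open Split (split r≤n)
      x w y u : Series
      x = Q (suc n)
      w = Q r
      y = Q (suc n ∸ r)
      u = U (suc n) r
      q-n≈ : q- (suc n) ≈ 𝟙 ⊖ y ⊛ w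
      q-n≈ = +-congˡ (⊝-cong Qn≈)

    -- Up to degree B, U B r is the product of the factors 1 - q^(B-j) with j < r, hence 1 plus
    -- terms of degree above B - r, which q^R pushes beyond B. This stands in for the limit n → ∞,
    -- where U tends to 1.
    U-absorb : ∀ R r → r ≤ R → Q R ⊛ U B r ≈ Q R
    U-absorb R zero    _   = *-identityʳ (Q R)
    U-absorb R (suc r) r<R = begin
      Q R ⊛ (U B r ⊛ (q- (B ∸ r) ⊛ inv b))
        ≈⟨ solve 4 (λ q u a i → q :* (u :* (a :* i)) := q :* u :* a :* i) ≈-refl (Q R) (U B r) (q- (B ∸ r)) (inv b) ⟩
      Q R ⊛ U B r ⊛ q- (B ∸ r) ⊛ inv b    ≈⟨ *-congʳ (*-congʳ (U-absorb R r (ℕ.<⇒≤ r<R))) ⟩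
      Q R ⊛ q- (B ∸ r) ⊛ inv b            ≈⟨ *-cong absorbed inv≈ ⟩
      Q R ⊛ 𝟙                             ≈⟨ *-identityʳ (Q R) ⟩
      Q R                                 ∎
      where
      b : Series
      b = q- (suc B + r)
      b≈ : b ≈ 𝟙
      b≈ = ≈-trans (+-congˡ (⊝-cong (Q-vanish (suc B + r) (s≤s (ℕ.m≤m+n B r))))) (⊖-𝟘 𝟙)
      inv≈ : inv b ≈ 𝟙
      inv≈ = ≈-trans (≈-sym (*-identityˡ _)) (≈-trans (*-congʳ (≈-sym b≈)) (inv-inverse b (q-₀ (B + r))))
      R+> : B < R + (B ∸ r)
      R+> = ℕ.≤-trans (s≤s (ℕ.m≤n+m∸n B r)) (ℕ.+-monoˡ-≤ (B ∸ r) r<R)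
      absorbed : Q R ⊛ q- (B ∸ r) ≈ Q R
      absorbed = begin
        Q R ⊛ (𝟙 ⊖ Q (B ∸ r))     ≈⟨ solve 2 (λ x y → x :* (con 1ℤ :- y) := x :- x :* y) ≈-refl (Q R) (Q (B ∸ r)) ⟩
        Q R ⊖ Q R ⊛ Q (B ∸ r)     ≈⟨ +-congˡ (⊝-cong (≈-trans (≈-sym (Q-+ R (B ∸ r))) (Q-vanish _ R+>))) ⟩
        Q R ⊖ 𝟘                   ≈⟨ ⊖-𝟘 (Q R) ⟩
        Q R                       ∎

    -- Finite form of Gauss's identity: `sum n` = (q)ₙ / (-q)ₙ, given through its recursion in n.
    -- Index r of `term` stands for the two summands ±(r + 1) of Σ (-1)ʳ q^(r²) U, and `cert` is the
    -- certificate for the telescoping in r.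
    module Gauss where
      term cert : ℕ → ℕ → Series
      term n r = sg (suc r) ⊛ (Q (suc r * suc r) ⊛ U n (suc r))
      cert n r = sg (suc r) ⊛ (Q (r * suc r) ⊛ (U n (suc r) ⊛ q- (suc n + r)))

      sum : ℕ → Series
      sum n = 𝟙 ⊕ two ⊛ Σ< B (term n)

      private
        step : ∀ n r → q- (suc n) ⊛ (q+ (suc n) ⊛ term (suc n) r ⊖ q- (suc n) ⊛ term n r)
                       ≈ Q (suc n) ⊛ (cert (suc n) r ⊖ cert (suc n) (suc r))
        step n r′ with suc r′ ℕ.≤? suc n
        ... | no r≰n = ≈-trans (vanish₁ (U-vanish (suc n) (suc r′) r>) (U-vanish n (suc r′) (ℕ.<-trans ℕ.≤-refl r>)))
                (≈-sym (vanish₂ (U-vanish (suc n) (suc r′) r>) (U-vanish (suc n) (suc (suc r′)) (ℕ.m<n⇒m<1+n r>))))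
          where
          r> : suc n < suc r′
          r> = ℕ.≰⇒> r≰n
          vanish₁ : ∀ {u v a b c s t} → u ≈ 𝟘 → v ≈ 𝟘 → a ⊛ (b ⊛ (s ⊛ (t ⊛ u)) ⊖ c ⊛ (s ⊛ (t ⊛ v))) ≈ 𝟘
          vanish₁ {u} {v} {a} {b} {c} {s} {t} e f = begin
            a ⊛ (b ⊛ (s ⊛ (t ⊛ u)) ⊖ c ⊛ (s ⊛ (t ⊛ v)))
              ≈⟨ solve 7 (λ a b s t u c v → a :* (b :* (s :* (t :* u)) :- c :* (s :* (t :* v)))
                   := a :* (b :* (s :* t)) :* u :+ :- (a :* (c :* (s :* t))) :* v) ≈-refl a b s t u c v ⟩
            a ⊛ (b ⊛ (s ⊛ t)) ⊛ u ⊕ ⊝ (a ⊛ (c ⊛ (s ⊛ t))) ⊛ v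
              ≈⟨ +-cong (≈-trans (*-congˡ e) (zeroʳ _)) (≈-trans (*-congˡ f) (zeroʳ _)) ⟩
            𝟘 ⊕ 𝟘 ≈⟨ +-identityʳ 𝟘 ⟩
            𝟘 ∎
          vanish₂ : ∀ {u v a s s′ t t′ d d′} → u ≈ 𝟘 → v ≈ 𝟘 → a ⊛ (s ⊛ (t ⊛ (u ⊛ d)) ⊖ s′ ⊛ (t′ ⊛ (v ⊛ d′))) ≈ 𝟘
          vanish₂ {u} {v} {a} {s} {s′} {t} {t′} {d} {d′} e f = begin
            a ⊛ (s ⊛ (t ⊛ (u ⊛ d)) ⊖ s′ ⊛ (t′ ⊛ (v ⊛ d′)))
              ≈⟨ *-congˡ (+-cong (*-congˡ (*-congˡ (≈-trans (*-congʳ e) (zeroˡ d))))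
                   (⊝-cong (*-congˡ (*-congˡ (≈-trans (*-congʳ f) (zeroˡ d′)))))) ⟩
            a ⊛ (s ⊛ (t ⊛ 𝟘) ⊖ s′ ⊛ (t′ ⊛ 𝟘))
              ≈⟨ *-congˡ (+-cong (≈-trans (*-congˡ (zeroʳ t)) (zeroʳ s)) (⊝-cong (≈-trans (*-congˡ (zeroʳ t′)) (zeroʳ s′)))) ⟩
            a ⊛ (𝟘 ⊖ 𝟘) ≈⟨ *-congˡ (⊕-inverseʳ 𝟘) ⟩
            a ⊛ 𝟘 ≈⟨ zeroʳ a ⟩
            𝟘 ∎
        ... | yes r≤n = begin
          q- (suc n) ⊛ (q+ (suc n) ⊛ (s ⊛ (Q (r * r) ⊛ u)) ⊖ q- (suc n) ⊛ (s ⊛ (Q (r * r) ⊛ U n r)))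
            ≈⟨ solve 5 (λ x s t u v → (con 1ℤ :- x) :* ((con 1ℤ :+ x) :* (s :* (t :* u)) :- (con 1ℤ :- x) :* (s :* (t :* v)))
                 := s :* t :* (u :* (con 1ℤ :- x :* x) :- v :* ((con 1ℤ :- x) :* (con 1ℤ :- x))))
                 ≈-refl (Q (suc n)) s (Q (r * r)) u (U n r) ⟩
          s ⊛ Q (r * r) ⊛ (u ⊛ (𝟙 ⊖ Q (suc n) ⊛ Q (suc n)) ⊖ U n r ⊛ (q- (suc n) ⊛ q- (suc n)))
            ≈⟨ *-congˡ (+-congˡ (⊝-cong (U-step n r))) ⟩
          s ⊛ Q (r * r) ⊛ (u ⊛ (𝟙 ⊖ Q (suc n) ⊛ Q (suc n)) ⊖ u ⊛ (q- (suc n ∸ r) ⊛ q- (suc n + r)))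
            ≈⟨ *-cong (*-congˡ (≈-trans (Q-+ r (r′ * r)) (*-comm w P))) (+-cong (*-congˡ (+-congˡ (⊝-cong (*-cong Qn≈ Qn≈))))
                 (⊝-cong (*-congˡ (*-congˡ (+-congˡ (⊝-cong Qn+≈)))))) ⟩
          s ⊛ (P ⊛ w) ⊛ (u ⊛ (𝟙 ⊖ y ⊛ w ⊛ (y ⊛ w)) ⊖ u ⊛ ((𝟙 ⊖ y) ⊛ (𝟙 ⊖ y ⊛ (w ⊛ w))))
            ≈⟨ solve 5 (λ s P w y u →
                 s :* (P :* w) :* (u :* (con 1ℤ :- y :* w :* (y :* w)) :- u :* ((con 1ℤ :- y) :* (con 1ℤ :- y :* (w :* w))))
                 := y :* w :* (s :* (P :* (u :* (con 1ℤ :- y :* (w :* w)))) :- (:- s) :* (P :* (w :* w) :* (u :* (con 1ℤ :- y)))))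
                 ≈-refl s P w y u ⟩
          y ⊛ w ⊛ (s ⊛ (P ⊛ (u ⊛ (𝟙 ⊖ y ⊛ (w ⊛ w)))) ⊖ ⊝ s ⊛ (P ⊛ (w ⊛ w) ⊛ (u ⊛ (𝟙 ⊖ y))))
            ≈⟨ *-cong (≈-sym Qn≈) (+-cong
                 (*-congˡ (*-congˡ (*-congˡ (+-congˡ (⊝-cong (≈-trans (≈-sym Qn+≈) (Q-≡ (cong suc (ℕ.+-suc n r′)))))))))
                 (⊝-cong (*-congˡ (*-cong Pww (≈-sym (U-suc (suc n) r)))))) ⟩
          Q (suc n) ⊛ (cert (suc n) r′ ⊖ cert (suc n) r) ∎
          where
          r : ℕ
          r = suc r′
          open Split (split r≤n)
          s P w y u : Series
          s = sg r
          P = Q (r′ * r)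
          w = Q r
          y = Q (suc n ∸ r)
          u = U (suc n) r
          Pww : P ⊛ (w ⊛ w) ≈ Q (r * suc r)
          Pww = begin
            P ⊛ (w ⊛ w)        ≈⟨ solve 2 (λ P w → P :* (w :* w) := w :* (w :* P)) ≈-refl P w ⟩
            w ⊛ (w ⊛ P)        ≈⟨ *-congˡ (Q-+ r (r′ * r)) ⟨
            w ⊛ Q (r * r)      ≈⟨ Q-+ r (r * r) ⟨
            Q (r + r * r)      ≈⟨ Q-≡ (sym (ℕ.*-suc r r)) ⟩
            Q (r * suc r)      ∎

        base : ∀ n → q- (suc n) ⊛ (q+ (suc n) ⊖ q- (suc n)) ⊕ two ⊛ (Q (suc n) ⊛ cert (suc n) 0) ≈ 𝟘
        base n = begin
          q- (suc n) ⊛ (q+ (suc n) ⊖ q- (suc n)) ⊕ two ⊛ (Q (suc n) ⊛ (⊝ 𝟙 ⊛ (Q 0 ⊛ (U (suc n) 1 ⊛ q- (suc (suc n) + 0)))))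
            ≈⟨ +-congˡ (*-congˡ (*-congˡ (*-congˡ (*-cong Q-0 (≈-trans (U-suc (suc n) 0) (*-identityˡ _)))))) ⟩
          q- (suc n) ⊛ (q+ (suc n) ⊖ q- (suc n)) ⊕ two ⊛ (Q (suc n) ⊛ (⊝ 𝟙 ⊛ (𝟙 ⊛ q- (suc n))))
            ≈⟨ solve 1 (λ x → (con 1ℤ :- x) :* (con 1ℤ :+ x :- (con 1ℤ :- x)) :+ con (+ 2) :* (x :* (:- con 1ℤ :* (con 1ℤ :* (con 1ℤ :- x))))
                          := con 0ℤ) ≈-refl (Q (suc n)) ⟩
          const 0ℤ ≈⟨ ≗⇒≈ (λ { zero → refl ; (suc _) → refl }) ⟩
          𝟘 ∎

      sum-step : ∀ n → suc n ≤ B → q+ (suc n) ⊛ sum (suc n) ≈ q- (suc n) ⊛ sum n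
      sum-step n n<B = wz B (q- (suc n)) (Q (suc n)) (q+ (suc n)) (q- (suc n))
        (term (suc n)) (term n) (cert (suc n)) (q-₀ n) (λ r _ → step n r) (base n)
        (≈-trans (*-congˡ (≈-trans (*-congˡ (≈-trans (*-congʳ (U-vanish (suc n) (suc B) (s≤s n<B))) (zeroˡ _))) (zeroʳ _))) (zeroʳ _))

      sum-0 : sum 0 ≈ 𝟙
      sum-0 = begin
        𝟙 ⊕ two ⊛ Σ< B (term 0) ≈⟨ +-congˡ (*-congˡ (allzero B)) ⟩
        𝟙 ⊕ two ⊛ 𝟘             ≈⟨ +-congˡ (zeroʳ two) ⟩
        𝟙 ⊕ 𝟘                   ≈⟨ +-identityʳ 𝟙 ⟩
        𝟙                       ∎
        where
        allzero : ∀ k → Σ< k (term 0) ≈ 𝟘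
        allzero zero    = ≈-refl
        allzero (suc k) = ≈-trans (+-cong (allzero k) (≈-trans (*-congˡ (≈-trans (*-congˡ (U-vanish 0 (suc k) (s≤s z≤n))) (zeroʳ _))) (zeroʳ _)))
                            (+-identityʳ 𝟘)

    -- The Bailey pair relative to 1 with α₀ = 1, α₂ᵣ = 2 (-1)ʳ q^(2r²) and α zero at odd indices.
    -- The recursion says that `sum n` = (q)ₙ (-q; q²)ₙ / ((-q)ₙ (q; q²)ₙ).
    module Pair where
      term cert : ℕ → ℕ → Series
      term n r = sg (suc r) ⊛ (Q (suc r * suc r + suc r * suc r) ⊛ U n (suc r + suc r))
      cert n r = sg (suc r) ⊛ (Q (r * suc r + r * suc r)
                   ⊛ (U n (suc r + suc r) ⊛ (q- (n + (suc r + suc r)) ⊛ q- (n + (r + suc r)))))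

      sum : ℕ → Series
      sum n = 𝟙 ⊕ two ⊛ Σ< B (term n)

      private
        U-suc² : ∀ n R → U (suc n) (suc (suc R)) ⊛ (q- (suc n + suc (suc R)) ⊛ q- (suc n + suc R))
                         ≈ U (suc n) R ⊛ (q- (suc n ∸ R) ⊛ q- (n ∸ R))
        U-suc² n R = begin
          U (suc n) (suc (suc R)) ⊛ (q- (suc n + suc (suc R)) ⊛ q- (suc n + suc R))
            ≈⟨ *-congˡ (*-cong (q-≡ (ℕ.+-suc (suc n) (suc R))) (q-≡ (ℕ.+-suc (suc n) R))) ⟩
          U (suc n) (suc (suc R)) ⊛ (q- (suc (suc n) + suc R) ⊛ q- (suc (suc n) + R))
            ≈⟨ *-assoc _ _ _ ⟨
          U (suc n) (suc (suc R)) ⊛ q- (suc (suc n) + suc R) ⊛ q- (suc (suc n) + R)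
            ≈⟨ *-congʳ (U-suc (suc n) (suc R)) ⟩
          U (suc n) (suc R) ⊛ q- (n ∸ R) ⊛ q- (suc (suc n) + R)
            ≈⟨ solve 3 (λ u a b → u :* a :* b := u :* b :* a) ≈-refl (U (suc n) (suc R)) (q- (n ∸ R)) (q- (suc (suc n) + R)) ⟩
          U (suc n) (suc R) ⊛ q- (suc (suc n) + R) ⊛ q- (n ∸ R)
            ≈⟨ *-congʳ (U-suc (suc n) R) ⟩
          U (suc n) R ⊛ q- (suc n ∸ R) ⊛ q- (n ∸ R)
            ≈⟨ *-assoc _ _ _ ⟩
          U (suc n) R ⊛ (q- (suc n ∸ R) ⊛ q- (n ∸ R)) ∎

        step : ∀ n r → q- (suc n) ⊛ (q+ (suc n) ⊛ q- (suc n + n) ⊛ term (suc n) r ⊖ q- (suc n) ⊛ q+ (suc n + n) ⊛ term n r)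
                       ≈ Q (suc n) ⊛ (cert (suc n) r ⊖ cert (suc n) (suc r))
        step n r′ with suc r′ + suc r′ ℕ.≤? suc n
        ... | no R≰n = ≈-trans (vanish₁ (U-vanish (suc n) _ R>) (U-vanish n _ (ℕ.<-trans ℕ.≤-refl R>)))
                (≈-sym (vanish₂ (U-vanish (suc n) _ R>)
                  (U-vanish (suc n) _ (ℕ.<-≤-trans R> (ℕ.+-mono-≤ (ℕ.n≤1+n (suc r′)) (ℕ.n≤1+n (suc r′)))))))
          where
          R> : suc n < suc r′ + suc r′
          R> = ℕ.≰⇒> R≰n
          vanish₁ : ∀ {u v a b c s t} → u ≈ 𝟘 → v ≈ 𝟘 → a ⊛ (b ⊛ (s ⊛ (t ⊛ u)) ⊖ c ⊛ (s ⊛ (t ⊛ v))) ≈ 𝟘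
          vanish₁ {u} {v} {a} {b} {c} {s} {t} e f = begin
            a ⊛ (b ⊛ (s ⊛ (t ⊛ u)) ⊖ c ⊛ (s ⊛ (t ⊛ v)))
              ≈⟨ solve 7 (λ a b s t u c v → a :* (b :* (s :* (t :* u)) :- c :* (s :* (t :* v)))
                   := a :* (b :* (s :* t)) :* u :+ :- (a :* (c :* (s :* t))) :* v) ≈-refl a b s t u c v ⟩
            a ⊛ (b ⊛ (s ⊛ t)) ⊛ u ⊕ ⊝ (a ⊛ (c ⊛ (s ⊛ t))) ⊛ v
              ≈⟨ +-cong (≈-trans (*-congˡ e) (zeroʳ _)) (≈-trans (*-congˡ f) (zeroʳ _)) ⟩
            𝟘 ⊕ 𝟘 ≈⟨ +-identityʳ 𝟘 ⟩
            𝟘 ∎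
          vanish₂ : ∀ {u v a s s′ t t′ d d′} → u ≈ 𝟘 → v ≈ 𝟘 → a ⊛ (s ⊛ (t ⊛ (u ⊛ d)) ⊖ s′ ⊛ (t′ ⊛ (v ⊛ d′))) ≈ 𝟘
          vanish₂ {u} {v} {a} {s} {s′} {t} {t′} {d} {d′} e f = begin
            a ⊛ (s ⊛ (t ⊛ (u ⊛ d)) ⊖ s′ ⊛ (t′ ⊛ (v ⊛ d′)))
              ≈⟨ *-congˡ (+-cong (*-congˡ (*-congˡ (≈-trans (*-congʳ e) (zeroˡ d))))
                   (⊝-cong (*-congˡ (*-congˡ (≈-trans (*-congʳ f) (zeroˡ d′)))))) ⟩
            a ⊛ (s ⊛ (t ⊛ 𝟘) ⊖ s′ ⊛ (t′ ⊛ 𝟘))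
              ≈⟨ *-congˡ (+-cong (≈-trans (*-congˡ (zeroʳ t)) (zeroʳ s)) (⊝-cong (≈-trans (*-congˡ (zeroʳ t′)) (zeroʳ s′)))) ⟩
            a ⊛ (𝟘 ⊖ 𝟘) ≈⟨ *-congˡ (⊕-inverseʳ 𝟘) ⟩
            a ⊛ 𝟘 ≈⟨ zeroʳ a ⟩
            𝟘 ∎
        ... | yes R≤n = begin
          (𝟙 ⊖ x) ⊛ ((𝟙 ⊕ x) ⊛ (𝟙 ⊖ Q (suc n + n)) ⊛ (s ⊛ (T ⊛ u)) ⊖ (𝟙 ⊖ x) ⊛ (𝟙 ⊕ Q (suc n + n)) ⊛ (s ⊛ (T ⊛ U n R)))
            ≈⟨ solve 6 (λ x g s T u v → (con 1ℤ :- x) :* ((con 1ℤ :+ x) :* (con 1ℤ :- g) :* (s :* (T :* u)) :- (con 1ℤ :- x) :* (con 1ℤ :+ g) :* (s :* (T :* v)))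
                 := s :* T :* (u :* ((con 1ℤ :- x :* x) :* (con 1ℤ :- g)) :- (con 1ℤ :+ g) :* (v :* ((con 1ℤ :- x) :* (con 1ℤ :- x)))))
                 ≈-refl x (Q (suc n + n)) s T u (U n R) ⟩
          s ⊛ T ⊛ (u ⊛ ((𝟙 ⊖ x ⊛ x) ⊛ (𝟙 ⊖ Q (suc n + n))) ⊖ (𝟙 ⊕ Q (suc n + n)) ⊛ (U n R ⊛ (q- (suc n) ⊛ q- (suc n))))
            ≈⟨ *-congˡ (+-cong (*-congˡ (*-congˡ (+-congˡ (⊝-cong g≈)))) (⊝-cong (*-cong (+-congˡ g≈) (U-step n R)))) ⟩
          s ⊛ T ⊛ (u ⊛ ((𝟙 ⊖ x ⊛ x) ⊛ (𝟙 ⊖ g)) ⊖ (𝟙 ⊕ g) ⊛ (u ⊛ ((𝟙 ⊖ y) ⊛ (𝟙 ⊖ v))))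
            -- The identity needs the relation x² = y v, which the solver does not know; the
            -- multiple of x² - y v is therefore split off as a separate summand and removed in the
            -- next steps.
            ≈⟨ solve 7 (λ s T u x g y v → s :* T :* (u :* ((con 1ℤ :- x :* x) :* (con 1ℤ :- g)) :- (con 1ℤ :+ g) :* (u :* ((con 1ℤ :- y) :* (con 1ℤ :- v))))
                 := s :* T :* u :* (y :+ v :- con (+ 2) :* (x :* x) :- con (+ 2) :* g :+ g :* y :+ g :* v :+ (x :* x :- y :* v) :* (con 1ℤ :+ g)))
                 ≈-refl s T u x g y v ⟩
          s ⊛ T ⊛ u ⊛ (y ⊕ v ⊖ two ⊛ (x ⊛ x) ⊖ two ⊛ g ⊕ g ⊛ y ⊕ g ⊛ v ⊕ (x ⊛ x ⊖ y ⊛ v) ⊛ (𝟙 ⊕ g))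
            ≈⟨ *-congˡ (+-congˡ (≈-trans (*-congʳ (≈-trans (+-congʳ xx≈) (⊕-inverseʳ (y ⊛ v)))) (≈-trans (zeroˡ _) (≈-sym (zeroˡ 𝟙))))) ⟩
          s ⊛ T ⊛ u ⊛ (y ⊕ v ⊖ two ⊛ (x ⊛ x) ⊖ two ⊛ g ⊕ g ⊛ y ⊕ g ⊛ v ⊕ 𝟘 ⊛ 𝟙)
            ≈⟨ *-congˡ (+-cong (+-congʳ (+-congʳ (+-congʳ (+-congˡ (⊝-cong (*-congˡ xx≈)))))) (zeroˡ 𝟙)) ⟩
          s ⊛ T ⊛ u ⊛ (y ⊕ v ⊖ two ⊛ (y ⊛ v) ⊖ two ⊛ g ⊕ g ⊛ y ⊕ g ⊛ v ⊕ 𝟘)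
            ≈⟨ *-congˡ (+-identityʳ _) ⟩
          s ⊛ T ⊛ u ⊛ (y ⊕ v ⊖ two ⊛ (y ⊛ v) ⊖ two ⊛ g ⊕ g ⊛ y ⊕ g ⊛ v)
            ≈⟨ solve 6 (λ s T u y v g → s :* T :* u :* (y :+ v :- con (+ 2) :* (y :* v) :- con (+ 2) :* g :+ g :* y :+ g :* v)
                 := s :* T :* u :* ((con 1ℤ :- v) :* y :- (con 1ℤ :- v) :* g :+ (v :* (con 1ℤ :- y) :- (con 1ℤ :- y) :* g)))
                 ≈-refl s T u y v g ⟩
          s ⊛ T ⊛ u ⊛ ((𝟙 ⊖ v) ⊛ y ⊖ (𝟙 ⊖ v) ⊛ g ⊕ (v ⊛ (𝟙 ⊖ y) ⊖ (𝟙 ⊖ y) ⊛ g))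
            ≈⟨ *-congˡ (+-cong (+-congˡ (⊝-cong (*-congˡ yv′≈))) (+-congˡ (⊝-cong vy′≈))) ⟨
          s ⊛ T ⊛ u ⊛ ((𝟙 ⊖ v) ⊛ y ⊖ (𝟙 ⊖ v) ⊛ (y ⊛ v′) ⊕ (v ⊛ (𝟙 ⊖ y) ⊖ (𝟙 ⊖ y) ⊛ (v ⊛ y′)))
            ≈⟨ solve 7 (λ s T u y v v′ y′ → s :* T :* u :* ((con 1ℤ :- v) :* y :- (con 1ℤ :- v) :* (y :* v′) :+ (v :* (con 1ℤ :- y) :- (con 1ℤ :- y) :* (v :* y′)))
                 := T :* y :* (s :* (u :* ((con 1ℤ :- v) :* (con 1ℤ :- v′)))) :+ T :* v :* (s :* (u :* ((con 1ℤ :- y) :* (con 1ℤ :- y′)))))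
                 ≈-refl s T u y v v′ y′ ⟩
          T ⊛ y ⊛ (s ⊛ (u ⊛ ((𝟙 ⊖ v) ⊛ (𝟙 ⊖ v′)))) ⊕ T ⊛ v ⊛ (s ⊛ (u ⊛ ((𝟙 ⊖ y) ⊛ (𝟙 ⊖ y′))))
            ≈⟨ +-cong (*-congʳ Ty≈) (*-cong Tv≈ (*-congˡ (≈-sym u-next))) ⟩
          x ⊛ Q (r′ * r + r′ * r) ⊛ (s ⊛ (u ⊛ ((𝟙 ⊖ v) ⊛ (𝟙 ⊖ v′)))) ⊕ x ⊛ T₂ ⊛ (s ⊛ u₂)
            ≈⟨ solve 7 (λ x P s u q T u₂ → x :* P :* (s :* (u :* q)) :+ x :* T :* (s :* u₂)
                 := x :* (s :* (P :* (u :* q)) :- :- s :* (T :* u₂)))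
                 ≈-refl x (Q (r′ * r + r′ * r)) s u ((𝟙 ⊖ v) ⊛ (𝟙 ⊖ v′)) T₂ u₂ ⟩
          x ⊛ (cert (suc n) r′ ⊖ cert (suc n) r) ∎
          where
          r R k : ℕ
          r = suc r′
          R = r + r
          k = suc n ∸ R
          open Split (split R≤n)
          s T T₂ u u₂ x y v g v′ y′ : Series
          s = sg r
          T = Q (r * r + r * r)
          T₂ = Q (r * suc r + r * suc r)
          u = U (suc n) R
          u₂ = U (suc n) (suc r + suc r) ⊛ (q- (suc n + (suc r + suc r)) ⊛ q- (suc n + (r + suc r)))
          x = Q (suc n)
          y = Q k
          v = Q (suc n + R)
          g = x ⊛ Q n
          v′ = Q (suc n + (r′ + r))
          y′ = Q (n ∸ R)
          g≈ : Q (suc n + n) ≈ g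
          g≈ = Q-+ (suc n) n
          k+R : k + R ≡ suc n
          k+R = ℕ.m∸n+n≡m R≤n
          n≡ : k + (r′ + r) ≡ n
          n≡ = ℕ.suc-injective (trans (sym (ℕ.+-suc k (r′ + r))) k+R)
          xx≈ : x ⊛ x ≈ y ⊛ v
          xx≈ = begin
            x ⊛ x                       ≈⟨ *-cong Qn≈ Qn≈ ⟩
            y ⊛ Q R ⊛ (y ⊛ Q R)         ≈⟨ solve 2 (λ y w → y :* w :* (y :* w) := y :* (y :* (w :* w))) ≈-refl y (Q R) ⟩
            y ⊛ (y ⊛ (Q R ⊛ Q R))       ≈⟨ *-congˡ Qn+≈ ⟨
            y ⊛ v                       ∎
          yv′≈ : y ⊛ v′ ≈ g
          yv′≈ = begin
            y ⊛ v′                      ≈⟨ Q-+ k (suc n + (r′ + r)) ⟨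
            Q (k + (suc n + (r′ + r)))  ≈⟨ Q-≡ (trans (sym (ℕ.+-assoc k (suc n) _)) (trans (cong (_+ (r′ + r)) (ℕ.+-comm k (suc n)))
                                             (trans (ℕ.+-assoc (suc n) k _) (cong (λ z → suc n + z) n≡)))) ⟩
            Q (suc n + n)               ≈⟨ g≈ ⟩
            g                           ∎
          -- The factor 1 - y is kept because of the boundary R = n + 1: there n ∸ R is cut off at 0
          -- and v y′ differs from g, but y = 1.
          vy′≈ : (𝟙 ⊖ y) ⊛ (v ⊛ y′) ≈ (𝟙 ⊖ y) ⊛ g
          vy′≈ with ℕ.m≤n⇒m<n∨m≡n R≤n
          ... | inj₁ (s≤s R≤n′) = *-congˡ (begin
            v ⊛ y′                      ≈⟨ Q-+ (suc n + R) (n ∸ R) ⟨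
            Q (suc n + R + (n ∸ R))     ≈⟨ Q-≡ (trans (ℕ.+-assoc (suc n) R _) (cong (λ z → suc n + z) (ℕ.m+[n∸m]≡n R≤n′))) ⟩
            Q (suc n + n)               ≈⟨ g≈ ⟩
            g                           ∎)
          ... | inj₂ R≡n = ≈-trans (≈-trans (*-congʳ y≈) (zeroˡ _)) (≈-sym (≈-trans (*-congʳ y≈) (zeroˡ _)))
            where
            y≈ : 𝟙 ⊖ y ≈ 𝟘
            y≈ = ≈-trans (q-≡ (trans (cong (suc n ∸_) R≡n) (ℕ.n∸n≡0 (suc n)))) q-0
          Ty≈ : T ⊛ y ≈ x ⊛ Q (r′ * r + r′ * r)
          Ty≈ = begin
            T ⊛ y                                   ≈⟨ *-congʳ (Q-≡ (lem r (r′ * r))) ⟩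
            Q (R + (r′ * r + r′ * r)) ⊛ y           ≈⟨ *-congʳ (Q-+ R _) ⟩
            Q R ⊛ Q (r′ * r + r′ * r) ⊛ y           ≈⟨ solve 3 (λ w P y → w :* P :* y := y :* w :* P) ≈-refl (Q R) (Q (r′ * r + r′ * r)) y ⟩
            y ⊛ Q R ⊛ Q (r′ * r + r′ * r)           ≈⟨ *-congʳ Qn≈ ⟨
            x ⊛ Q (r′ * r + r′ * r)                 ∎
            where
            lem : ∀ a b → a + b + (a + b) ≡ a + a + (b + b)
            lem a b = trans (ℕ.+-assoc a b (a + b)) (trans (cong (λ z → a + z) (trans (sym (ℕ.+-assoc b a b))
              (trans (cong (_+ b) (ℕ.+-comm b a)) (ℕ.+-assoc a b b)))) (sym (ℕ.+-assoc a a (b + b))))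
          Tv≈ : T ⊛ v ≈ x ⊛ T₂
          Tv≈ = begin
            T ⊛ v                         ≈⟨ Q-+ (r * r + r * r) (suc n + R) ⟨
            Q (r * r + r * r + (suc n + R)) ≈⟨ Q-≡ (lem (r * r) (suc n) r) ⟩
            Q (suc n + (r + r * r + (r + r * r))) ≈⟨ Q-≡ (cong (λ z → suc n + (z + z)) (sym (ℕ.*-suc r r))) ⟩
            Q (suc n + (r * suc r + r * suc r)) ≈⟨ Q-+ (suc n) _ ⟩
            x ⊛ T₂                        ∎
            where
            lem : ∀ a m r → a + a + (m + (r + r)) ≡ m + (r + a + (r + a))
            lem = ℕ-solve
          u-next : u₂ ≈ u ⊛ ((𝟙 ⊖ y) ⊛ (𝟙 ⊖ y′))
          u-next = ≈-trans (*-cong (U-≡ idx) (*-cong (q-≡ (cong (λ z → suc n + z) idx)) (q-≡ (cong (λ z → suc n + z) (ℕ.+-suc r r))))) (U-suc² n R)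
            where
            idx : suc r + suc r ≡ suc (suc R)
            idx = cong suc (ℕ.+-suc r r)
            U-≡ : ∀ {m m′} → m ≡ m′ → U (suc n) m ≈ U (suc n) m′
            U-≡ refl = ≈-refl

        base : ∀ n → q- (suc n) ⊛ (q+ (suc n) ⊛ q- (suc n + n) ⊖ q- (suc n) ⊛ q+ (suc n + n))
                     ⊕ two ⊛ (Q (suc n) ⊛ cert (suc n) 0) ≈ 𝟘
        base n = begin
          q- (suc n) ⊛ (q+ (suc n) ⊛ q- (suc n + n) ⊖ q- (suc n) ⊛ q+ (suc n + n))
            ⊕ two ⊛ (Q (suc n) ⊛ (⊝ 𝟙 ⊛ (Q 0 ⊛ (U (suc n) 2 ⊛ (q- (suc n + 2) ⊛ q- (suc n + 1))))))
            ≈⟨ +-cong (*-congˡ (+-cong (*-congˡ (+-congˡ (⊝-cong (Q-+ (suc n) n)))) (⊝-cong (*-congˡ (+-congˡ (Q-+ (suc n) n))))))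
                 (*-congˡ (*-congˡ (*-congˡ (*-cong Q-0 (U-suc² n 0))))) ⟩
          (𝟙 ⊖ x) ⊛ ((𝟙 ⊕ x) ⊛ (𝟙 ⊖ x ⊛ b) ⊖ (𝟙 ⊖ x) ⊛ (𝟙 ⊕ x ⊛ b))
            ⊕ two ⊛ (x ⊛ (⊝ 𝟙 ⊛ (𝟙 ⊛ (𝟙 ⊛ ((𝟙 ⊖ x) ⊛ (𝟙 ⊖ b))))))
            ≈⟨ solve 2 (λ x b → (con 1ℤ :- x) :* ((con 1ℤ :+ x) :* (con 1ℤ :- x :* b) :- (con 1ℤ :- x) :* (con 1ℤ :+ x :* b))
                 :+ con (+ 2) :* (x :* (:- con 1ℤ :* (con 1ℤ :* (con 1ℤ :* ((con 1ℤ :- x) :* (con 1ℤ :- b)))))) := con 0ℤ)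
                 ≈-refl x b ⟩
          const 0ℤ ≈⟨ ≗⇒≈ (λ { zero → refl ; (suc _) → refl }) ⟩
          𝟘 ∎
          where
          x b : Series
          x = Q (suc n)
          b = Q n

      sum-step : ∀ n → suc n ≤ B →
                 q+ (suc n) ⊛ q- (suc n + n) ⊛ sum (suc n) ≈ q- (suc n) ⊛ q+ (suc n + n) ⊛ sum n
      sum-step n n<B = wz B (q- (suc n)) (Q (suc n)) (q+ (suc n) ⊛ q- (suc n + n)) (q- (suc n) ⊛ q+ (suc n + n))
        (term (suc n)) (term n) (cert (suc n)) (q-₀ n) (λ r _ → step n r) (base n)
        (≈-trans (*-congˡ (≈-trans (*-congˡ (≈-trans (*-congʳ (U-vanish (suc n) _ (ℕ.<-≤-trans (s≤s n<B) (ℕ.m≤m+n (suc B) (suc B))))) (zeroˡ _))) (zeroʳ _))) (zeroʳ _))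

      sum-0 : sum 0 ≈ 𝟙
      sum-0 = begin
        𝟙 ⊕ two ⊛ Σ< B (term 0) ≈⟨ +-congˡ (*-congˡ (allzero B)) ⟩
        𝟙 ⊕ two ⊛ 𝟘             ≈⟨ +-congˡ (zeroʳ two) ⟩
        𝟙 ⊕ 𝟘                   ≈⟨ +-identityʳ 𝟙 ⟩
        𝟙                       ∎
        where
        allzero : ∀ k → Σ< k (term 0) ≈ 𝟘
        allzero zero    = ≈-refl
        allzero (suc k) = ≈-trans (+-cong (allzero k) (≈-trans (*-congˡ (≈-trans (*-congˡ (U-vanish 0 (suc k + suc k) (s≤s z≤n))) (zeroʳ _))) (zeroʳ _)))
                            (+-identityʳ 𝟘)

-- From products over parts to Lambert series.

module GeneratingFunction where
  open PowerSeries
  open BaileyPair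
  open import Data.Nat using (_+_; _*_; _∸_; _<_)

  module Lambert (B p : ℕ) where
    open Truncated B p
    open Units B p
    open Solver
    open Relation.Binary.Reasoning.Setoid setoid

    private
      mono-double-+ : ∀ m n → mono (m + n + (m + n)) ≈ mono (m + m) ⊛ mono (n + n)
      mono-double-+ m n = ≈-trans (≗⇒≈ λ i → cong (λ z → mono z i) (lem m n)) (mono-+ (m + m) (n + n))
        where
        lem : ∀ a b → a + b + (a + b) ≡ a + a + (b + b)
        lem a b = trans (ℕ.+-assoc a b (a + b)) (trans (cong (λ z → a + z) (trans (sym (ℕ.+-assoc b a b))
          (trans (cong (_+ b) (ℕ.+-comm b a)) (ℕ.+-assoc a b b)))) (sym (ℕ.+-assoc a a (b + b))))

    -- Base q carries the Bailey pair; base q² is used for Gauss's identity, because beyond twice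
    -- the smallest part only even parts remain.
    module One = Bailey B p mono (λ _ → refl) ≈-refl mono-+ (λ _ → mono-vanish)
    module Two = Bailey B p (λ m → mono (m + m)) (λ _ → refl) ≈-refl mono-double-+
                   (λ m B<m → mono-vanish (ℕ.<-≤-trans B<m (ℕ.m≤m+n m m)))
    open One using (q-; q+; U; q-₀; q+₀; lambert-step; U-absorb; U-vanish)

    -- q^s/(1−q^s)²
    lambert : ℕ → Series
    lambert s = Σ< B (λ d → const (+ suc d) ⊛ mono (suc d * s))

    -- With x = q^s, the first k terms of Σ d x^d times (1 - x)² give x - (k + 1) x^(k+1) + k
    -- x^(k+2), and for k = B the last two terms exceed degree B.
    lambert-spec : ∀ s → q- (suc s) ⊛ (q- (suc s) ⊛ lambert (suc s)) ≈ mono (suc s)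
    lambert-spec s′ = begin
      q- s ⊛ (q- s ⊛ lambert s)            ≈⟨ partial B ⟩
      x ⊖ const (+ suc B) ⊛ mono (suc B * s) ⊕ const (+ B) ⊛ (x ⊛ mono (suc B * s))
        ≈⟨ +-cong (+-congˡ (⊝-cong (≈-trans (*-congˡ big) (zeroʳ _)))) (≈-trans (*-congˡ (≈-trans (*-congˡ big) (zeroʳ _))) (zeroʳ _)) ⟩
      x ⊖ 𝟘 ⊕ 𝟘                            ≈⟨ ≈-trans (+-identityʳ _) (⊖-𝟘 x) ⟩
      x                                    ∎
      where
      s : ℕ
      s = suc s′
      x : Series
      x = mono s
      big : mono (suc B * s) ≈ 𝟘
      big = mono-vanish (ℕ.m≤m*n (suc B) s)
      partial : ∀ k → q- s ⊛ (q- s ⊛ Σ< k (λ d → const (+ suc d) ⊛ mono (suc d * s)))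
                      ≈ x ⊖ const (+ suc k) ⊛ mono (suc k * s) ⊕ const (+ k) ⊛ (x ⊛ mono (suc k * s))
      partial zero = begin
        q- s ⊛ (q- s ⊛ 𝟘) ≈⟨ ≈-trans (*-congˡ (zeroʳ _)) (zeroʳ _) ⟩
        𝟘                 ≈⟨ ⊕-inverseʳ x ⟨
        x ⊖ x             ≈⟨ solve 1 (λ x → x :- x := x :- con 1ℤ :* x :+ con 0ℤ :* (x :* x)) ≈-refl x ⟩
        x ⊖ 𝟙 ⊛ x ⊕ const 0ℤ ⊛ (x ⊛ x)
          ≈⟨ +-cong (+-congˡ (⊝-cong (*-congˡ one))) (*-congˡ (*-congˡ one)) ⟩
        x ⊖ 𝟙 ⊛ mono (1 * s) ⊕ const 0ℤ ⊛ (x ⊛ mono (1 * s)) ∎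
        where
        one : x ≈ mono (1 * s)
        one = ≗⇒≈ λ i → cong (λ z → mono z i) (sym (ℕ.*-identityˡ s))
      partial (suc k) = begin
        q- s ⊛ (q- s ⊛ (Σ< k _ ⊕ const (+ suc k) ⊛ y))
          ≈⟨ solve 4 (λ a S c y → a :* (a :* (S :+ c :* y)) := a :* (a :* S) :+ a :* (a :* (c :* y))) ≈-refl (q- s) (Σ< k _) (const (+ suc k)) y ⟩
        q- s ⊛ (q- s ⊛ Σ< k _) ⊕ q- s ⊛ (q- s ⊛ (const (+ suc k) ⊛ y))
          ≈⟨ +-congʳ (partial k) ⟩
        x ⊖ const (+ suc k) ⊛ y ⊕ const (+ k) ⊛ (x ⊛ y) ⊕ q- s ⊛ (q- s ⊛ (const (+ suc k) ⊛ y))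
          ≈⟨ +-cong (+-congʳ (+-congˡ (⊝-cong (*-congʳ (const-+ 1ℤ (+ k)))))) (*-congˡ (*-congˡ (*-congʳ (const-+ 1ℤ (+ k))))) ⟩
        x ⊖ (𝟙 ⊕ const (+ k)) ⊛ y ⊕ const (+ k) ⊛ (x ⊛ y) ⊕ q- s ⊛ (q- s ⊛ ((𝟙 ⊕ const (+ k)) ⊛ y))
          ≈⟨ solve 3 (λ x c y → x :- (con 1ℤ :+ c) :* y :+ c :* (x :* y) :+ (con 1ℤ :- x) :* ((con 1ℤ :- x) :* ((con 1ℤ :+ c) :* y))
               := x :- (con (+ 2) :+ c) :* (x :* y) :+ (con 1ℤ :+ c) :* (x :* (x :* y))) ≈-refl x (const (+ k)) y ⟩
        x ⊖ (two ⊕ const (+ k)) ⊛ (x ⊛ y) ⊕ (𝟙 ⊕ const (+ k)) ⊛ (x ⊛ (x ⊛ y))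
          ≈⟨ +-cong (+-congˡ (⊝-cong (*-cong (const-+ (+ 2) (+ k)) (mono-+ s _)))) (*-cong (const-+ 1ℤ (+ k)) (*-congˡ (mono-+ s _))) ⟨
        x ⊖ const (+ suc (suc k)) ⊛ mono (suc (suc k) * s) ⊕ const (+ suc k) ⊛ (x ⊛ mono (suc (suc k) * s)) ∎
        where
        y : Series
        y = mono (suc k * s)

    private
      cancel₂ : ∀ s {x y} → q- (suc s) ⊛ (q- (suc s) ⊛ x) ≈ q- (suc s) ⊛ (q- (suc s) ⊛ y) → x ≈ y
      cancel₂ s e = cancel _ (q-₀ s) (cancel _ (q-₀ s) e)

      lambert-U : ∀ n r → lambert (suc n) ⊛ U (suc n) (suc r) ≈ lambert (suc r) ⊛ (U (suc n) (suc r) ⊖ U n (suc r))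
      lambert-U n r = cancel₂ r (cancel₂ n (begin
        a ⊛ (a ⊛ (b ⊛ (b ⊛ (lambert (suc n) ⊛ u))))
          ≈⟨ solve 4 (λ a b l u → a :* (a :* (b :* (b :* (l :* u)))) := b :* (b :* (a :* (a :* l) :* u))) ≈-refl a b (lambert (suc n)) u ⟩
        b ⊛ (b ⊛ (a ⊛ (a ⊛ lambert (suc n)) ⊛ u)) ≈⟨ *-congˡ (*-congˡ (*-congʳ (lambert-spec n))) ⟩
        b ⊛ (b ⊛ (mono (suc n) ⊛ u))              ≈⟨ lambert-step n (suc r) ⟩
        mono (suc r) ⊛ (a ⊛ (a ⊛ v))              ≈⟨ *-congʳ (lambert-spec r) ⟨
        b ⊛ (b ⊛ lambert (suc r)) ⊛ (a ⊛ (a ⊛ v))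
          ≈⟨ solve 4 (λ a b l v → b :* (b :* l) :* (a :* (a :* v)) := a :* (a :* (b :* (b :* (l :* v))))) ≈-refl a b (lambert (suc r)) v ⟩
        a ⊛ (a ⊛ (b ⊛ (b ⊛ (lambert (suc r) ⊛ v)))) ∎))
        where
        a b u v : Series
        a = q- (suc n)
        b = q- (suc r)
        u = U (suc n) (suc r)
        v = u ⊖ U n (suc r)

      lambert-absorb : ∀ r → lambert (suc r) ⊛ U B (suc r) ≈ lambert (suc r)
      lambert-absorb r = cancel₂ r (begin
        b ⊛ (b ⊛ (lambert (suc r) ⊛ u))   ≈⟨ solve 3 (λ b l u → b :* (b :* (l :* u)) := b :* (b :* l) :* u) ≈-refl b (lambert (suc r)) u ⟩
        b ⊛ (b ⊛ lambert (suc r)) ⊛ u     ≈⟨ *-congʳ (lambert-spec r) ⟩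
        mono (suc r) ⊛ u                  ≈⟨ U-absorb (suc r) (suc r) ℕ.≤-refl ⟩
        mono (suc r)                      ≈⟨ lambert-spec r ⟨
        b ⊛ (b ⊛ lambert (suc r))         ∎)
        where
        b u : Series
        b = q- (suc r)
        u = U B (suc r)

      -- Divided by the four unit factors, `lambert-step` makes every summand a difference of
      -- consecutive values of U. The sum starts from U 0 = 0 and ends in U B, which the factor
      -- q^(r+1) of L(r + 1) absorbs.
      Σ-lambert-U : ∀ r → Σ< B (λ s → lambert (suc s) ⊛ U (suc s) (suc r)) ≈ lambert (suc r)
      Σ-lambert-U r = begin
        Σ< B (λ s → lambert (suc s) ⊛ U (suc s) (suc r))   ≈⟨ partial B ⟩
        lambert (suc r) ⊛ U B (suc r)                      ≈⟨ lambert-absorb r ⟩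
        lambert (suc r)                                    ∎
        where
        partial : ∀ k → Σ< k (λ s → lambert (suc s) ⊛ U (suc s) (suc r)) ≈ lambert (suc r) ⊛ U k (suc r)
        partial zero    = ≈-sym (≈-trans (*-congˡ (U-vanish 0 (suc r) (s≤s z≤n))) (zeroʳ _))
        partial (suc k) = begin
          Σ< k _ ⊕ lambert (suc k) ⊛ U (suc k) (suc r) ≈⟨ +-cong (partial k) (lambert-U k r) ⟩
          l ⊛ U k (suc r) ⊕ l ⊛ (U (suc k) (suc r) ⊖ U k (suc r))
            ≈⟨ solve 3 (λ l u v → l :* u :+ l :* (v :- u) := l :* v) ≈-refl l (U k (suc r)) (U (suc k) (suc r)) ⟩
          l ⊛ U (suc k) (suc r) ∎
          where
          l : Series
          l = lambert (suc r)

      Σ<-⊕ : ∀ n f g → Σ< n (λ i → f i ⊕ g i) ≈ Σ< n f ⊕ Σ< n g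
      Σ<-⊕ zero    f g = ≈-sym (+-identityʳ 𝟘)
      Σ<-⊕ (suc n) f g = begin
        Σ< n (λ i → f i ⊕ g i) ⊕ (f n ⊕ g n) ≈⟨ +-congʳ (Σ<-⊕ n f g) ⟩
        Σ< n f ⊕ Σ< n g ⊕ (f n ⊕ g n)
          ≈⟨ solve 4 (λ x y u v → x :+ y :+ (u :+ v) := x :+ u :+ (y :+ v)) ≈-refl (Σ< n f) (Σ< n g) (f n) (g n) ⟩
        Σ< n f ⊕ f n ⊕ (Σ< n g ⊕ g n)        ∎

      Σ<-swap : ∀ m n (f : ℕ → ℕ → Series) → Σ< m (λ i → Σ< n (f i)) ≈ Σ< n (λ j → Σ< m (λ i → f i j))
      Σ<-swap zero    n f = ≈-sym (zeros n)
        where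
        zeros : ∀ n → Σ< n (λ _ → 𝟘) ≈ 𝟘
        zeros zero    = ≈-refl
        zeros (suc n) = ≈-trans (+-identityʳ _) (zeros n)
      Σ<-swap (suc m) n f = ≈-trans (+-congʳ (Σ<-swap m n f)) (≈-sym (Σ<-⊕ n _ _))

    -- Interchanging the sums lets α₂ᵣ meet Σ_s L(s) U_s(2r) = L(2r), while α₀ leaves Σ L(s).
    bailey : Σ< B (λ s → lambert (suc s) ⊛ One.Pair.sum (suc s))
             ≈ Σ< B (λ s → lambert (suc s))
               ⊕ two ⊛ Σ< B (λ r → sg (suc r) ⊛ (mono (suc r * suc r + suc r * suc r) ⊛ lambert (suc r + suc r)))
    bailey = begin
      Σ< B (λ s → lambert (suc s) ⊛ (𝟙 ⊕ two ⊛ Σ< B (One.Pair.term (suc s))))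
        ≈⟨ Σ<-cong B (λ s _ → ≈-trans (solve 3 (λ l t S → l :* (con 1ℤ :+ t :* S) := l :+ t :* (l :* S)) ≈-refl (lambert (suc s)) two (Σ< B (One.Pair.term (suc s))))
             (+-congˡ (*-congˡ (Σ<-⊛ B _ _)))) ⟩
      Σ< B (λ s → lambert (suc s) ⊕ two ⊛ Σ< B (λ r → lambert (suc s) ⊛ One.Pair.term (suc s) r))
        ≈⟨ Σ<-⊕ B _ _ ⟩
      Σ< B (λ s → lambert (suc s)) ⊕ Σ< B (λ s → two ⊛ Σ< B (λ r → lambert (suc s) ⊛ One.Pair.term (suc s) r))
        ≈⟨ +-congˡ (≈-trans (≈-sym (Σ<-⊛ B two _)) (*-congˡ (Σ<-swap B B _))) ⟩
      Σ< B (λ s → lambert (suc s)) ⊕ two ⊛ Σ< B (λ r → Σ< B (λ s → lambert (suc s) ⊛ One.Pair.term (suc s) r))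
        ≈⟨ +-congˡ (*-congˡ (Σ<-cong B λ r _ → inner r)) ⟩
      Σ< B (λ s → lambert (suc s))
        ⊕ two ⊛ Σ< B (λ r → sg (suc r) ⊛ (mono (suc r * suc r + suc r * suc r) ⊛ lambert (suc r + suc r))) ∎
      where
      inner : ∀ r → Σ< B (λ s → lambert (suc s) ⊛ One.Pair.term (suc s) r)
                    ≈ sg (suc r) ⊛ (mono (suc r * suc r + suc r * suc r) ⊛ lambert (suc r + suc r))
      inner r = begin
        Σ< B (λ s → lambert (suc s) ⊛ (sg (suc r) ⊛ (m ⊛ U (suc s) (suc r + suc r))))
          ≈⟨ Σ<-cong B (λ s _ → solve 4 (λ l g m u → l :* (g :* (m :* u)) := g :* m :* (l :* u)) ≈-refl (lambert (suc s)) (sg (suc r)) m (U (suc s) (suc r + suc r))) ⟩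
        Σ< B (λ s → sg (suc r) ⊛ m ⊛ (lambert (suc s) ⊛ U (suc s) (suc r + suc r)))
          ≈⟨ Σ<-⊛ B _ _ ⟨
        sg (suc r) ⊛ m ⊛ Σ< B (λ s → lambert (suc s) ⊛ U (suc s) (suc r + suc r))
          ≈⟨ *-congˡ (Σ-lambert-U (r + suc r)) ⟩
        sg (suc r) ⊛ m ⊛ lambert (suc r + suc r)
          ≈⟨ *-assoc _ _ _ ⟩
        sg (suc r) ⊛ (m ⊛ lambert (suc r + suc r)) ∎
        where
        m : Series
        m = mono (suc r * suc r + suc r * suc r)

    -- φ(−q²)
    φ₂ : Series
    φ₂ = 𝟙 ⊕ two ⊛ Σ< B (λ r → sg (suc r) ⊛ mono (suc r * suc r + suc r * suc r))

    gauss : Two.Gauss.sum B ≈ φ₂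
    gauss = +-congˡ (*-congˡ (Σ<-cong B λ r _ → *-congˡ (Two.U-absorb (suc r * suc r) (suc r) (ℕ.m≤m*n (suc r) (suc r)))))

    -- The hypotheses say that A s m is the generating function of the overpartitions with smallest
    -- part s overlined and parts at most m, weighted by the number of smallest parts.
    module _ (A : ℕ → ℕ → Series)
      (A-start : ∀ s → A (suc s) (suc s) ≈ lambert (suc s))
      (A-part : ∀ s m → s ≤ m → (∃ λ j → suc m ≡ j + j) ⊎ (suc m < s + s) →
                q- (suc m) ⊛ A s (suc m) ≈ q+ (suc m) ⊛ A s m)
      (A-skip : ∀ s j → s ≤ j → A s (suc (j + j)) ≈ A s (j + j)) where

      private
        Φ : ℕ → Series
        Φ = Two.Gauss.sum

        -- The product of (1 + qⁱ)/(1 - qⁱ) for i ≤ m, which generates all overpartitions with parts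
        -- at most m.
        R : ℕ → Series
        R zero    = 𝟙
        R (suc m) = R m ⊛ (q+ (suc m) ⊛ inv (q- (suc m)))

        inv₀ : ∀ a → a 0 ≡ 1ℤ → (inv a) 0 ≡ 1ℤ
        inv₀ a a₀ = inv-constant a a₀

        R₀ : ∀ m → R m 0 ≡ 1ℤ
        R₀ zero    = refl
        R₀ (suc m) = cong₂ ℤ._*_ (R₀ m) (cong₂ ℤ._*_ (q+₀ m) (inv₀ (q- (suc m)) (q-₀ m)))

        R-suc : ∀ m → q- (suc m) ⊛ R (suc m) ≈ q+ (suc m) ⊛ R m
        R-suc m = begin
          a ⊛ (R m ⊛ (q+ (suc m) ⊛ inv a))   ≈⟨ solve 4 (λ a r b i → a :* (r :* (b :* i)) := b :* r :* (a :* i)) ≈-refl a (R m) (q+ (suc m)) (inv a) ⟩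
          q+ (suc m) ⊛ R m ⊛ (a ⊛ inv a)     ≈⟨ *-congˡ (inv-inverse a (q-₀ m)) ⟩
          q+ (suc m) ⊛ R m ⊛ 𝟙               ≈⟨ *-identityʳ _ ⟩
          q+ (suc m) ⊛ R m                   ∎
          where
          a : Series
          a = q- (suc m)

        -- Both sides are (-q; q²)ₛ / (q; q²)ₛ: on the left R cancels the factors (q)ₛ / (-q)ₛ of
        -- the pair, on the right Φ cancels the even factors of R (2s).
        pair-product : ∀ s → s ≤ B → One.Pair.sum s ⊛ R s ≈ R (s + s) ⊛ Φ s
        pair-product zero    _   = begin
          One.Pair.sum 0 ⊛ 𝟙  ≈⟨ *-congʳ One.Pair.sum-0 ⟩
          𝟙 ⊛ 𝟙               ≈⟨ *-congˡ Two.Gauss.sum-0 ⟨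
          𝟙 ⊛ Φ 0             ∎
        pair-product (suc s) s<B = cancel b (q+₀ s) (cancel c (q-₀ (s + s)) (cancel a (q-₀ s)
          (cancel e (q+₀ (s + suc s)) (cancel d (q-₀ (s + suc s)) (begin
          d ⊛ (e ⊛ (a ⊛ (c ⊛ (b ⊛ (One.Pair.sum (suc s) ⊛ R (suc s))))))
            ≈⟨ solve 7 (λ a b c d e P r → d :* (e :* (a :* (c :* (b :* (P :* r))))) := d :* e :* ((b :* c :* P) :* (a :* r)))
                 ≈-refl a b c d e (One.Pair.sum (suc s)) (R (suc s)) ⟩
          d ⊛ e ⊛ ((b ⊛ c ⊛ One.Pair.sum (suc s)) ⊛ (a ⊛ R (suc s)))
            ≈⟨ *-congˡ (*-cong (One.Pair.sum-step s s<B) (R-suc s)) ⟩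
          d ⊛ e ⊛ ((a ⊛ f ⊛ One.Pair.sum s) ⊛ (b ⊛ R s))
            ≈⟨ solve 7 (λ a b d e f P r → d :* e :* ((a :* f :* P) :* (b :* r)) := a :* b :* d :* e :* f :* (P :* r))
                 ≈-refl a b d e f (One.Pair.sum s) (R s) ⟩
          a ⊛ b ⊛ d ⊛ e ⊛ f ⊛ (One.Pair.sum s ⊛ R s)
            ≈⟨ *-congˡ (pair-product s (ℕ.<⇒≤ s<B)) ⟩
          a ⊛ b ⊛ d ⊛ e ⊛ f ⊛ (R (s + s) ⊛ Φ s)
            ≈⟨ solve 7 (λ a b d e f r p → a :* b :* d :* e :* f :* (r :* p) := a :* b :* (e :* (f :* r)) :* (d :* p))
                 ≈-refl a b d e f (R (s + s)) (Φ s) ⟩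
          a ⊛ b ⊛ (e ⊛ (f ⊛ R (s + s))) ⊛ (d ⊛ Φ s)
            ≈⟨ *-cong (*-congˡ (*-congˡ (R-suc (s + s)))) (Two.Gauss.sum-step s s<B) ⟨
          a ⊛ b ⊛ (e ⊛ (c ⊛ R (suc (s + s)))) ⊛ (e ⊛ Φ (suc s))
            ≈⟨ solve 6 (λ a b c e r p → a :* b :* (e :* (c :* r)) :* (e :* p) := a :* b :* c :* (e :* r) :* (e :* p))
                 ≈-refl a b c e (R (suc (s + s))) (Φ (suc s)) ⟩
          a ⊛ b ⊛ c ⊛ (e ⊛ R (suc (s + s))) ⊛ (e ⊛ Φ (suc s))
            ≈⟨ *-congʳ (*-congˡ R-last) ⟨
          a ⊛ b ⊛ c ⊛ (d ⊛ R (suc s + suc s)) ⊛ (e ⊛ Φ (suc s))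
            ≈⟨ solve 7 (λ a b c d e r p → a :* b :* c :* (d :* r) :* (e :* p) := d :* (e :* (a :* (c :* (b :* (r :* p))))))
                 ≈-refl a b c d e (R (suc s + suc s)) (Φ (suc s)) ⟩
          d ⊛ (e ⊛ (a ⊛ (c ⊛ (b ⊛ (R (suc s + suc s) ⊛ Φ (suc s)))))) ∎)))))
          where
          a b c d e f : Series
          a = q- (suc s)
          b = q+ (suc s)
          c = q- (suc s + s)
          d = q- (suc s + suc s)
          e = q+ (suc s + suc s)
          f = q+ (suc s + s)
          R-last : d ⊛ R (suc s + suc s) ≈ e ⊛ R (suc (s + s))
          R-last = ≈-trans (R-suc (s + suc s)) (*-congˡ (≗⇒≈ λ i → cong (λ z → R z i) (ℕ.+-suc s s)))

        -- Up to twice the smallest part every larger part is permitted: below the bound by size,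
        -- and at the bound itself because it is even.
        A-low : ∀ s j → j ≤ suc s → A (suc s) (suc s + j) ⊛ R (suc s) ≈ lambert (suc s) ⊛ R (suc s + j)
        A-low s zero    _   = subst (λ z → A (suc s) z ⊛ R (suc s) ≈ lambert (suc s) ⊛ R z) (sym (ℕ.+-identityʳ (suc s)))
                                (*-congʳ (A-start s))
        A-low s (suc j) j<s = subst (λ z → A (suc s) z ⊛ R (suc s) ≈ lambert (suc s) ⊛ R z) (sym (ℕ.+-suc (suc s) j))
          (cancel c (q-₀ (suc s + j)) (begin
            c ⊛ (A (suc s) (suc m) ⊛ R (suc s))   ≈⟨ *-assoc _ _ _ ⟨
            c ⊛ A (suc s) (suc m) ⊛ R (suc s)     ≈⟨ *-congʳ (A-part (suc s) m (ℕ.m≤m+n (suc s) j) (allowed (ℕ.m≤n⇒m<n∨m≡n j<s))) ⟩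
            q+ (suc m) ⊛ A (suc s) m ⊛ R (suc s)  ≈⟨ *-assoc _ _ _ ⟩
            q+ (suc m) ⊛ (A (suc s) m ⊛ R (suc s)) ≈⟨ *-congˡ (A-low s j (ℕ.<⇒≤ j<s)) ⟩
            q+ (suc m) ⊛ (l ⊛ R m)                ≈⟨ solve 3 (λ a l r → a :* (l :* r) := l :* (a :* r)) ≈-refl (q+ (suc m)) l (R m) ⟩
            l ⊛ (q+ (suc m) ⊛ R m)                ≈⟨ *-congˡ (R-suc m) ⟨
            l ⊛ (c ⊛ R (suc m))                   ≈⟨ solve 3 (λ c l r → l :* (c :* r) := c :* (l :* r)) ≈-refl c l (R (suc m)) ⟩
            c ⊛ (l ⊛ R (suc m))                   ∎))
          where
          m : ℕ
          m = suc s + j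
          c l : Series
          c = q- (suc m)
          l = lambert (suc s)
          allowed : (suc j < suc s) ⊎ (suc j ≡ suc s) → (∃ λ i → suc m ≡ i + i) ⊎ (suc m < suc s + suc s)
          allowed (inj₁ lt)   = inj₂ (subst (_< suc s + suc s) (ℕ.+-suc (suc s) j) (ℕ.+-monoʳ-< (suc s) lt))
          allowed (inj₂ refl) = inj₁ (suc j , cong suc (sym (ℕ.+-suc j j)))

        A-double : ∀ s → suc s ≤ B → Φ (suc s) ⊛ A (suc s) (suc s + suc s) ≈ lambert (suc s) ⊛ One.Pair.sum (suc s)
        A-double s s<B = cancel (R (suc s)) (R₀ (suc s)) (begin
          r ⊛ (Φ (suc s) ⊛ a)     ≈⟨ solve 3 (λ r p a → r :* (p :* a) := p :* (a :* r)) ≈-refl r (Φ (suc s)) a ⟩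
          Φ (suc s) ⊛ (a ⊛ r)     ≈⟨ *-congˡ (A-low s (suc s) ℕ.≤-refl) ⟩
          Φ (suc s) ⊛ (l ⊛ R (suc s + suc s)) ≈⟨ solve 3 (λ p l r → p :* (l :* r) := l :* (r :* p)) ≈-refl (Φ (suc s)) l (R (suc s + suc s)) ⟩
          l ⊛ (R (suc s + suc s) ⊛ Φ (suc s)) ≈⟨ *-congˡ (pair-product (suc s) s<B) ⟨
          l ⊛ (One.Pair.sum (suc s) ⊛ r)      ≈⟨ solve 3 (λ l p r → l :* (p :* r) := r :* (l :* p)) ≈-refl l (One.Pair.sum (suc s)) r ⟩
          r ⊛ (l ⊛ One.Pair.sum (suc s))      ∎)
          where
          r a l : Series
          r = R (suc s)
          a = A (suc s) (suc s + suc s)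
          l = lambert (suc s)

        -- Beyond twice the smallest part, odd parts are skipped and the even part 2m contributes (1
        -- + q^(2m))/(1 - q^(2m)), the inverse of the factor that Φ acquires. The product is thus
        -- constant in the bound.
        A-high : ∀ s k → suc s + k ≤ B →
                 Φ (suc s + k) ⊛ A (suc s) (suc s + k + (suc s + k)) ≈ lambert (suc s) ⊛ One.Pair.sum (suc s)
        A-high s zero    s≤B = subst (λ z → Φ z ⊛ A (suc s) (z + z) ≈ lambert (suc s) ⊛ One.Pair.sum (suc s)) (sym (ℕ.+-identityʳ (suc s)))
                                 (A-double s (subst (_≤ B) (ℕ.+-identityʳ (suc s)) s≤B))
        A-high s (suc k) s≤B = subst (λ z → Φ z ⊛ A (suc s) (z + z) ≈ lambert (suc s) ⊛ One.Pair.sum (suc s)) (sym (ℕ.+-suc (suc s) k))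
          (cancel c (q-₀ (m + suc m)) (cancel d (q+₀ (m + suc m)) (begin
            d ⊛ (c ⊛ (Φ (suc m) ⊛ A (suc s) (suc m + suc m)))
              ≈⟨ solve 4 (λ c d p a → d :* (c :* (p :* a)) := d :* p :* (c :* a)) ≈-refl c d (Φ (suc m)) (A (suc s) (suc m + suc m)) ⟩
            d ⊛ Φ (suc m) ⊛ (c ⊛ A (suc s) (suc m + suc m))
              ≈⟨ *-cong (Two.Gauss.sum-step m m<B) (A-part (suc s) (m + suc m) (ℕ.≤-trans (ℕ.m≤m+n (suc s) k) (ℕ.m≤m+n m (suc m))) (inj₁ (suc m , refl))) ⟩
            c ⊛ Φ m ⊛ (d ⊛ A (suc s) (m + suc m))
              ≈⟨ *-congˡ (*-congˡ (≈-trans (≗⇒≈ λ i → cong (λ z → A (suc s) z i) (ℕ.+-suc m m)) (A-skip (suc s) m (ℕ.m≤m+n (suc s) k)))) ⟩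
            c ⊛ Φ m ⊛ (d ⊛ A (suc s) (m + m))
              ≈⟨ solve 4 (λ c d p a → c :* p :* (d :* a) := d :* (c :* (p :* a))) ≈-refl c d (Φ m) (A (suc s) (m + m)) ⟩
            d ⊛ (c ⊛ (Φ m ⊛ A (suc s) (m + m)))
              ≈⟨ *-congˡ (*-congˡ (A-high s k (ℕ.<⇒≤ m<B))) ⟩
            d ⊛ (c ⊛ (lambert (suc s) ⊛ One.Pair.sum (suc s))) ∎)))
          where
          m : ℕ
          m = suc s + k
          m<B : suc m ≤ B
          m<B = subst (_≤ B) (ℕ.+-suc (suc s) k) s≤B
          c d : Series
          c = q- (suc m + suc m)
          d = q+ (suc m + suc m)

      generating-function : φ₂ ⊛ Σ< B (λ s → A (suc s) (B + B))
        ≈ Σ< B (λ s → lambert (suc s))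
          ⊕ two ⊛ Σ< B (λ r → sg (suc r) ⊛ (mono (suc r * suc r + suc r * suc r) ⊛ lambert (suc r + suc r)))
      generating-function = begin
        φ₂ ⊛ Σ< B (λ s → A (suc s) (B + B))                        ≈⟨ *-congʳ gauss ⟨
        Φ B ⊛ Σ< B (λ s → A (suc s) (B + B))                       ≈⟨ Σ<-⊛ B _ _ ⟩
        Σ< B (λ s → Φ B ⊛ A (suc s) (B + B))                       ≈⟨ Σ<-cong B each ⟩
        Σ< B (λ s → lambert (suc s) ⊛ One.Pair.sum (suc s))        ≈⟨ bailey ⟩
        _                                                          ∎
        where
        each : ∀ s → s < B → Φ B ⊛ A (suc s) (B + B) ≈ lambert (suc s) ⊛ One.Pair.sum (suc s)
        each s s<B = subst (λ z → Φ z ⊛ A (suc s) (z + z) ≈ lambert (suc s) ⊛ One.Pair.sum (suc s)) (ℕ.m+[n∸m]≡n s<B)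
          (A-high s (B ∸ suc s) (ℕ.≤-reflexive (ℕ.m+[n∸m]≡n s<B)))

-- Counting overpartitions by their smallest part.

module Overpartitions where
  open import Data.Nat using (_+_; _*_; _∸_; _<_)
  open import Data.List using (concatMap; filterᵇ; upTo; applyUpTo)
  open import Data.Bool.ListAction using (all)
  open import Data.List.Properties using (map-++; map-∘; map-cong)
  open import Data.Nat.ListAction using (sum)
  open import Data.Nat.ListAction.Properties using (sum-++)

  -- The local function of `weight` that walks to the smallest block cannot be named from outside; the
  -- type of weight-walk determines it by unification, with the overpartition as a separate argument.
  mutual
    walk : List Block → List Block → ℕ
    walk = _

    weight-walk : ∀ x y r → weight (x ∷ y ∷ r) ≡ walk (x ∷ y ∷ r) (y ∷ r)
    weight-walk x y r with y ∷ r
    ... | ρ with x ∷ ρ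
    ... | π = refl

  admissible : ℕ → ℕ → Bool
  admissible s v = not (isOdd v) ∨ (v <ᵇ 2 * s)

  allAdmissible : ℕ → List Block → Bool
  allAdmissible s π = all (λ x → admissible s (proj₁ x)) π

  lastBlock : Block → List Block → Block
  lastBlock x []      = x
  lastBlock x (y ∷ r) = lastBlock y r

  all-cong : ∀ {p q : Block → Bool} → (∀ x → p x ≡ q x) → ∀ π → all p π ≡ all q π
  all-cong e []      = refl
  all-cong e (x ∷ π) = cong₂ _∧_ (e x) (all-cong e π)

  walk-last : ∀ π x r → walk π (x ∷ r) ≡
    (let (s , k , b) = lastBlock x r in if b ∧ allAdmissible s π then k else 0)
  -- The predicate inside `weight` is a local pattern-matching function, so it is compared with
  -- `admissible` pointwise.
  walk-last π (s , k , b) []  = cong (λ z → if b ∧ z then k else 0) (all-cong (λ _ → refl) π)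
  walk-last π x (y ∷ r)       = walk-last π y r

  weight-last : ∀ x r → weight (x ∷ r) ≡
    (let (s , k , b) = lastBlock x r in if b ∧ allAdmissible s (x ∷ r) then k else 0)
  weight-last x r = walk-last (x ∷ r) x r

  -- The share of the smallest part s in `weight`, by recursion from the largest block so that it
  -- follows the recursion of `ovps`. The last block needs no test for odd parts, since its value is
  -- s < 2s.
  contrib : ℕ → List Block → ℕ
  contrib s []                    = 0
  contrib s ((v , k , b) ∷ [])    = if (v ≡ᵇ s) ∧ b then k else 0
  contrib s ((v , k , b) ∷ y ∷ r) = if admissible s v then contrib s (y ∷ r) else 0

  <ᵇ-true : ∀ {m n} → m < n → (m <ᵇ n) ≡ true
  <ᵇ-true {m} {n} m<n with m <ᵇ n | ℕ.<⇒<ᵇ m<n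
  ... | true | _ = refl

  <ᵇ-false : ∀ {m n} → n ≤ m → (m <ᵇ n) ≡ false
  <ᵇ-false {m} {n} n≤m with m <ᵇ n in eq
  ... | false = refl
  ... | true  = ⊥-elim (ℕ.<⇒≱ (ℕ.<ᵇ⇒< m n (subst Data.Bool.T (sym eq) tt)) n≤m)

  ≡ᵇ-refl : ∀ n → (n ≡ᵇ n) ≡ true
  ≡ᵇ-refl zero    = refl
  ≡ᵇ-refl (suc n) = ≡ᵇ-refl n

  ≡ᵇ-false : ∀ {m n} → m ≢ n → (m ≡ᵇ n) ≡ false
  ≡ᵇ-false {m} {n} m≢n with m ≡ᵇ n in eq
  ... | false = refl
  ... | true  = ⊥-elim (m≢n (ℕ.≡ᵇ⇒≡ m n (subst Data.Bool.T (sym eq) tt)))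

  admissible-self : ∀ s → admissible (suc s) (suc s) ≡ true
  admissible-self s = trans (cong (not (isOdd (suc s)) ∨_) (<ᵇ-true {suc s} (ℕ.m<m+n (suc s) (s≤s z≤n)))) (Bool.∨-zeroʳ _)

  contrib-last : ∀ s x r → contrib (suc s) (x ∷ r) ≡
    (let (v , k , b) = lastBlock x r in if (v ≡ᵇ suc s) ∧ (b ∧ allAdmissible (suc s) (x ∷ r)) then k else 0)
  contrib-last s (v , k , b) [] with v ≡ᵇ suc s in eq
  ... | false = refl
  ... | true rewrite ℕ.≡ᵇ⇒≡ v (suc s) (subst Data.Bool.T (sym eq) tt) | admissible-self s | Bool.∧-identityʳ b = refl
  contrib-last s (v , k , b) (y ∷ r) with admissible (suc s) v
  ... | true  = contrib-last s y r
  ... | false with lastBlock y r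
  ...   | (w , l , c) rewrite Bool.∧-zeroʳ c | Bool.∧-zeroʳ (w ≡ᵇ suc s) = refl

  Σℕ : ℕ → (ℕ → ℕ) → ℕ
  Σℕ zero    f = 0
  Σℕ (suc n) f = f 0 + Σℕ n (f ∘ suc)

  Σℕ-cong : ∀ n {f g} → (∀ i → i < n → f i ≡ g i) → Σℕ n f ≡ Σℕ n g
  Σℕ-cong zero    e = refl
  Σℕ-cong (suc n) e = cong₂ _+_ (e 0 (s≤s z≤n)) (Σℕ-cong n λ i i<n → e (suc i) (s≤s i<n))

  Σℕ-zero : ∀ n {f} → (∀ i → i < n → f i ≡ 0) → Σℕ n f ≡ 0
  Σℕ-zero zero    e = refl
  Σℕ-zero (suc n) e = cong₂ _+_ (e 0 (s≤s z≤n)) (Σℕ-zero n λ i i<n → e (suc i) (s≤s i<n))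

  Σℕ-extend : ∀ m n f → m ≤ n → (∀ i → m ≤ i → f i ≡ 0) → Σℕ n f ≡ Σℕ m f
  Σℕ-extend zero    n       f _         e = Σℕ-zero n λ i _ → e i z≤n
  Σℕ-extend (suc m) (suc n) f (s≤s m≤n) e = cong (λ z → f 0 + z) (Σℕ-extend m n (f ∘ suc) m≤n λ i m≤i → e (suc i) (s≤s m≤i))

  Σℕ-+ : ∀ n f g → Σℕ n (λ i → f i + g i) ≡ Σℕ n f + Σℕ n g
  Σℕ-+ zero    f g = refl
  Σℕ-+ (suc n) f g = trans (cong (λ z → f 0 + g 0 + z) (Σℕ-+ n (f ∘ suc) (g ∘ suc))) (lem (f 0) (g 0) _ _)
    where
    lem : ∀ a b c d → a + b + (c + d) ≡ a + c + (b + d)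
    lem = ℕ-solve

  Σℕ-single : ∀ n j {f} → j < n → (∀ i → i ≢ j → f i ≡ 0) → Σℕ n f ≡ f j
  Σℕ-single (suc n) zero    {f} _         e = trans (cong (λ z → f 0 + z) (Σℕ-zero n λ i _ → e (suc i) λ ())) (ℕ.+-identityʳ _)
  Σℕ-single (suc n) (suc j) {f} (s≤s j<n) e = trans (cong (_+ Σℕ n (f ∘ suc)) (e 0 λ ()))
    (Σℕ-single n j j<n λ i i≢j → e (suc i) (i≢j ∘ ℕ.suc-injective))

  module _ {A : Set} where
    sumOver : (A → ℕ) → List A → ℕ
    sumOver c xs = sum (map c xs)

    sumOver-++ : ∀ c xs ys → sumOver c (xs ++ ys) ≡ sumOver c xs + sumOver c ys
    sumOver-++ c xs ys = trans (cong sum (map-++ c xs ys)) (sum-++ (map c xs) (map c ys))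

    sumOver-cong : ∀ {c d} → c ≗ d → ∀ xs → sumOver c xs ≡ sumOver d xs
    sumOver-cong e xs = cong sum (map-cong e xs)

    sumOver-zero : ∀ {c} → (∀ x → c x ≡ 0) → ∀ xs → sumOver c xs ≡ 0
    sumOver-zero e []       = refl
    sumOver-zero e (x ∷ xs) = cong₂ _+_ (e x) (sumOver-zero e xs)

    sumOver-+ : ∀ c d xs → sumOver (λ x → c x + d x) xs ≡ sumOver c xs + sumOver d xs
    sumOver-+ c d []       = refl
    sumOver-+ c d (x ∷ xs) = trans (cong (λ z → c x + d x + z) (sumOver-+ c d xs)) (lem (c x) (d x) _ _)
      where
      lem : ∀ a b c d → a + b + (c + d) ≡ a + c + (b + d)
      lem = ℕ-solve

    sumOver-map : ∀ {B : Set} (c : A → ℕ) (f : B → A) xs → sum (map c (map f xs)) ≡ sum (map (c ∘ f) xs)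
    sumOver-map c f xs = cong sum (sym (map-∘ xs))

    sumOver-concatMap : ∀ {B : Set} (c : A → ℕ) (f : B → List A) xs → sumOver c (concatMap f xs) ≡ sum (map (λ x → sumOver c (f x)) xs)
    sumOver-concatMap c f []       = refl
    sumOver-concatMap c f (x ∷ xs) = trans (sumOver-++ c (f x) _) (cong (λ z → sumOver c (f x) + z) (sumOver-concatMap c f xs))

  sumOver-filter : ∀ {A : Set} (c : A → ℕ) (p : A → Bool) xs →
                   sumOver c (filterᵇ p xs) ≡ sumOver (λ x → if p x then c x else 0) xs
  sumOver-filter c p []       = refl
  sumOver-filter c p (x ∷ xs) with p x
  ... | true  = cong (λ z → c x + z) (sumOver-filter c p xs)
  ... | false = sumOver-filter c p xs

  sumOver-applyUpTo : ∀ (c : ℕ → ℕ) f n → sumOver c (applyUpTo f n) ≡ Σℕ n (c ∘ f)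
  sumOver-applyUpTo c f zero    = refl
  sumOver-applyUpTo c f (suc n) = cong (λ z → c (f 0) + z) (sumOver-applyUpTo c (f ∘ suc) n)

  sumOver-ovps : ∀ c m n → sumOver c (ovps (suc m) n) ≡ sumOver c (ovps m n)
    + Σℕ n (λ k → if suc k * suc m ≤ᵇ n
                  then sumOver (λ π → c ((suc m , suc k , true) ∷ π)) (ovps m (n ∸ suc k * suc m))
                     + sumOver (λ π → c ((suc m , suc k , false) ∷ π)) (ovps m (n ∸ suc k * suc m))
                  else 0)
  sumOver-ovps c m n = trans (sumOver-++ c (ovps m n) _) (cong (λ z → sumOver c (ovps m n) + z) (begin
    sumOver c (concatMap block (filterᵇ fits (upTo n)))              ≡⟨ sumOver-concatMap c block (filterᵇ fits (upTo n)) ⟩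
    sumOver (λ k → sumOver c (block k)) (filterᵇ fits (upTo n))      ≡⟨ sumOver-filter _ fits (upTo n) ⟩
    sumOver (λ k → if fits k then sumOver c (block k) else 0) (upTo n) ≡⟨ sumOver-applyUpTo _ id n ⟩
    Σℕ n (λ k → if fits k then sumOver c (block k) else 0)
      ≡⟨ Σℕ-cong n (λ k _ → cong (λ z → if fits k then z else 0) (both k)) ⟩
    _ ∎))
    where
    open ≡-Reasoning
    fits : ℕ → Bool
    fits k = suc k * suc m ≤ᵇ n
    rest : ℕ → List (List Block)
    rest k = ovps m (n ∸ suc k * suc m)
    block : ℕ → List (List Block)
    block k = concatMap (λ b → map ((suc m , suc k , b) ∷_) (rest k)) (true ∷ false ∷ [])
    both : ∀ k → sumOver c (block k) ≡ sumOver (λ π → c ((suc m , suc k , true) ∷ π)) (rest k)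
                                      + sumOver (λ π → c ((suc m , suc k , false) ∷ π)) (rest k)
    both k = trans (sumOver-concatMap c (λ b → map ((suc m , suc k , b) ∷_) (rest k)) (true ∷ false ∷ []))
      (cong₂ _+_ (sumOver-map c _ (rest k)) (trans (ℕ.+-identityʳ _) (sumOver-map c _ (rest k))))

  -- The coefficient of qⁿ in the series called A s m in the hypotheses of `generating-function`.
  A : ℕ → ℕ → ℕ → ℕ
  A s m n = sumOver (contrib s) (ovps m n)

  isEmpty : List Block → ℕ
  isEmpty []      = 1
  isEmpty (_ ∷ _) = 0

  contrib-∷ : ∀ s v k b π → v ≢ s → contrib s ((v , k , b) ∷ π) ≡ (if admissible s v then contrib s π else 0)
  contrib-∷ s v k b (y ∷ r) v≢s = refl
  contrib-∷ s v k b []      v≢s rewrite ≡ᵇ-false v≢s with admissible s v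
  ... | true  = refl
  ... | false = refl

  -- A block of value s is the smallest one exactly when nothing follows, which `isEmpty` detects.
  -- In the application the rest has only parts below s, so the second summand will add up to 0.
  contrib-self : ∀ s k b π → contrib (suc s) ((suc s , k , b) ∷ π) ≡ (if b then k * isEmpty π else 0) + contrib (suc s) π
  contrib-self s k true  []      rewrite ≡ᵇ-refl s | ℕ.*-identityʳ k = sym (ℕ.+-identityʳ k)
  contrib-self s k false []      rewrite ≡ᵇ-refl s = refl
  contrib-self s k true  (y ∷ r) rewrite admissible-self s | ℕ.*-zeroʳ k = refl
  contrib-self s k false (y ∷ r) rewrite admissible-self s = refl

  -- The coefficients of (q^v + q^(2v) + ...) a. A part v that may be overlined has the factor (1 +
  -- q^v)/(1 - q^v) = 1 + 2 (q^v + q^(2v) + ...), hence the two copies below.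
  multiples : (ℕ → ℕ) → ℕ → ℕ → ℕ
  multiples a v n = Σℕ n (λ k → if suc k * v ≤ᵇ n then a (n ∸ suc k * v) else 0)

  if-+ : ∀ (b : Bool) {x y : ℕ} → (if b then x + y else 0) ≡ (if b then x else 0) + (if b then y else 0)
  if-+ true  = refl
  if-+ false = refl

  A-admissible : ∀ s m n → suc m ≢ s → admissible s (suc m) ≡ true →
                 A s (suc m) n ≡ A s m n + (multiples (A s m) (suc m) n + multiples (A s m) (suc m) n)
  A-admissible s m n m≢s adm = trans (sumOver-ovps (contrib s) m n) (cong (λ z → A s m n + z)
    (trans (Σℕ-cong n λ k _ → trans (cong (λ z → if suc k * suc m ≤ᵇ n then z else 0) (cong₂ _+_ (each k true) (each k false))) (if-+ (suc k * suc m ≤ᵇ n)))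
           (Σℕ-+ n _ _)))
    where
    each : ∀ k b → sumOver (λ π → contrib s ((suc m , suc k , b) ∷ π)) (ovps m (n ∸ suc k * suc m)) ≡ A s m (n ∸ suc k * suc m)
    each k b = sumOver-cong (λ π → trans (contrib-∷ s (suc m) (suc k) b π m≢s) (cong (λ z → if z then contrib s π else 0) adm)) (ovps m (n ∸ suc k * suc m))

  A-inadmissible : ∀ s m n → suc m ≢ s → admissible s (suc m) ≡ false → A s (suc m) n ≡ A s m n
  A-inadmissible s m n m≢s adm = trans (sumOver-ovps (contrib s) m n) (trans (cong (λ z → A s m n + z)
    (Σℕ-zero n λ k _ → trans (cong (λ z → if suc k * suc m ≤ᵇ n then z else 0) (cong₂ _+_ (each k true) (each k false))) (if-0 (suc k * suc m ≤ᵇ n))))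
    (ℕ.+-identityʳ _))
    where
    if-0 : ∀ (b : Bool) → (if b then 0 else 0) ≡ 0
    if-0 true  = refl
    if-0 false = refl
    each : ∀ k b → sumOver (λ π → contrib s ((suc m , suc k , b) ∷ π)) (ovps m (n ∸ suc k * suc m)) ≡ 0
    each k b = sumOver-zero (λ π → trans (contrib-∷ s (suc m) (suc k) b π m≢s) (cong (λ z → if z then contrib s π else 0) adm)) (ovps m (n ∸ suc k * suc m))

  multiples-zero : ∀ {a} v n → (∀ i → a i ≡ 0) → multiples a v n ≡ 0
  multiples-zero v n e = Σℕ-zero n λ k _ → lem (suc k * v ≤ᵇ n) (e _)
    where
    lem : ∀ b {x} → x ≡ 0 → (if b then x else 0) ≡ 0
    lem true  e = e
    lem false e = refl

  A-below : ∀ s m n → m < s → A s m n ≡ 0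
  A-below s zero    zero    _   = refl
  A-below s zero    (suc n) _   = refl
  A-below s (suc m) n       m<s with admissible s (suc m) in eq
  ... | false = trans (A-inadmissible s m n (ℕ.<⇒≢ m<s) eq) (A-below s m n (ℕ.<-trans ℕ.≤-refl m<s))
  ... | true  = trans (A-admissible s m n (ℕ.<⇒≢ m<s) eq)
    (cong₂ _+_ (A-below s m n m<s′) (cong₂ _+_ (multiples-zero (suc m) n λ i → A-below s m i m<s′) (multiples-zero (suc m) n λ i → A-below s m i m<s′)))
    where
    m<s′ : m < s
    m<s′ = ℕ.<-trans ℕ.≤-refl m<s

  count-empty : ∀ m n → sumOver isEmpty (ovps m n) ≡ (if n ≡ᵇ 0 then 1 else 0)
  count-empty zero    zero    = refl
  count-empty zero    (suc n) = refl
  count-empty (suc m) n = trans (sumOver-ovps isEmpty m n) (trans (cong₂ _+_ (count-empty m n) (Σℕ-zero n λ k _ → lem k (suc k * suc m ≤ᵇ n))) (ℕ.+-identityʳ _))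
    where
    lem : ∀ k (b : Bool) → (if b then sumOver (λ π → isEmpty ((suc m , suc k , true) ∷ π)) (ovps m (n ∸ suc k * suc m))
                     + sumOver (λ π → isEmpty ((suc m , suc k , false) ∷ π)) (ovps m (n ∸ suc k * suc m)) else 0) ≡ 0
    lem k true  = cong₂ _+_ (sumOver-zero (λ _ → refl) (ovps m (n ∸ suc k * suc m))) (sumOver-zero (λ _ → refl) (ovps m (n ∸ suc k * suc m)))
    lem k false = refl

  sumOver-* : ∀ {A : Set} k (c : A → ℕ) xs → sumOver (λ x → k * c x) xs ≡ k * sumOver c xs
  sumOver-* k c []       = sym (ℕ.*-zeroʳ k)
  sumOver-* k c (x ∷ xs) = trans (cong (λ z → k * c x + z) (sumOver-* k c xs)) (sym (ℕ.*-distribˡ-+ k (c x) _))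

  A-self : ∀ s n → A (suc s) (suc s) n ≡ Σℕ n (λ k → if suc k * suc s ≡ᵇ n then suc k else 0)
  A-self s n = trans (sumOver-ovps (contrib (suc s)) s n) (trans (cong₂ _+_ (A-below (suc s) s n ℕ.≤-refl) refl) (Σℕ-cong n λ k _ → each k))
    where
    block : ∀ k b → sumOver (λ π → contrib (suc s) ((suc s , suc k , b) ∷ π)) (ovps s (n ∸ suc k * suc s))
                    ≡ (if b then suc k * (if (n ∸ suc k * suc s) ≡ᵇ 0 then 1 else 0) else 0)
    block k b = trans (sumOver-cong (contrib-self s (suc k) b) (ovps s n′)) (trans (sumOver-+ _ (contrib (suc s)) (ovps s n′))
      (trans (cong₂ _+_ (lem b) (A-below (suc s) s n′ ℕ.≤-refl)) (ℕ.+-identityʳ _)))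
      where
      n′ : ℕ
      n′ = n ∸ suc k * suc s
      lem : ∀ b → sumOver (λ π → if b then suc k * isEmpty π else 0) (ovps s n′) ≡ (if b then suc k * (if n′ ≡ᵇ 0 then 1 else 0) else 0)
      lem true  = trans (sumOver-* (suc k) isEmpty (ovps s n′)) (cong (suc k *_) (count-empty s n′))
      lem false = sumOver-zero (λ _ → refl) (ovps s n′)
    pick : ∀ j m k → (if j ≤ᵇ m then k * (if (m ∸ j) ≡ᵇ 0 then 1 else 0) + 0 else 0) ≡ (if j ≡ᵇ m then k else 0)
    pick zero    zero    k = trans (ℕ.+-identityʳ _) (ℕ.*-identityʳ k)
    pick zero    (suc m) k = trans (ℕ.+-identityʳ _) (ℕ.*-zeroʳ k)
    pick (suc j) zero    k = refl
    pick (suc zero)    (suc m) k = pick zero m k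
    pick (suc (suc j)) (suc m) k = pick (suc j) m k
    each : ∀ k → _ ≡ (if suc k * suc s ≡ᵇ n then suc k else 0)
    each k = trans (cong (λ z → if suc k * suc s ≤ᵇ n then z else 0) (cong₂ _+_ (block k true) (block k false))) (pick (suc k * suc s) n (suc k))

  ≤ᵇ-true : ∀ {m n} → m ≤ n → (m ≤ᵇ n) ≡ true
  ≤ᵇ-true {m} {n} m≤n with m ≤ᵇ n | ℕ.≤⇒≤ᵇ m≤n
  ... | true | _ = refl

  ≤ᵇ-false : ∀ {m n} → n < m → (m ≤ᵇ n) ≡ false
  ≤ᵇ-false {m} {n} n<m with m ≤ᵇ n in eq
  ... | false = refl
  ... | true  = ⊥-elim (ℕ.<⇒≱ n<m (ℕ.≤ᵇ⇒≤ m n (subst Data.Bool.T (sym eq) tt)))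

  multiples-< : ∀ a v n → n < suc v → multiples a (suc v) n ≡ 0
  multiples-< a v n n<v = Σℕ-zero n λ k _ → cong (λ z → if z then a (n ∸ suc k * suc v) else 0)
    (≤ᵇ-false (ℕ.<-≤-trans n<v (ℕ.m≤m+n (suc v) (k * suc v))))

  -- The smallest multiple gives the term a n and the others move down by one. The range of k is
  -- longer than the number of multiples that fit, so the surplus terms have to be shown to vanish.
  multiples-step : ∀ a v n → multiples a (suc v) (suc v + n) ≡ a n + multiples a (suc v) n
  multiples-step a v n = cong₂ _+_ first (trans (Σℕ-cong (v + n) λ k _ → shifted k) (Σℕ-extend n (v + n) _ (ℕ.m≤n+m n v) beyond))
    where
    first : (if 1 * suc v ≤ᵇ suc v + n then a (suc v + n ∸ 1 * suc v) else 0) ≡ a n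
    first rewrite ℕ.+-identityʳ v | ≤ᵇ-true {suc v} {suc v + n} (ℕ.m≤m+n (suc v) n) | ℕ.m+n∸m≡n v n = refl
    shifted : ∀ k → (if suc (suc k) * suc v ≤ᵇ suc v + n then a (suc v + n ∸ suc (suc k) * suc v) else 0)
                    ≡ (if suc k * suc v ≤ᵇ n then a (n ∸ suc k * suc v) else 0)
    shifted k = cong₂ (λ p z → if p then a z else 0) (fits (suc k * suc v)) (ℕ.[m+n]∸[m+o]≡n∸o (suc v) n (suc k * suc v))
      where
      fits : ∀ j → (suc v + j ≤ᵇ suc v + n) ≡ (j ≤ᵇ n)
      fits j with j ℕ.≤? n
      ... | yes j≤n = trans (≤ᵇ-true (ℕ.+-monoʳ-≤ (suc v) j≤n)) (sym (≤ᵇ-true j≤n))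
      ... | no j≰n  = trans (≤ᵇ-false (ℕ.+-monoʳ-< (suc v) (ℕ.≰⇒> j≰n))) (sym (≤ᵇ-false (ℕ.≰⇒> j≰n)))
    beyond : ∀ k → n ≤ k → (if suc k * suc v ≤ᵇ n then a (n ∸ suc k * suc v) else 0) ≡ 0
    beyond k n≤k = cong (λ z → if z then a (n ∸ suc k * suc v) else 0) (≤ᵇ-false (ℕ.≤-trans (s≤s n≤k) (ℕ.m≤m*n (suc k) (suc v))))

  if-false : ∀ {b} {x : ℕ} → b ≡ false → (if b then x else 0) ≡ 0
  if-false refl = refl

  -- A part above n does not fit. This allows one common bound for the parts in all coefficients up
  -- to degree B.
  A-large : ∀ s k n → A s (n + k) n ≡ A s n n
  A-large s zero    n = cong (λ z → A s z n) (ℕ.+-identityʳ n)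
  A-large s (suc k) n = trans (cong (λ z → A s z n) (ℕ.+-suc n k)) (trans step (A-large s k n))
    where
    step : A s (suc (n + k)) n ≡ A s (n + k) n
    step = trans (sumOver-ovps (contrib s) (n + k) n) (trans (cong (λ z → A s (n + k) n + z) (Σℕ-zero n λ j _ →
      if-false (≤ᵇ-false (ℕ.≤-trans (s≤s (ℕ.m≤m+n n k)) (ℕ.m≤m+n (suc (n + k)) (j * suc (n + k))))))) (ℕ.+-identityʳ _))

  PartsIn : ℕ → List Block → Set
  PartsIn m = All (λ x → (0 < proj₁ x) × (proj₁ x ≤ m))

  ovps-parts : ∀ m n → All (PartsIn m) (ovps m n)
  ovps-parts zero    zero    = [] ∷ []
  ovps-parts zero    (suc n) = []
  ovps-parts (suc m) n = All.++⁺ (All.map weaken (ovps-parts m n))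
    (All.concat⁺ (All.map⁺ (All.universal (λ k → All.concat⁺ (All.map⁺ (All.universal (λ b →
      All.map⁺ (All.map (λ ps → _∷_ {x = suc m , suc k , b} (s≤s z≤n , ℕ.≤-refl) (weaken ps)) (ovps-parts m (n ∸ suc k * suc m)))) (true ∷ false ∷ []))))
      (filterᵇ (λ k → suc k * suc m ≤ᵇ n) (upTo n)))))
    where
    weaken : ∀ {π} → PartsIn m π → PartsIn (suc m) π
    weaken = All.map λ (p , q) → p , ℕ.m≤n⇒m≤1+n q

  -- Only the summand for the value of the last block survives; `PartsIn` ensures that this value is
  -- positive and within the range of summation.
  weight-contrib : ∀ m π → PartsIn m π → weight π ≡ Σℕ m (λ s → contrib (suc s) π)
  weight-contrib m []      _  = sym (Σℕ-zero m λ _ _ → refl)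
  weight-contrib m (x ∷ r) ps with lastBlock x r | weight-last x r | (λ s → contrib-last s x r) | last-in x r ps
    where
    last-in : ∀ x r → PartsIn m (x ∷ r) → (0 < proj₁ (lastBlock x r)) × (proj₁ (lastBlock x r) ≤ m)
    last-in x []      (p ∷ _)  = p
    last-in x (y ∷ r) (_ ∷ ps) = last-in y r ps
  ... | (suc v , k , b) | w | c | (_ , v≤m) = trans w (sym (trans (Σℕ-single m v v≤m other)
          (trans (c v) (cong (λ z → if z ∧ (b ∧ allAdmissible (suc v) (x ∷ r)) then k else 0) (≡ᵇ-refl v)))))
    where
    other : ∀ i → i ≢ v → contrib (suc i) (x ∷ r) ≡ 0
    other i i≢v = trans (c i) (cong (λ z → if z ∧ (b ∧ allAdmissible (suc i) (x ∷ r)) then k else 0) (≡ᵇ-false {v} {i} (i≢v ∘ sym)))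

  sumOver-Σℕ : ∀ m (c : ℕ → List Block → ℕ) xs → sumOver (λ π → Σℕ m (λ s → c s π)) xs ≡ Σℕ m (λ s → sumOver (c s) xs)
  sumOver-Σℕ zero    c xs = sumOver-zero (λ _ → refl) xs
  sumOver-Σℕ (suc m) c xs = trans (sumOver-+ (c 0) _ xs) (cong (λ z → sumOver (c 0) xs + z) (sumOver-Σℕ m (c ∘ suc) xs))

  sptω-A : ∀ n → sptω n ≡ Σℕ n (λ s → A (suc s) n n)
  sptω-A n = trans (cong-All (ovps-parts n n)) (sumOver-Σℕ n (λ s → contrib (suc s)) (ovps n n))
    where
    cong-All : ∀ {xs} → All (PartsIn n) xs → sumOver weight xs ≡ sumOver (λ π → Σℕ n (λ s → contrib (suc s) π)) xs
    cong-All []       = refl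
    cong-All (p ∷ ps) = cong₂ _+_ (weight-contrib n _ p) (cong-All ps)

-- The generating function meets the hypotheses.

module SptSeries where
  open PowerSeries
  open BaileyPair
  open GeneratingFunction
  open Overpartitions
  open import Data.Nat using (_+_; _*_; _<_)

  isOdd-double : ∀ j → isOdd (j + j) ≡ false
  isOdd-double j = cong (_≡ᵇ 1) (trans (cong (ℕ._% 2) (trans (cong (λ z → j + z) (sym (ℕ.+-identityʳ j))) (ℕ.*-comm 2 j))) (ℕ.m*n%n≡0 j 2))

  isOdd-suc-double : ∀ j → isOdd (suc (j + j)) ≡ true
  isOdd-suc-double j = cong (_≡ᵇ 1) (trans (cong (λ z → suc z ℕ.% 2) (trans (cong (λ z → j + z) (sym (ℕ.+-identityʳ j))) (ℕ.*-comm 2 j))) (ℕ.[m+kn]%n≡m%n 1 j 2))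

  mono-at : ∀ j n → mono j n ≡ (if j ≡ᵇ n then 1ℤ else 0ℤ)
  mono-at zero    zero    = refl
  mono-at zero    (suc n) = refl
  mono-at (suc j) zero    = refl
  mono-at (suc j) (suc n) = mono-at j n

  Σℕ-snoc : ∀ n f → Σℕ (suc n) f ≡ Σℕ n f + f n
  Σℕ-snoc zero    f = ℕ.+-comm (f 0) 0
  Σℕ-snoc (suc n) f = trans (cong (λ z → f 0 + z) (Σℕ-snoc n (f ∘ suc))) (sym (ℕ.+-assoc (f 0) _ _))

  spt : Series
  spt n = + sptω n

  module _ (B p : ℕ) where
    open Truncated B p
    open Units B p
    open Lambert B p

    Σ<-at : ∀ k f g n → (∀ i → f i n ≡ + g i) → Σ< k f n ≡ + Σℕ k g
    Σ<-at zero    f g n e = refl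
    Σ<-at (suc k) f g n e = trans (⊕-at (Σ< k f) (f k) n) (trans (cong₂ ℤ._+_ (Σ<-at k f g n e) (e k))
      (cong +_ (sym (Σℕ-snoc k g))))

    series : ℕ → ℕ → Series
    series s m n = + A s m n

    lambert-at : ∀ s n → lambert s n ≡ + Σℕ B (λ d → if suc d * s ≡ᵇ n then suc d else 0)
    lambert-at s n = Σ<-at B _ _ n λ d → trans (⊛-const (+ suc d) (mono (suc d * s)) n)
      (trans (cong (λ z → + suc d ℤ.* z) (mono-at (suc d * s) n)) (lem (suc d * s ≡ᵇ n) (suc d)))
      where
      lem : ∀ b x → + x ℤ.* (if b then 1ℤ else 0ℤ) ≡ + (if b then x else 0)
      lem true  x = ℤ.*-identityʳ (+ x)
      lem false x = ℤ.*-zeroʳ (+ x)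

    start : ∀ s → series (suc s) (suc s) ≈ lambert (suc s)
    start s = upTo λ n n≤B → ≡⇒≋ (trans (cong +_ (trans (A-self s n)
      (sym (Σℕ-extend n B _ n≤B λ i n≤i → if-false (≡ᵇ-false (ℕ.>⇒≢ (ℕ.≤-trans (s≤s n≤i) (ℕ.m≤m*n (suc i) (suc s))))))))) (sym (lambert-at (suc s) n)))

    part : ∀ s m → s ≤ m → (∃ λ j → suc m ≡ j + j) ⊎ (suc m < s + s) →
           One.q- (suc m) ⊛ series s (suc m) ≈ One.q+ (suc m) ⊛ series s m
    part s m s≤m ok = ≈-trans (solve 2 (λ q a → (con 1ℤ :- q) :* a := a :- q :* a) ≈-refl (mono (suc m)) (series s (suc m)))
      (≈-trans (≗⇒≈ λ n → trans (⊖-at (series s (suc m)) (mono (suc m) ⊛ series s (suc m)) n)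
                   (trans (cong (λ y → + A s (suc m) n ℤ.+ ℤ.- y) (mono-⊛ (suc m) (series s (suc m)) n))
                   (trans (coeff n) (trans (cong (λ z → + A s m n ℤ.+ z) (sym (mono-⊛ (suc m) (series s m) n))) (sym (⊕-at (series s m) (mono (suc m) ⊛ series s m) n))))))
        (solve 2 (λ q a → a :+ q :* a := (con 1ℤ :+ q) :* a) ≈-refl (mono (suc m)) (series s m)))
      where
      open Solver
      adm : (∃ λ j → suc m ≡ j + j) ⊎ (suc m < s + s) → admissible s (suc m) ≡ true
      adm (inj₁ (j , eq)) = cong (λ z → not z ∨ (suc m ℕ.<ᵇ 2 * s)) (trans (cong isOdd eq) (isOdd-double j))
      adm (inj₂ lt)       = trans (cong (not (isOdd (suc m)) ∨_) (<ᵇ-true {suc m} (subst (suc m <_) (cong (λ z → s + z) (sym (ℕ.+-identityʳ s))) lt))) (Bool.∨-zeroʳ _)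
      expand : ∀ n → A s (suc m) n ≡ A s m n + (multiples (A s m) (suc m) n + multiples (A s m) (suc m) n)
      expand n = A-admissible s m n (ℕ.>⇒≢ (s≤s s≤m)) (adm ok)
      coeff : ∀ n → + A s (suc m) n ℤ.+ ℤ.- shift (suc m) (series s (suc m)) n ≡ + A s m n ℤ.+ shift (suc m) (series s m) n
      coeff n with suc m ℕ.≤? n
      ... | no v≰n = cong₂ ℤ._+_ (cong +_ (trans (expand n) (trans (cong (λ z → A s m n + (z + z)) (multiples-< (A s m) m n (ℕ.≰⇒> v≰n))) (ℕ.+-identityʳ _))))
                       (trans (cong ℤ.-_ (shift-< (suc m) (series s (suc m)) (ℕ.≰⇒> v≰n))) (sym (shift-< (suc m) (series s m) (ℕ.≰⇒> v≰n))))
      ... | yes v≤n with ℕ.m≤n⇒∃[o]m+o≡n v≤n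
      ...   | (n′ , refl) = begin
        + A s (suc m) n ℤ.+ ℤ.- shift (suc m) (series s (suc m)) n
          ≡⟨ cong₂ (λ x y → + x ℤ.+ ℤ.- y) (expand n) (trans (shift-at (suc m) (series s (suc m)) n′) (cong +_ (expand n′))) ⟩
        + (A s m n + (multiples (A s m) (suc m) n + multiples (A s m) (suc m) n)) ℤ.+ ℤ.- + (a + (t + t))
          ≡⟨ cong (λ z → + (A s m n + (z + z)) ℤ.+ ℤ.- + (a + (t + t))) (multiples-step (A s m) m n′) ⟩
        + (A s m n) ℤ.+ (+ a ℤ.+ + t ℤ.+ (+ a ℤ.+ + t)) ℤ.+ ℤ.- (+ a ℤ.+ (+ t ℤ.+ + t))
          ≡⟨ lem (+ A s m n) (+ a) (+ t) ⟩
        + A s m n ℤ.+ + a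
          ≡⟨ cong (λ z → + A s m n ℤ.+ z) (shift-at (suc m) (series s m) n′) ⟨
        + A s m n ℤ.+ shift (suc m) (series s m) n ∎
        where
        open ≡-Reasoning
        a t : ℕ
        a = A s m n′
        t = multiples (A s m) (suc m) n′
        lem : ∀ x a t → x ℤ.+ (a ℤ.+ t ℤ.+ (a ℤ.+ t)) ℤ.+ ℤ.- (a ℤ.+ (t ℤ.+ t)) ≡ x ℤ.+ a
        lem = solve-∀

    skip : ∀ s j → s ≤ j → series s (suc (j + j)) ≈ series s (j + j)
    skip s j s≤j = ≗⇒≈ λ n → cong +_ (A-inadmissible s (j + j) n (ℕ.>⇒≢ (s≤s (ℕ.≤-trans s≤j (ℕ.m≤m+n j j))))
      (trans (cong (λ z → not z ∨ (suc (j + j) ℕ.<ᵇ 2 * s)) (isOdd-suc-double j))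
             (<ᵇ-false (ℕ.m≤n⇒m≤1+n (subst (_≤ j + j) (cong (λ z → s + z) (sym (ℕ.+-identityʳ s))) (ℕ.+-mono-≤ s≤j s≤j))))))

    -- The largest part B + B is where the telescoping of `A-high` stops for degree B; up to that
    -- degree neither larger parts nor smallest parts above n contribute.
    spt-series : Σ< B (λ s → series (suc s) (B + B)) ≈ spt
    spt-series = upTo λ n n≤B → ≡⇒≋ (trans (Σ<-at B _ (λ s → A (suc s) n n) n
        (λ s → cong +_ (trans (cong (λ z → A (suc s) z n) (sym (ℕ.m+[n∸m]≡n (ℕ.≤-trans n≤B (ℕ.m≤m+n B B))))) (A-large (suc s) _ n))))
      (cong +_ (trans (Σℕ-extend n B _ n≤B λ i n≤i → A-below (suc i) n n (s≤s n≤i)) (sym (sptω-A n)))))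

    spt-identity : φ₂ ⊛ spt ≈ Σ< B (λ s → lambert (suc s))
      ⊕ two ⊛ Σ< B (λ r → sg (suc r) ⊛ (mono (suc r * suc r + suc r * suc r) ⊛ lambert (suc r + suc r)))
    spt-identity = ≈-trans (*-congˡ (≈-sym spt-series)) (generating-function series start part skip)

-- Finite sums over sets and their transport along bijections.

module Regions where
  open import Data.Integer using (_+_; _*_; -_)
  open import Data.List.Membership.Propositional.Properties.WithK using (unique∧set⇒bag)
  open import Data.List.Relation.Binary.BagAndSetEquality using (∼bag⇒↭)
  open import Data.List.Relation.Binary.Permutation.Propositional as ↭ using (_↭_)
  open import Function.Bundles using (mk⇔)
  open import Relation.Unary using (Decidable)

  ΣL : ∀ {A : Set} → List A → (A → ℤ) → ℤ
  ΣL []       f = 0ℤ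
  ΣL (x ∷ xs) f = f x + ΣL xs f

  module _ {A : Set} where
    ΣL-↭ : ∀ {xs ys} (f : A → ℤ) → xs ↭ ys → ΣL xs f ≡ ΣL ys f
    ΣL-↭ f ↭.refl          = refl
    ΣL-↭ f (↭.prep x p)    = cong (λ z → f x + z) (ΣL-↭ f p)
    ΣL-↭ {x ∷ y ∷ xs} {_ ∷ _ ∷ ys} f (↭.swap x y p) = trans (cong (λ z → f x + (f y + z)) (ΣL-↭ f p)) (lem (f x) (f y) (ΣL ys f))
      where
      lem : ∀ a b c → a + (b + c) ≡ b + (a + c)
      lem = solve-∀
    ΣL-↭ f (↭.trans p q)   = trans (ΣL-↭ f p) (ΣL-↭ f q)

    ΣL-cong : ∀ {f g : A → ℤ} xs → (∀ x → x ∈ xs → f x ≡ g x) → ΣL xs f ≡ ΣL xs g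
    ΣL-cong []       e = refl
    ΣL-cong (x ∷ xs) e = cong₂ _+_ (e x (here refl)) (ΣL-cong xs λ y y∈ → e y (there y∈))

    ΣL-+ : ∀ (f g : A → ℤ) xs → ΣL xs (λ x → f x + g x) ≡ ΣL xs f + ΣL xs g
    ΣL-+ f g []       = refl
    ΣL-+ f g (x ∷ xs) = trans (cong (λ z → f x + g x + z) (ΣL-+ f g xs)) (lem (f x) (g x) (ΣL xs f) (ΣL xs g))
      where
      lem : ∀ a b c d → a + b + (c + d) ≡ a + c + (b + d)
      lem = solve-∀

    ΣL-* : ∀ t (f : A → ℤ) xs → ΣL xs (λ x → t * f x) ≡ t * ΣL xs f
    ΣL-* t f []       = sym (ℤ.*-zeroʳ t)
    ΣL-* t f (x ∷ xs) = trans (cong (λ z → t * f x + z) (ΣL-* t f xs)) (sym (ℤ.*-distribˡ-+ t (f x) (ΣL xs f)))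

    ΣL-filter : ∀ {Q : A → Set} (Q? : Decidable Q) (f : A → ℤ) xs →
                ΣL xs f ≡ ΣL (filter Q? xs) f + ΣL (filter (¬? ∘ Q?) xs) f
    ΣL-filter Q? f []       = refl
    ΣL-filter Q? f (x ∷ xs) with Q? x
    ... | yes _ = trans (cong (λ z → f x + z) (ΣL-filter Q? f xs)) (sym (ℤ.+-assoc (f x) _ _))
    ... | no _  = trans (cong (λ z → f x + z) (ΣL-filter Q? f xs)) (lem (f x) (ΣL (filter Q? xs) f) (ΣL (filter (¬? ∘ Q?) xs) f))
      where
      lem : ∀ a b c → a + (b + c) ≡ b + (a + c)
      lem = solve-∀

  ΣL-map : ∀ {A B : Set} (φ : A → B) (f : B → ℤ) xs → ΣL (map φ xs) f ≡ ΣL xs (f ∘ φ)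
  ΣL-map φ f []       = refl
  ΣL-map φ f (x ∷ xs) = cong (λ z → f (φ x) + z) (ΣL-map φ f xs)

  -- A duplicate-free list of exactly the elements of P. Two such lists are permutations of each
  -- other, so a sum depends on P alone and bijections need not respect any order.
  record Region {A : Set} (P : A → Set) : Set where
    field
      elements : List A
      unique   : Unique elements
      sound    : ∀ {a} → a ∈ elements → P a
      complete : ∀ {a} → P a → a ∈ elements
  open Region

  Σ[_] : ∀ {A : Set} {P : A → Set} → Region P → (A → ℤ) → ℤ
  Σ[ R ] f = ΣL (elements R) f

  -- The inverse laws are demanded on P and Q only, because maps such as `half` invert doubling only
  -- on even numbers.
  record Bij {A B : Set} (P : A → Set) (Q : B → Set) : Set where
    field
      to      : A → B
      from    : B → A
      to-in   : ∀ {a} → P a → Q (to a)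
      from-in : ∀ {b} → Q b → P (from b)
      from-to : ∀ {a} → P a → from (to a) ≡ a
      to-from : ∀ {b} → Q b → to (from b) ≡ b
  open Bij public

  module _ {A B : Set} {P : A → Set} {Q : B → Set} (b : Bij P Q) where
    private
      map-unique : ∀ {xs} → All P xs → Unique xs → Unique (map (to b) xs)
      map-unique []       []       = []
      map-unique (p ∷ ps) (u ∷ us) = distinct p ps u ∷ map-unique ps us
        where
        distinct : ∀ {x xs} → P x → All P xs → All (x ≢_) xs → All (to b x ≢_) (map (to b) xs)
        distinct p []       []       = []
        distinct p (q ∷ qs) (n ∷ ns) =
          (λ e → n (trans (sym (from-to b p)) (trans (cong (from b) e) (from-to b q)))) ∷ distinct p qs ns

    transport : Region P → Region Q
    transport R = record
      { elements = map (to b) (elements R)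
      ; unique   = map-unique (All.tabulate (sound R)) (unique R)
      ; sound    = λ b∈ → let (a , a∈ , eq) = ∈-map⁻ (to b) b∈ in subst Q (sym eq) (to-in b (sound R a∈))
      ; complete = λ q → subst (_∈ map (to b) (elements R)) (to-from b q) (∈-map⁺ (to b) (complete R (from-in b q)))
      }

    Σ-bij : ∀ (R : Region P) (R′ : Region Q) {f g} → (∀ a → P a → f a ≡ g (to b a)) → Σ[ R ] f ≡ Σ[ R′ ] g
    Σ-bij R R′ {f} {g} e = trans (ΣL-cong (elements R) λ a a∈ → e a (sound R a∈))
      (trans (sym (ΣL-map (to b) g (elements R)))
        (ΣL-↭ g (∼bag⇒↭ (unique∧set⇒bag (unique (transport R)) (unique R′)
          (mk⇔ (complete R′ ∘ sound (transport R)) (complete (transport R) ∘ sound R′))))))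

  module _ {A : Set} {P : A → Set} (R : Region P) where
    restrict : ∀ {Q : A → Set} → Decidable Q → Region (λ a → P a × Q a)
    restrict Q? = record
      { elements = filter Q? (elements R)
      ; unique   = filter⁺ Q? (unique R)
      ; sound    = λ a∈ → let (a∈R , q) = ∈-filter⁻ Q? a∈ in sound R a∈R , q
      ; complete = λ (p , q) → ∈-filter⁺ Q? (complete R p) q
      }

    Σ-split : ∀ {Q : A → Set} (Q? : Decidable Q) f → Σ[ R ] f ≡ Σ[ restrict Q? ] f + Σ[ restrict (¬? ∘ Q?) ] f
    Σ-split Q? f = ΣL-filter Q? f (elements R)

    Σ-cong : ∀ {f g} → (∀ a → P a → f a ≡ g a) → Σ[ R ] f ≡ Σ[ R ] g
    Σ-cong e = ΣL-cong (elements R) λ a a∈ → e a (sound R a∈)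

    Σ-+ : ∀ f g → Σ[ R ] (λ a → f a + g a) ≡ Σ[ R ] f + Σ[ R ] g
    Σ-+ f g = ΣL-+ f g (elements R)

    Σ-* : ∀ t f → Σ[ R ] (λ a → t * f a) ≡ t * Σ[ R ] f
    Σ-* t f = ΣL-* t f (elements R)

    Σ-zero : ∀ {f} → (∀ a → P a → f a ≡ 0ℤ) → Σ[ R ] f ≡ 0ℤ
    Σ-zero {f} e = trans (Σ-cong e) (zeros (elements R))
      where
      zeros : ∀ xs → ΣL {A} xs (λ _ → 0ℤ) ≡ 0ℤ
      zeros []       = refl
      zeros (x ∷ xs) = trans (ℤ.+-identityˡ _) (zeros xs)

    -- Reindexing shows that the sum equals its own negative, and ℤ has no 2-torsion.
    Σ-cancel : (b : Bij P P) → ∀ {f} → (∀ a → P a → f a ≡ - f (to b a)) → Σ[ R ] f ≡ 0ℤ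
    Σ-cancel b {f} e = self-neg (Σ[ R ] f) (trans (Σ-bij b R R e) (trans (Σ-cong (λ a _ → neg (f a))) (trans (Σ-* (ℤ.-[1+ 0 ]) f) (sym (neg (Σ[ R ] f))))))
      where
      neg : ∀ z → - z ≡ ℤ.-[1+ 0 ] * z
      neg = λ z → sym (ℤ.-1*i≡-i z)
      self-neg : ∀ z → z ≡ - z → z ≡ 0ℤ
      self-neg (+ 0) _ = refl

  same : ∀ {A : Set} {P Q : A → Set} → (∀ {a} → P a → Q a) → (∀ {a} → Q a → P a) → Bij P Q
  same f g = record { to = λ a → a ; from = λ a → a ; to-in = f ; from-in = g ; from-to = λ _ → refl ; to-from = λ _ → refl }

-- Parity, the sign (-1)ᵏ and splitting by sign.

module Parity where
  open Regions
  open import Data.Integer using (_+_; _*_; -_; _⊖_)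

  sgnℕ : ℕ → ℤ
  sgnℕ zero    = 1ℤ
  sgnℕ (suc n) = - sgnℕ n

  -- This is (-1)ⁱ. Evenness is expressed through it below, which turns parity arguments into
  -- multiplications of signs.
  σ : ℤ → ℤ
  σ i = sgnℕ ∣ i ∣

  sgnℕ-+ : ∀ m n → sgnℕ (m ℕ.+ n) ≡ sgnℕ m * sgnℕ n
  sgnℕ-+ zero    n = sym (ℤ.*-identityˡ _)
  sgnℕ-+ (suc m) n = trans (cong -_ (sgnℕ-+ m n)) (ℤ.neg-distribˡ-* (sgnℕ m) (sgnℕ n))

  σ-⊖ : ∀ m n → σ (m ⊖ n) ≡ sgnℕ m * sgnℕ n
  σ-⊖ m       zero    = sym (ℤ.*-identityʳ _)
  σ-⊖ zero    (suc n) = sym (ℤ.*-identityˡ _)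
  σ-⊖ (suc m) (suc n) = trans (cong σ (ℤ.[1+m]⊖[1+n]≡m⊖n m n)) (trans (σ-⊖ m n) (lem (sgnℕ m) (sgnℕ n)))
    where
    lem : ∀ a b → a * b ≡ - a * - b
    lem = solve-∀

  σ-+ : ∀ a b → σ (a + b) ≡ σ a * σ b
  σ-+ (+ m)    (+ n)    = sgnℕ-+ m n
  σ-+ (+ m)    -[1+ n ] = σ-⊖ m (suc n)
  σ-+ -[1+ m ] (+ n)    = trans (σ-⊖ n (suc m)) (ℤ.*-comm (sgnℕ n) _)
  σ-+ -[1+ m ] -[1+ n ] = trans (cong (sgnℕ ∘ suc) (sym (ℕ.+-suc m n))) (sgnℕ-+ (suc m) (suc n))

  σ-neg : ∀ a → σ (- a) ≡ σ a
  σ-neg a = cong sgnℕ (ℤ.∣-i∣≡∣i∣ a)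

  σ-± : ∀ a → σ a ≡ 1ℤ ⊎ σ a ≡ -1ℤ
  σ-± a = go ∣ a ∣
    where
    go : ∀ n → sgnℕ n ≡ 1ℤ ⊎ sgnℕ n ≡ -1ℤ
    go zero    = inj₁ refl
    go (suc n) with go n
    ... | inj₁ e = inj₂ (cong -_ e)
    ... | inj₂ e = inj₁ (cong -_ e)

  σ-square : ∀ a → σ a * σ a ≡ 1ℤ
  σ-square a with σ-± a
  ... | inj₁ e = cong₂ _*_ e e
  ... | inj₂ e = cong₂ _*_ e e

  σ-double : ∀ a → σ (a + a) ≡ 1ℤ
  σ-double a = trans (σ-+ a a) (σ-square a)

  parity : ∀ a → (∃ λ m → a ≡ m + m) ⊎ (∃ λ m → a ≡ 1ℤ + (m + m))
  parity (+ n) = go n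
    where
    go : ∀ n → (∃ λ m → + n ≡ m + m) ⊎ (∃ λ m → + n ≡ 1ℤ + (m + m))
    go zero    = inj₁ (0ℤ , refl)
    go (suc n) with go n
    ... | inj₁ (m , e) = inj₂ (m , cong (λ z → 1ℤ + z) e)
    ... | inj₂ (m , e) = inj₁ (1ℤ + m , trans (cong (λ z → 1ℤ + z) e) (lem m))
      where
      lem : ∀ m → 1ℤ + (1ℤ + (m + m)) ≡ 1ℤ + m + (1ℤ + m)
      lem = solve-∀
  parity -[1+ n ] with parity (+ suc n)
  ... | inj₁ (m , e) = inj₁ (- m , trans (cong -_ e) (ℤ.neg-distrib-+ m m))
  ... | inj₂ (m , e) = inj₂ (- m + -1ℤ , trans (cong -_ e) (lem m))
    where
    lem : ∀ m → - (1ℤ + (m + m)) ≡ 1ℤ + (- m + -1ℤ + (- m + -1ℤ))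
    lem = solve-∀

  double-injective : ∀ {a b} → a + a ≡ b + b → a ≡ b
  double-injective {a} {b} e = ℤ.*-cancelˡ-≡ (+ 2) a b (trans (lem a) (trans e (sym (lem b))))
    where
    lem : ∀ a → + 2 * a ≡ a + a
    lem = solve-∀

  Even : ℤ → Set
  Even a = σ a ≡ 1ℤ

  even? : ∀ a → Dec (Even a)
  even? a = σ a ℤ.≟ 1ℤ

  odd : ∀ a → ¬ Even a → σ a ≡ -1ℤ
  odd a ¬e with σ-± a
  ... | inj₁ e = ⊥-elim (¬e e)
  ... | inj₂ e = e

  -- Rounded down at odd arguments; it is used only where the argument is known to be even.
  half : ℤ → ℤ
  half a with parity a
  ... | inj₁ (m , _) = m
  ... | inj₂ (m , _) = m

  half+half : ∀ a → Even a → half a + half a ≡ a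
  half+half a e with parity a
  ... | inj₁ (m , eq) = sym eq
  ... | inj₂ (m , eq) with trans (sym e) (trans (cong σ eq) (trans (σ-+ 1ℤ (m + m)) (cong (λ z → -1ℤ * z) (σ-double m))))
  ...   | ()

  half-double : ∀ m → half (m + m) ≡ m
  half-double m = double-injective (half+half (m + m) (σ-double m))

  σ-even-* : ∀ a b → Even a → Even (a * b)
  σ-even-* a b e = trans (cong σ (trans (cong (_* b) (sym (half+half a e))) (lem (half a) b))) (σ-double (half a * b))
    where
    lem : ∀ m b → (m + m) * b ≡ m * b + m * b
    lem = solve-∀

  σ-sq : ∀ a → σ (a * a) ≡ σ a
  σ-sq a with parity a
  ... | inj₁ (m , refl) = trans (σ-even-* (m + m) (m + m) (σ-double m)) (sym (σ-double m))
  ... | inj₂ (m , refl) = trans (cong σ (lem m)) (trans (σ-+ 1ℤ (q + q)) (trans (cong (λ z → -1ℤ * z) (trans (σ-double q) (sym (σ-double m)))) (sym (σ-+ 1ℤ (m + m)))))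
    where
    q : ℤ
    q = m + m + (m * m + m * m)
    lem : ∀ m → (1ℤ + (m + m)) * (1ℤ + (m + m)) ≡ 1ℤ + (m + m + (m * m + m * m) + (m + m + (m * m + m * m)))
    lem = solve-∀

  Pos : ℤ → Set
  Pos a = 0ℤ ℤ.< a

  pos? : ∀ a → Dec (Pos a)
  pos? a = 0ℤ ℤ.<? a

  pos-+ : ∀ {a b} → Pos a → Pos b → Pos (a + b)
  pos-+ = ℤ.+-mono-<

  pos-half : ∀ {a} → Pos (a + a) → Pos a
  pos-half {+ zero}  (ℤ.+<+ ())
  pos-half {+ suc n} _ = ℤ.+<+ (ℕ.s≤s ℕ.z≤n)

  ¬pos-0 : ¬ Pos 0ℤ
  ¬pos-0 = ℤ.<-irrefl refl

  ¬pos-neg : ∀ {a} → Pos a → ¬ Pos (- a)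
  ¬pos-neg {a} p q = ¬pos-0 (subst Pos (ℤ.+-inverseʳ a) (pos-+ p q))

  pos-neg : ∀ {a} → ¬ Pos a → ¬ a ≡ 0ℤ → Pos (- a)
  pos-neg {+ zero}  _  ¬z = ⊥-elim (¬z refl)
  pos-neg {+ suc n} ¬p _  = ⊥-elim (¬p (ℤ.+<+ (ℕ.s≤s ℕ.z≤n)))
  pos-neg { -[1+ n ]} _ _ = ℤ.+<+ (ℕ.s≤s ℕ.z≤n)

  module _ {A : Set} {P : A → Set} (R : Region P) (t : A → ℤ) where
    positive : Region (λ a → P a × Pos (t a))
    positive = restrict R (λ a → pos? (t a))

    vanishing : Region (λ a → P a × t a ≡ 0ℤ)
    vanishing = restrict R (λ a → t a ℤ.≟ 0ℤ)

    negative : Region (λ a → P a × Pos (- t a))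
    negative = restrict R (λ a → pos? (- t a))

    Σ-trichotomy : ∀ f → Σ[ R ] f ≡ Σ[ positive ] f + (Σ[ vanishing ] f + Σ[ negative ] f)
    Σ-trichotomy f = trans (Σ-split R P? f) (cong (λ z → Σ[ positive ] f + z)
      (trans (Σ-split rest Z? f) (cong₂ _+_
        (Σ-bij (same (λ ((p , _) , z) → p , z) (λ (p , z) → (p , λ q → ¬pos-0 (subst Pos z q)) , z))
           (restrict rest Z?) vanishing (λ _ _ → refl))
        (Σ-bij (same (λ ((p , n) , z) → p , pos-neg n z)
                     (λ (p , n) → (p , λ q → ¬pos-neg q n) , λ z → ¬pos-0 (subst (Pos ∘ -_) z n)))
           (restrict rest (¬? ∘ Z?)) negative (λ _ _ → refl)))))
      where
      P? : ∀ a → Dec (Pos (t a))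
      P? a = pos? (t a)
      Z? : ∀ a → Dec (t a ≡ 0ℤ)
      Z? a = t a ℤ.≟ 0ℤ
      rest : Region (λ a → P a × ¬ Pos (t a))
      rest = restrict R (¬? ∘ P?)

-- Liouville's substitutions on the quadric x² + y² - h² = M.

module LiouvilleSums where
  open Regions
  open Parity
  open import Data.Integer using (_+_; _*_; -_)

  ℤ³ : Set
  ℤ³ = ℤ × ℤ × ℤ

  triple : ∀ {a b c a′ b′ c′ : ℤ} → a ≡ a′ → b ≡ b′ → c ≡ c′ → (a , b , c) ≡ (a′ , b′ , c′)
  triple refl refl refl = refl

  -- The indefinite forms n x² + 2 k x y − d y² of determinant −M with n and d positive.
  InS : ℤ → ℤ³ → Set
  InS M (n , k , d) = Pos n × Pos d × k * k + n * d ≡ M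

  -- The same triples with n ≡ d (mod 2), in the coordinates n = x − h, d = x + h, k = y.
  InE : ℤ → ℤ³ → Set
  InE M (x , y , h) = Pos (x + - h) × Pos (x + h) × x * x + y * y + - (h * h) ≡ M

  -- The quadric of `InE`, with the half-space h > -x replaced by h > y. The two substitution lemmas
  -- below compare sums over these two pieces of the quadric.
  InA : ℤ → ℤ³ → Set
  InA M (x , y , h) = Pos (x + - h) × Pos (h + - y) × x * x + y * y + - (h * h) ≡ M

  -- InA is this set in the coordinates u = x − h, c = h − y, w = x − h + y.
  InS₂ : ℤ → ℤ³ → Set
  InS₂ M (u , w , c) = Pos u × Pos c × w * w + (u + u) * c ≡ M

  uncurry₃ : (ℤ → ℤ → ℤ → ℤ) → ℤ³ → ℤ
  uncurry₃ g (x , y , h) = g x y h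

  swap-S : ∀ {M} → Bij (InS M) (InS M)
  swap-S {M} = record
    { to = λ (n , k , d) → d , k , n
    ; from = λ (n , k , d) → d , k , n
    ; to-in = λ { {n , k , d} → sw n k d } ; from-in = λ { {n , k , d} → sw n k d } ; from-to = λ _ → refl ; to-from = λ _ → refl }
    where
    sw : ∀ n k d → InS M (n , k , d) → InS M (d , k , n)
    sw n k d (p , q , e) = q , p , trans (cong (λ z → k * k + z) (ℤ.*-comm d n)) e

  flip-S : ∀ {M} → Bij (InS M) (InS M)
  flip-S {M} = record
    { to = λ (n , k , d) → n , - k , d
    ; from = λ (n , k , d) → n , - k , d
    ; to-in = λ { {n , k , d} → neg n k d } ; from-in = λ { {n , k , d} → neg n k d }
    ; from-to = λ { {n , k , d} _ → triple refl (ℤ.neg-involutive k) refl }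
    ; to-from = λ { {n , k , d} _ → triple refl (ℤ.neg-involutive k) refl } }
    where
    neg : ∀ n k d → InS M (n , k , d) → InS M (n , - k , d)
    neg n k d (p , q , e) = p , q , trans (lem n k d) e
      where
      lem : ∀ n k d → - k * - k + n * d ≡ k * k + n * d
      lem = solve-∀

  swap-S₂ : ∀ {M} → Bij (InS₂ M) (InS₂ M)
  swap-S₂ {M} = record
    { to = λ (n , k , d) → d , k , n
    ; from = λ (n , k , d) → d , k , n
    ; to-in = λ { {u , w , c} → sw u w c } ; from-in = λ { {u , w , c} → sw u w c } ; from-to = λ _ → refl ; to-from = λ _ → refl }
    where
    sw : ∀ u w c → InS₂ M (u , w , c) → InS₂ M (c , w , u)
    sw u w c (p , q , e) = q , p , trans (lem u w c) e
      where
      lem : ∀ u w c → w * w + (c + c) * u ≡ w * w + (u + u) * c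
      lem = solve-∀

  flip-S₂ : ∀ {M} → Bij (InS₂ M) (InS₂ M)
  flip-S₂ {M} = record
    { to = λ (n , k , d) → n , - k , d
    ; from = λ (n , k , d) → n , - k , d
    ; to-in = λ { {u , w , c} → neg u w c } ; from-in = λ { {u , w , c} → neg u w c }
    ; from-to = λ { {n , k , d} _ → triple refl (ℤ.neg-involutive k) refl }
    ; to-from = λ { {n , k , d} _ → triple refl (ℤ.neg-involutive k) refl } }
    where
    neg : ∀ u w c → InS₂ M (u , w , c) → InS₂ M (u , - w , c)
    neg u w c (p , q , e) = p , q , trans (lem u w c) e
      where
      lem : ∀ u w c → - w * - w + (u + u) * c ≡ w * w + (u + u) * c
      lem = solve-∀

  S↔E : ∀ {M} → Bij (λ (a : ℤ³) → InS M a × Even (proj₁ a + proj₂ (proj₂ a))) (InE M)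
  S↔E {M} = record
    { to = λ (n , k , d) → half (n + d) , k , half (d + - n)
    ; from = λ (x , y , h) → x + - h , y , x + h
    ; to-in = λ { {n , k , d} → to-in′ n k d }
    ; from-in = λ { {x , y , h} (p , q , e) → (p , q , trans (quad x y h) e) , trans (cong σ (sum x h)) (σ-double x) }
    ; from-to = λ { {n , k , d} (_ , ev) → triple (n≡ n d ev) refl (d≡ n d ev) }
    ; to-from = λ { {x , y , h} _ → triple (trans (cong half (sum x h)) (half-double x)) refl (trans (cong half (diff x h)) (half-double h)) }
    }
    where
    quad : ∀ x y h → y * y + (x + - h) * (x + h) ≡ x * x + y * y + - (h * h)
    quad = solve-∀
    sum : ∀ x h → x + - h + (x + h) ≡ x + x
    sum = solve-∀
    diff : ∀ x h → x + h + - (x + - h) ≡ h + h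
    diff = solve-∀
    even-diff : ∀ n d → Even (n + d) → Even (d + - n)
    even-diff n d ev = trans (σ-+ d (- n)) (trans (cong (λ z → σ d * z) (σ-neg n)) (trans (sym (σ-+ d n)) (trans (cong σ (ℤ.+-comm d n)) ev)))
    n≡ : ∀ n d → Even (n + d) → half (n + d) + - half (d + - n) ≡ n
    n≡ n d ev = double-injective (trans (lem (half (n + d)) (half (d + - n)))
      (trans (cong₂ (λ a b → a + - b) (half+half (n + d) ev) (half+half (d + - n) (even-diff n d ev))) (lem₂ n d)))
      where
      lem : ∀ a b → a + - b + (a + - b) ≡ a + a + - (b + b)
      lem = solve-∀
      lem₂ : ∀ n d → n + d + - (d + - n) ≡ n + n
      lem₂ = solve-∀
    d≡ : ∀ n d → Even (n + d) → half (n + d) + half (d + - n) ≡ d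
    d≡ n d ev = double-injective (trans (lem (half (n + d)) (half (d + - n)))
      (trans (cong₂ _+_ (half+half (n + d) ev) (half+half (d + - n) (even-diff n d ev))) (lem₂ n d)))
      where
      lem : ∀ a b → a + b + (a + b) ≡ a + a + (b + b)
      lem = solve-∀
      lem₂ : ∀ n d → n + d + (d + - n) ≡ d + d
      lem₂ = solve-∀
    to-in′ : ∀ n k d → InS M (n , k , d) × Even (n + d) → InE M (half (n + d) , k , half (d + - n))
    to-in′ n k d ((p , q , e) , ev) = subst Pos (sym (n≡ n d ev)) p , subst Pos (sym (d≡ n d ev)) q ,
      trans (sym (quad (half (n + d)) k (half (d + - n)))) (trans (cong₂ (λ a b → k * k + a * b) (n≡ n d ev) (d≡ n d ev)) e)

  S↔S₂ : ∀ {M} → Bij (λ (a : ℤ³) → InS M a × Even (proj₁ a)) (InS₂ M)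
  S↔S₂ {M} = record
    { to = λ (n , k , d) → half n , k , d
    ; from = λ (u , w , c) → u + u , w , c
    ; to-in = λ { {n , k , d} ((p , q , e) , ev) →
        pos-half (subst Pos (sym (half+half n ev)) p) , q , trans (cong (λ z → k * k + z * d) (half+half n ev)) e }
    ; from-in = λ { {u , w , c} (p , q , e) → (pos-+ p p , q , e) , σ-double u }
    ; from-to = λ { {n , k , d} (_ , ev) → triple (half+half n ev) refl refl }
    ; to-from = λ { {u , w , c} _ → triple (half-double u) refl refl }
    }

  S₂↔A : ∀ {M} → Bij (InS₂ M) (InA M)
  S₂↔A {M} = record
    { to = λ (u , w , c) → c + w , w + - u , c + w + - u
    ; from = λ (x , y , h) → x + - h , x + - h + y , h + - y
    ; to-in = λ { {u , w , c} (p , q , e) → subst Pos (sym (e₁ u w c)) p , subst Pos (sym (e₂ u w c)) q , trans (e₃ u w c) e }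
    ; from-in = λ { {x , y , h} (p , q , e) → p , q , trans (e₄ x y h) e }
    ; from-to = λ { {u , w , c} _ → triple (e₁ u w c) (e₅ u w c) (e₂ u w c) }
    ; to-from = λ { {x , y , h} _ → triple (e₆ x y h) (e₇ x y h) (e₈ x y h) }
    }
    where
    e₁ : ∀ u w c → c + w + - (c + w + - u) ≡ u
    e₁ = solve-∀
    e₂ : ∀ u w c → c + w + - u + - (w + - u) ≡ c
    e₂ = solve-∀
    e₃ : ∀ u w c → (c + w) * (c + w) + (w + - u) * (w + - u) + - ((c + w + - u) * (c + w + - u)) ≡ w * w + (u + u) * c
    e₃ = solve-∀
    e₄ : ∀ x y h → (x + - h + y) * (x + - h + y) + (x + - h + (x + - h)) * (h + - y) ≡ x * x + y * y + - (h * h)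
    e₄ = solve-∀
    e₅ : ∀ u w c → c + w + - (c + w + - u) + (w + - u) ≡ w
    e₅ = solve-∀
    e₆ : ∀ x y h → h + - y + (x + - h + y) ≡ x
    e₆ = solve-∀
    e₇ : ∀ x y h → x + - h + y + - (x + - h) ≡ y
    e₇ = solve-∀
    e₈ : ∀ x y h → h + - y + (x + - h + y) + - (x + - h) ≡ h
    e₈ = solve-∀

  module _ {M : ℤ} (E : Region (InE M)) (A : Region (InA M)) where

    E⁺ : Region (λ a → InE M a × Pos (proj₂ (proj₂ a)))
    E⁺ = positive E (λ (x , y , h) → h)

    -- For h > 0 the triples of E with h > y are those of A, and those with h < y cancel under
    -- (x , y , h) ↦ (y , x , h); the two halves h > 0 and h < 0 of A are exchanged by (− y , − x , − h).
    antisymmetric-sum : ∀ g → (∀ x y h → g y x h ≡ - g x y h) → (∀ x y h → g (- y) (- x) (- h) ≡ g x y h) →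
      (∀ x y → g x y 0ℤ ≡ 0ℤ) →
      + 2 * Σ[ E⁺ ] (uncurry₃ g) ≡ Σ[ A ] (uncurry₃ g) + + 2 * Σ[ vanishing E⁺ (λ (x , y , h) → h + - y) ] (uncurry₃ g)
    antisymmetric-sum g anti sym₃ zero₃ = begin
      + 2 * Σ[ E⁺ ] G
        ≡⟨ cong (+ 2 *_) (Σ-trichotomy E⁺ t G) ⟩
      + 2 * (Σ[ positive E⁺ t ] G + (Σ[ vanishing E⁺ t ] G + Σ[ negative E⁺ t ] G))
        ≡⟨ cong₂ (λ a b → + 2 * (a + (Σ[ vanishing E⁺ t ] G + b))) left right ⟩
      + 2 * (Σ[ positive A h₃ ] G + (Σ[ vanishing E⁺ t ] G + 0ℤ))
        ≡⟨ lem (Σ[ positive A h₃ ] G) (Σ[ vanishing E⁺ t ] G) ⟩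
      Σ[ positive A h₃ ] G + (0ℤ + Σ[ positive A h₃ ] G) + + 2 * Σ[ vanishing E⁺ t ] G
        ≡⟨ cong₂ (λ a b → Σ[ positive A h₃ ] G + (a + b) + + 2 * Σ[ vanishing E⁺ t ] G) (sym middle) mirror ⟩
      Σ[ positive A h₃ ] G + (Σ[ vanishing A h₃ ] G + Σ[ negative A h₃ ] G) + + 2 * Σ[ vanishing E⁺ t ] G
        ≡⟨ cong (_+ + 2 * Σ[ vanishing E⁺ t ] G) (sym (Σ-trichotomy A h₃ G)) ⟩
      Σ[ A ] G + + 2 * Σ[ vanishing E⁺ t ] G ∎
      where
      open ≡-Reasoning
      G : ℤ³ → ℤ
      G = uncurry₃ g
      t h₃ : ℤ³ → ℤ
      t (x , y , h) = h + - y
      h₃ (x , y , h) = h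
      lem : ∀ a b → + 2 * (a + (b + 0ℤ)) ≡ a + (0ℤ + a) + + 2 * b
      lem = solve-∀
      left : Σ[ positive E⁺ t ] G ≡ Σ[ positive A h₃ ] G
      left = Σ-bij (same (λ { {x , y , h} (((p , q , e) , r) , s) → (p , s , e) , r })
                         (λ { {x , y , h} ((p , s , e) , r) → ((p , subst Pos (e₁ x h) (pos-+ p (pos-+ r r)) , e) , r) , s }))
               (positive E⁺ t) (positive A h₃) (λ _ _ → refl)
        where
        e₁ : ∀ x h → x + - h + (h + h) ≡ x + h
        e₁ = solve-∀
      right : Σ[ negative E⁺ t ] G ≡ 0ℤ
      right = Σ-cancel (negative E⁺ t) (record
        { to = λ (x , y , h) → y , x , h ; from = λ (x , y , h) → y , x , h
        ; to-in = λ { {x , y , h} → sw x y h } ; from-in = λ { {x , y , h} → sw x y h }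
        ; from-to = λ _ → refl ; to-from = λ _ → refl })
        (λ (x , y , h) _ → trans (sym (ℤ.neg-involutive (g x y h))) (cong -_ (sym (anti x y h))))
        where
        e₁ : ∀ y h → - (h + - y) ≡ y + - h
        e₁ = solve-∀
        e₂ : ∀ y h → - (h + - y) + (h + h) ≡ y + h
        e₂ = solve-∀
        e₃ : ∀ x h → x + - h ≡ - (h + - x)
        e₃ = solve-∀
        e₄ : ∀ x y h → y * y + x * x + - (h * h) ≡ x * x + y * y + - (h * h)
        e₄ = solve-∀
        sw : ∀ x y h → (InE M (x , y , h) × Pos h) × Pos (- (h + - y)) → (InE M (y , x , h) × Pos h) × Pos (- (h + - x))
        sw x y h (((p , q , e) , r) , s) = ((subst Pos (e₁ y h) s , subst Pos (e₂ y h) (pos-+ s (pos-+ r r)) , trans (e₄ x y h) e) , r) , subst Pos (e₃ x h) p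
      middle : Σ[ vanishing A h₃ ] G ≡ 0ℤ
      middle = Σ-zero (vanishing A h₃) λ { (x , y , h) (_ , refl) → zero₃ x y }
      mirror : Σ[ positive A h₃ ] G ≡ Σ[ negative A h₃ ] G
      mirror = Σ-bij (record
        { to = λ (x , y , h) → - y , - x , - h ; from = λ (x , y , h) → - y , - x , - h
        ; to-in = λ { {x , y , h} (a , r) → rot x y h a , subst Pos (sym (ℤ.neg-involutive h)) r }
        ; from-in = λ { {x , y , h} (a , r) → rot x y h a , r }
        ; from-to = λ { {x , y , h} _ → triple (ℤ.neg-involutive x) (ℤ.neg-involutive y) (ℤ.neg-involutive h) }
        ; to-from = λ { {x , y , h} _ → triple (ℤ.neg-involutive x) (ℤ.neg-involutive y) (ℤ.neg-involutive h) } })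
        (positive A h₃) (negative A h₃) (λ (x , y , h) _ → sym (sym₃ x y h))
        where
        e₁ : ∀ y h → h + - y ≡ - y + - - h
        e₁ = solve-∀
        e₂ : ∀ x h → x + - h ≡ - h + - - x
        e₂ = solve-∀
        e₃ : ∀ x y h → - y * - y + - x * - x + - (- h * - h) ≡ x * x + y * y + - (h * h)
        e₃ = solve-∀
        rot : ∀ x y h → InA M (x , y , h) → InA M (- y , - x , - h)
        rot x y h (p , q , e) = subst Pos (e₁ y h) q , subst Pos (e₂ x h) p , trans (e₃ x y h) e

    -- Compares E and A through the sign of x + h, using x ↦ − x and (y , h) ↦ (− y , − h).
    odd-sum : ∀ g → (∀ x y h → g (- x) y h ≡ - g x y h) → (∀ x y h → g x (- y) (- h) ≡ g x y h) →
      + 2 * Σ[ A ] (uncurry₃ g) + Σ[ vanishing E (λ (x , y , h) → h + - y) ] (uncurry₃ g)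
      ≡ Σ[ E ] (uncurry₃ g) + + 2 * Σ[ vanishing A (λ (x , y , h) → x + h) ] (uncurry₃ g)
    odd-sum g odd-x even-yh = begin
      + 2 * Σ[ A ] G + Σ[ vanishing E t ] G
        ≡⟨ cong (λ z → + 2 * z + Σ[ vanishing E t ] G) (Σ-trichotomy A s G) ⟩
      + 2 * (Σ[ positive A s ] G + (Σ[ vanishing A s ] G + Σ[ negative A s ] G)) + Σ[ vanishing E t ] G
        ≡⟨ cong (λ z → + 2 * (Σ[ positive A s ] G + (Σ[ vanishing A s ] G + z)) + Σ[ vanishing E t ] G) cancelled ⟩
      + 2 * (Σ[ positive A s ] G + (Σ[ vanishing A s ] G + 0ℤ)) + Σ[ vanishing E t ] G
        ≡⟨ lem (Σ[ positive A s ] G) (Σ[ vanishing A s ] G) (Σ[ vanishing E t ] G) ⟩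
      Σ[ positive A s ] G + (Σ[ vanishing E t ] G + Σ[ positive A s ] G) + + 2 * Σ[ vanishing A s ] G
        ≡⟨ cong₂ (λ a b → a + (Σ[ vanishing E t ] G + b) + + 2 * Σ[ vanishing A s ] G) left (trans left mirror) ⟩
      Σ[ positive E t ] G + (Σ[ vanishing E t ] G + Σ[ negative E t ] G) + + 2 * Σ[ vanishing A s ] G
        ≡⟨ cong (_+ + 2 * Σ[ vanishing A s ] G) (sym (Σ-trichotomy E t G)) ⟩
      Σ[ E ] G + + 2 * Σ[ vanishing A s ] G ∎
      where
      open ≡-Reasoning
      G : ℤ³ → ℤ
      G = uncurry₃ g
      t s : ℤ³ → ℤ
      t (x , y , h) = h + - y
      s (x , y , h) = x + h
      lem : ∀ a b c → + 2 * (a + (b + 0ℤ)) + c ≡ a + (c + a) + + 2 * b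
      lem = solve-∀
      left : Σ[ positive A s ] G ≡ Σ[ positive E t ] G
      left = Σ-bij (same (λ { {x , y , h} ((p , q , e) , r) → (p , r , e) , q }) (λ { {x , y , h} ((p , r , e) , q) → (p , q , e) , r }))
               (positive A s) (positive E t) (λ _ _ → refl)
      cancelled : Σ[ negative A s ] G ≡ 0ℤ
      cancelled = Σ-cancel (negative A s) (record
        { to = λ (x , y , h) → - x , y , h ; from = λ (x , y , h) → - x , y , h
        ; to-in = λ { {x , y , h} → refl-x x y h } ; from-in = λ { {x , y , h} → refl-x x y h }
        ; from-to = λ { {x , y , h} _ → triple (ℤ.neg-involutive x) refl refl }
        ; to-from = λ { {x , y , h} _ → triple (ℤ.neg-involutive x) refl refl } })
        (λ (x , y , h) _ → trans (sym (ℤ.neg-involutive (g x y h))) (cong -_ (sym (odd-x x y h))))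
        where
        e₁ : ∀ x h → - (x + h) ≡ - x + - h
        e₁ = solve-∀
        e₂ : ∀ x h → x + - h ≡ - (- x + h)
        e₂ = solve-∀
        e₃ : ∀ x y h → - x * - x + y * y + - (h * h) ≡ x * x + y * y + - (h * h)
        e₃ = solve-∀
        refl-x : ∀ x y h → InA M (x , y , h) × Pos (- (x + h)) → InA M (- x , y , h) × Pos (- (- x + h))
        refl-x x y h ((p , q , e) , r) = (subst Pos (e₁ x h) r , q , trans (e₃ x y h) e) , subst Pos (e₂ x h) p
      mirror : Σ[ positive E t ] G ≡ Σ[ negative E t ] G
      mirror = Σ-bij (record
        { to = λ (x , y , h) → x , - y , - h ; from = λ (x , y , h) → x , - y , - h
        ; to-in = λ { {x , y , h} (a , r) → rot x y h a , subst Pos (e₁ y h) r }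
        ; from-in = λ { {x , y , h} (a , r) → rot x y h a , subst Pos (e₂ y h) r }
        ; from-to = λ { {x , y , h} _ → triple refl (ℤ.neg-involutive y) (ℤ.neg-involutive h) }
        ; to-from = λ { {x , y , h} _ → triple refl (ℤ.neg-involutive y) (ℤ.neg-involutive h) } })
        (positive E t) (negative E t) (λ (x , y , h) _ → sym (even-yh x y h))
        where
        e₁ : ∀ y h → h + - y ≡ - (- h + - - y)
        e₁ = solve-∀
        e₂ : ∀ y h → - (h + - y) ≡ - h + - - y
        e₂ = solve-∀
        e₃ : ∀ x y h → x * x + - y * - y + - (- h * - h) ≡ x * x + y * y + - (h * h)
        e₃ = solve-∀
        e₄ : ∀ x h → x + h ≡ x + - - h
        e₄ = solve-∀
        rot : ∀ x y h → InE M (x , y , h) → InE M (x , - y , - h)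
        rot x y h (p , q , e) = subst Pos (e₄ x h) q , p , trans (e₃ x y h) e

-- Boundary terms of the substitutions.

module BoundaryTerms where
  open Regions
  open Parity
  open LiouvilleSums
  open import Data.Integer using (_+_; _*_; -_)
  open import Data.Integer.Divisibility.Signed using (_∣_; divides; ∣m∣n⇒∣m+n)

  Σ-∣ : ∀ {A : Set} {P : A → Set} (R : Region P) {m f} → (∀ a → P a → m ∣ f a) → m ∣ Σ[ R ] f
  Σ-∣ R {m} {f} e = go (Region.elements R) λ a a∈ → e a (Region.sound R a∈)
    where
    go : ∀ xs → (∀ a → a ∈ xs → m ∣ f a) → m ∣ ΣL xs f
    go []       _ = divides 0ℤ refl
    go (x ∷ xs) e = ∣m∣n⇒∣m+n (e x (here refl)) (go xs λ a a∈ → e a (there a∈))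

  Σ-neg : ∀ {A : Set} {P : A → Set} (R : Region P) f → Σ[ R ] (λ a → - f a) ≡ - Σ[ R ] f
  Σ-neg R f = trans (Σ-cong R (λ a _ → sym (ℤ.-1*i≡-i (f a)))) (trans (Σ-* R -1ℤ f) (ℤ.-1*i≡-i _))

  pos-pred : ∀ {a} → Pos a → a ≢ 1ℤ → Pos (a + -1ℤ)
  pos-pred {+ zero}        (ℤ.+<+ ()) _
  pos-pred {+ suc zero}    _          ≢1 = ⊥-elim (≢1 refl)
  pos-pred {+ suc (suc n)} _          _  = ℤ.+<+ (ℕ.s≤s ℕ.z≤n)

  pos-suc : ∀ {a} → Pos a → Pos (a + 1ℤ)
  pos-suc p = pos-+ p (ℤ.+<+ (ℕ.s≤s ℕ.z≤n))

  module Boundary {M : ℤ} (E : Region (InE M)) (A : Region (InA M)) where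

    t s h₃ : ℤ³ → ℤ
    t (x , y , h) = h + - y
    s (x , y , h) = x + h
    h₃ (x , y , h) = h

    private
      -- On both boundaries, h = y and x + h = 0, two squares cancel and the quadric degenerates to
      -- X² = M, leaving a parameter H with 0 < H < X. Points of the first boundary with h = 0 are
      -- kept apart in `InD₀`.
      InD : ℤ × ℤ → Set
      InD (X , H) = Pos H × Pos (X + - H) × X * X ≡ M

      InD₀ : ℤ → Set
      InD₀ X = Pos X × X * X ≡ M

      h≡y : ∀ h y → h + - y ≡ 0ℤ → y ≡ h
      h≡y h y e = trans (lem h y) (trans (cong (λ z → - z + h) e) (ℤ.+-identityˡ h))
        where
        lem : ∀ h y → y ≡ - (h + - y) + h
        lem = solve-∀

      square : ∀ x h → x * x + h * h + - (h * h) ≡ x * x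
      square = solve-∀

      on-diagonal : ∀ x y h → h + - y ≡ 0ℤ → x * x + y * y + - (h * h) ≡ M → x * x ≡ M
      on-diagonal x y h z e with h≡y h y z
      ... | refl = trans (sym (square x h)) e

      B⁺ : Bij (λ a → (InE M a × Pos (h₃ a)) × t a ≡ 0ℤ) InD
      B⁺ = record
        { to = λ (x , y , h) → x , h ; from = λ (X , H) → X , H , H
        ; to-in = λ { {x , y , h} (((p , q , e) , r) , z) → r , p , on-diagonal x y h z e }
        ; from-in = λ { {X , H} (r , p , e) → ((p , subst Pos (lem X H) (pos-+ p (pos-+ r r)) , trans (square X H) e) , r) , ℤ.+-inverseʳ H }
        ; from-to = λ { {x , y , h} (_ , z) → triple refl (sym (h≡y h y z)) refl } ; to-from = λ _ → refl }
        where
        lem : ∀ x h → x + - h + (h + h) ≡ x + h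
        lem = solve-∀

      D : Region InD
      D = transport B⁺ (vanishing (positive E h₃) t)

      V⁺ : Bij (λ a → (InE M a × t a ≡ 0ℤ) × Pos (h₃ a)) InD
      V⁺ = record
        { to = to B⁺ ; from = from B⁺
        ; to-in = λ { {a} ((e , z) , r) → to-in B⁺ {a} ((e , r) , z) }
        ; from-in = λ { {a} d → let ((e , r) , z) = from-in B⁺ {a} d in (e , z) , r }
        ; from-to = λ { {a} ((e , z) , r) → from-to B⁺ {a} ((e , r) , z) } ; to-from = λ _ → refl }

      V⁻ : Bij (λ a → (InE M a × t a ≡ 0ℤ) × Pos (- h₃ a)) InD
      V⁻ = record
        { to = λ (x , y , h) → x , - h ; from = λ (X , H) → X , - H , - H
        ; to-in = λ { {x , y , h} (((p , q , e) , z) , r) → r , subst (λ w → Pos (x + w)) (sym (ℤ.neg-involutive h)) q , on-diagonal x y h z e }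
        ; from-in = λ { {X , H} (r , p , e) → ((subst Pos (lem X H) (pos-+ p (pos-+ r r)) , p , trans (square X (- H)) e) , ℤ.+-inverseʳ (- H)) , subst Pos (sym (ℤ.neg-involutive H)) r }
        ; from-to = λ { {x , y , h} ((_ , z) , _) → triple refl (trans (ℤ.neg-involutive h) (sym (h≡y h y z))) (ℤ.neg-involutive h) }
        ; to-from = λ { {X , H} _ → cong (X ,_) (ℤ.neg-involutive H) } }
        where
        lem : ∀ x h → x + - h + (h + h) ≡ x + - - h
        lem = solve-∀

      V⁰ : Bij (λ a → (InE M a × t a ≡ 0ℤ) × h₃ a ≡ 0ℤ) InD₀
      V⁰ = record
        { to = λ (x , y , h) → x ; from = λ X → X , 0ℤ , 0ℤ
        ; to-in = λ { {x , y , h} (((p , q , e) , z) , refl) → subst Pos (ℤ.+-identityʳ x) q , on-diagonal x y h z e }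
        ; from-in = λ { {X} (p , e) → ((subst Pos (sym (ℤ.+-identityʳ X)) p , subst Pos (sym (ℤ.+-identityʳ X)) p , trans (square X 0ℤ) e) , refl) , refl }
        ; from-to = λ { {x , y , h} ((_ , z) , refl) → triple refl (sym (h≡y 0ℤ y z)) refl }
        ; to-from = λ _ → refl }

      D₀ : Region InD₀
      D₀ = transport V⁰ (vanishing (vanishing E t) h₃)

      B₃ : Bij (λ a → InA M a × s a ≡ 0ℤ) InD
      B₃ = record
        { to = λ (x , y , h) → - y , x ; from = λ (X , H) → H , - X , - H
        ; to-in = λ { {x , y , h} ((p , q , e) , z) → pos-half (subst (λ w → Pos (x + w)) (neg-h x h z) p)
                    , subst Pos (trans (cong (_+ - y) (h≡ x h z)) (ℤ.+-comm (- x) (- y))) q , trans (lem x y h) (trans (cong (λ w → x * x + y * y + - (h * h) + (w * w + - (x * x))) (h≡ x h z)) (trans (lem₂ x _) e)) }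
        ; from-in = λ { {X , H} (r , p , e) → (subst Pos (cong (λ w → H + w) (sym (ℤ.neg-involutive H))) (pos-+ r r)
                    , subst Pos (lem₃ X H) p , trans (lem₄ X H) e) , ℤ.+-inverseʳ H }
        ; from-to = λ { {x , y , h} (_ , z) → triple refl (ℤ.neg-involutive y) (sym (h≡ x h z)) }
        ; to-from = λ { {X , H} _ → cong (_, H) (ℤ.neg-involutive X) } }
        where
        h≡ : ∀ x h → x + h ≡ 0ℤ → h ≡ - x
        h≡ x h z = trans (lem x h) (trans (cong (λ w → w + - x) z) (ℤ.+-identityˡ (- x)))
          where
          lem : ∀ x h → h ≡ x + h + - x
          lem = solve-∀
        neg-h : ∀ x h → x + h ≡ 0ℤ → - h ≡ x
        neg-h x h z = trans (cong -_ (h≡ x h z)) (ℤ.neg-involutive x)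
        lem : ∀ x y h → - y * - y ≡ x * x + y * y + - (h * h) + (h * h + - (x * x))
        lem = solve-∀
        lem₂ : ∀ x v → v + (- x * - x + - (x * x)) ≡ v
        lem₂ = solve-∀
        lem₃ : ∀ X H → X + - H ≡ - H + - - X
        lem₃ = solve-∀
        lem₄ : ∀ X H → H * H + - X * - X + - (- H * - H) ≡ X * X
        lem₄ = solve-∀

      module _ (F : ℤ → ℤ → ℤ) where
        F₂ : ℤ × ℤ → ℤ
        F₂ (X , H) = F X H

        last? : ∀ (a : ℤ × ℤ) → Dec (proj₁ a + - proj₂ a ≡ 1ℤ)
        last? (X , H) = X + - H ℤ.≟ 1ℤ
        first? : ∀ (a : ℤ × ℤ) → Dec (proj₂ a ≡ 1ℤ)
        first? (X , H) = H ℤ.≟ 1ℤ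
        one? : ∀ (X : ℤ) → Dec (X ≡ 1ℤ)
        one? X = X ℤ.≟ 1ℤ

        ends : Region (λ X → InD₀ X × ¬ X ≡ 1ℤ)
        ends = restrict D₀ (¬? ∘ one?)

        -- For fixed X the parameter runs over 1, ..., X - 1; the shift H ↦ H + 1 matches everything
        -- except the last and the first term. For X = 1 the range is empty, in accordance with F 1
        -- 1 - F 1 1 = 0.
        telescope : Σ[ D ] (λ (X , H) → F X (H + 1ℤ) + - F X H) ≡ Σ[ D₀ ] (λ X → F X X + - F X 1ℤ)
        telescope = begin
          Σ[ D ] (λ a → Fs a + - F₂ a)
            ≡⟨ trans (Σ-+ D Fs (λ a → - F₂ a)) (cong (λ z → Σ[ D ] Fs + z) (Σ-neg D F₂)) ⟩
          Σ[ D ] Fs + - Σ[ D ] F₂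
            ≡⟨ cong₂ (λ a b → a + - b) (Σ-split D last? Fs) (Σ-split D first? F₂) ⟩
          (Σ[ restrict D last? ] Fs + Σ[ restrict D (¬? ∘ last?) ] Fs) + - (Σ[ restrict D first? ] F₂ + Σ[ restrict D (¬? ∘ first?) ] F₂)
            ≡⟨ cong₂ (λ a b → (Σ[ restrict D last? ] Fs + a) + - (b + Σ[ restrict D (¬? ∘ first?) ] F₂)) shift-eq first-eq ⟩
          (Σ[ restrict D last? ] Fs + Σ[ restrict D (¬? ∘ first?) ] F₂) + - (Σ[ ends ] (λ X → F X 1ℤ) + Σ[ restrict D (¬? ∘ first?) ] F₂)
            ≡⟨ cong (λ a → (a + Σ[ restrict D (¬? ∘ first?) ] F₂) + - (Σ[ ends ] (λ X → F X 1ℤ) + Σ[ restrict D (¬? ∘ first?) ] F₂)) last-eq ⟩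
          (Σ[ ends ] (λ X → F X X) + Σ[ restrict D (¬? ∘ first?) ] F₂) + - (Σ[ ends ] (λ X → F X 1ℤ) + Σ[ restrict D (¬? ∘ first?) ] F₂)
            ≡⟨ lem (Σ[ ends ] (λ X → F X X)) (Σ[ restrict D (¬? ∘ first?) ] F₂) (Σ[ ends ] (λ X → F X 1ℤ)) ⟩
          0ℤ + (Σ[ ends ] (λ X → F X X) + - Σ[ ends ] (λ X → F X 1ℤ))
            ≡⟨ cong₂ _+_ (sym (Σ-zero (restrict D₀ one?) λ { X (_ , refl) → ℤ.+-inverseʳ (F 1ℤ 1ℤ) }))
                 (sym (trans (Σ-+ ends (λ X → F X X) (λ X → - F X 1ℤ)) (cong (λ z → Σ[ ends ] (λ X → F X X) + z) (Σ-neg ends (λ X → F X 1ℤ))))) ⟩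
          Σ[ restrict D₀ one? ] (λ X → F X X + - F X 1ℤ) + Σ[ ends ] (λ X → F X X + - F X 1ℤ)
            ≡⟨ sym (Σ-split D₀ one? _) ⟩
          Σ[ D₀ ] (λ X → F X X + - F X 1ℤ) ∎
          where
          open ≡-Reasoning
          Fs : ℤ × ℤ → ℤ
          Fs (X , H) = F X (H + 1ℤ)
          lem : ∀ a b c → (a + b) + - (c + b) ≡ 0ℤ + (a + - c)
          lem = solve-∀
          shift-eq : Σ[ restrict D (¬? ∘ last?) ] Fs ≡ Σ[ restrict D (¬? ∘ first?) ] F₂
          shift-eq = Σ-bij (record
            { to = λ (X , H) → X , H + 1ℤ ; from = λ (X , H) → X , H + -1ℤ
            ; to-in = λ { {X , H} ((r , p , e) , ¬l) → (pos-suc r , subst Pos (e₁ X H) (pos-pred p ¬l) , e) , λ eq → ¬pos-0 (subst Pos (trans (e₂ H) (cong (_+ -1ℤ) eq)) r) }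
            ; from-in = λ { {X , H} ((r , p , e) , ¬f) → (pos-pred r ¬f , subst Pos (e₃ X H) (pos-suc p) , e)
                        , λ eq → ¬pos-0 (subst Pos (trans (e₄ X H) (cong (_+ -1ℤ) eq)) p) }
            ; from-to = λ { {X , H} _ → cong (X ,_) (sym (e₂ H)) }
            ; to-from = λ { {X , H} _ → cong (X ,_) (sym (e₅ H)) } })
            (restrict D (¬? ∘ last?)) (restrict D (¬? ∘ first?)) (λ _ _ → refl)
            where
            e₁ : ∀ X H → X + - H + -1ℤ ≡ X + - (H + 1ℤ)
            e₁ = solve-∀
            e₂ : ∀ H → H ≡ H + 1ℤ + -1ℤ
            e₂ = solve-∀
            e₃ : ∀ X H → X + - H + 1ℤ ≡ X + - (H + -1ℤ)
            e₃ = solve-∀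
            e₄ : ∀ X H → X + - H ≡ X + - (H + -1ℤ) + -1ℤ
            e₄ = solve-∀
            e₅ : ∀ H → H ≡ H + -1ℤ + 1ℤ
            e₅ = solve-∀
          last-eq : Σ[ restrict D last? ] Fs ≡ Σ[ ends ] (λ X → F X X)
          last-eq = Σ-bij (record
            { to = proj₁ ; from = λ X → X , X + -1ℤ
            ; to-in = λ { {X , H} ((r , p , e) , l) → (subst Pos (e₁ X H) (pos-+ p r) , e)
                      , λ eq → ¬pos-0 (subst Pos (trans (e₂ X H) (cong₂ (λ a b → a + - b) eq l)) r) }
            ; from-in = λ { {X} ((p , e) , ≢1) → (pos-pred p ≢1 , subst Pos (sym (e₃ X)) (ℤ.+<+ (ℕ.s≤s ℕ.z≤n)) , e) , e₃ X }
            ; from-to = λ { {X , H} (_ , l) → cong (X ,_) (sym (trans (e₂ X H) (cong (λ z → X + - z) l))) }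
            ; to-from = λ _ → refl })
            (restrict D last?) ends (λ { (X , H) (_ , l) → cong (F X) (trans (e₄ X H) (trans (cong (λ z → X + (1ℤ + - z)) l) (e₅ X))) })
            where
            e₁ : ∀ X H → X + - H + H ≡ X
            e₁ = solve-∀
            e₂ : ∀ X H → H ≡ X + - (X + - H)
            e₂ = solve-∀
            e₃ : ∀ X → X + - (X + -1ℤ) ≡ 1ℤ
            e₃ = solve-∀
            e₄ : ∀ X H → H + 1ℤ ≡ X + (1ℤ + - (X + - H))
            e₄ = solve-∀
            e₅ : ∀ X → X + (1ℤ + - 1ℤ) ≡ X
            e₅ = solve-∀
          first-eq : Σ[ restrict D first? ] F₂ ≡ Σ[ ends ] (λ X → F X 1ℤ)
          first-eq = Σ-bij (record
            { to = proj₁ ; from = λ X → X , 1ℤ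
            ; to-in = λ { {X , _} ((r , p , e) , refl) → (subst Pos (e₁ X) (pos-suc p) , e) , λ { refl → ¬pos-0 p } }
            ; from-in = λ ((p , e) , ≢1) → (ℤ.+<+ (ℕ.s≤s ℕ.z≤n) , pos-pred p ≢1 , e) , refl
            ; from-to = λ { (_ , refl) → refl } ; to-from = λ _ → refl })
            (restrict D first?) ends (λ { (X , _) (_ , refl) → refl })
            where
            e₁ : ∀ X → X + -1ℤ + 1ℤ ≡ X
            e₁ = solve-∀

    -- F is an antiderivative in H, modulo p, of the combined boundary weights: by `step` their sum
    -- over H collapses to F X X - F X 1, and by `base` this is compensated by the points with h =
    -- 0.
    boundary : ∀ {p} (G g : ℤ → ℤ → ℤ → ℤ) (F : ℤ → ℤ → ℤ) →
      (∀ X H → p ∣ + 2 * G X H H + g X H H + g X (- H) (- H) + - (+ 2 * g H (- X) (- H)) + - (F X (H + 1ℤ) + - F X H)) →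
      (∀ X → p ∣ g X 0ℤ 0ℤ + (F X X + - F X 1ℤ)) →
      p ∣ + 2 * Σ[ vanishing (positive E h₃) t ] (uncurry₃ G) + Σ[ vanishing E t ] (uncurry₃ g) + - (+ 2 * Σ[ vanishing A s ] (uncurry₃ g))
    boundary {p} G g F step base = subst (p ∣_) (sym total) (∣m∣n⇒∣m+n (Σ-∣ D λ (X , H) _ → step X H) (Σ-∣ D₀ λ X _ → base X))
      where
      open ≡-Reasoning
      diff : ℤ × ℤ → ℤ
      diff (X , H) = F X (H + 1ℤ) + - F X H
      a₁ a₂ a₃ a₄ : ℤ × ℤ → ℤ
      a₁ (X , H) = G X H H
      a₂ (X , H) = g X H H
      a₃ (X , H) = g X (- H) (- H)
      a₄ (X , H) = g H (- X) (- H)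
      step-sum : Σ[ D ] (λ (X , H) → + 2 * G X H H + g X H H + g X (- H) (- H) + - (+ 2 * g H (- X) (- H)) + - (F X (H + 1ℤ) + - F X H))
                 ≡ + 2 * Σ[ D ] a₁ + Σ[ D ] a₂ + Σ[ D ] a₃ + - (+ 2 * Σ[ D ] a₄) + - Σ[ D ] diff
      step-sum = trans (Σ-+ D (λ a → + 2 * a₁ a + a₂ a + a₃ a + - (+ 2 * a₄ a)) (λ a → - diff a)) (cong₂ _+_
        (trans (Σ-+ D (λ a → + 2 * a₁ a + a₂ a + a₃ a) (λ a → - (+ 2 * a₄ a))) (cong₂ _+_
          (trans (Σ-+ D (λ a → + 2 * a₁ a + a₂ a) a₃) (cong (_+ Σ[ D ] a₃)
            (trans (Σ-+ D (λ a → + 2 * a₁ a) a₂) (cong (_+ Σ[ D ] a₂) (Σ-* D (+ 2) a₁)))))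
          (trans (Σ-neg D (λ a → + 2 * a₄ a)) (cong -_ (Σ-* D (+ 2) a₄)))))
        (Σ-neg D diff))
      total : + 2 * Σ[ vanishing (positive E h₃) t ] (uncurry₃ G) + Σ[ vanishing E t ] (uncurry₃ g) + - (+ 2 * Σ[ vanishing A s ] (uncurry₃ g))
              ≡ Σ[ D ] (λ (X , H) → + 2 * G X H H + g X H H + g X (- H) (- H) + - (+ 2 * g H (- X) (- H)) + - (F X (H + 1ℤ) + - F X H))
                + Σ[ D₀ ] (λ X → g X 0ℤ 0ℤ + (F X X + - F X 1ℤ))
      total = begin
        + 2 * Σ[ vanishing (positive E h₃) t ] (uncurry₃ G) + Σ[ vanishing E t ] (uncurry₃ g) + - (+ 2 * Σ[ vanishing A s ] (uncurry₃ g))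
          ≡⟨ cong₂ _+_ (cong₂ (λ a b → + 2 * a + b)
               (Σ-bij B⁺ (vanishing (positive E h₃) t) D {g = a₁} (λ { (x , y , h) (_ , z) → cong (λ w → G x w h) (h≡y h y z) }))
               (trans (Σ-trichotomy (vanishing E t) h₃ (uncurry₃ g)) (cong₂ _+_
                 (Σ-bij V⁺ (positive (vanishing E t) h₃) D {g = a₂} (λ { (x , y , h) ((_ , z) , _) → cong (λ w → g x w h) (h≡y h y z) }))
                 (cong₂ _+_
                   (Σ-bij V⁰ (vanishing (vanishing E t) h₃) D₀ {g = λ X → g X 0ℤ 0ℤ} (λ { (x , y , h) ((_ , z) , refl) → cong (λ w → g x w 0ℤ) (h≡y 0ℤ y z) }))
                   (Σ-bij V⁻ (negative (vanishing E t) h₃) D {g = a₃} (λ { (x , y , h) ((_ , z) , _) →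
                     cong₂ (λ v w → g x v w) (trans (h≡y h y z) (sym (ℤ.neg-involutive h))) (sym (ℤ.neg-involutive h)) }))))))
               (cong (λ a → - (+ 2 * a)) (Σ-bij B₃ (vanishing A s) D {g = a₄} (λ { (x , y , h) q@(_ , z) → cong (uncurry₃ g) (sym (from-to B₃ {x , y , h} q)) }))) ⟩
        + 2 * Σ[ D ] a₁ + (Σ[ D ] a₂ + (Σ[ D₀ ] (λ X → g X 0ℤ 0ℤ) + Σ[ D ] a₃)) + - (+ 2 * Σ[ D ] a₄)
          ≡⟨ lem (Σ[ D ] a₁) (Σ[ D ] a₂) (Σ[ D₀ ] (λ X → g X 0ℤ 0ℤ)) (Σ[ D ] a₃) (Σ[ D ] a₄) (Σ[ D ] diff) ⟩
        (+ 2 * Σ[ D ] a₁ + Σ[ D ] a₂ + Σ[ D ] a₃ + - (+ 2 * Σ[ D ] a₄) + - Σ[ D ] diff) + (Σ[ D₀ ] (λ X → g X 0ℤ 0ℤ) + Σ[ D ] diff)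
          ≡⟨ cong₂ _+_ (sym step-sum) (trans (cong (λ z → Σ[ D₀ ] (λ X → g X 0ℤ 0ℤ) + z) (telescope F)) (sym (Σ-+ D₀ _ _))) ⟩
        _ ∎
        where
        lem : ∀ a b c d e v → + 2 * a + (b + (c + d)) + - (+ 2 * e) ≡ (+ 2 * a + b + d + - (+ 2 * e) + - v) + (c + v)
        lem = solve-∀

-- The even case: how a certificate forces divisibility.

module EvenForms where
  open Regions
  open Parity
  open LiouvilleSums
  open BoundaryTerms
  open import Data.Integer using (_+_; _*_; -_)
  open import Data.Integer.Divisibility.Signed using (_∣_; divides; ∣m∣n⇒∣m+n; ∣m⇒∣-m; ∣n⇒∣m*n; ∣m⇒∣m*n)

  infix 5 [_<_]
  [_<_] : ℤ → ℤ → ℤ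
  [ n < d ] with pos? (d + - n)
  ... | yes _ = 1ℤ
  ... | no _  = 0ℤ

  [<]-yes : ∀ n d → Pos (d + - n) → [ n < d ] ≡ 1ℤ
  [<]-yes n d p with pos? (d + - n)
  ... | yes _ = refl
  ... | no ¬p = ⊥-elim (¬p p)

  [<]-no : ∀ n d → ¬ Pos (d + - n) → [ n < d ] ≡ 0ℤ
  [<]-no n d ¬p with pos? (d + - n)
  ... | yes p = ⊥-elim (¬p p)
  ... | no _  = refl

  onEven : ℤ → (ℤ → ℤ) → ℤ
  onEven n b with even? n
  ... | yes _ = b (half n)
  ... | no _  = 0ℤ

  onEven-yes : ∀ n b → Even n → onEven n b ≡ b (half n)
  onEven-yes n b e with even? n
  ... | yes _ = refl
  ... | no ¬e = ⊥-elim (¬e e)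

  onEven-no : ∀ n b → ¬ Even n → onEven n b ≡ 0ℤ
  onEven-no n b ¬e with even? n
  ... | yes e = ⊥-elim (¬e e)
  ... | no _  = refl

  σ-odd-pair : ∀ n d → ¬ Even (n + d) → σ d ≡ - σ n
  σ-odd-pair n d ¬e with σ-± n | σ-± d
  ... | inj₁ a | inj₁ b = ⊥-elim (¬e (trans (σ-+ n d) (cong₂ _*_ a b)))
  ... | inj₁ a | inj₂ b = trans b (cong -_ (sym a))
  ... | inj₂ a | inj₁ b = trans b (cong -_ (sym a))
  ... | inj₂ a | inj₂ b = ⊥-elim (¬e (trans (σ-+ n d) (cong₂ _*_ a b)))

  σ-even-pair : ∀ n d → Even (n + d) → σ d ≡ σ n
  σ-even-pair n d e = trans (sym (ℤ.*-identityˡ (σ d))) (trans (cong (_* σ d) (sym (σ-square n)))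
    (trans (ℤ.*-assoc (σ n) (σ n) (σ d)) (trans (cong (σ n *_) (trans (sym (σ-+ n d)) e)) (ℤ.*-identityʳ (σ n)))))

  weighted : (ℤ → ℤ → ℤ → ℤ) → ℤ³ → ℤ
  weighted A (n , k , d) = σ k * A n k d

  symmetrized : (ℤ → ℤ → ℤ → ℤ) → ℤ → ℤ → ℤ → ℤ
  symmetrized A n k d = A n k d + A n (- k) d + (A d k n + A d (- k) n)

  module _ {P : ℤ³ → Set} (R : Region P) (swap : Bij P P) (flip : Bij P P)
    (swap≡ : ∀ n k d → to swap (n , k , d) ≡ (d , k , n)) (flip≡ : ∀ n k d → to flip (n , k , d) ≡ (n , - k , d)) where

    -- The sign of k is invariant under both symmetries, so averaging over the four images affects
    -- only A. Weights that cancel in pairs need be congruent to 0 only after this averaging.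
    Σ-symmetrized : ∀ A → + 4 * Σ[ R ] (weighted A) ≡ Σ[ R ] (weighted (symmetrized A))
    Σ-symmetrized A = begin
      + 4 * Σ[ R ] (weighted A)
        ≡⟨ lem (Σ[ R ] (weighted A)) ⟩
      Σ[ R ] (weighted A) + Σ[ R ] (weighted A) + (Σ[ R ] (weighted A) + Σ[ R ] (weighted A))
        ≡⟨ cong₂ (λ a b → Σ[ R ] (weighted A) + a + b) flipped (cong₂ _+_ (swapped (weighted A)) (trans flipped (swapped _))) ⟩
      Σ[ R ] (weighted A) + Σ[ R ] w₁ + (Σ[ R ] w₂ + Σ[ R ] w₃)
        ≡⟨ cong₂ _+_ (sym (Σ-+ R (weighted A) w₁)) (sym (Σ-+ R w₂ w₃)) ⟩
      Σ[ R ] (λ a → weighted A a + w₁ a) + Σ[ R ] (λ a → w₂ a + w₃ a)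
        ≡⟨ sym (Σ-+ R (λ a → weighted A a + w₁ a) (λ a → w₂ a + w₃ a)) ⟩
      Σ[ R ] (λ a → weighted A a + w₁ a + (w₂ a + w₃ a))
        ≡⟨ Σ-cong R (λ (n , k , d) _ → lem₂ (σ k) (A n k d) (A n (- k) d) (A d k n) (A d (- k) n)) ⟩
      Σ[ R ] (weighted (symmetrized A)) ∎
      where
      open ≡-Reasoning
      w₁ w₂ w₃ : ℤ³ → ℤ
      w₁ (n , k , d) = σ k * A n (- k) d
      w₂ (n , k , d) = σ k * A d k n
      w₃ (n , k , d) = σ k * A d (- k) n
      lem : ∀ z → + 4 * z ≡ z + z + (z + z)
      lem = solve-∀
      lem₂ : ∀ s a b c d → s * a + s * b + (s * c + s * d) ≡ s * (a + b + (c + d))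
      lem₂ = solve-∀
      flipped : Σ[ R ] (weighted A) ≡ Σ[ R ] w₁
      flipped = sym (Σ-bij flip R R λ (n , k , d) _ → trans (cong (_* A n (- k) d) (sym (σ-neg k))) (cong (weighted A) (sym (flip≡ n k d))))
      swapped : ∀ w → Σ[ R ] w ≡ Σ[ R ] (λ (n , k , d) → w (d , k , n))
      swapped w = sym (Σ-bij swap R R λ (n , k , d) _ → cong w (sym (swap≡ n k d)))

  -- Here f multiplies the terms with n < d, a is the weight on all triples and b an additional one
  -- on those with n = 2u. The auxiliary g lives on the quadric, γ is its form in the coordinates n,
  -- k, d, and F is the antiderivative for the boundary. `onS` and `onS₂` collect what is left once
  -- the condition n < d has been eliminated.
  record Weights : Set where
    field
      f         : ℤ → ℤ
      g γ a b   : ℤ → ℤ → ℤ → ℤ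
      F         : ℤ → ℤ → ℤ

    WF G₁ onS onS₂ : ℤ → ℤ → ℤ → ℤ
    WF n k d = f (d + - n) * ((d + n) * (d + n) + - (+ 4 * (k * k)))
    G₁ x y h = f (h + h) * (+ 4 * (x * x) + - (+ 4 * (y * y)))
    onS n k d = a n k d + γ n k d + - WF n k d
    onS₂ u w c = b u w c + + 2 * (WF (u + u) w c + - γ (u + u) w c)
      + (G₁ (c + w) (w + - u) (c + w + - u) + + 2 * g (c + w) (w + - u) (c + w + - u))

  -- All conditions are identities or congruences between functions of at most three integers,
  -- without any summation. The inverse `quarter` of 4 undoes the factor introduced by
  -- symmetrization.
  record Certificate (p : ℤ) (weights : Weights) : Set where
    open Weights weights
    field
      quarter quotient : ℤ
      quarter-inverse  : quarter * + 4 ≡ 1ℤ + quotient * p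
      f-odd            : ∀ j → f (- j) ≡ - f j
      g-odd            : ∀ x y h → g (- x) y h ≡ - g x y h
      g-even           : ∀ x y h → g x (- y) (- h) ≡ g x y h
      γ-mirror         : ∀ n k d → γ d (- k) n ≡ γ n k d
      g-γ              : ∀ x y h → p ∣ g x y h + - γ (x + - h) y (x + h)
      F-step           : ∀ X H → p ∣ + 2 * G₁ X H H + g X H H + g X (- H) (- H) + - (+ 2 * g H (- X) (- H)) + - (F X (H + 1ℤ) + - F X H)
      F-base           : ∀ X → p ∣ g X 0ℤ 0ℤ + (F X X + - F X 1ℤ)
      onS-vanishes     : ∀ n k d → p ∣ symmetrized onS n k d
      onS₂-vanishes    : ∀ u w c → p ∣ symmetrized onS₂ u w c

  module _ {p : ℤ} {weights : Weights} (certificate : Certificate p weights) {M : ℤ} (S : Region (InS M)) where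
    open Weights weights
    open Certificate certificate

    private
      S₂ : Region (InS₂ M)
      S₂ = transport S↔S₂ (restrict S (λ (n , k , d) → even? n))
      A : Region (InA M)
      A = transport S₂↔A S₂
      pe? : ∀ (a : ℤ³) → Dec (Even (proj₁ a + proj₂ (proj₂ a)))
      pe? (n , k , d) = even? (n + d)
      to-E : Bij (λ (a : ℤ³) → InS M a × Even (proj₁ a + proj₂ (proj₂ a))) (InE M)
      to-E = S↔E
      E : Region (InE M)
      E = transport to-E (restrict S pe?)
      open Boundary E A

      gap : ℤ³ → ℤ
      gap (n , k , d) = d + - n

      Ψ : ℤ³ → ℤ
      Ψ (n , k , d) = σ k * (σ n * WF n k d)

      WF-swap : ∀ n k d → WF d k n ≡ - WF n k d
      WF-swap n k d = trans (cong (_* ((n + d) * (n + d) + - (+ 4 * (k * k)))) (trans (cong f (lem n d)) (f-odd (d + - n))))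
                        (lem₂ (f (d + - n)) n d k)
        where
        lem : ∀ n d → n + - d ≡ - (d + - n)
        lem = solve-∀
        lem₂ : ∀ v n d k → - v * ((n + d) * (n + d) + - (+ 4 * (k * k))) ≡ - (v * ((d + n) * (d + n) + - (+ 4 * (k * k))))
        lem₂ = solve-∀

      f-0 : f 0ℤ ≡ 0ℤ
      f-0 = self-neg (f 0ℤ) (f-odd 0ℤ)
        where
        self-neg : ∀ z → z ≡ - z → z ≡ 0ℤ
        self-neg (+ 0) _ = refl

      -- Squares preserve parity, so M has the parity of x + y + h. For n ≡ d (mod 2) the sign
      -- (-1)^(k+n) is therefore constant, and it can be taken out of the sum.
      σM : ∀ x y h → x * x + y * y + - (h * h) ≡ M → σ y * σ (x + - h) ≡ σ M
      σM x y h e = trans (cong (σ y *_) (trans (σ-+ x (- h)) (cong (σ x *_) (σ-neg h))))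
        (trans (lem (σ y) (σ x) (σ h)) (sym (trans (cong σ (sym e)) (trans (σ-+ (x * x + y * y) (- (h * h)))
          (cong₂ _*_ (trans (σ-+ (x * x) (y * y)) (cong₂ _*_ (σ-sq x) (σ-sq y))) (trans (σ-neg (h * h)) (σ-sq h)))))))
        where
        lem : ∀ a b c → a * (b * c) ≡ b * a * c
        lem = solve-∀

      S₀ : Region (λ a → InS M a × Even (proj₁ a + proj₂ (proj₂ a)))
      S₀ = restrict S pe?
      S₁ : Region (λ a → InS M a × ¬ Even (proj₁ a + proj₂ (proj₂ a)))
      S₁ = restrict S (¬? ∘ pe?)

      even-swap : ∀ n d → Even (n + d) → Even (d + n)
      even-swap n d = subst Even (ℤ.+-comm n d)

      swap₀ : Bij (λ (a : ℤ³) → InS M a × Even (proj₁ a + proj₂ (proj₂ a))) (λ a → InS M a × Even (proj₁ a + proj₂ (proj₂ a)))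
      swap₀ = record
        { to = to swap-S′ ; from = from swap-S′
        ; to-in = λ { {n , k , d} (s , e) → to-in swap-S′ {n , k , d} s , even-swap n d e }
        ; from-in = λ { {n , k , d} (s , e) → to-in swap-S′ {n , k , d} s , even-swap n d e }
        ; from-to = λ _ → refl ; to-from = λ _ → refl }
        where
        swap-S′ : Bij (InS M) (InS M)
        swap-S′ = swap-S

      W : ℤ
      W = Σ[ positive S gap ] Ψ

      even-part : Σ[ restrict (positive S gap) pe? ] Ψ ≡ σ M * Σ[ positive E h₃ ] (uncurry₃ G₁)
      even-part = trans (Σ-bij (record
          { to = to to-E ; from = from to-E
          ; to-in = λ { {n , k , d} ((s , r) , e) → to-in to-E {n , k , d} (s , e) , pos-half (subst Pos (sym (double n k d s e)) r) }
          ; from-in = λ { {x , y , h} (i , r) → let (s , e) = from-in to-E {x , y , h} i in (s , subst Pos (gap-E x h) (pos-+ r r)) , e }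
          ; from-to = λ { {a} ((s , r) , e) → from-to to-E {a} (s , e) }
          ; to-from = λ { {a} (i , _) → to-from to-E {a} i } })
        (restrict (positive S gap) pe?) (positive E h₃) {g = λ (x , y , h) → σ M * G₁ x y h}
        (λ { a@(n , k , d) ((s , r) , e) → trans (cong Ψ (sym (from-to to-E {a} (s , e)))) (on-E (to to-E a) (to-in to-E {a} (s , e))) }))
        (Σ-* (positive E h₃) (σ M) (uncurry₃ G₁))
        where
        gap-E : ∀ x h → h + h ≡ x + h + - (x + - h)
        gap-E = solve-∀
        double : ∀ n k d → InS M (n , k , d) → Even (n + d) → proj₂ (proj₂ (to to-E (n , k , d))) + proj₂ (proj₂ (to to-E (n , k , d))) ≡ d + - n
        double n k d s e = half+half (d + - n) (trans (σ-+ d (- n)) (trans (cong (σ d *_) (σ-neg n)) (trans (cong (_* σ n) (σ-even-pair n d e)) (σ-square n))))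
        on-E : ∀ a → InE M a → Ψ (from to-E a) ≡ σ M * uncurry₃ G₁ a
        on-E (x , y , h) (_ , _ , e) = trans (sym (ℤ.*-assoc (σ y) (σ (x + - h)) _))
          (cong₂ _*_ (σM x y h e) (cong₂ _*_ (cong f (sym (gap-E x h))) (quad x y h)))
          where
          quad : ∀ x y h → (x + h + (x + - h)) * (x + h + (x + - h)) + - (+ 4 * (y * y)) ≡ + 4 * (x * x) + - (+ 4 * (y * y))
          quad = solve-∀

      -- For n ≡ d the signs of n and d agree while `WF` is odd under n ↔ d.
      Ψ-even : Σ[ S₀ ] Ψ ≡ 0ℤ
      Ψ-even = Σ-cancel S₀ swap₀ λ { (n , k , d) (_ , e) →
        trans (lem (σ k) (σ n) (WF n k d)) (cong -_ (cong₂ (λ s w → σ k * (s * w)) (sym (σ-even-pair n d e)) (sym (WF-swap n k d)))) }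
        where
        lem : ∀ a b c → a * (b * c) ≡ - (a * (b * - c))
        lem = solve-∀

      -- For n and d of different parity both the sign and `WF` change under n ↔ d, so the triples
      -- with n < d and with n > d contribute equally.
      odd-part : Σ[ S₁ ] Ψ ≡ + 2 * Σ[ restrict (positive S gap) (¬? ∘ pe?) ] Ψ
      odd-part = begin
        Σ[ S₁ ] Ψ
          ≡⟨ Σ-trichotomy S₁ gap Ψ ⟩
        Σ[ positive S₁ gap ] Ψ + (Σ[ vanishing S₁ gap ] Ψ + Σ[ negative S₁ gap ] Ψ)
          ≡⟨ cong₂ (λ a b → Σ[ positive S₁ gap ] Ψ + (a + b)) zero-gap mirror ⟩
        Σ[ positive S₁ gap ] Ψ + (0ℤ + Σ[ positive S₁ gap ] Ψ)
          ≡⟨ lem (Σ[ positive S₁ gap ] Ψ) ⟩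
        + 2 * Σ[ positive S₁ gap ] Ψ
          ≡⟨ cong (+ 2 *_) (Σ-bij (same (λ ((s , e) , r) → (s , r) , e) (λ ((s , r) , e) → (s , e) , r))
               (positive S₁ gap) (restrict (positive S gap) (¬? ∘ pe?)) (λ _ _ → refl)) ⟩
        + 2 * Σ[ restrict (positive S gap) (¬? ∘ pe?) ] Ψ ∎
        where
        open ≡-Reasoning
        lem : ∀ z → z + (0ℤ + z) ≡ + 2 * z
        lem = solve-∀
        zero-gap : Σ[ vanishing S₁ gap ] Ψ ≡ 0ℤ
        zero-gap = Σ-zero (vanishing S₁ gap) λ { (n , k , d) (_ , z) →
          trans (cong (λ v → σ k * (σ n * (v * ((d + n) * (d + n) + - (+ 4 * (k * k)))))) (trans (cong f z) f-0)) (lem₂ (σ k) (σ n) ((d + n) * (d + n) + - (+ 4 * (k * k)))) }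
          where
          lem₂ : ∀ a b c → a * (b * (0ℤ * c)) ≡ 0ℤ
          lem₂ = solve-∀
        neg-gap : ∀ n d → - (d + - n) ≡ n + - d
        neg-gap = solve-∀
        mirror : Σ[ negative S₁ gap ] Ψ ≡ Σ[ positive S₁ gap ] Ψ
        mirror = Σ-bij (record
          { to = λ (n , k , d) → d , k , n ; from = λ (n , k , d) → d , k , n
          ; to-in = λ { {n , k , d} ((s , e) , r) → (to-in swap-S {n , k , d} s , λ e′ → e (even-swap d n e′)) , subst Pos (neg-gap n d) r }
          ; from-in = λ { {n , k , d} ((s , e) , r) → (to-in swap-S {n , k , d} s , λ e′ → e (even-swap d n e′)) , subst Pos (sym (neg-gap d n)) r }
          ; from-to = λ _ → refl ; to-from = λ _ → refl })
          (negative S₁ gap) (positive S₁ gap) λ { (n , k , d) ((_ , e) , _) →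
            trans (lem₃ (σ k) (σ n) (WF n k d)) (cong₂ (λ s w → σ k * (s * w)) (sym (σ-odd-pair n d e)) (sym (WF-swap n k d))) }
          where
          lem₃ : ∀ a b c → a * (b * c) ≡ a * (- b * - c)
          lem₃ = solve-∀

      -- The condition n < d disappears from the triples with n + d odd and survives only as h > 0
      -- on the quadric, where `liouville` removes it.
      twice-W : + 2 * W ≡ Σ[ S ] Ψ + σ M * (+ 2 * Σ[ positive E h₃ ] (uncurry₃ G₁))
      twice-W = begin
        + 2 * W
          ≡⟨ cong (+ 2 *_) (Σ-split (positive S gap) pe? Ψ) ⟩
        + 2 * (Σ[ restrict (positive S gap) pe? ] Ψ + o)
          ≡⟨ cong (λ z → + 2 * (z + o)) even-part ⟩
        + 2 * (σ M * e + o)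
          ≡⟨ lem (σ M) e o ⟩
        0ℤ + + 2 * o + σ M * (+ 2 * e)
          ≡⟨ cong₂ (λ u v → u + v + σ M * (+ 2 * e)) (sym Ψ-even) (sym odd-part) ⟩
        Σ[ S₀ ] Ψ + Σ[ S₁ ] Ψ + σ M * (+ 2 * e)
          ≡⟨ cong (_+ σ M * (+ 2 * e)) (sym (Σ-split S pe? Ψ)) ⟩
        Σ[ S ] Ψ + σ M * (+ 2 * e) ∎
        where
        open ≡-Reasoning
        e o : ℤ
        e = Σ[ positive E h₃ ] (uncurry₃ G₁)
        o = Σ[ restrict (positive S gap) (¬? ∘ pe?) ] Ψ
        lem : ∀ s e o → + 2 * (s * e + o) ≡ 0ℤ + + 2 * o + s * (+ 2 * e)
        lem = solve-∀

      -- `antisymmetric-sum` trades the half h > 0 of E for A. To this is added the relation of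
      -- `odd-sum` for g, which costs nothing but boundary terms and changes the weights on A and E.
      liouville : + 2 * Σ[ positive E h₃ ] (uncurry₃ G₁)
        ≡ Σ[ A ] (λ v → uncurry₃ G₁ v + + 2 * uncurry₃ g v) + - Σ[ E ] (uncurry₃ g)
          + (+ 2 * Σ[ vanishing (positive E h₃) t ] (uncurry₃ G₁) + Σ[ vanishing E t ] (uncurry₃ g) + - (+ 2 * Σ[ vanishing A s ] (uncurry₃ g)))
      liouville = begin
        + 2 * Σ[ positive E h₃ ] (uncurry₃ G₁)
          ≡⟨ antisymmetric-sum E A G₁ G₁-anti G₁-mirror G₁-zero ⟩
        a₁ + + 2 * b₁
          ≡⟨ lem a₁ b₁ a₂ b₂ b₃ ⟩
        (a₁ + + 2 * a₂) + - (+ 2 * a₂ + b₂ + - (+ 2 * b₃)) + (+ 2 * b₁ + b₂ + - (+ 2 * b₃))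
          ≡⟨ cong₂ (λ u v → u + - (v + - (+ 2 * b₃)) + (+ 2 * b₁ + b₂ + - (+ 2 * b₃)))
               (sym (trans (Σ-+ A (uncurry₃ G₁) (λ v → + 2 * uncurry₃ g v)) (cong (λ z → a₁ + z) (Σ-* A (+ 2) (uncurry₃ g)))))
               (odd-sum E A g g-odd g-even) ⟩
        Σ[ A ] (λ v → uncurry₃ G₁ v + + 2 * uncurry₃ g v) + - (Σ[ E ] (uncurry₃ g) + + 2 * b₃ + - (+ 2 * b₃)) + (+ 2 * b₁ + b₂ + - (+ 2 * b₃))
          ≡⟨ cong (λ z → Σ[ A ] (λ v → uncurry₃ G₁ v + + 2 * uncurry₃ g v) + - z + (+ 2 * b₁ + b₂ + - (+ 2 * b₃))) (lem₂ (Σ[ E ] (uncurry₃ g)) b₃) ⟩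
        _ ∎
        where
        open ≡-Reasoning
        a₁ a₂ b₁ b₂ b₃ : ℤ
        a₁ = Σ[ A ] (uncurry₃ G₁)
        a₂ = Σ[ A ] (uncurry₃ g)
        b₁ = Σ[ vanishing (positive E h₃) t ] (uncurry₃ G₁)
        b₂ = Σ[ vanishing E t ] (uncurry₃ g)
        b₃ = Σ[ vanishing A s ] (uncurry₃ g)
        lem : ∀ a₁ b₁ a₂ b₂ b₃ → a₁ + + 2 * b₁ ≡ (a₁ + + 2 * a₂) + - (+ 2 * a₂ + b₂ + - (+ 2 * b₃)) + (+ 2 * b₁ + b₂ + - (+ 2 * b₃))
        lem = solve-∀
        lem₂ : ∀ e b → e + + 2 * b + - (+ 2 * b) ≡ e
        lem₂ = solve-∀
        G₁-anti : ∀ x y h → G₁ y x h ≡ - G₁ x y h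
        G₁-anti x y h = lem₃ (f (h + h)) x y
          where
          lem₃ : ∀ v x y → v * (+ 4 * (y * y) + - (+ 4 * (x * x))) ≡ - (v * (+ 4 * (x * x) + - (+ 4 * (y * y))))
          lem₃ = solve-∀
        G₁-mirror : ∀ x y h → G₁ (- y) (- x) (- h) ≡ G₁ x y h
        G₁-mirror x y h = trans (cong (_* (+ 4 * (- y * - y) + - (+ 4 * (- x * - x)))) (trans (cong f (sym (ℤ.neg-distrib-+ h h))) (f-odd (h + h)))) (lem₃ (f (h + h)) x y)
          where
          lem₃ : ∀ v x y → - v * (+ 4 * (- y * - y) + - (+ 4 * (- x * - x))) ≡ v * (+ 4 * (x * x) + - (+ 4 * (y * y)))
          lem₃ = solve-∀
        G₁-zero : ∀ x y → G₁ x y 0ℤ ≡ 0ℤ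
        G₁-zero x y = trans (cong (_* (+ 4 * (x * x) + - (+ 4 * (y * y)))) f-0) (ℤ.*-zeroˡ (+ 4 * (x * x) + - (+ 4 * (y * y))))

      -- From w² + 2 u c = M the constant sign of M is that of w, so sums over A become weighted
      -- sums over S₂.
      σΣA : ∀ g → σ M * Σ[ A ] (uncurry₃ g) ≡ Σ[ S₂ ] (weighted (λ u w c → g (c + w) (w + - u) (c + w + - u)))
      σΣA g = trans (sym (Σ-* A (σ M) (uncurry₃ g))) (sym (Σ-bij S₂↔A S₂ A λ (u , w , c) (_ , _ , e) → cong (_* g (c + w) (w + - u) (c + w + - u))
        (trans (sym (trans (cong (_* 1ℤ) (σ-sq w)) (ℤ.*-identityʳ (σ w)))) (trans (cong (σ (w * w) *_) (sym (σ-even-* (u + u) c (σ-double u)))) (trans (sym (σ-+ (w * w) ((u + u) * c))) (cong σ e))))))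

      -- On each triple (-1)ⁿ is twice the indicator of even n, minus 1; the even n are the triples
      -- of S₂ with n = 2u.
      parity-expand : ∀ h → Σ[ S ] (λ (n , k , d) → σ k * (σ n * h n k d)) ≡ Σ[ S₂ ] (weighted (λ u w c → + 2 * h (u + u) w c)) + - Σ[ S ] (weighted h)
      parity-expand h = begin
        Σ[ S ] Φ
          ≡⟨ Σ-split S ne? Φ ⟩
        Σ[ Se ] Φ + Σ[ So ] Φ
          ≡⟨ cong₂ _+_ (Σ-cong Se (λ { (n , k , d) (_ , e) → cong (σ k *_) (trans (cong (_* h n k d) e) (ℤ.*-identityˡ (h n k d))) }))
                       (trans (Σ-cong So (λ { (n , k , d) (_ , ¬e) → trans (cong (λ z → σ k * (z * h n k d)) (odd n ¬e)) (lem (σ k) (h n k d)) })) (Σ-neg So (weighted h))) ⟩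
        Σ[ Se ] (weighted h) + - Σ[ So ] (weighted h)
          ≡⟨ lem₂ (Σ[ Se ] (weighted h)) (Σ[ So ] (weighted h)) ⟩
        + 2 * Σ[ Se ] (weighted h) + - (Σ[ Se ] (weighted h) + Σ[ So ] (weighted h))
          ≡⟨ cong₂ (λ x y → x + - y) to-S₂ (sym (Σ-split S ne? (weighted h))) ⟩
        Σ[ S₂ ] (weighted (λ u w c → + 2 * h (u + u) w c)) + - Σ[ S ] (weighted h) ∎
        where
        open ≡-Reasoning
        Φ : ℤ³ → ℤ
        Φ (n , k , d) = σ k * (σ n * h n k d)
        ne? : ∀ (a : ℤ³) → Dec (Even (proj₁ a))
        ne? (n , k , d) = even? n
        Se : Region (λ a → InS M a × Even (proj₁ a))
        Se = restrict S ne?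
        So : Region (λ a → InS M a × ¬ Even (proj₁ a))
        So = restrict S (¬? ∘ ne?)
        lem : ∀ a b → a * (-1ℤ * b) ≡ - (a * b)
        lem = solve-∀
        lem₂ : ∀ a b → a + - b ≡ + 2 * a + - (a + b)
        lem₂ = solve-∀
        to-S₂ : + 2 * Σ[ Se ] (weighted h) ≡ Σ[ S₂ ] (weighted (λ u w c → + 2 * h (u + u) w c))
        to-S₂ = trans (sym (Σ-* Se (+ 2) (weighted h))) (Σ-bij S↔S₂ Se S₂ λ { a@(n , k , d) q →
          trans (cong (λ v → + 2 * weighted h v) (sym (from-to S↔S₂ {a} q))) (lem₃ (σ k) (h (half n + half n) k d)) })
          where
          lem₃ : ∀ a b → + 2 * (a * b) ≡ a * (+ 2 * b)
          lem₃ = solve-∀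

      Γ : ℤ
      Γ = Σ[ S ] (λ (n , k , d) → σ k * (σ n * γ n k d))

      -- The map (n , k , d) ↦ (d , -k , n) fixes γ and reverses the sign of n when n + d is odd, so
      -- only the triples of E remain, where γ is congruent to g.
      γ-sum : p ∣ Γ + - (σ M * Σ[ E ] (uncurry₃ g))
      γ-sum = subst (p ∣_) (sym eq) (∣m⇒∣-m (Σ-∣ E λ { (x , y , h) _ → ∣n⇒∣m*n (σ M) (g-γ x y h) }))
        where
        open ≡-Reasoning
        Φ : ℤ³ → ℤ
        Φ (n , k , d) = σ k * (σ n * γ n k d)
        γE : ℤ³ → ℤ
        γE (x , y , h) = γ (x + - h) y (x + h)
        odd-zero : Σ[ S₁ ] Φ ≡ 0ℤ
        odd-zero = Σ-cancel S₁ (record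
          { to = λ (n , k , d) → d , - k , n ; from = λ (n , k , d) → d , - k , n
          ; to-in = λ { {n , k , d} (s , e) → to-in flip-S {d , k , n} (to-in swap-S {n , k , d} s) , λ e′ → e (even-swap d n e′) }
          ; from-in = λ { {n , k , d} (s , e) → to-in flip-S {d , k , n} (to-in swap-S {n , k , d} s) , λ e′ → e (even-swap d n e′) }
          ; from-to = λ { {n , k , d} _ → triple refl (ℤ.neg-involutive k) refl }
          ; to-from = λ { {n , k , d} _ → triple refl (ℤ.neg-involutive k) refl } })
          λ { (n , k , d) (_ , e) → trans (lem (σ k) (σ n) (γ n k d)) (cong -_ (trans (cong (λ z → z * (- σ n * γ n k d)) (sym (σ-neg k)))
                (cong₂ (λ s w → σ (- k) * (s * w)) (sym (σ-odd-pair n d e)) (sym (γ-mirror n k d))))) }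
          where
          lem : ∀ a b c → a * (b * c) ≡ - (a * (- b * c))
          lem = solve-∀
        even-E : Σ[ S₀ ] Φ ≡ Σ[ E ] (λ v → σ M * γE v)
        even-E = Σ-bij to-E S₀ E λ { a q → trans (cong Φ (sym (from-to to-E {a} q))) (on-E (to to-E a) (to-in to-E {a} q)) }
          where
          on-E : ∀ v → InE M v → Φ (from to-E v) ≡ σ M * γE v
          on-E (x , y , h) (_ , _ , e) = trans (sym (ℤ.*-assoc (σ y) (σ (x + - h)) _)) (cong (_* γ (x + - h) y (x + h)) (σM x y h e))
        eq : Γ + - (σ M * Σ[ E ] (uncurry₃ g)) ≡ - Σ[ E ] (λ v → σ M * (uncurry₃ g v + - γE v))
        eq = begin
          Γ + - (σ M * Σ[ E ] (uncurry₃ g))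
            ≡⟨ cong₂ (λ u v → u + - v) (trans (Σ-split S pe? Φ) (trans (cong₂ _+_ even-E odd-zero) (ℤ.+-identityʳ (Σ[ E ] (λ v → σ M * γE v))))) (sym (Σ-* E (σ M) (uncurry₃ g))) ⟩
          Σ[ E ] (λ v → σ M * γE v) + - Σ[ E ] (λ v → σ M * uncurry₃ g v)
            ≡⟨ lem (Σ[ E ] (λ v → σ M * γE v)) (Σ[ E ] (λ v → σ M * uncurry₃ g v)) ⟩
          - (Σ[ E ] (λ v → σ M * uncurry₃ g v) + - Σ[ E ] (λ v → σ M * γE v))
            ≡⟨ cong (λ z → - (Σ[ E ] (λ v → σ M * uncurry₃ g v) + z)) (sym (Σ-neg E (λ v → σ M * γE v))) ⟩
          - (Σ[ E ] (λ v → σ M * uncurry₃ g v) + Σ[ E ] (λ v → - (σ M * γE v)))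
            ≡⟨ cong -_ (sym (Σ-+ E (λ v → σ M * uncurry₃ g v) (λ v → - (σ M * γE v)))) ⟩
          - Σ[ E ] (λ v → σ M * uncurry₃ g v + - (σ M * γE v))
            ≡⟨ cong -_ (Σ-cong E (λ v _ → lem₂ (σ M) (uncurry₃ g v) (γE v))) ⟩
          - Σ[ E ] (λ v → σ M * (uncurry₃ g v + - γE v)) ∎
          where
          lem : ∀ a b → a + - b ≡ - (b + - a)
          lem = solve-∀
          lem₂ : ∀ s a b → s * a + - (s * b) ≡ s * (a + - b)
          lem₂ = solve-∀

      divide-4 : ∀ z → p ∣ + 4 * z → p ∣ z
      divide-4 z d = subst (p ∣_) eq (∣m∣n⇒∣m+n (∣n⇒∣m*n quarter d) (∣m⇒∣-m (∣m⇒∣m*n z (divides quotient refl))))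
        where
        eq : quarter * (+ 4 * z) + - (quotient * p * z) ≡ z
        eq = trans (cong (_+ - (quotient * p * z)) (trans (sym (ℤ.*-assoc quarter (+ 4) z)) (cong (_* z) quarter-inverse))) (lem (quotient * p) z)
          where
          lem : ∀ q z → (1ℤ + q) * z + - (q * z) ≡ z
          lem = solve-∀

      S-part : p ∣ Σ[ S ] (weighted onS)
      S-part = divide-4 (Σ[ S ] (weighted onS)) (subst (p ∣_) (sym (Σ-symmetrized S swap-S flip-S (λ _ _ _ → refl) (λ _ _ _ → refl) onS))
        (Σ-∣ S λ (n , k , d) _ → ∣n⇒∣m*n (σ k) (onS-vanishes n k d)))

      S₂-part : p ∣ Σ[ S₂ ] (weighted onS₂)
      S₂-part = divide-4 (Σ[ S₂ ] (weighted onS₂)) (subst (p ∣_) (sym (Σ-symmetrized S₂ swap-S₂ flip-S₂ (λ _ _ _ → refl) (λ _ _ _ → refl) onS₂))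
        (Σ-∣ S₂ λ (u , w , c) _ → ∣n⇒∣m*n (σ w) (onS₂-vanishes u w c)))

      weighted-+ : ∀ {P : ℤ³ → Set} (R : Region P) x y → Σ[ R ] (weighted (λ n k d → x n k d + y n k d)) ≡ Σ[ R ] (weighted x) + Σ[ R ] (weighted y)
      weighted-+ R x y = trans (Σ-cong R (λ (n , k , d) _ → ℤ.*-distribˡ-+ (σ k) (x n k d) (y n k d))) (Σ-+ R (weighted x) (weighted y))

      weighted-neg : ∀ {P : ℤ³ → Set} (R : Region P) x → Σ[ R ] (weighted (λ n k d → - x n k d)) ≡ - Σ[ R ] (weighted x)
      weighted-neg R x = trans (Σ-cong R (λ (n , k , d) _ → sym (ℤ.neg-distribʳ-* (σ k) (x n k d)))) (Σ-neg R (weighted x))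

    total : ℤ³ → ℤ
    total (n , k , d) = σ k * (+ 2 * (σ n * ([ n < d ] * WF n k d)) + a n k d + onEven n (λ u → b u k d))

    private
      total-sum : Σ[ S ] total ≡ + 2 * W + Σ[ S ] (weighted a) + Σ[ S₂ ] (weighted b)
      total-sum = begin
        Σ[ S ] total
          ≡⟨ Σ-cong S (λ (n , k , d) _ → lem (σ k) (σ n) [ n < d ] (WF n k d) (a n k d) (onEven n (λ u → b u k d))) ⟩
        Σ[ S ] (λ v → + 2 * W₁ v + weighted a v + B₁ v)
          ≡⟨ trans (Σ-+ S (λ v → + 2 * W₁ v + weighted a v) B₁) (cong (_+ Σ[ S ] B₁) (trans (Σ-+ S (λ v → + 2 * W₁ v) (weighted a)) (cong (_+ Σ[ S ] (weighted a)) (Σ-* S (+ 2) W₁)))) ⟩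
        + 2 * Σ[ S ] W₁ + Σ[ S ] (weighted a) + Σ[ S ] B₁
          ≡⟨ cong₂ (λ x y → + 2 * x + Σ[ S ] (weighted a) + y) W₁≡ B₁≡ ⟩
        + 2 * W + Σ[ S ] (weighted a) + Σ[ S₂ ] (weighted b) ∎
        where
        open ≡-Reasoning
        W₁ B₁ : ℤ³ → ℤ
        W₁ (n , k , d) = [ n < d ] * (σ k * (σ n * WF n k d))
        B₁ (n , k , d) = σ k * onEven n (λ u → b u k d)
        lem : ∀ s s′ l w a b → s * (+ 2 * (s′ * (l * w)) + a + b) ≡ + 2 * (l * (s * (s′ * w))) + s * a + s * b
        lem = solve-∀
        gap? : ∀ (v : ℤ³) → Dec (Pos (gap v))
        gap? v = pos? (gap v)
        W₁≡ : Σ[ S ] W₁ ≡ W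
        W₁≡ = trans (Σ-split S gap? W₁) (trans (cong₂ _+_
          (Σ-cong (restrict S gap?) (λ { (n , k , d) (_ , r) → trans (cong (_* (σ k * (σ n * WF n k d))) ([<]-yes n d r)) (ℤ.*-identityˡ _) }))
          (Σ-zero (restrict S (¬? ∘ gap?)) (λ { (n , k , d) (_ , r) → trans (cong (_* (σ k * (σ n * WF n k d))) ([<]-no n d r)) (ℤ.*-zeroˡ (σ k * (σ n * WF n k d))) })))
          (ℤ.+-identityʳ W))
        ne? : ∀ (v : ℤ³) → Dec (Even (proj₁ v))
        ne? (n , k , d) = even? n
        B₁≡ : Σ[ S ] B₁ ≡ Σ[ S₂ ] (weighted b)
        B₁≡ = trans (Σ-split S ne? B₁) (trans (cong₂ _+_
          (Σ-bij S↔S₂ (restrict S ne?) S₂ (λ { (n , k , d) (_ , e) → cong (σ k *_) (onEven-yes n (λ u → b u k d) e) }))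
          (Σ-zero (restrict S (¬? ∘ ne?)) (λ { (n , k , d) (_ , ¬e) → trans (cong (σ k *_) (onEven-no n (λ u → b u k d) ¬e)) (ℤ.*-zeroʳ (σ k)) })))
          (ℤ.+-identityʳ _))

      BD : ℤ
      BD = + 2 * Σ[ vanishing (positive E h₃) t ] (uncurry₃ G₁) + Σ[ vanishing E t ] (uncurry₃ g) + - (+ 2 * Σ[ vanishing A s ] (uncurry₃ g))

      -- Inserting Γ and subtracting it again moves the sum of g over E to S and S₂, so that
      -- polynomial weights are left only on those two regions, apart from the boundary.
      reorganized : Σ[ S ] total ≡ Σ[ S ] (weighted onS) + Σ[ S₂ ] (weighted onS₂) + (Γ + - (σ M * Σ[ E ] (uncurry₃ g))) + σ M * BD
      reorganized = begin
        Σ[ S ] total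
          ≡⟨ total-sum ⟩
        + 2 * W + α + β
          ≡⟨ cong (λ z → z + α + β) (trans twice-W (cong (λ z → Σ[ S ] Ψ + σ M * z) liouville)) ⟩
        Σ[ S ] Ψ + σ M * (ΣA + - e + BD) + α + β
          ≡⟨ cong (λ z → z + σ M * (ΣA + - e + BD) + α + β) (parity-expand WF) ⟩
        (w₂ + - w₁) + σ M * (ΣA + - e + BD) + α + β
          ≡⟨ lem w₂ w₁ (σ M) ΣA e BD α β (Σ[ S₂ ] (weighted (λ u w c → + 2 * γ (u + u) w c))) (Σ[ S ] (weighted γ)) ⟩
        (α + Σ[ S ] (weighted γ) + - w₁) + (β + (w₂ + - Σ[ S₂ ] (weighted (λ u w c → + 2 * γ (u + u) w c))) + σ M * ΣA)
          + ((Σ[ S₂ ] (weighted (λ u w c → + 2 * γ (u + u) w c)) + - Σ[ S ] (weighted γ)) + - (σ M * e)) + σ M * BD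
          ≡⟨ cong₂ (λ x y → x + y + σ M * BD) (cong₂ _+_ (sym onS-sum) (sym onS₂-sum)) (cong (_+ - (σ M * e)) (sym (parity-expand γ))) ⟩
        Σ[ S ] (weighted onS) + Σ[ S₂ ] (weighted onS₂) + (Γ + - (σ M * e)) + σ M * BD ∎
        where
        open ≡-Reasoning
        α β w₁ w₂ ΣA e : ℤ
        α = Σ[ S ] (weighted a)
        β = Σ[ S₂ ] (weighted b)
        w₁ = Σ[ S ] (weighted WF)
        w₂ = Σ[ S₂ ] (weighted (λ u w c → + 2 * WF (u + u) w c))
        ΣA = Σ[ A ] (λ v → uncurry₃ G₁ v + + 2 * uncurry₃ g v)
        e = Σ[ E ] (uncurry₃ g)
        lem : ∀ w₂ w₁ m A e B α β g₂ g₁ → (w₂ + - w₁) + m * (A + - e + B) + α + β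
              ≡ (α + g₁ + - w₁) + (β + (w₂ + - g₂) + m * A) + ((g₂ + - g₁) + - (m * e)) + m * B
        lem = solve-∀
        onS-sum : Σ[ S ] (weighted onS) ≡ α + Σ[ S ] (weighted γ) + - w₁
        onS-sum = trans (weighted-+ S (λ n k d → a n k d + γ n k d) (λ n k d → - WF n k d)) (cong₂ _+_ (weighted-+ S a γ) (weighted-neg S WF))
        onS₂-sum : Σ[ S₂ ] (weighted onS₂) ≡ β + (w₂ + - Σ[ S₂ ] (weighted (λ u w c → + 2 * γ (u + u) w c))) + σ M * ΣA
        onS₂-sum = trans (weighted-+ S₂ (λ u w c → b u w c + + 2 * (WF (u + u) w c + - γ (u + u) w c)) (λ u w c → G₁ (c + w) (w + - u) (c + w + - u) + + 2 * g (c + w) (w + - u) (c + w + - u)))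
          (cong₂ _+_ (trans (weighted-+ S₂ b (λ u w c → + 2 * (WF (u + u) w c + - γ (u + u) w c))) (cong (λ z → β + z)
            (trans (Σ-cong S₂ (λ (u , w , c) _ → cong (σ w *_) (lem₂ (WF (u + u) w c) (γ (u + u) w c))))
              (trans (weighted-+ S₂ (λ u w c → + 2 * WF (u + u) w c) (λ u w c → - (+ 2 * γ (u + u) w c))) (cong (λ z → w₂ + z) (weighted-neg S₂ (λ u w c → + 2 * γ (u + u) w c)))))))
            (sym (σΣA (λ x y h → G₁ x y h + + 2 * g x y h))))
          where
          lem₂ : ∀ x y → + 2 * (x + - y) ≡ + 2 * x + - (+ 2 * y)
          lem₂ = solve-∀

    total-divisible : p ∣ Σ[ S ] total
    total-divisible = subst (p ∣_) (sym reorganized)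
      (∣m∣n⇒∣m+n (∣m∣n⇒∣m+n (∣m∣n⇒∣m+n S-part S₂-part) γ-sum) (∣n⇒∣m*n (σ M) (boundary G₁ g F F-step F-base)))

-- Polynomial congruences and the certificates modulo 3 and 5.

module Certificates where
  open EvenForms
  open import Data.Bool using (T)
  open import Data.Integer using (_+_; _*_; -_)
  open import Data.Integer.Divisibility.Signed using (_∣_; divides; ∣m∣n⇒∣m+n; ∣m⇒∣-m; ∣n⇒∣m*n; ∣m⇒∣m*n)

  infixl 6 _⊞_
  infixl 7 _⊠_
  infix  8 ⊟_
  data Expr : Set where
    v₀ v₁ v₂ : Expr
    #_      : ℤ → Expr
    _⊞_ _⊠_ : Expr → Expr → Expr
    ⊟_      : Expr → Expr

  ⟦_⟧ : Expr → ℤ → ℤ → ℤ → ℤ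
  ⟦ v₀ ⟧     x y z = x
  ⟦ v₁ ⟧     x y z = y
  ⟦ v₂ ⟧     x y z = z
  ⟦ # c ⟧   x y z = c
  ⟦ e ⊞ e′ ⟧ x y z = ⟦ e ⟧ x y z + ⟦ e′ ⟧ x y z
  ⟦ e ⊠ e′ ⟧ x y z = ⟦ e ⟧ x y z * ⟦ e′ ⟧ x y z
  ⟦ ⊟ e ⟧   x y z = - ⟦ e ⟧ x y z

  -- A polynomial with integer coefficients vanishes modulo m as soon as it does at the residues 0, …, m − 1.
  module Residues (m : ℕ) .{{_ : ℕ.NonZero m}} where
    private
      p : ℤ
      p = + m

      below : ℕ → (ℕ → Bool) → Bool
      below zero    t = true
      below (suc n) t = t n ∧ below n t

      below-sound : ∀ n t → T (below n t) → ∀ i → i ℕ.< n → T (t i)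
      below-sound (suc n) t ok i (s≤s i≤n) with t n in eq | i ℕ.≟ n
      ... | true | yes refl = subst T (sym eq) tt
      ... | true | no i≢n   = below-sound n t ok i (ℕ.≤∧≢⇒< i≤n i≢n)

      divides? : ℤ → Bool
      divides? z = (z ℤ.%ℕ m) ℕ.≡ᵇ 0

      divides?-sound : ∀ z → T (divides? z) → p ∣ z
      divides?-sound z ok = divides (z ℤ./ℕ m) (trans (ℤ.a≡a%ℕn+[a/ℕn]*n z m)
        (trans (cong (λ r → + r + (z ℤ./ℕ m) * p) (ℕ.≡ᵇ⇒≡ (z ℤ.%ℕ m) 0 ok)) (ℤ.+-identityˡ _)))

      residue : ∀ x → p ∣ x + - + (x ℤ.%ℕ m)
      residue x = divides (x ℤ./ℕ m) (trans (cong (_+ - + (x ℤ.%ℕ m)) (ℤ.a≡a%ℕn+[a/ℕn]*n x m)) (lem (+ (x ℤ.%ℕ m)) ((x ℤ./ℕ m) * p)))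
        where
        lem : ∀ a b → a + b + - a ≡ b
        lem = solve-∀

      ⟦⟧-cong : ∀ e {x y z x′ y′ z′} → p ∣ x + - x′ → p ∣ y + - y′ → p ∣ z + - z′ → p ∣ ⟦ e ⟧ x y z + - ⟦ e ⟧ x′ y′ z′
      ⟦⟧-cong v₀ a b c = a
      ⟦⟧-cong v₁ a b c = b
      ⟦⟧-cong v₂ a b c = c
      ⟦⟧-cong (# i) a b c = divides 0ℤ (ℤ.+-inverseʳ i)
      ⟦⟧-cong (e ⊞ e′) {x} {y} {z} {x′} {y′} {z′} a b c = subst (p ∣_) (lem (⟦ e ⟧ x y z) (⟦ e′ ⟧ x y z) (⟦ e ⟧ x′ y′ z′) (⟦ e′ ⟧ x′ y′ z′))
        (∣m∣n⇒∣m+n (⟦⟧-cong e a b c) (⟦⟧-cong e′ a b c))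
        where
        lem : ∀ a b c d → a + - c + (b + - d) ≡ a + b + - (c + d)
        lem = solve-∀
      ⟦⟧-cong (e ⊠ e′) {x} {y} {z} {x′} {y′} {z′} a b c = subst (p ∣_) (lem (⟦ e ⟧ x y z) (⟦ e′ ⟧ x y z) (⟦ e ⟧ x′ y′ z′) (⟦ e′ ⟧ x′ y′ z′))
        (∣m∣n⇒∣m+n (∣m⇒∣m*n (⟦ e′ ⟧ x y z) (⟦⟧-cong e a b c)) (∣n⇒∣m*n (⟦ e ⟧ x′ y′ z′) (⟦⟧-cong e′ a b c)))
        where
        lem : ∀ a b c d → (a + - c) * b + c * (b + - d) ≡ a * b + - (c * d)
        lem = solve-∀
      ⟦⟧-cong (⊟ e) {x} {y} {z} {x′} {y′} {z′} a b c = subst (p ∣_) (lem (⟦ e ⟧ x y z) (⟦ e ⟧ x′ y′ z′)) (∣m⇒∣-m (⟦⟧-cong e a b c))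
        where
        lem : ∀ a b → - (a + - b) ≡ - a + - - b
        lem = solve-∀

    -- It evaluates to `true` on the closed expressions below, and this computation, accepted
    -- through `tt`, is the proof of the congruences in the certificates.
    check : Expr → Bool
    check e = below m λ i → below m λ j → below m λ k → divides? (⟦ e ⟧ (+ i) (+ j) (+ k))

    vanishes : ∀ e → T (check e) → ∀ x y z → p ∣ ⟦ e ⟧ x y z
    vanishes e ok x y z = subst (p ∣_) (lem (⟦ e ⟧ x y z) (⟦ e ⟧ (+ i) (+ j) (+ k)))
      (∣m∣n⇒∣m+n (⟦⟧-cong e (residue x) (residue y) (residue z))
        (divides?-sound _ (below-sound m _ (below-sound m _ (below-sound m _ ok i (ℤ.n%ℕd<d x m)) j (ℤ.n%ℕd<d y m)) k (ℤ.n%ℕd<d z m))))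
      where
      i j k : ℕ
      i = x ℤ.%ℕ m
      j = y ℤ.%ℕ m
      k = z ℤ.%ℕ m
      lem : ∀ a b → a + - b + b ≡ a
      lem = solve-∀

  -- The derived weights over an arbitrary carrier, to be read both as integers and as expressions.
  record Arithmetic : Set₁ where
    infixl 6 _⊹_
    infixl 7 _⊗_
    infix  8 ∼_
    field
      Carrier : Set
      _⊹_ _⊗_ : Carrier → Carrier → Carrier
      ∼_      : Carrier → Carrier
      lit     : ℤ → Carrier

  integers expressions : Arithmetic
  integers = record { Carrier = ℤ ; _⊹_ = _+_ ; _⊗_ = _*_ ; ∼_ = -_ ; lit = λ c → c }
  expressions = record { Carrier = Expr ; _⊹_ = _⊞_ ; _⊗_ = _⊠_ ; ∼_ = ⊟_ ; lit = #_ }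

  module Derived (𝔸 : Arithmetic) where
    open Arithmetic 𝔸

    module Of (f : Carrier → Carrier) (g γ a b : Carrier → Carrier → Carrier → Carrier) (F : Carrier → Carrier → Carrier) where
      WF G₁ onS onS₂ : Carrier → Carrier → Carrier → Carrier
      WF n k d = f (d ⊹ (∼ n)) ⊗ ((d ⊹ n) ⊗ (d ⊹ n) ⊹ (∼ (lit (+ 4) ⊗ (k ⊗ k))))
      G₁ x y h = f (h ⊹ h) ⊗ (lit (+ 4) ⊗ (x ⊗ x) ⊹ (∼ (lit (+ 4) ⊗ (y ⊗ y))))
      onS n k d = a n k d ⊹ γ n k d ⊹ (∼ WF n k d)
      onS₂ u w c = b u w c ⊹ lit (+ 2) ⊗ (WF (u ⊹ u) w c ⊹ (∼ γ (u ⊹ u) w c))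
        ⊹ (G₁ (c ⊹ w) (w ⊹ (∼ u)) (c ⊹ w ⊹ (∼ u)) ⊹ lit (+ 2) ⊗ g (c ⊹ w) (w ⊹ (∼ u)) (c ⊹ w ⊹ (∼ u)))
      sym₄ : (Carrier → Carrier → Carrier → Carrier) → Carrier → Carrier → Carrier → Carrier
      sym₄ A n k d = A n k d ⊹ A n (∼ k) d ⊹ (A d k n ⊹ A d (∼ k) n)
      step : Carrier → Carrier → Carrier
      step X H = lit (+ 2) ⊗ G₁ X H H ⊹ g X H H ⊹ g X (∼ H) (∼ H) ⊹ (∼ (lit (+ 2) ⊗ g H (∼ X) (∼ H)))
        ⊹ (∼ (F X (H ⊹ lit 1ℤ) ⊹ (∼ F X H)))
      base : Carrier → Carrier
      base X = g X (lit 0ℤ) (lit 0ℤ) ⊹ (F X X ⊹ (∼ F X (lit 1ℤ)))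
      match : Carrier → Carrier → Carrier → Carrier
      match x y h = g x y h ⊹ (∼ γ (x ⊹ (∼ h)) y (x ⊹ h))

  module Mod3 where
    module W (𝔸 : Arithmetic) where
      open Arithmetic 𝔸
      -- Chosen so that j² f(j) = j³ ≡ j (mod 3), with j = d - n.
      f : Carrier → Carrier
      f j = j
      g γ a b : Carrier → Carrier → Carrier → Carrier
      g x y h = lit 0ℤ
      γ n k d = lit 0ℤ
      -- With X = n d - k², weights c₁ = 4 v and c₂ = 2 v combine to c₁ + 2 X c₂ = 4 (1 + X) v. In a
      -- this is applied to v = 3 n, and in b to v = -2u, the two polynomial pieces of `evenWeight`.
      a n k d = lit (+ 4) ⊗ ((lit 1ℤ ⊹ (n ⊗ d ⊹ (∼ (k ⊗ k)))) ⊗ (lit (+ 3) ⊗ n))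
      b u k d = lit (+ 4) ⊗ ((lit 1ℤ ⊹ ((u ⊹ u) ⊗ d ⊹ (∼ (k ⊗ k)))) ⊗ (∼ (u ⊹ u)))
      F : Carrier → Carrier → Carrier
      -- As H³ ≡ H, the boundary weight 16 H (X² - H²) is congruent to (X² - 1) H. The difference of
      -- F in H is 4 (X² - 1) H, congruent to the same.
      F X H = lit (+ 2) ⊗ (X ⊗ X ⊹ lit -1ℤ) ⊗ (H ⊗ (H ⊹ lit -1ℤ))
      open Derived.Of 𝔸 f g γ a b F public
    private
      module I = W integers
      module E = W expressions
    open Residues 3

    weights : Weights
    weights = record { f = I.f ; g = I.g ; γ = I.γ ; a = I.a ; b = I.b ; F = I.F }

    certificate : Certificate (+ 3) weights
    certificate = record
      { quarter = 1ℤ ; quotient = 1ℤ ; quarter-inverse = refl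
      ; f-odd = λ _ → refl ; g-odd = λ _ _ _ → refl ; g-even = λ _ _ _ → refl ; γ-mirror = λ _ _ _ → refl
      ; g-γ = vanishes (E.match v₀ v₁ v₂) tt
      ; F-step = λ x h → vanishes (E.step v₀ v₁) tt x h 0ℤ
      ; F-base = λ x → vanishes (E.base v₀) tt x 0ℤ 0ℤ
      ; onS-vanishes = vanishes (E.sym₄ E.onS v₀ v₁ v₂) tt
      ; onS₂-vanishes = vanishes (E.sym₄ E.onS₂ v₀ v₁ v₂) tt
      }

  module Mod5 where
    module W (𝔸 : Arithmetic) where
      open Arithmetic 𝔸
      -- This odd polynomial satisfies (j² + 2) f(j) ≡ j⁵ + j ≡ 2 j (mod 5), so the weights j² f(j)
      -- and 2 f(j) add up to the term 2 j of `evenWeight`.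
      f : Carrier → Carrier
      f j = j ⊗ j ⊗ j ⊹ lit (+ 3) ⊗ j
      -- Free correction terms, on all n and on n = 2u. They enter c₁ and c₂ with the opposite
      -- factors -3 and 3, so c₁ + c₂ does not see them.
      e e₂ : Carrier → Carrier → Carrier
      e n d = lit (+ 4) ⊗ (n ⊗ n ⊗ n)
      e₂ u d = lit (+ 2) ⊗ (u ⊗ u ⊗ d) ⊹ lit (+ 2) ⊗ (u ⊗ u ⊗ u) ⊹ lit (+ 4) ⊗ u
      -- g and F were found by solving the linear system over 𝔽₅ that the certificate imposes on their coefficients.
      g γ a b : Carrier → Carrier → Carrier → Carrier
      g x y h = lit (+ 3) ⊗ (x ⊗ x ⊗ x) ⊗ (y ⊗ y) ⊹ lit (+ 4) ⊗ (x ⊗ x ⊗ x) ⊗ (h ⊗ h) ⊹ lit (+ 4) ⊗ (x ⊗ x ⊗ x)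
        ⊹ lit (+ 2) ⊗ x ⊗ (y ⊗ y ⊗ y ⊗ h) ⊹ lit (+ 4) ⊗ x ⊗ (y ⊗ y ⊗ (h ⊗ h)) ⊹ lit (+ 2) ⊗ x ⊗ (h ⊗ h)
        ⊹ lit (+ 4) ⊗ x ⊗ (h ⊗ h ⊗ (h ⊗ h)) ⊹ x
      -- Modulo 5 the number 3 is the inverse of 2, so this is g at x = (n + d)/2, y = k, h = (d -
      -- n)/2.
      γ n k d = g (lit (+ 3) ⊗ (n ⊹ d)) k (lit (+ 3) ⊗ (d ⊹ (∼ n)))
      -- The factor 6 X - 3, with X = n d - k², is -3 + 2 X · 3: the correction enters c₁ with -3
      -- and c₂ with 3. The leading 2 doubles the whole twisted weight.
      a n k d = lit (+ 2) ⊗ (lit (+ 3) ⊗ n ⊹ (lit (+ 6) ⊗ (n ⊗ d ⊹ (∼ (k ⊗ k))) ⊹ lit -[1+ 2 ]) ⊗ e n d)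
      b u k d = lit (+ 2) ⊗ ((∼ (u ⊹ u)) ⊹ (lit (+ 6) ⊗ ((u ⊹ u) ⊗ d ⊹ (∼ (k ⊗ k))) ⊹ lit -[1+ 2 ]) ⊗ e₂ u d)
      F : Carrier → Carrier → Carrier
      F X H = lit (+ 4) ⊗ (X ⊗ X ⊹ lit 1ℤ) ⊗ (H ⊗ (H ⊹ lit -1ℤ)) ⊹ (lit (+ 3) ⊗ (X ⊗ X ⊗ X) ⊹ lit (+ 2) ⊗ X) ⊗ H
        ⊹ lit (+ 4) ⊗ X ⊗ ((H ⊹ lit -1ℤ) ⊗ H ⊗ (lit (+ 2) ⊗ H ⊹ lit -1ℤ))
      open Derived.Of 𝔸 f g γ a b F public
    module I = W integers
    private
      module E = W expressions
    open Residues 5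

    weights : Weights
    weights = record { f = I.f ; g = I.g ; γ = I.γ ; a = I.a ; b = I.b ; F = I.F }

    certificate : Certificate (+ 5) weights
    certificate = record
      { quarter = -1ℤ ; quotient = -1ℤ ; quarter-inverse = refl
      ; f-odd = f-odd ; g-odd = g-odd ; g-even = g-even ; γ-mirror = γ-mirror
      ; g-γ = vanishes (E.match v₀ v₁ v₂) tt
      ; F-step = λ x h → vanishes (E.step v₀ v₁) tt x h 0ℤ
      ; F-base = λ x → vanishes (E.base v₀) tt x 0ℤ 0ℤ
      ; onS-vanishes = vanishes (E.sym₄ E.onS v₀ v₁ v₂) tt
      ; onS₂-vanishes = vanishes (E.sym₄ E.onS₂ v₀ v₁ v₂) tt
      }
      where
      f-odd : ∀ j → - j * - j * - j + + 3 * - j ≡ - (j * j * j + + 3 * j)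
      f-odd = solve-∀
      G : ℤ → ℤ → ℤ → ℤ
      G x y h = I.g x y h
      g-odd : ∀ x y h → I.g (- x) y h ≡ - I.g x y h
      g-odd x y h = lem x y h
        where
        lem : ∀ x y h → + 3 * (- x * - x * - x) * (y * y) + + 4 * (- x * - x * - x) * (h * h) + + 4 * (- x * - x * - x)
          + + 2 * - x * (y * y * y * h) + + 4 * - x * (y * y * (h * h)) + + 2 * - x * (h * h) + + 4 * - x * (h * h * (h * h)) + - x
          ≡ - (+ 3 * (x * x * x) * (y * y) + + 4 * (x * x * x) * (h * h) + + 4 * (x * x * x)
          + + 2 * x * (y * y * y * h) + + 4 * x * (y * y * (h * h)) + + 2 * x * (h * h) + + 4 * x * (h * h * (h * h)) + x)
        lem = solve-∀
      g-even : ∀ x y h → I.g x (- y) (- h) ≡ I.g x y h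
      g-even x y h = lem x y h
        where
        lem : ∀ x y h → + 3 * (x * x * x) * (- y * - y) + + 4 * (x * x * x) * (- h * - h) + + 4 * (x * x * x)
          + + 2 * x * (- y * - y * - y * - h) + + 4 * x * (- y * - y * (- h * - h)) + + 2 * x * (- h * - h) + + 4 * x * (- h * - h * (- h * - h)) + x
          ≡ + 3 * (x * x * x) * (y * y) + + 4 * (x * x * x) * (h * h) + + 4 * (x * x * x)
          + + 2 * x * (y * y * y * h) + + 4 * x * (y * y * (h * h)) + + 2 * x * (h * h) + + 4 * x * (h * h * (h * h)) + x
        lem = solve-∀
      γ-mirror : ∀ n k d → I.γ d (- k) n ≡ I.γ n k d
      γ-mirror n k d = trans (cong₂ (λ s t → I.g s (- k) t) (lem₁ n d) (lem₂ n d)) (g-even (+ 3 * (n + d)) k (+ 3 * (d + - n)))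
        where
        lem₁ : ∀ n d → + 3 * (d + n) ≡ + 3 * (n + d)
        lem₁ = solve-∀
        lem₂ : ∀ n d → + 3 * (n + - d) ≡ - (+ 3 * (d + - n))
        lem₂ = solve-∀

-- The odd case: cancellation by reflections.

module OddForms where
  open Regions
  open Parity
  open LiouvilleSums
  open BoundaryTerms
  open EvenForms
  open Certificates
  open import Data.Integer using (_+_; _*_; -_)
  open import Data.Integer.Divisibility.Signed using (_∣_; divides; ∣m∣n⇒∣m+n; ∣m⇒∣-m; ∣n⇒∣m*n)

  InT : ℤ → ℤ³ → Set
  InT N (n , k , d) = Pos n × Pos d × k * k + k * k + n * d ≡ N

  -- In the coordinates x = d + 2 k, y = 2 k − n, h = d + 2 k − n this is h (x² − y²).
  ω : ℤ → ℤ → ℤ → ℤ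
  ω n k d = (d + (k + k) + - n) * ((d + (k + k)) * (d + (k + k)) + - ((k + k + - n) * (k + k + - n)))

  module _ {N : ℤ} (odd-N : σ N ≡ -1ℤ) (T : Region (InT N)) where
    private
      odd-nd : ∀ n k d → InT N (n , k , d) → σ (n * d) ≡ -1ℤ
      odd-nd n k d (_ , _ , e) = trans (sym (trans (σ-+ (k * k + k * k) (n * d)) (trans (cong (_* σ (n * d)) (σ-double (k * k))) (ℤ.*-identityˡ _))))
        (trans (cong σ e) odd-N)

      1≢-1 : ∀ {z} → z ≡ 1ℤ → z ≢ -1ℤ
      1≢-1 refl ()

      odd-n : ∀ n k d → InT N (n , k , d) → σ n ≡ -1ℤ
      odd-n n k d i = odd n λ ev → 1≢-1 (σ-even-* n d ev) (odd-nd n k d i)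

      odd-d : ∀ n k d → InT N (n , k , d) → σ d ≡ -1ℤ
      odd-d n k d i = odd d λ ev → 1≢-1 (σ-even-* d n ev) (trans (cong σ (ℤ.*-comm d n)) (odd-nd n k d i))

      Ω : ℤ³ → ℤ
      Ω = weighted ω

      -- In the coordinates of ω one has x² + y² - h² = 2 N, n = x - h and d = h - y, while s₁ = x +
      -- h and s₂ = h + y. Their signs decide which of the three reflections preserves positivity.
      s₁ s₂ : ℤ³ → ℤ
      s₁ (n , k , d) = d + d + (k + k + (k + k)) + - n
      s₂ (n , k , d) = d + (k + k + (k + k)) + - (n + n)

      P₁ : Region (λ a → InT N a × Pos (s₁ a))
      P₁ = positive T s₁

      flip-sign : ∀ {s s′ x y} → s′ ≡ - s → y ≡ x → s * x ≡ - (s′ * y)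
      flip-sign {s} {x = x} refl refl = lem s x
        where
        lem : ∀ s x → s * x ≡ - (- s * x)
        lem = solve-∀

      -- The reflection x ↦ -x replaces n by -s₁ and k by -k - d, fixing d. The weight ω is even in
      -- x, and the sign of k changes because d is odd.
      reflect-x : Σ[ negative T s₁ ] Ω ≡ 0ℤ
      reflect-x = Σ-cancel (negative T s₁) (record
        { to = φ ; from = φ
        ; to-in = λ { {n , k , d} → inside n k d } ; from-in = λ { {n , k , d} → inside n k d }
        ; from-to = λ { {n , k , d} _ → triple (e₁ n k d) (e₂ k d) refl } ; to-from = λ { {n , k , d} _ → triple (e₁ n k d) (e₂ k d) refl } })
        λ { (n , k , d) (i , _) → flip-sign (trans (σ-+ (- k) (- d)) (trans (cong₂ _*_ (σ-neg k) (trans (σ-neg d) (odd-d n k d i))) (neg (σ k)))) (e₅ n k d) }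
        where
        φ : ℤ³ → ℤ³
        φ (n , k , d) = n + - (d + d + (k + k + (k + k))) , - k + - d , d
        neg : ∀ z → z * -1ℤ ≡ - z
        neg = solve-∀
        e₁ : ∀ n k d → n + - (d + d + (k + k + (k + k))) + - (d + d + (- k + - d + (- k + - d) + (- k + - d + (- k + - d)))) ≡ n
        e₁ = solve-∀
        e₂ : ∀ k d → - (- k + - d) + - d ≡ k
        e₂ = solve-∀
        e₃ : ∀ n k d → (- k + - d) * (- k + - d) + (- k + - d) * (- k + - d) + (n + - (d + d + (k + k + (k + k)))) * d ≡ k * k + k * k + n * d
        e₃ = solve-∀
        e₄ : ∀ n k d → - (d + d + (k + k + (k + k)) + - n) ≡ n + - (d + d + (k + k + (k + k)))
        e₄ = solve-∀
        e₅ : ∀ n k d → ω (n + - (d + d + (k + k + (k + k)))) (- k + - d) d ≡ ω n k d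
        e₅ n k d = lem n k d
          where
          lem : ∀ n k d → (d + (- k + - d + (- k + - d)) + - (n + - (d + d + (k + k + (k + k))))) * ((d + (- k + - d + (- k + - d))) * (d + (- k + - d + (- k + - d)))
                + - ((- k + - d + (- k + - d) + - (n + - (d + d + (k + k + (k + k))))) * (- k + - d + (- k + - d) + - (n + - (d + d + (k + k + (k + k)))))))
                ≡ (d + (k + k) + - n) * ((d + (k + k)) * (d + (k + k)) + - ((k + k + - n) * (k + k + - n)))
          lem = solve-∀
        e₆ : ∀ n k d → n ≡ - (d + d + (- k + - d + (- k + - d) + (- k + - d + (- k + - d))) + - (n + - (d + d + (k + k + (k + k)))))
        e₆ = solve-∀
        inside : ∀ n k d → InT N (n , k , d) × Pos (- s₁ (n , k , d)) → InT N (φ (n , k , d)) × Pos (- s₁ (φ (n , k , d)))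
        inside n k d ((p , q , e) , r) = (subst Pos (e₄ n k d) r , q , trans (e₃ n k d) e) , subst Pos (e₆ n k d) p

      -- The reflection y ↦ -y exchanges d with s₂ and k with n - k. Here ω is even in y, and the
      -- sign changes because n is odd.
      reflect-y : Σ[ positive P₁ s₂ ] Ω ≡ 0ℤ
      reflect-y = Σ-cancel (positive P₁ s₂) (record
        { to = φ ; from = φ
        ; to-in = λ { {n , k , d} → inside n k d } ; from-in = λ { {n , k , d} → inside n k d }
        ; from-to = λ { {n , k , d} _ → triple refl (e₂ n k) (e₁ n k d) } ; to-from = λ { {n , k , d} _ → triple refl (e₂ n k) (e₁ n k d) } })
        λ { (n , k , d) ((i , _) , _) → flip-sign (trans (σ-+ n (- k)) (trans (cong₂ _*_ (odd-n n k d i) (σ-neg k)) (ℤ.-1*i≡-i (σ k)))) (e₅ n k d) }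
        where
        φ : ℤ³ → ℤ³
        φ (n , k , d) = n , n + - k , d + (k + k + (k + k)) + - (n + n)
        e₁ : ∀ n k d → d + (k + k + (k + k)) + - (n + n) + (n + - k + (n + - k) + (n + - k + (n + - k))) + - (n + n) ≡ d
        e₁ = solve-∀
        e₂ : ∀ n k → n + - (n + - k) ≡ k
        e₂ = solve-∀
        e₃ : ∀ n k d → (n + - k) * (n + - k) + (n + - k) * (n + - k) + n * (d + (k + k + (k + k)) + - (n + n)) ≡ k * k + k * k + n * d
        e₃ = solve-∀
        e₄ : ∀ n k d → d + d + (k + k + (k + k)) + - n ≡ (d + (k + k + (k + k)) + - (n + n)) + (d + (k + k + (k + k)) + - (n + n)) + (n + - k + (n + - k) + (n + - k + (n + - k))) + - n
        e₄ = solve-∀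
        e₅ : ∀ n k d → ω n (n + - k) (d + (k + k + (k + k)) + - (n + n)) ≡ ω n k d
        e₅ n k d = lem n k d
          where
          lem : ∀ n k d → (d + (k + k + (k + k)) + - (n + n) + (n + - k + (n + - k)) + - n) * ((d + (k + k + (k + k)) + - (n + n) + (n + - k + (n + - k))) * (d + (k + k + (k + k)) + - (n + n) + (n + - k + (n + - k)))
                + - ((n + - k + (n + - k) + - n) * (n + - k + (n + - k) + - n)))
                ≡ (d + (k + k) + - n) * ((d + (k + k)) * (d + (k + k)) + - ((k + k + - n) * (k + k + - n)))
          lem = solve-∀
        inside : ∀ n k d → (InT N (n , k , d) × Pos (s₁ (n , k , d))) × Pos (s₂ (n , k , d)) → (InT N (φ (n , k , d)) × Pos (s₁ (φ (n , k , d)))) × Pos (s₂ (φ (n , k , d)))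
        inside n k d (((p , q , e) , r) , s) = ((p , s , trans (e₃ n k d) e) , subst Pos (e₄ n k d) r) , subst Pos (sym (e₁ n k d)) q

      -- The reflection h ↦ -h exchanges n with s₁ and d with -s₂. Now ω changes sign, while the
      -- parity of k is preserved because n and d are both odd.
      reflect-h : Σ[ negative P₁ s₂ ] Ω ≡ 0ℤ
      reflect-h = Σ-cancel (negative P₁ s₂) (record
        { to = φ ; from = φ
        ; to-in = λ { {n , k , d} → inside n k d } ; from-in = λ { {n , k , d} → inside n k d }
        ; from-to = λ { {n , k , d} _ → triple (e₁ n k d) (e₂ n k d) (e₇ n k d) } ; to-from = λ { {n , k , d} _ → triple (e₁ n k d) (e₂ n k d) (e₇ n k d) } })
        λ { (n , k , d) ((i , _) , _) → trans (cong (σ k *_) (trans (sym (ℤ.neg-involutive (ω n k d))) (cong -_ (sym (e₅ n k d)))))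
              (trans (sym (ℤ.neg-distribʳ-* (σ k) _)) (cong (λ z → - (z * ω (d + d + (k + k + (k + k)) + - n) (d + (k + k + k) + - n) (n + n + - (k + k + (k + k)) + - d))) (sym (sign n k d i)))) }
        where
        φ : ℤ³ → ℤ³
        φ (n , k , d) = d + d + (k + k + (k + k)) + - n , d + (k + k + k) + - n , n + n + - (k + k + (k + k)) + - d
        sign : ∀ n k d → InT N (n , k , d) → σ (d + (k + k + k) + - n) ≡ σ k
        sign n k d i = trans (σ-+ (d + (k + k + k)) (- n)) (trans (cong₂ _*_ (trans (σ-+ d (k + k + k)) (cong₂ _*_ (odd-d n k d i) (trans (σ-+ (k + k) k) (cong (_* σ k) (σ-double k))))) (trans (σ-neg n) (odd-n n k d i))) (lem (σ k)))
          where
          lem : ∀ z → -1ℤ * (1ℤ * z) * -1ℤ ≡ z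
          lem = solve-∀
        e₁ : ∀ n k d → (n + n + - (k + k + (k + k)) + - d) + (n + n + - (k + k + (k + k)) + - d) + (d + (k + k + k) + - n + (d + (k + k + k) + - n) + (d + (k + k + k) + - n + (d + (k + k + k) + - n))) + - (d + d + (k + k + (k + k)) + - n) ≡ n
        e₁ = solve-∀
        e₂ : ∀ n k d → (n + n + - (k + k + (k + k)) + - d) + (d + (k + k + k) + - n + (d + (k + k + k) + - n) + (d + (k + k + k) + - n)) + - (d + d + (k + k + (k + k)) + - n) ≡ k
        e₂ = solve-∀
        e₃ : ∀ n k d → (d + (k + k + k) + - n) * (d + (k + k + k) + - n) + (d + (k + k + k) + - n) * (d + (k + k + k) + - n) + (d + d + (k + k + (k + k)) + - n) * (n + n + - (k + k + (k + k)) + - d) ≡ k * k + k * k + n * d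
        e₃ = solve-∀
        e₄ : ∀ n k d → - (d + (k + k + (k + k)) + - (n + n)) ≡ n + n + - (k + k + (k + k)) + - d
        e₄ = solve-∀
        e₅ : ∀ n k d → ω (d + d + (k + k + (k + k)) + - n) (d + (k + k + k) + - n) (n + n + - (k + k + (k + k)) + - d) ≡ - ω n k d
        e₅ n k d = lem n k d
          where
          lem : ∀ n k d → ((n + n + - (k + k + (k + k)) + - d) + (d + (k + k + k) + - n + (d + (k + k + k) + - n)) + - (d + d + (k + k + (k + k)) + - n)) * (((n + n + - (k + k + (k + k)) + - d) + (d + (k + k + k) + - n + (d + (k + k + k) + - n))) * ((n + n + - (k + k + (k + k)) + - d) + (d + (k + k + k) + - n + (d + (k + k + k) + - n)))
                + - ((d + (k + k + k) + - n + (d + (k + k + k) + - n) + - (d + d + (k + k + (k + k)) + - n)) * (d + (k + k + k) + - n + (d + (k + k + k) + - n) + - (d + d + (k + k + (k + k)) + - n))))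
                ≡ - ((d + (k + k) + - n) * ((d + (k + k)) * (d + (k + k)) + - ((k + k + - n) * (k + k + - n))))
          lem = solve-∀
        e₇ : ∀ n k d → (d + d + (k + k + (k + k)) + - n) + (d + d + (k + k + (k + k)) + - n) + - (d + (k + k + k) + - n + (d + (k + k + k) + - n) + (d + (k + k + k) + - n + (d + (k + k + k) + - n))) + - (n + n + - (k + k + (k + k)) + - d) ≡ d
        e₇ = solve-∀
        e₈ : ∀ n k d → d ≡ - ((n + n + - (k + k + (k + k)) + - d) + (d + (k + k + k) + - n + (d + (k + k + k) + - n) + (d + (k + k + k) + - n + (d + (k + k + k) + - n))) + - ((d + d + (k + k + (k + k)) + - n) + (d + d + (k + k + (k + k)) + - n)))
        e₈ = solve-∀
        inside : ∀ n k d → (InT N (n , k , d) × Pos (s₁ (n , k , d))) × Pos (- s₂ (n , k , d)) → (InT N (φ (n , k , d)) × Pos (s₁ (φ (n , k , d)))) × Pos (- s₂ (φ (n , k , d)))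
        inside n k d (((p , q , e) , r) , s) = ((r , subst Pos (e₄ n k d) s , trans (e₃ n k d) e) , subst Pos (sym (e₁ n k d)) p) , subst Pos (e₈ n k d) q

      -- The three reflections cover all triples off the walls. The walls are empty: s₁ = 0 would
      -- give n = 2 (d + 2k) and s₂ = 0 would give d = 2 (n - 2k), but both are odd.
      ω-sum : Σ[ T ] Ω ≡ 0ℤ
      ω-sum = trans (Σ-trichotomy T s₁ Ω) (trans (cong₂ (λ a b → a + (b + Σ[ negative T s₁ ] Ω)) first none₁) (trans (cong (λ z → 0ℤ + (0ℤ + z)) reflect-x) refl))
        where
        none₁ : Σ[ vanishing T s₁ ] Ω ≡ 0ℤ
        none₁ = Σ-zero (vanishing T s₁) λ { (n , k , d) (i , z) → ⊥-elim (1≢-1 (trans (cong σ (trans (sym (ℤ.+-identityˡ n)) (trans (cong (_+ n) (sym z)) (lem n k d)))) (σ-double (d + (k + k)))) (odd-n n k d i)) }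
          where
          lem : ∀ n k d → d + d + (k + k + (k + k)) + - n + n ≡ d + (k + k) + (d + (k + k))
          lem = solve-∀
        none₂ : Σ[ vanishing P₁ s₂ ] Ω ≡ 0ℤ
        none₂ = Σ-zero (vanishing P₁ s₂) λ { (n , k , d) ((i , _) , z) → ⊥-elim (1≢-1 (trans (cong σ (trans (lem n k d) (trans (cong (_+ (n + - (k + k) + (n + - (k + k)))) z) (ℤ.+-identityˡ (n + - (k + k) + (n + - (k + k))))))) (σ-double (n + - (k + k)))) (odd-d n k d i)) }
          where
          lem : ∀ n k d → d ≡ d + (k + k + (k + k)) + - (n + n) + (n + - (k + k) + (n + - (k + k)))
          lem = solve-∀
        first : Σ[ P₁ ] Ω ≡ 0ℤ
        first = trans (Σ-trichotomy P₁ s₂ Ω) (cong₂ _+_ reflect-y (cong₂ _+_ none₂ reflect-h))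

      swap-T flip-T : Bij (InT N) (InT N)
      swap-T = record
        { to = λ (n , k , d) → d , k , n ; from = λ (n , k , d) → d , k , n
        ; to-in = λ { {n , k , d} → sw n k d } ; from-in = λ { {n , k , d} → sw n k d } ; from-to = λ _ → refl ; to-from = λ _ → refl }
        where
        sw : ∀ n k d → InT N (n , k , d) → InT N (d , k , n)
        sw n k d (p , q , e) = q , p , trans (cong (λ z → k * k + k * k + z) (ℤ.*-comm d n)) e
      flip-T = record
        { to = λ (n , k , d) → n , - k , d ; from = λ (n , k , d) → n , - k , d
        ; to-in = λ { {n , k , d} → neg n k d } ; from-in = λ { {n , k , d} → neg n k d }
        ; from-to = λ { {n , k , d} _ → triple refl (ℤ.neg-involutive k) refl }
        ; to-from = λ { {n , k , d} _ → triple refl (ℤ.neg-involutive k) refl } }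
        where
        neg : ∀ n k d → InT N (n , k , d) → InT N (n , - k , d)
        neg n k d (p , q , e) = p , q , trans (lem n k d) e
          where
          lem : ∀ n k d → - k * - k + - k * - k + n * d ≡ k * k + k * k + n * d
          lem = solve-∀

    -- The twisted weight for c₁ = -d and c₂ = d, corresponding to the operator θ - 1.
    odd-weight : ℤ → ℤ → ℤ → ℤ
    odd-weight n k d = (n * d + - (k * k + k * k) + -1ℤ) * d

    -- Since ω sums to 0, adding 2 ω is free, and it makes the symmetrized weight vanish modulo 3.
    -- The factor 4 from symmetrization is removed by subtracting 3 times the sum.
    odd-divisible : + 3 ∣ Σ[ T ] (weighted odd-weight)
    odd-divisible = subst (+ 3 ∣_) (lem₂ (Σ[ T ] (weighted odd-weight)))
      (∣m∣n⇒∣m+n four (∣m⇒∣-m (divides (Σ[ T ] (weighted odd-weight)) (ℤ.*-comm (+ 3) _))))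
      where
      V : ℤ → ℤ → ℤ → ℤ
      V n k d = odd-weight n k d + + 2 * ω n k d
      open Residues 3
      V-expr : Expr → Expr → Expr → Expr
      V-expr n k d = (n ⊠ d ⊞ ⊟ (k ⊠ k ⊞ k ⊠ k) ⊞ # -1ℤ) ⊠ d ⊞ # (+ 2) ⊠ ((d ⊞ (k ⊞ k) ⊞ ⊟ n) ⊠ ((d ⊞ (k ⊞ k)) ⊠ (d ⊞ (k ⊞ k)) ⊞ ⊟ ((k ⊞ k ⊞ ⊟ n) ⊠ (k ⊞ k ⊞ ⊟ n))))
      V-vanishes : ∀ n k d → + 3 ∣ symmetrized V n k d
      V-vanishes = vanishes (V-expr v₀ v₁ v₂ ⊞ V-expr v₀ (⊟ v₁) v₂ ⊞ (V-expr v₂ v₁ v₀ ⊞ V-expr v₂ (⊟ v₁) v₀)) tt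
      V-sum : Σ[ T ] (weighted V) ≡ Σ[ T ] (weighted odd-weight)
      V-sum = trans (Σ-cong T (λ (n , k , d) _ → lem (σ k) (odd-weight n k d) (ω n k d)))
        (trans (Σ-+ T (weighted odd-weight) (λ v → + 2 * Ω v)) (trans (cong (λ z → Σ[ T ] (weighted odd-weight) + z) (trans (Σ-* T (+ 2) Ω) (cong (+ 2 *_) ω-sum))) (ℤ.+-identityʳ _)))
        where
        lem : ∀ s x y → s * (x + + 2 * y) ≡ s * x + + 2 * (s * y)
        lem = solve-∀
      four : + 3 ∣ + 4 * Σ[ T ] (weighted odd-weight)
      four = subst (+ 3 ∣_) (trans (sym (Σ-symmetrized T swap-T flip-T (λ _ _ _ → refl) (λ _ _ _ → refl) V)) (cong (+ 4 *_) V-sum))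
        (Σ-∣ T λ (n , k , d) _ → ∣n⇒∣m*n (σ k) (V-vanishes n k d))
      lem₂ : ∀ z → + 4 * z + - (+ 3 * z) ≡ z
      lem₂ = solve-∀

-- Series attached to weighted finite sets of lattice points.

module LatticeSeries where
  open PowerSeries
  open BaileyPair
  open SptSeries
  open Regions
  open Parity
  open LiouvilleSums using (ℤ³; InS)
  open OddForms using (InT)
  open import Data.Integer using (_+_; _*_)

  when : Bool → ℤ → ℤ
  when b z = if b then z else 0ℤ

  -- The polynomial Σ c(x) q^(e(x)). Products become cartesian products of index lists, and
  -- coefficients become sums over the points with a given exponent.
  gen : ∀ {A : Set} → List A → (A → ℕ) → (A → ℤ) → Series
  gen xs e c n = ΣL xs (λ x → when (e x ≡ᵇ n) (c x))

  when-* : ∀ b t z → t * when b z ≡ when b (t * z)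
  when-* true  t z = refl
  when-* false t z = ℤ.*-zeroʳ t

  when-+ : ∀ b x y → when b x + when b y ≡ when b (x + y)
  when-+ true  x y = refl
  when-+ false x y = refl

  ΣL-zero : ∀ {A : Set} (xs : List A) {f} → (∀ x → f x ≡ 0ℤ) → ΣL xs f ≡ 0ℤ
  ΣL-zero []       e = refl
  ΣL-zero (x ∷ xs) e = cong₂ _+_ (e x) (ΣL-zero xs e)

  ΣL-cong′ : ∀ {A : Set} (xs : List A) {f g : A → ℤ} → (∀ x → f x ≡ g x) → ΣL xs f ≡ ΣL xs g
  ΣL-cong′ xs e = ΣL-cong xs λ x _ → e x

  ΣL-cartesian : ∀ {A B : Set} (xs : List A) (ys : List B) f → ΣL (cartesianProduct xs ys) f ≡ ΣL xs (λ x → ΣL ys (λ y → f (x , y)))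
  ΣL-cartesian []       ys f = refl
  ΣL-cartesian (x ∷ xs) ys f = trans (ΣL-++ (map (x ,_) ys) _ f) (cong₂ _+_ (ΣL-map (x ,_) f ys) (ΣL-cartesian xs ys f))
    where
    ΣL-++ : ∀ {A : Set} (xs ys : List A) f → ΣL (xs ++ ys) f ≡ ΣL xs f + ΣL ys f
    ΣL-++ []       ys f = sym (ℤ.+-identityˡ _)
    ΣL-++ (x ∷ xs) ys f = trans (cong (λ z → f x + z) (ΣL-++ xs ys f)) (sym (ℤ.+-assoc (f x) _ _))

  shift-ΣL : ∀ {A : Set} k (xs : List A) (F : A → Series) n → shift k (λ i → ΣL xs (λ x → F x i)) n ≡ ΣL xs (λ x → shift k (F x) n)
  shift-ΣL zero    xs F n       = refl
  shift-ΣL (suc k) xs F zero    = sym (ΣL-zero xs λ _ → refl)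
  shift-ΣL (suc k) xs F (suc n) = shift-ΣL k xs F n

  shift-when : ∀ k e z n → shift k (λ i → when (e ≡ᵇ i) z) n ≡ when (k ℕ.+ e ≡ᵇ n) z
  shift-when zero    e z n       = refl
  shift-when (suc k) e z zero    = refl
  shift-when (suc k) e z (suc n) = shift-when k e z n

  gen-⊛ˡ : ∀ {A : Set} (xs : List A) e c b n → (gen xs e c ⊛ b) n ≡ ΣL xs (λ x → c x * shift (e x) b n)
  gen-⊛ˡ []       e c b n = ⊛-zeroˡ b n
  gen-⊛ˡ (x ∷ xs) e c b n = trans (⊛-distribʳ (λ i → when (e x ≡ᵇ i) (c x)) (gen xs e c) b n)
    (cong₂ _+_ one (gen-⊛ˡ xs e c b n))
    where
    one : ((λ i → when (e x ≡ᵇ i) (c x)) ⊛ b) n ≡ c x * shift (e x) b n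
    one = trans (⊛-comm (λ i → when (e x ≡ᵇ i) (c x)) b n) (trans (⊛-pointwise n b (λ i → sym (scaled i)))
      (trans (⊛-comm b (λ i → c x * mono (e x) i) n) (trans (⊛-scaleˡ (c x) (mono (e x)) b n) (cong (c x *_) (mono-⊛ (e x) b n)))))
      where
      scaled : ∀ i → c x * mono (e x) i ≡ when (e x ≡ᵇ i) (c x)
      scaled i = trans (cong (c x *_) (mono-at (e x) i)) (trans (when-* (e x ≡ᵇ i) (c x) 1ℤ) (cong (when (e x ≡ᵇ i)) (ℤ.*-identityʳ (c x))))
      ⊛-pointwise : ∀ n a {b b′ : Series} → b ≗ b′ → (a ⊛ b) n ≡ (a ⊛ b′) n
      ⊛-pointwise zero    a eq = cong (a 0 *_) (eq 0)
      ⊛-pointwise (suc n) a eq = cong₂ _+_ (cong (a 0 *_) (eq (suc n))) (⊛-pointwise n (a ∘ suc) eq)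

  gen-⊛ : ∀ {A B : Set} (xs : List A) (ys : List B) e e′ c c′ n → (gen xs e c ⊛ gen ys e′ c′) n
    ≡ gen (cartesianProduct xs ys) (λ (x , y) → e x ℕ.+ e′ y) (λ (x , y) → c x * c′ y) n
  gen-⊛ xs ys e e′ c c′ n = trans (gen-⊛ˡ xs e c (gen ys e′ c′) n)
    (sym (trans (ΣL-cartesian xs ys _) (ΣL-cong′ xs λ x → sym (trans (cong (c x *_) (trans (shift-ΣL (e x) ys (λ y i → when (e′ y ≡ᵇ i) (c′ y)) n)
      (ΣL-cong′ ys λ y → shift-when (e x) (e′ y) (c′ y) n)))
      (trans (sym (ΣL-* (c x) (λ y → when (e x ℕ.+ e′ y ≡ᵇ n) (c′ y)) ys)) (ΣL-cong′ ys λ y → when-* (e x ℕ.+ e′ y ≡ᵇ n) (c x) (c′ y)))))))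

  θ-gen : ∀ {A : Set} (xs : List A) e c n → θ (gen xs e c) n ≡ gen xs e (λ x → + e x * c x) n
  θ-gen xs e c n = trans (sym (ΣL-* (+ n) _ xs)) (ΣL-cong′ xs λ x → lem (e x) (c x))
    where
    lem : ∀ k z → + n * when (k ≡ᵇ n) z ≡ when (k ≡ᵇ n) (+ k * z)
    lem k z with k ≡ᵇ n in eq
    ... | true  = cong (λ i → + i * z) (sym (ℕ.≡ᵇ⇒≡ k n (subst Data.Bool.T (sym eq) _)))
    ... | false = ℤ.*-zeroʳ (+ n)

  gen-+ : ∀ {A : Set} (xs : List A) e c c′ n → gen xs e (λ x → c x + c′ x) n ≡ gen xs e c n + gen xs e c′ n
  gen-+ xs e c c′ n = trans (ΣL-cong′ xs λ x → sym (when-+ (e x ≡ᵇ n) (c x) (c′ x))) (ΣL-+ _ _ xs)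

  gen-filter : ∀ {A : Set} (xs : List A) e c n → gen xs e c n ≡ ΣL (filter (λ x → e x ℕ.≟ n) xs) c
  gen-filter []       e c n = refl
  gen-filter (x ∷ xs) e c n with e x ≡ᵇ n
  ... | true  = cong (λ z → c x + z) (gen-filter xs e c n)
  ... | false = trans (ℤ.+-identityˡ _) (gen-filter xs e c n)

  between : ℕ → List ℤ
  between zero    = 0ℤ ∷ []
  between (suc K) = + suc K ∷ -[1+ K ] ∷ between K

  upward : ℕ → List ℤ
  upward zero    = []
  upward (suc K) = + suc K ∷ upward K

  pairs : ℕ → List (ℤ × ℤ)
  pairs K = cartesianProduct (upward K) (upward K)

  between-bound : ∀ K {k} → k ∈ between K → ∣ k ∣ ≤ K
  between-bound zero    (here refl)         = z≤n
  between-bound (suc K) (here refl)         = ℕ.≤-refl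
  between-bound (suc K) (there (here refl)) = ℕ.≤-refl
  between-bound (suc K) (there (there k∈))  = ℕ.m≤n⇒m≤1+n (between-bound K k∈)

  between-complete : ∀ K k → ∣ k ∣ ≤ K → k ∈ between K
  between-complete zero    (+ zero)  _ = here refl
  between-complete (suc K) k         k≤K with ℕ.m≤n⇒m<n∨m≡n k≤K
  ... | inj₁ (s≤s lt) = there (there (between-complete K k lt))
  between-complete (suc K) (+ _)     k≤K | inj₂ refl = here refl
  between-complete (suc K) -[1+ _ ]  k≤K | inj₂ refl = there (here refl)

  between-unique : ∀ K → Unique (between K)
  between-unique zero    = [] ∷ []
  between-unique (suc K) = ((λ ()) ∷ All.tabulate (λ k∈ eq → ℕ.<⇒≱ ℕ.≤-refl (subst (λ z → ∣ z ∣ ≤ K) (sym eq) (between-bound K k∈))))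
    ∷ All.tabulate (λ k∈ eq → ℕ.<⇒≱ ℕ.≤-refl (subst (λ z → ∣ z ∣ ≤ K) (sym eq) (between-bound K k∈))) ∷ between-unique K

  upward-bound : ∀ K {n} → n ∈ upward K → Pos n × ∣ n ∣ ≤ K
  upward-bound (suc K) (here refl) = ℤ.+<+ (s≤s z≤n) , ℕ.≤-refl
  upward-bound (suc K) (there n∈)  = let (p , b) = upward-bound K n∈ in p , ℕ.m≤n⇒m≤1+n b

  upward-complete : ∀ K n → Pos n → ∣ n ∣ ≤ K → n ∈ upward K
  upward-complete zero    (+ zero)  (ℤ.+<+ ()) _
  upward-complete (suc K) n p n≤K with ℕ.m≤n⇒m<n∨m≡n n≤K
  ... | inj₁ (s≤s lt) = there (upward-complete K n p lt)
  upward-complete (suc K) (+ _) p n≤K | inj₂ refl = here refl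

  upward-unique : ∀ K → Unique (upward K)
  upward-unique zero    = []
  upward-unique (suc K) = All.tabulate (λ n∈ eq → ℕ.<⇒≱ ℕ.≤-refl (subst (λ z → ∣ z ∣ ≤ K) (sym eq) (proj₂ (upward-bound K n∈)))) ∷ upward-unique K

  InPair : ℕ → ℤ × ℤ → Set
  InPair m (n , d) = Pos n × Pos d × n * d ≡ + m

  pos-abs : ∀ {n} → Pos n → + ∣ n ∣ ≡ n
  pos-abs {+ n} _ = refl

  abs-product : ∀ {n d} → Pos n → Pos d → n * d ≡ + (∣ n ∣ ℕ.* ∣ d ∣)
  abs-product {n} {d} p q = trans (cong₂ _*_ (sym (pos-abs p)) (sym (pos-abs q))) (sym (ℤ.pos-* ∣ n ∣ ∣ d ∣))

  abs-square : ∀ k → k * k ≡ + (∣ k ∣ ℕ.* ∣ k ∣)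
  abs-square (+ n)      = sym (ℤ.pos-* n n)
  abs-square -[1+ n ]   = refl

  pos-nonzero : ∀ {n} → Pos n → 1 ≤ ∣ n ∣
  pos-nonzero {+ suc n} _ = s≤s z≤n
  pos-nonzero {+ zero} (ℤ.+<+ ())

  module _ (K : ℕ) where
    private
      -- Each factor is at least 1 and hence at most the product, so a box of side K contains every
      -- solution for all m ≤ K.
      member : ∀ {n d} → Pos n → Pos d → ∣ n ∣ ℕ.* ∣ d ∣ ≤ K → (n , d) ∈ pairs K
      member {n} {d} p q le = ∈-cartesianProduct⁺
        (upward-complete K n p (ℕ.≤-trans (ℕ.≤-trans (ℕ.≤-reflexive (sym (ℕ.*-identityʳ ∣ n ∣))) (ℕ.*-monoʳ-≤ ∣ n ∣ (pos-nonzero q))) le))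
        (upward-complete K d q (ℕ.≤-trans (ℕ.≤-trans (ℕ.≤-reflexive (sym (ℕ.*-identityˡ ∣ d ∣))) (ℕ.*-monoˡ-≤ ∣ d ∣ (pos-nonzero p))) le))

      bounds : ∀ {n d} → (n , d) ∈ pairs K → Pos n × Pos d
      bounds nd∈ = let (n∈ , d∈) = ∈-cartesianProduct⁻ (upward K) (upward K) nd∈ in proj₁ (upward-bound K n∈) , proj₁ (upward-bound K d∈)

    pairBox : Region (_∈ pairs K)
    pairBox = record { elements = pairs K ; unique = cartesianProduct⁺ (upward-unique K) (upward-unique K) ; sound = id ; complete = id }

    tripleBox : Region (_∈ cartesianProduct (between K) (pairs K))
    tripleBox = record { elements = cartesianProduct (between K) (pairs K)
      ; unique = cartesianProduct⁺ (between-unique K) (Region.unique pairBox) ; sound = id ; complete = id }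

    area : ℤ × ℤ → ℕ
    area (n , d) = ∣ n ∣ ℕ.* ∣ d ∣

    private
      pair-bij : ∀ m → m ≤ K → Bij (λ (a : ℤ × ℤ) → a ∈ pairs K × area a ≡ m) (InPair m)
      pair-bij m m≤K = same
        (λ { {n , d} (nd∈ , e) → let (p , q) = bounds nd∈ in p , q , trans (abs-product p q) (cong +_ e) })
        (λ { {n , d} (p , q , e) → let e′ = ℤ.+-injective (trans (sym (abs-product p q)) e) in member p q (subst (_≤ K) (sym e′) m≤K) , e′ })

    pairRegion : ∀ m → m ≤ K → Region (InPair m)
    pairRegion m m≤K = transport (pair-bij m m≤K) (restrict pairBox (λ a → area a ℕ.≟ m))

    gen-pairs : ∀ m (m≤K : m ≤ K) c → gen (pairs K) area c m ≡ Σ[ pairRegion m m≤K ] c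
    gen-pairs m m≤K c = trans (gen-filter (pairs K) area c m)
      (Σ-bij (pair-bij m m≤K) (restrict pairBox (λ a → area a ℕ.≟ m)) (pairRegion m m≤K) (λ _ _ → refl))

    square≤ : ∀ {k n d m} → k * k + n * d ≡ + m → Pos n → Pos d → ∣ k ∣ ℕ.* ∣ k ∣ ℕ.+ ∣ n ∣ ℕ.* ∣ d ∣ ≡ m
    square≤ {k} {n} {d} e p q = ℤ.+-injective (trans (cong₂ _+_ (sym (abs-square k)) (sym (abs-product p q))) e)

    k≤k² : ∀ k → k ≤ k ℕ.* k
    k≤k² zero    = z≤n
    k≤k² (suc k) = ℕ.m≤m*n (suc k) (suc k)

    private
      S-bij : ∀ m → m ≤ K → Bij (λ (a : ℤ × (ℤ × ℤ)) → a ∈ cartesianProduct (between K) (pairs K)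
                              × ∣ proj₁ a ∣ ℕ.* ∣ proj₁ a ∣ ℕ.+ area (proj₂ a) ≡ m) (InS (+ m))
      S-bij m m≤K = record
        { to = λ (k , n , d) → n , k , d ; from = λ (n , k , d) → k , n , d
        ; to-in = λ { {k , n , d} (a∈ , e) → let (p , q) = bounds (proj₂ (∈-cartesianProduct⁻ (between K) (pairs K) a∈)) in
            p , q , trans (cong₂ _+_ (abs-square k) (abs-product p q)) (cong +_ e) }
        ; from-in = λ { {n , k , d} (p , q , e) → let e′ = square≤ {k} {n} {d} e p q in
            ∈-cartesianProduct⁺ (between-complete K k (ℕ.≤-trans (k≤k² ∣ k ∣) (ℕ.≤-trans (ℕ.≤-trans (ℕ.m≤m+n _ _) (ℕ.≤-reflexive e′)) m≤K)))
                                (member p q (ℕ.≤-trans (ℕ.≤-trans (ℕ.m≤n+m _ _) (ℕ.≤-reflexive e′)) m≤K)) , e′ }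
        ; from-to = λ _ → refl ; to-from = λ _ → refl }

      T-bij : ∀ m → m ≤ K → Bij (λ (a : ℤ × (ℤ × ℤ)) → a ∈ cartesianProduct (between K) (pairs K)
                              × ∣ proj₁ a ∣ ℕ.* ∣ proj₁ a ∣ ℕ.+ ∣ proj₁ a ∣ ℕ.* ∣ proj₁ a ∣ ℕ.+ area (proj₂ a) ≡ m) (InT (+ m))
      T-bij m m≤K = record
        { to = λ (k , n , d) → n , k , d ; from = λ (n , k , d) → k , n , d
        ; to-in = λ { {k , n , d} (a∈ , e) → let (p , q) = bounds (proj₂ (∈-cartesianProduct⁻ (between K) (pairs K) a∈)) in
            p , q , trans (cong₂ _+_ (cong₂ _+_ (abs-square k) (abs-square k)) (abs-product p q)) (cong +_ e) }
        ; from-in = λ { {n , k , d} (p , q , e) → let e′ = ℤ.+-injective (trans (cong₂ _+_ (cong₂ _+_ (sym (abs-square k)) (sym (abs-square k))) (sym (abs-product p q))) e) in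
            ∈-cartesianProduct⁺ (between-complete K k (ℕ.≤-trans (k≤k² ∣ k ∣) (ℕ.≤-trans (ℕ.≤-trans (ℕ.≤-trans (ℕ.m≤m+n _ _) (ℕ.m≤m+n _ _)) (ℕ.≤-reflexive e′)) m≤K)))
                                (member p q (ℕ.≤-trans (ℕ.≤-trans (ℕ.m≤n+m _ _) (ℕ.≤-reflexive e′)) m≤K)) , e′ }
        ; from-to = λ _ → refl ; to-from = λ _ → refl }

    tripleRegion : ∀ m → m ≤ K → Region (InS (+ m))
    tripleRegion m m≤K = transport (S-bij m m≤K) (restrict tripleBox (λ (k , nd) → ∣ k ∣ ℕ.* ∣ k ∣ ℕ.+ area nd ℕ.≟ m))

    gen-triples : ∀ m (m≤K : m ≤ K) (c : ℤ³ → ℤ) →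
      gen (cartesianProduct (between K) (pairs K)) (λ (k , nd) → ∣ k ∣ ℕ.* ∣ k ∣ ℕ.+ area nd) (λ (k , n , d) → c (n , k , d)) m
      ≡ Σ[ tripleRegion m m≤K ] c
    gen-triples m m≤K c = trans (gen-filter (cartesianProduct (between K) (pairs K)) (λ (k , nd) → ∣ k ∣ ℕ.* ∣ k ∣ ℕ.+ area nd) (λ (k , n , d) → c (n , k , d)) m)
      (Σ-bij (S-bij m m≤K) (restrict tripleBox (λ (k , nd) → ∣ k ∣ ℕ.* ∣ k ∣ ℕ.+ area nd ℕ.≟ m)) (tripleRegion m m≤K) (λ _ _ → refl))

    oddRegion : ∀ m → m ≤ K → Region (InT (+ m))
    oddRegion m m≤K = transport (T-bij m m≤K) (restrict tripleBox (λ (k , nd) → ∣ k ∣ ℕ.* ∣ k ∣ ℕ.+ ∣ k ∣ ℕ.* ∣ k ∣ ℕ.+ area nd ℕ.≟ m))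

    gen-odd : ∀ m (m≤K : m ≤ K) (c : ℤ³ → ℤ) →
      gen (cartesianProduct (between K) (pairs K)) (λ (k , nd) → ∣ k ∣ ℕ.* ∣ k ∣ ℕ.+ ∣ k ∣ ℕ.* ∣ k ∣ ℕ.+ area nd) (λ (k , n , d) → c (n , k , d)) m
      ≡ Σ[ oddRegion m m≤K ] c
    gen-odd m m≤K c = trans (gen-filter (cartesianProduct (between K) (pairs K)) (λ (k , nd) → ∣ k ∣ ℕ.* ∣ k ∣ ℕ.+ ∣ k ∣ ℕ.* ∣ k ∣ ℕ.+ area nd) (λ (k , n , d) → c (n , k , d)) m)
      (Σ-bij (T-bij m m≤K) (restrict tripleBox (λ (k , nd) → ∣ k ∣ ℕ.* ∣ k ∣ ℕ.+ ∣ k ∣ ℕ.* ∣ k ∣ ℕ.+ area nd ℕ.≟ m)) (oddRegion m m≤K) (λ _ _ → refl))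

-- Even and odd parts of the generating function.

module Dissection where
  open PowerSeries
  open BaileyPair
  open GeneratingFunction
  open Overpartitions using (≡ᵇ-false)
  open SptSeries
  open Regions
  open Parity
  open LatticeSeries
  open EvenForms using ([_<_]; [<]-yes; [<]-no; onEven; onEven-yes; onEven-no)
  open import Data.Integer using (_+_; _*_; -_)

  evenᵇ : ℕ → Bool
  evenᵇ zero    = true
  evenᵇ (suc n) = not (evenᵇ n)

  sgnℕ-even : ∀ n → evenᵇ n ≡ true → sgnℕ n ≡ 1ℤ
  sgnℕ-odd  : ∀ n → evenᵇ n ≡ false → sgnℕ n ≡ -1ℤ
  sgnℕ-even zero    _ = refl
  sgnℕ-even (suc n) e with evenᵇ n in eq
  ... | false = cong -_ (sgnℕ-odd n eq)
  sgnℕ-odd (suc n) e with evenᵇ n in eq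
  ... | true = cong -_ (sgnℕ-even n eq)

  evenᵇ-double : ∀ n → evenᵇ (n ℕ.+ n) ≡ true
  evenᵇ-double zero    = refl
  evenᵇ-double (suc n) = trans (cong (not ∘ evenᵇ) (ℕ.+-suc n n)) (trans (not-not (evenᵇ (n ℕ.+ n))) (evenᵇ-double n))
    where
    not-not : ∀ b → not (not b) ≡ b
    not-not true  = refl
    not-not false = refl

  evenᵇ-half : ∀ n → evenᵇ n ≡ true → ∃ λ m → n ≡ m ℕ.+ m
  evenᵇ-half zero    _ = 0 , refl
  evenᵇ-half (suc (suc n)) e with evenᵇ-half n (trans (sym (not-not (evenᵇ n))) e)
    where
    not-not : ∀ b → not (not b) ≡ b
    not-not true  = refl
    not-not false = refl
  ... | m , refl = suc m , cong suc (sym (ℕ.+-suc m m))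

  evenPart oddPart : Series → Series
  evenPart a n = if evenᵇ n then a n else 0ℤ
  oddPart a n = if evenᵇ n then 0ℤ else a n

  evenPart-shift : ∀ j a n → evenPart (shift (j ℕ.+ j) a) n ≡ shift (j ℕ.+ j) (evenPart a) n
  evenPart-shift zero    a n = refl
  evenPart-shift (suc j) a n rewrite ℕ.+-suc j j = go n
    where
    go : ∀ n → evenPart (shift (suc (suc (j ℕ.+ j))) a) n ≡ shift (suc (suc (j ℕ.+ j))) (evenPart a) n
    go zero          = refl
    go (suc zero)    = refl
    go (suc (suc n)) with evenᵇ n | evenPart-shift j a n
    ... | true  | e = e
    ... | false | e = e

  oddPart-shift : ∀ j a n → oddPart (shift (j ℕ.+ j) a) n ≡ shift (j ℕ.+ j) (oddPart a) n
  oddPart-shift zero    a n = refl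
  oddPart-shift (suc j) a n rewrite ℕ.+-suc j j = go n
    where
    go : ∀ n → oddPart (shift (suc (suc (j ℕ.+ j))) a) n ≡ shift (suc (suc (j ℕ.+ j))) (oddPart a) n
    go zero          = refl
    go (suc zero)    = refl
    go (suc (suc n)) with evenᵇ n | oddPart-shift j a n
    ... | true  | e = e
    ... | false | e = e

  ΣL-if : ∀ {A : Set} (xs : List A) b (f : A → ℤ) → (if b then ΣL xs f else 0ℤ) ≡ ΣL xs (λ x → if b then f x else 0ℤ)
  ΣL-if xs true  f = refl
  ΣL-if xs false f = sym (ΣL-zero xs λ _ → refl)

  ΣL-if′ : ∀ {A : Set} (xs : List A) b (f : A → ℤ) → (if b then 0ℤ else ΣL xs f) ≡ ΣL xs (λ x → if b then 0ℤ else f x)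
  ΣL-if′ xs false f = refl
  ΣL-if′ xs true  f = sym (ΣL-zero xs λ _ → refl)

  if-* : ∀ b t z → (if b then t * z else 0ℤ) ≡ t * (if b then z else 0ℤ)
  if-* true  t z = refl
  if-* false t z = sym (ℤ.*-zeroʳ t)

  if-*′ : ∀ b t z → (if b then 0ℤ else t * z) ≡ t * (if b then 0ℤ else z)
  if-*′ false t z = refl
  if-*′ true  t z = sym (ℤ.*-zeroʳ t)

  -- All exponents of the left factor are even, so multiplying by it preserves the parity of
  -- degrees.
  evenPart-⊛ : ∀ {A : Set} (xs : List A) (e : A → ℕ) c a n →
    evenPart (gen xs (λ x → e x ℕ.+ e x) c ⊛ a) n ≡ (gen xs (λ x → e x ℕ.+ e x) c ⊛ evenPart a) n
  evenPart-⊛ xs e c a n = trans (cong (λ z → if evenᵇ n then z else 0ℤ) (gen-⊛ˡ xs (λ x → e x ℕ.+ e x) c a n))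
    (trans (ΣL-if xs (evenᵇ n) _) (trans (ΣL-cong′ xs λ x → trans (if-* (evenᵇ n) (c x) _) (cong (c x *_) (evenPart-shift (e x) a n)))
      (sym (gen-⊛ˡ xs (λ x → e x ℕ.+ e x) c (evenPart a) n))))

  oddPart-⊛ : ∀ {A : Set} (xs : List A) (e : A → ℕ) c a n →
    oddPart (gen xs (λ x → e x ℕ.+ e x) c ⊛ a) n ≡ (gen xs (λ x → e x ℕ.+ e x) c ⊛ oddPart a) n
  oddPart-⊛ xs e c a n = trans (cong (λ z → if evenᵇ n then 0ℤ else z) (gen-⊛ˡ xs (λ x → e x ℕ.+ e x) c a n))
    (trans (ΣL-if′ xs (evenᵇ n) _) (trans (ΣL-cong′ xs λ x → trans (if-*′ (evenᵇ n) (c x) _) (cong (c x *_) (oddPart-shift (e x) a n)))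
      (sym (gen-⊛ˡ xs (λ x → e x ℕ.+ e x) c (oddPart a) n))))

  upward-suc : ∀ K {i} → i ∈ upward K → + suc (ℕ.pred ∣ i ∣) ≡ i
  upward-suc K {i} i∈ with i | proj₁ (upward-bound K i∈)
  ... | + suc n | _ = refl
  ... | + zero  | ℤ.+<+ ()

  gen-none : ∀ {A : Set} (xs : List A) e c n → (∀ x → e x ≢ n) → gen xs e c n ≡ 0ℤ
  gen-none xs e c n ne = ΣL-zero xs λ x → cong (λ b → when b (c x)) (≡ᵇ-false (ne x))

  ≡ᵇ-double : ∀ a m → (a ℕ.+ a ≡ᵇ m ℕ.+ m) ≡ (a ≡ᵇ m)
  ≡ᵇ-double zero    zero    = refl
  ≡ᵇ-double zero    (suc m) = refl
  ≡ᵇ-double (suc a) zero    = refl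
  ≡ᵇ-double (suc a) (suc m) = trans (cong₂ _≡ᵇ_ (ℕ.+-suc a a) (ℕ.+-suc m m)) (≡ᵇ-double a m)

  gen-double : ∀ {A : Set} (xs : List A) e c m → gen xs (λ x → e x ℕ.+ e x) c (m ℕ.+ m) ≡ gen xs e c m
  gen-double xs e c m = ΣL-cong′ xs λ x → cong (λ b → when b (c x)) (≡ᵇ-double (e x) m)

  odd≢double : ∀ n j → evenᵇ n ≡ false → j ℕ.+ j ≢ n
  odd≢double n j o refl with trans (sym o) (evenᵇ-double j)
  ... | ()

  const-mono-at : ∀ c j n → (const c ⊛ mono j) n ≡ when (j ≡ᵇ n) c
  const-mono-at c j n = trans (⊛-const c (mono j) n) (trans (cong (c *_) (mono-at j n))
    (trans (when-* (j ≡ᵇ n) c 1ℤ) (cong (when (j ≡ᵇ n)) (ℤ.*-identityʳ c))))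

  square : ℤ → ℕ
  square k = ∣ k ∣ ℕ.* ∣ k ∣

  module _ (B p : ℕ) where
    open Truncated B p
    open Units B p
    open Lambert B p

    -- φ(−q²)
    φ : Series
    φ = gen (between B) (λ k → square k ℕ.+ square k) σ

    Σ<-upward : ∀ K F n → Σ< K F n ≡ ΣL (upward K) (λ i → F (ℕ.pred ∣ i ∣) n)
    Σ<-upward zero    F n = refl
    Σ<-upward (suc K) F n = trans (⊕-at (Σ< K F) (F K) n) (trans (ℤ.+-comm _ (F K n)) (cong (λ z → F K n + z) (Σ<-upward K F n)))

    sg-const : ∀ r → sg r ≈ const (sgnℕ r)
    sg-const zero    = ≈-refl
    sg-const (suc r) = ≈-trans (⊝-cong (sg-const r)) (≈-sym (const-neg (sgnℕ r)))

    φ₂≈φ : φ₂ ≈ φ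
    φ₂≈φ = ≈-trans (+-congˡ (*-congˡ (Σ<-cong B λ r _ → *-congʳ (sg-const (suc r))))) (≗⇒≈ λ n →
      trans (⊕-at 𝟙 _ n) (trans (cong (λ z → 𝟙 n + z) (⊛-const (+ 2) _ n)) (go B n)))
      where
      term : ℕ → Series
      term r = const (sgnℕ (suc r)) ⊛ mono (suc r ℕ.* suc r ℕ.+ suc r ℕ.* suc r)
      go : ∀ K n → 𝟙 n + + 2 * Σ< K term n ≡ gen (between K) (λ k → square k ℕ.+ square k) σ n
      go zero    zero    = refl
      go zero    (suc n) = refl
      go (suc K) n = trans (cong (λ z → 𝟙 n + + 2 * z) (⊕-at (Σ< K term) (term K) n)) (trans (lem (𝟙 n) (Σ< K term n) (term K n))
        (cong₂ (λ x y → x + (x + y)) (const-mono-at (sgnℕ (suc K)) (suc K ℕ.* suc K ℕ.+ suc K ℕ.* suc K) n) (go K n)))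
        where
        lem : ∀ a b c → a + + 2 * (b + c) ≡ c + (c + (a + + 2 * b))
        lem = solve-∀

    lambert-sum : ∀ n → Σ< B (λ s → lambert (suc s)) n ≡ gen (pairs B) (area B) proj₂ n
    lambert-sum n = trans (Σ<-upward B (λ s → lambert (suc s)) n) (trans (ΣL-cong (upward B) λ s s∈ →
        trans (Σ<-upward B _ n) (ΣL-cong (upward B) λ a a∈ → inner s a s∈ a∈))
      (sym (ΣL-cartesian (upward B) (upward B) _)))
      where
      inner : ∀ s a → s ∈ upward B → a ∈ upward B →
        (const (+ suc (ℕ.pred ∣ a ∣)) ⊛ mono (suc (ℕ.pred ∣ a ∣) ℕ.* suc (ℕ.pred ∣ s ∣))) n ≡ when (∣ s ∣ ℕ.* ∣ a ∣ ≡ᵇ n) a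
      inner s a s∈ a∈ = trans (const-mono-at (+ suc (ℕ.pred ∣ a ∣)) (suc (ℕ.pred ∣ a ∣) ℕ.* suc (ℕ.pred ∣ s ∣)) n)
        (cong₂ (λ j z → when (j ≡ᵇ n) z) (trans (cong₂ ℕ._*_ (cong ∣_∣ (upward-suc B a∈)) (cong ∣_∣ (upward-suc B s∈))) (ℕ.*-comm ∣ a ∣ ∣ s ∣)) (upward-suc B a∈))

    -- Half the exponent of the term a q^(2ra) of L(2r), multiplied by q^(2r²). All these exponents
    -- are even, so this second sum does not reach the odd part.
    mixed : ℤ × ℤ → ℕ
    mixed (r , a) = ∣ r ∣ ℕ.* ∣ r ∣ ℕ.+ ∣ r ∣ ℕ.* ∣ a ∣

    second : Series
    second = gen (pairs B) (λ ra → mixed ra ℕ.+ mixed ra) (λ (r , a) → + 2 * (σ r * a))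

    second-sum : two ⊛ Σ< B (λ r → sg (suc r) ⊛ (mono (suc r ℕ.* suc r ℕ.+ suc r ℕ.* suc r) ⊛ lambert (suc r ℕ.+ suc r))) ≈ second
    second-sum = ≈-trans (*-congˡ (Σ<-cong B λ r _ → *-congʳ (sg-const (suc r)))) (≗⇒≈ λ n →
      trans (⊛-const (+ 2) _ n) (trans (cong (+ 2 *_) (Σ<-upward B _ n)) (trans (sym (ΣL-* (+ 2) _ (upward B)))
        (trans (ΣL-cong (upward B) λ r r∈ → outer r n r∈) (sym (ΣL-cartesian (upward B) (upward B) _))))))
      where
      outer : ∀ r n → r ∈ upward B →
        + 2 * (const (sgnℕ (suc (ℕ.pred ∣ r ∣))) ⊛ (mono (suc (ℕ.pred ∣ r ∣) ℕ.* suc (ℕ.pred ∣ r ∣) ℕ.+ suc (ℕ.pred ∣ r ∣) ℕ.* suc (ℕ.pred ∣ r ∣)) ⊛ lambert (suc (ℕ.pred ∣ r ∣) ℕ.+ suc (ℕ.pred ∣ r ∣)))) n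
        ≡ ΣL (upward B) (λ a → when (mixed (r , a) ℕ.+ mixed (r , a) ≡ᵇ n) (+ 2 * (σ r * a)))
      outer r n r∈ = trans (cong body (cong ∣_∣ (upward-suc B r∈))) (begin
        + 2 * (const (σ r) ⊛ (mono (square r ℕ.+ square r) ⊛ lambert (∣ r ∣ ℕ.+ ∣ r ∣))) n
          ≡⟨ cong (+ 2 *_) (trans (⊛-const (σ r) _ n) (cong (σ r *_) (mono-⊛ (square r ℕ.+ square r) _ n))) ⟩
        + 2 * (σ r * shift (square r ℕ.+ square r) (lambert (∣ r ∣ ℕ.+ ∣ r ∣)) n)
          ≡⟨ sym (ℤ.*-assoc (+ 2) (σ r) _) ⟩
        + 2 * σ r * shift (square r ℕ.+ square r) (lambert (∣ r ∣ ℕ.+ ∣ r ∣)) n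
          ≡⟨ cong (+ 2 * σ r *_) (trans (shift-cong (square r ℕ.+ square r) lam n)
               (trans (shift-ΣL (square r ℕ.+ square r) (upward B) (λ a i → when (∣ a ∣ ℕ.* (∣ r ∣ ℕ.+ ∣ r ∣) ≡ᵇ i) a) n)
                 (ΣL-cong′ (upward B) λ a → shift-when (square r ℕ.+ square r) (∣ a ∣ ℕ.* (∣ r ∣ ℕ.+ ∣ r ∣)) a n))) ⟩
        + 2 * σ r * ΣL (upward B) (λ a → when (square r ℕ.+ square r ℕ.+ ∣ a ∣ ℕ.* (∣ r ∣ ℕ.+ ∣ r ∣) ≡ᵇ n) a)
          ≡⟨ trans (sym (ΣL-* (+ 2 * σ r) _ (upward B))) (ΣL-cong′ (upward B) λ a →
               trans (when-* _ (+ 2 * σ r) a) (cong₂ (λ j z → when (j ≡ᵇ n) z) (expo ∣ r ∣ ∣ a ∣) (ℤ.*-assoc (+ 2) (σ r) a))) ⟩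
        ΣL (upward B) (λ a → when (mixed (r , a) ℕ.+ mixed (r , a) ≡ᵇ n) (+ 2 * (σ r * a))) ∎)
        where
        open ≡-Reasoning
        body : ℕ → ℤ
        body j = + 2 * (const (sgnℕ j) ⊛ (mono (j ℕ.* j ℕ.+ j ℕ.* j) ⊛ lambert (j ℕ.+ j))) n
        expo : ∀ r a → r ℕ.* r ℕ.+ r ℕ.* r ℕ.+ a ℕ.* (r ℕ.+ r) ≡ r ℕ.* r ℕ.+ r ℕ.* a ℕ.+ (r ℕ.* r ℕ.+ r ℕ.* a)
        expo = ℕ-solve
        lam : ∀ i → lambert (∣ r ∣ ℕ.+ ∣ r ∣) i ≡ ΣL (upward B) (λ a → when (∣ a ∣ ℕ.* (∣ r ∣ ℕ.+ ∣ r ∣) ≡ᵇ i) a)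
        lam i = trans (Σ<-upward B _ i) (ΣL-cong (upward B) λ a a∈ → trans (const-mono-at (+ suc (ℕ.pred ∣ a ∣)) (suc (ℕ.pred ∣ a ∣) ℕ.* (∣ r ∣ ℕ.+ ∣ r ∣)) i)
          (cong (λ z → when (∣ z ∣ ℕ.* (∣ r ∣ ℕ.+ ∣ r ∣) ≡ᵇ i) z) (upward-suc B a∈)))

    φ-spt : φ ⊛ spt ≈ gen (pairs B) (area B) proj₂ ⊕ second
    φ-spt = ≈-trans (*-congʳ (≈-sym φ₂≈φ)) (≈-trans (spt-identity B p) (+-cong (≗⇒≈ lambert-sum) second-sum))

    -- The divisor sum whose n-th term is the coefficient of q^(2n) in the product φ(−q²) ⊛ spt.
    evenWeight : ℤ × ℤ → ℤ
    evenWeight (n , d) = + 3 * n + - onEven n (λ u → u + u) + + 2 * (σ n * ([ n < d ] * (d + - n)))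

    private
      -- In s a = 2m an even a = 2n contributes 2n for the factorization n d = m with s = d. An odd
      -- a forces s = 2d and contributes n = a, present only for odd n.
      first-region : ∀ m (m≤B : m ≤ B) (2m≤B : m ℕ.+ m ≤ B) →
        Σ[ pairRegion B (m ℕ.+ m) 2m≤B ] proj₂ ≡ Σ[ pairRegion B m m≤B ] (λ (n , d) → + 3 * n + - onEven n (λ u → u + u))
      first-region m m≤B 2m≤B = begin
        Σ[ R₂ ] proj₂
          ≡⟨ Σ-split R₂ second-even? proj₂ ⟩
        Σ[ restrict R₂ second-even? ] proj₂ + Σ[ restrict R₂ (¬? ∘ second-even?) ] proj₂
          ≡⟨ cong₂ _+_ evens odds ⟩
        Σ[ R₁ ] (λ (n , d) → n + n) + Σ[ restrict R₁ (¬? ∘ first-even?) ] proj₁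
          ≡⟨ cong (λ z → Σ[ R₁ ] (λ (n , d) → n + n) + z) odd-only ⟩
        Σ[ R₁ ] (λ (n , d) → n + n) + Σ[ R₁ ] (λ (n , d) → n + - onEven n (λ u → u + u))
          ≡⟨ sym (Σ-+ R₁ _ _) ⟩
        Σ[ R₁ ] (λ (n , d) → n + n + (n + - onEven n (λ u → u + u)))
          ≡⟨ Σ-cong R₁ (λ (n , d) _ → lem n (onEven n (λ u → u + u))) ⟩
        Σ[ R₁ ] (λ (n , d) → + 3 * n + - onEven n (λ u → u + u)) ∎
        where
        open ≡-Reasoning
        R₁ : Region (InPair m)
        R₁ = pairRegion B m m≤B
        R₂ : Region (InPair (m ℕ.+ m))
        R₂ = pairRegion B (m ℕ.+ m) 2m≤B
        second-even? first-even? : ∀ (a : ℤ × ℤ) → Dec _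
        second-even? a = even? (proj₂ a)
        first-even? a = even? (proj₁ a)
        lem : ∀ n v → n + n + (n + - v) ≡ + 3 * n + - v
        lem = solve-∀
        evens : Σ[ restrict R₂ second-even? ] proj₂ ≡ Σ[ R₁ ] (λ (n , d) → n + n)
        evens = Σ-bij (record
          { to = λ (s , a) → half a , s ; from = λ (n , d) → d , n + n
          ; to-in = λ { {s , a} ((p , q , e) , ev) → pos-half (subst Pos (sym (half+half a ev)) q) , p
                      , double-injective (trans (l₁ (half a) s) (trans (cong (s *_) (half+half a ev)) e)) }
          ; from-in = λ { {n , d} (p , q , e) → (q , pos-+ p p , trans (l₂ n d) (cong₂ _+_ e e)) , σ-double n }
          ; from-to = λ { {s , a} (_ , ev) → cong (s ,_) (half+half a ev) }
          ; to-from = λ { {n , d} _ → cong (_, d) (half-double n) } })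
          (restrict R₂ second-even?) R₁ (λ { (s , a) (_ , ev) → sym (half+half a ev) })
          where
          l₁ : ∀ x s → x * s + x * s ≡ s * (x + x)
          l₁ = solve-∀
          l₂ : ∀ n d → d * (n + n) ≡ n * d + n * d
          l₂ = solve-∀
        odds : Σ[ restrict R₂ (¬? ∘ second-even?) ] proj₂ ≡ Σ[ restrict R₁ (¬? ∘ first-even?) ] proj₁
        odds = Σ-bij (record
          { to = λ (s , a) → a , half s ; from = λ (n , d) → d + d , n
          ; to-in = λ { {s , a} ((p , q , e) , od) → (q , pos-half (subst Pos (sym (half+half s (s-even s a e od))) p)
                      , double-injective (trans (l₁ a (half s)) (trans (cong (_* a) (half+half s (s-even s a e od))) e))) , od }
          ; from-in = λ { {n , d} ((p , q , e) , od) → (pos-+ q q , p , trans (l₂ n d) (cong₂ _+_ e e)) , od }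
          ; from-to = λ { {s , a} ((_ , _ , e) , od) → cong (_, a) (half+half s (s-even s a e od)) }
          ; to-from = λ { {n , d} _ → cong (n ,_) (half-double d) } })
          (restrict R₂ (¬? ∘ second-even?)) (restrict R₁ (¬? ∘ first-even?)) (λ _ _ → refl)
          where
          l₁ : ∀ a x → a * x + a * x ≡ (x + x) * a
          l₁ = solve-∀
          l₂ : ∀ n d → (d + d) * n ≡ n * d + n * d
          l₂ = solve-∀
          s-even : ∀ s a → s * a ≡ + (m ℕ.+ m) → ¬ Even a → Even s
          s-even s a e od with σ-± s
          ... | inj₁ ev = ev
          ... | inj₂ s-odd with trans (sym (σ-double (+ m))) (trans (cong σ (sym e)) (odd-product s a s-odd (odd a od)))
            where
            odd-product : ∀ s a → σ s ≡ -1ℤ → σ a ≡ -1ℤ → σ (s * a) ≡ -1ℤ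
            odd-product s a so ao with parity s
            ... | inj₁ (k , refl) = ⊥-elim (1≢-1 (trans (sym (σ-double k)) so))
              where
              1≢-1 : 1ℤ ≢ -1ℤ
              1≢-1 ()
            ... | inj₂ (k , refl) = trans (cong σ (l₃ k a)) (trans (σ-+ a (k * a + k * a)) (trans (cong₂ _*_ ao (σ-double (k * a))) refl))
              where
              l₃ : ∀ k a → (1ℤ + (k + k)) * a ≡ a + (k * a + k * a)
              l₃ = solve-∀
          ...   | ()
        odd-only : Σ[ restrict R₁ (¬? ∘ first-even?) ] proj₁ ≡ Σ[ R₁ ] (λ (n , d) → n + - onEven n (λ u → u + u))
        odd-only = sym (trans (Σ-split R₁ first-even? _) (trans (cong₂ _+_
          (Σ-zero (restrict R₁ first-even?) (λ { (n , d) (_ , ev) → trans (cong (λ z → n + - z) (trans (onEven-yes n (λ u → u + u) ev) (half+half n ev))) (ℤ.+-inverseʳ n) }))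
          (Σ-cong (restrict R₁ (¬? ∘ first-even?)) (λ { (n , d) (_ , od) → trans (cong (λ z → n + - z) (onEven-no n (λ u → u + u) od)) (ℤ.+-identityʳ n) })))
          (ℤ.+-identityˡ _)))

      -- As r² + r a = r (r + a), the pairs (r , a) are the factorizations of m into n = r and d = r
      -- + a, that is, those with n < d.
      second-region : ∀ m (m≤B : m ≤ B) →
        gen (pairs B) mixed (λ (r , a) → + 2 * (σ r * a)) m ≡ Σ[ pairRegion B m m≤B ] (λ (n , d) → + 2 * (σ n * ([ n < d ] * (d + - n))))
      second-region m m≤B = trans (gen-filter (pairs B) mixed _ m) (trans
        (Σ-bij bij (restrict (pairBox B) (λ ra → mixed ra ℕ.≟ m)) (restrict R₁ gap?) {g = λ (n , d) → + 2 * (σ n * ([ n < d ] * (d + - n)))}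
          (λ { (r , a) (ra∈ , _) → cong (λ z → + 2 * (σ r * z)) (trans (l₁ r a) (trans (sym (ℤ.*-identityˡ (r + a + - r)))
             (cong (_* (r + a + - r)) (sym ([<]-yes r (r + a) (subst Pos (l₁ r a) (proj₁ (upward-bound B (proj₂ (∈-cartesianProduct⁻ (upward B) (upward B) ra∈)))))))))) }))
        (sym (trans (Σ-split R₁ gap? _) (trans (cong (λ z → Σ[ restrict R₁ gap? ] (λ (n , d) → + 2 * (σ n * ([ n < d ] * (d + - n)))) + z)
          (Σ-zero (restrict R₁ (¬? ∘ gap?)) (λ { (n , d) (_ , ¬g) → trans (cong (λ z → + 2 * (σ n * (z * (d + - n)))) ([<]-no n d ¬g)) (l₂ (σ n) (d + - n)) })))
          (ℤ.+-identityʳ _)))))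
        where
        R₁ : Region (InPair m)
        R₁ = pairRegion B m m≤B
        gap? : ∀ (a : ℤ × ℤ) → Dec (Pos (proj₂ a + - proj₁ a))
        gap? (n , d) = pos? (d + - n)
        l₁ : ∀ r a → a ≡ r + a + - r
        l₁ = solve-∀
        l₂ : ∀ s v → + 2 * (s * (0ℤ * v)) ≡ 0ℤ
        l₂ = solve-∀
        l₃ : ∀ r a → r * (r + a) ≡ r * r + r * a
        l₃ = solve-∀
        l₄ : ∀ n d → n * n + n * (d + - n) ≡ n * d
        l₄ = solve-∀
        l₅ : ∀ n d → n + (d + - n) ≡ d
        l₅ = solve-∀
        bij : Bij (λ (ra : ℤ × ℤ) → ra ∈ pairs B × mixed ra ≡ m) (λ a → InPair m a × Pos (proj₂ a + - proj₁ a))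
        bij = record
          { to = λ (r , a) → r , r + a ; from = λ (n , d) → n , d + - n
          ; to-in = λ { {r , a} (ra∈ , e) →
              let (r∈ , a∈) = ∈-cartesianProduct⁻ (upward B) (upward B) ra∈
                  pr = proj₁ (upward-bound B r∈)
                  pa = proj₁ (upward-bound B a∈)
              in (pr , pos-+ pr pa , trans (l₃ r a) (trans (cong₂ _+_ (abs-square r) (abs-product pr pa)) (cong +_ e))) , subst Pos (l₁ r a) pa }
          ; from-in = λ { {n , d} ((p , q , e) , g) →
              let e′ = ℤ.+-injective (trans (cong₂ _+_ (sym (abs-square n)) (sym (abs-product p g))) (trans (l₄ n d) e))
                  le = ℕ.≤-trans (ℕ.≤-reflexive e′) m≤B
              in ∈-cartesianProduct⁺
                   (upward-complete B n p (ℕ.≤-trans (k≤k² B ∣ n ∣) (ℕ.≤-trans (ℕ.m≤m+n _ _) le)))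
                   (upward-complete B (d + - n) g (ℕ.≤-trans (ℕ.≤-trans (ℕ.≤-reflexive (sym (ℕ.*-identityˡ _))) (ℕ.*-monoˡ-≤ ∣ d + - n ∣ (pos-nonzero p))) (ℕ.≤-trans (ℕ.m≤n+m _ _) le)))
                 , e′ }
          ; from-to = λ { {r , a} _ → cong (r ,_) (sym (l₁ r a)) }
          ; to-from = λ { {n , d} _ → cong (n ,_) (l₅ n d) } }

    even-identity : φ ⊛ evenPart spt ≈ gen (pairs B) (λ nd → area B nd ℕ.+ area B nd) evenWeight
    even-identity = upTo λ n n≤B → ≋-trans (≡⇒≋ (sym (evenPart-⊛ (between B) square σ spt n))) (coefficient n n≤B)
      where
      coefficient : ∀ n → n ≤ B → evenPart (φ ⊛ spt) n ≋ gen (pairs B) (λ nd → area B nd ℕ.+ area B nd) evenWeight n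
      coefficient n n≤B with evenᵇ n in eq
      ... | false = ≡⇒≋ (sym (gen-none (pairs B) _ evenWeight n λ nd → odd≢double n (area B nd) eq))
      ... | true with evenᵇ-half n eq
      ...   | m , refl = ≋-trans (at φ-spt (m ℕ.+ m) n≤B) (≡⇒≋ (begin
        (gen (pairs B) (area B) proj₂ ⊕ second) (m ℕ.+ m)
          ≡⟨ ⊕-at _ second (m ℕ.+ m) ⟩
        gen (pairs B) (area B) proj₂ (m ℕ.+ m) + second (m ℕ.+ m)
          ≡⟨ cong₂ _+_ (trans (gen-pairs B (m ℕ.+ m) n≤B proj₂) (first-region m m≤B n≤B))
                       (trans (gen-double (pairs B) mixed _ m) (second-region m m≤B)) ⟩
        Σ[ pairRegion B m m≤B ] (λ (n , d) → + 3 * n + - onEven n (λ u → u + u)) + Σ[ pairRegion B m m≤B ] (λ (n , d) → + 2 * (σ n * ([ n < d ] * (d + - n))))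
          ≡⟨ sym (Σ-+ (pairRegion B m m≤B) _ _) ⟩
        Σ[ pairRegion B m m≤B ] evenWeight
          ≡⟨ sym (trans (gen-double (pairs B) (area B) evenWeight m) (gen-pairs B m m≤B evenWeight)) ⟩
        gen (pairs B) (λ nd → area B nd ℕ.+ area B nd) evenWeight (m ℕ.+ m) ∎))
        where
        open ≡-Reasoning
        m≤B : m ≤ B
        m≤B = ℕ.≤-trans (ℕ.m≤m+n m m) n≤B

    oddWeight : ℤ × ℤ → ℤ
    oddWeight nd = if evenᵇ (area B nd) then 0ℤ else proj₂ nd

    odd-identity : φ ⊛ oddPart spt ≈ gen (pairs B) (area B) oddWeight
    odd-identity = upTo λ n n≤B → ≋-trans (≡⇒≋ (sym (oddPart-⊛ (between B) square σ spt n))) (coefficient n n≤B)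
      where
      coefficient : ∀ n → n ≤ B → oddPart (φ ⊛ spt) n ≋ gen (pairs B) (area B) oddWeight n
      coefficient n n≤B with evenᵇ n in eq
      ... | true  = ≡⇒≋ (sym (ΣL-zero (pairs B) λ nd → lem nd))
        where
        lem : ∀ nd → when (area B nd ≡ᵇ n) (oddWeight nd) ≡ 0ℤ
        lem nd with area B nd ≡ᵇ n in e
        ... | false = refl
        ... | true  = cong (λ b → if b then 0ℤ else proj₂ nd) (trans (cong evenᵇ (ℕ.≡ᵇ⇒≡ (area B nd) n (subst Data.Bool.T (sym e) _))) eq)
      ... | false = ≋-trans (at φ-spt n n≤B) (≡⇒≋ (trans (⊕-at _ second n) (trans (cong₂ _+_ (ΣL-cong′ (pairs B) lem)
                      (gen-none (pairs B) _ _ n λ ra → odd≢double n (mixed ra) eq)) (ℤ.+-identityʳ _))))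
        where
        lem : ∀ nd → when (area B nd ≡ᵇ n) (proj₂ nd) ≡ when (area B nd ≡ᵇ n) (oddWeight nd)
        lem nd with area B nd ≡ᵇ n in e
        ... | false = refl
        ... | true  = cong (λ b → if b then 0ℤ else proj₂ nd) (sym (trans (cong evenᵇ (ℕ.≡ᵇ⇒≡ (area B nd) n (subst Data.Bool.T (sym e) _))) eq))

-- Differential relations modulo p and the congruences.

module Congruences where
  open PowerSeries
  open BaileyPair
  open GeneratingFunction
  open SptSeries
  open Regions
  open Parity
  open LiouvilleSums using (InS)
  open BoundaryTerms using (Σ-∣)
  open EvenForms using ([_<_]; onEven; weighted; total; total-divisible; Weights)
  open Certificates
  open OddForms using (odd-divisible)
  open LatticeSeries
  open Dissection
  open import Data.Bool using (T)
  open import Data.Integer using (_+_; _*_; -_)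
  open import Data.Integer.Divisibility.Signed using (_∣_; divides; _∣?_; ∣⇒∣ᵤ; ∣m∣n⇒∣m+n; ∣m⇒∣-m; ∣n⇒∣m*n)
  open import Relation.Nullary.Decidable using (toWitnessFalse)

  gen-on : ∀ {A : Set} (xs : List A) (e : A → ℕ) (c c′ : A → ℤ) n → (∀ x → e x ≡ n → c x ≡ c′ x) → gen xs e c n ≡ gen xs e c′ n
  gen-on xs e c c′ n eq = ΣL-cong′ xs at-x
    where
    at-x : ∀ x → when (e x ≡ᵇ n) (c x) ≡ when (e x ≡ᵇ n) (c′ x)
    at-x x with e x ≡ᵇ n in b
    ... | false = refl
    ... | true  = eq x (ℕ.≡ᵇ⇒≡ (e x) n (subst T (sym b) _))

  gen-exponent : ∀ {A : Set} (xs : List A) {e e′ : A → ℕ} (c : A → ℤ) n → (∀ x → e x ≡ e′ x) → gen xs e c n ≡ gen xs e′ c n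
  gen-exponent xs c n eq = ΣL-cong′ xs λ x → cong (λ i → when (i ≡ᵇ n) (c x)) (eq x)

  gen-neg : ∀ {A : Set} (xs : List A) e c n → gen xs e (λ x → - c x) n ≡ - gen xs e c n
  gen-neg []       e c n = refl
  gen-neg (x ∷ xs) e c n with e x ≡ᵇ n
  ... | true  = trans (cong (λ z → - c x + z) (gen-neg xs e c n)) (sym (ℤ.neg-distrib-+ (c x) _))
  ... | false = trans (cong (λ z → 0ℤ + z) (gen-neg xs e c n)) (sym (ℤ.neg-distrib-+ 0ℤ (gen xs e c n)))

  evenᵇ-+ : ∀ a b → evenᵇ (a ℕ.+ a ℕ.+ b) ≡ evenᵇ b
  evenᵇ-+ zero    b = refl
  evenᵇ-+ (suc a) b rewrite ℕ.+-suc a a with evenᵇ (a ℕ.+ a ℕ.+ b) | evenᵇ-+ a b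
  ... | true  | e = e
  ... | false | e = e

  module Coefficients (p : ℕ) {B : ℕ} where
    open Truncated B p

    ∣⇒≋ : ∀ {a b} → + p ∣ a + - b → a ≋ b
    ∣⇒≋ {a} {b} (divides q eq) = by q (trans (lem a b) (cong (λ z → b + z) eq))
      where
      lem : ∀ a b → a ≡ b + (a + - b)
      lem = solve-∀

    ∣⇒≋0 : ∀ {a} → + p ∣ a → a ≋ 0ℤ
    ∣⇒≋0 (divides q eq) = by q (trans eq (sym (ℤ.+-identityˡ _)))

    ≋0⇒∣ : ∀ {a} → a ≋ 0ℤ → + p ∣ a
    ≋0⇒∣ (by q eq) = divides q (trans eq (ℤ.+-identityˡ _))

    gen-cong≋ : ∀ {A : Set} (xs : List A) e {c c′ : A → ℤ} → (∀ x → + p ∣ c x + - c′ x) → gen xs e c ≈ gen xs e c′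
    gen-cong≋ xs e {c} {c′} d = upTo λ n _ → go n xs
      where
      go : ∀ n ys → gen ys e c n ≋ gen ys e c′ n
      go n []       = ≡⇒≋ refl
      go n (y ∷ ys) with e y ≡ᵇ n
      ... | true  = +-cong≋ {c y} {c′ y} {gen ys e c n} {gen ys e c′ n} (∣⇒≋ (d y)) (go n ys)
      ... | false = +-cong≋ {0ℤ} {0ℤ} {gen ys e c n} {gen ys e c′ n} (≡⇒≋ refl) (go n ys)

  module Twist (B p : ℕ) where
    open Truncated B p
    open Units B p
    open Coefficients p {B}

    private
      ϕ : Series
      ϕ = φ B p

    φ₀ : ϕ 0 ≡ 1ℤ
    φ₀ = go B
      where
      go : ∀ K → gen (between K) (λ k → square k ℕ.+ square k) σ 0 ≡ 1ℤ
      go zero    = refl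
      go (suc K) = trans (ℤ.+-identityˡ _) (trans (ℤ.+-identityˡ _) (go K))

    θ-cong : ∀ {a b} → a ≈ b → θ a ≈ θ b
    θ-cong {a} {b} e = upTo λ n l → *-cong≋ {+ n} {+ n} {a n} {b n} (≡⇒≋ refl) (at e n l)

    triples : List (ℤ × (ℤ × ℤ))
    triples = cartesianProduct (between B) (pairs B)

    module _ (e : ℤ × ℤ → ℕ) (c₁ c₂ : ℤ × ℤ → ℤ) where
      -- In φ θ s₂ - (θ φ) s₂ the derivative brings down the exponent of the s₂-term minus that of
      -- the φ-term, the factor multiplying c₂.
      twistedWeight : ℤ × (ℤ × ℤ) → ℤ
      twistedWeight (k , nd) = σ k * (c₁ nd + (+ e nd + - + (square k ℕ.+ square k)) * c₂ nd)

      private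
        s₁ s₂ : Series
        s₁ = gen (pairs B) e c₁
        s₂ = gen (pairs B) e c₂
        e₃ : ℤ × (ℤ × ℤ) → ℕ
        e₃ (k , nd) = square k ℕ.+ square k ℕ.+ e nd

      twisted-product : ∀ n → (ϕ ⊛ s₁ ⊕ (ϕ ⊛ θ s₂ ⊖ θ ϕ ⊛ s₂)) n ≡ gen triples e₃ twistedWeight n
      twisted-product n = begin
        (ϕ ⊛ s₁ ⊕ (ϕ ⊛ θ s₂ ⊖ θ ϕ ⊛ s₂)) n
          ≡⟨ trans (⊕-at (ϕ ⊛ s₁) _ n) (cong (λ z → (ϕ ⊛ s₁) n + z) (⊖-at (ϕ ⊛ θ s₂) (θ ϕ ⊛ s₂) n)) ⟩
        (ϕ ⊛ s₁) n + ((ϕ ⊛ θ s₂) n + - (θ ϕ ⊛ s₂) n)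
          ≡⟨ cong₂ _+_ (gen-⊛ (between B) (pairs B) sq e σ c₁ n) (cong₂ (λ x y → x + - y)
               (trans (⊛-pointwise ϕ (θ s₂) θs₂ (θ-gen (pairs B) e c₂) n) (gen-⊛ (between B) (pairs B) sq e σ (λ nd → + e nd * c₂ nd) n))
               (trans (⊛-comm (θ ϕ) s₂ n) (trans (⊛-pointwise s₂ (θ ϕ) θφ (θ-gen (between B) sq σ) n) (trans (⊛-comm s₂ θφ n)
                 (gen-⊛ (between B) (pairs B) sq e (λ k → + sq k * σ k) c₂ n))))) ⟩
        gen triples e₃ a n + (gen triples e₃ b n + - gen triples e₃ c n)
          ≡⟨ cong (λ z → gen triples e₃ a n + (gen triples e₃ b n + z)) (sym (gen-neg triples e₃ c n)) ⟩
        gen triples e₃ a n + (gen triples e₃ b n + gen triples e₃ (λ x → - c x) n)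
          ≡⟨ trans (cong (λ z → gen triples e₃ a n + z) (sym (gen-+ triples e₃ b (λ x → - c x) n))) (sym (gen-+ triples e₃ a (λ x → b x + - c x) n)) ⟩
        gen triples e₃ (λ x → a x + (b x + - c x)) n
          ≡⟨ gen-on triples e₃ (λ x → a x + (b x + - c x)) twistedWeight n (λ (k , nd) _ → lem (σ k) (c₁ nd) (c₂ nd) (+ e nd) (+ (square k ℕ.+ square k))) ⟩
        gen triples e₃ twistedWeight n ∎
        where
        open ≡-Reasoning
        a b c : ℤ × (ℤ × ℤ) → ℤ
        a (k , nd) = σ k * c₁ nd
        b (k , nd) = σ k * (+ e nd * c₂ nd)
        c (k , nd) = + (square k ℕ.+ square k) * σ k * c₂ nd
        lem : ∀ s x y e q → s * x + (s * (e * y) + - (q * s * y)) ≡ s * (x + (e + - q) * y)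
        lem = solve-∀
        ⊛-pointwise : ∀ (a b b′ : Series) → b ≗ b′ → a ⊛ b ≗ a ⊛ b′
        ⊛-pointwise a b b′ eq zero    = cong (a 0 *_) (eq 0)
        ⊛-pointwise a b b′ eq (suc n) = cong₂ _+_ (cong (a 0 *_) (eq (suc n))) (⊛-pointwise (a ∘ suc) b b′ eq n)
        sq : ℤ → ℕ
        sq k = square k ℕ.+ square k
        θs₂ θφ : Series
        θs₂ = gen (pairs B) e (λ nd → + e nd * c₂ nd)
        θφ = gen (between B) sq (λ k → + sq k * σ k)

      -- If s₂ = φ t₂, then φ θ s₂ − θφ s₂ = φ² θ t₂.
      untwist : ∀ {t₁ t₂} → ϕ ⊛ t₁ ≈ s₁ → ϕ ⊛ t₂ ≈ s₂ →
        (∀ n → n ≤ B → + p ∣ gen triples e₃ twistedWeight n) → t₁ ⊕ θ t₂ ≈ 𝟘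
      untwist {t₁} {t₂} e₁ e₂ d = cancel ϕ φ₀ (cancel ϕ φ₀ (begin
        ϕ ⊛ (ϕ ⊛ (t₁ ⊕ θ t₂))
          ≈⟨ solve 5 (λ f g x y z → f :* (f :* (x :+ z)) := f :* (f :* x) :+ (f :* (g :* y :+ f :* z) :- g :* (f :* y)))
               ≈-refl ϕ (θ ϕ) t₁ t₂ (θ t₂) ⟩
        ϕ ⊛ (ϕ ⊛ t₁) ⊕ (ϕ ⊛ (θ ϕ ⊛ t₂ ⊕ ϕ ⊛ θ t₂) ⊖ θ ϕ ⊛ (ϕ ⊛ t₂))
          ≈⟨ +-cong (*-congˡ e₁) (+-cong (*-congˡ (≈-trans leibniz (θ-cong e₂))) (⊝-cong (*-congˡ e₂))) ⟩
        ϕ ⊛ s₁ ⊕ (ϕ ⊛ θ s₂ ⊖ θ ϕ ⊛ s₂)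
          ≈⟨ upTo (λ n l → ≋-trans (≡⇒≋ (twisted-product n)) (∣⇒≋0 (d n l))) ⟩
        𝟘
          ≈⟨ ≈-trans (*-congˡ (zeroʳ ϕ)) (zeroʳ ϕ) ⟨
        ϕ ⊛ (ϕ ⊛ 𝟘) ∎))
        where
        open Solver
        open Relation.Binary.Reasoning.Setoid setoid
        leibniz : θ ϕ ⊛ t₂ ⊕ ϕ ⊛ θ t₂ ≈ θ (ϕ ⊛ t₂)
        leibniz = ≗⇒≈ λ n → trans (⊕-at (θ ϕ ⊛ t₂) (ϕ ⊛ θ t₂) n) (sym (θ-⊛ ϕ t₂ n))

    doubleArea : ℤ × ℤ → ℕ
    doubleArea nd = area B nd ℕ.+ area B nd

    -- All exponents are doubled: coefficients of odd degree are empty, and the one of degree 2m is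
    -- a sum over k² + n d = m.
    even-coefficients : ∀ c₁ c₂ →
      (∀ m m≤B → + p ∣ Σ[ tripleRegion B m m≤B ] (weighted λ n k d → c₁ (n , d) + (n * d + n * d + - (k * k + k * k)) * c₂ (n , d))) →
      ∀ n → n ≤ B → + p ∣ gen triples (λ (k , nd) → square k ℕ.+ square k ℕ.+ doubleArea nd) (twistedWeight doubleArea c₁ c₂) n
    even-coefficients c₁ c₂ d n n≤B = subst (+ p ∣_) (sym (gen-exponent triples w n (λ (k , nd) → expo (square k) (area B nd)))) main
      where
      e : ℤ × (ℤ × ℤ) → ℕ
      e (k , nd) = square k ℕ.+ area B nd
      w : ℤ × (ℤ × ℤ) → ℤ
      w = twistedWeight doubleArea c₁ c₂
      expo : ∀ a b → a ℕ.+ a ℕ.+ (b ℕ.+ b) ≡ a ℕ.+ b ℕ.+ (a ℕ.+ b)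
      expo = ℕ-solve
      main : + p ∣ gen triples (λ x → e x ℕ.+ e x) w n
      main with evenᵇ n in eq
      ... | false = divides 0ℤ (gen-none triples (λ x → e x ℕ.+ e x) w n λ x → odd≢double n (e x) eq)
      ... | true with evenᵇ-half n eq
      ...   | m , refl = subst (+ p ∣_) (sym (trans (gen-double triples e w m) (trans (gen-triples B m m≤B (λ (n , k , d) → w (k , n , d)))
                           (Σ-cong (tripleRegion B m m≤B) λ { (n , k , d) (pn , pd , _) → cong (λ z → σ k * (c₁ (n , d) + z * c₂ (n , d)))
                             (cong₂ (λ x y → x + x + - (y + y)) (sym (abs-product pn pd)) (sym (abs-square k))) })))) (d m m≤B)
        where
        m≤B : m ≤ B
        m≤B = ℕ.≤-trans (ℕ.m≤m+n m m) n≤B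

  -- w₁ and w₂ are 1 and 2 times evenWeight modulo 3, chosen so that their twisted weight is exactly
  -- the weight of Mod3.certificate.
  module Three (B : ℕ) where
    open Truncated B 3
    open Units B 3
    open Coefficients 3 {B}
    open Twist B 3
    open Residues 3

    private
      w₁ w₂ : ℤ × ℤ → ℤ
      w₁ (n , d) = + 2 * (σ n * ([ n < d ] * ((d + - n) * (d + - n) * (d + - n)))) + + 4 * (+ 3 * n + - onEven n (λ u → u + u))
      w₂ nd = + 2 * evenWeight B 3 nd

      -- The difference is 3 times the polynomial part of `evenWeight` plus a multiple of j³ - j
      -- with j = d - n.
      w₁-evenWeight : ∀ nd → + 3 ∣ w₁ nd + - evenWeight B 3 nd
      w₁-evenWeight (n , d) = subst (+ 3 ∣_) (lem (d + - n) (σ n) [ n < d ] (+ 3 * n + - onEven n (λ u → u + u)))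
        (∣m∣n⇒∣m+n (divides (+ 3 * n + - onEven n (λ u → u + u)) refl) (∣n⇒∣m*n (+ 2 * (σ n * [ n < d ])) (fermat (d + - n))))
        where
        fermat : ∀ j → + 3 ∣ j * j * j + - j
        fermat j = vanishes (v₀ ⊠ v₀ ⊠ v₀ ⊞ ⊟ v₀) tt j 0ℤ 0ℤ
        lem : ∀ j s l b → b * + 3 + + 2 * (s * l) * (j * j * j + - j) ≡ + 2 * (s * (l * (j * j * j))) + + 4 * b + - (b + + 2 * (s * (l * j)))
        lem = solve-∀

      triple-divisible : ∀ m m≤B → + 3 ∣ Σ[ tripleRegion B m m≤B ] (weighted λ n k d → w₁ (n , d) + (n * d + n * d + - (k * k + k * k)) * w₂ (n , d))
      triple-divisible m m≤B = subst (+ 3 ∣_) (Σ-cong S λ (n , k , d) _ → cong (σ k *_) (expand n k d)) (total-divisible Mod3.certificate S)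
        where
        S : Region (InS (+ m))
        S = tripleRegion B m m≤B
        expand : ∀ n k d → + 2 * (σ n * ([ n < d ] * Weights.WF Mod3.weights n k d)) + Weights.a Mod3.weights n k d + onEven n (λ u → Weights.b Mod3.weights u k d)
                 ≡ w₁ (n , d) + (n * d + n * d + - (k * k + k * k)) * w₂ (n , d)
        expand n k d with even? n
        ... | yes e = lem (σ n) [ n < d ] n k d (half n) (half+half n e)
          where
          poly : ∀ s l k d u → + 2 * (s * (l * ((d + - (u + u)) * ((d + (u + u)) * (d + (u + u)) + - (+ 4 * (k * k))))))
            + + 4 * ((1ℤ + ((u + u) * d + - (k * k))) * (+ 3 * (u + u))) + + 4 * ((1ℤ + ((u + u) * d + - (k * k))) * (- (u + u)))
            ≡ + 2 * (s * (l * ((d + - (u + u)) * (d + - (u + u)) * (d + - (u + u))))) + + 4 * (+ 3 * (u + u) + - (u + u))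
              + ((u + u) * d + (u + u) * d + - (k * k + k * k)) * (+ 2 * (+ 3 * (u + u) + - (u + u) + + 2 * (s * (l * (d + - (u + u))))))
          poly = solve-∀
          lem : ∀ s l n k d u → u + u ≡ n → + 2 * (s * (l * ((d + - n) * ((d + n) * (d + n) + - (+ 4 * (k * k))))))
            + + 4 * ((1ℤ + (n * d + - (k * k))) * (+ 3 * n)) + + 4 * ((1ℤ + ((u + u) * d + - (k * k))) * (- (u + u)))
            ≡ + 2 * (s * (l * ((d + - n) * (d + - n) * (d + - n)))) + + 4 * (+ 3 * n + - (u + u))
              + (n * d + n * d + - (k * k + k * k)) * (+ 2 * (+ 3 * n + - (u + u) + + 2 * (s * (l * (d + - n)))))
          lem s l _ k d u refl = poly s l k d u
        ... | no _ = lem (σ n) [ n < d ] n k d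
          where
          lem : ∀ s l n k d → + 2 * (s * (l * ((d + - n) * ((d + n) * (d + n) + - (+ 4 * (k * k))))))
            + + 4 * ((1ℤ + (n * d + - (k * k))) * (+ 3 * n)) + 0ℤ
            ≡ + 2 * (s * (l * ((d + - n) * (d + - n) * (d + - n)))) + + 4 * (+ 3 * n + - 0ℤ)
              + (n * d + n * d + - (k * k + k * k)) * (+ 2 * (+ 3 * n + - 0ℤ + + 2 * (s * (l * (d + - n)))))
          lem = solve-∀

    even-relation : evenPart spt ⊕ θ (const (+ 2) ⊛ evenPart spt) ≈ 𝟘
    even-relation = untwist doubleArea w₁ w₂
      (≈-trans (even-identity B 3) (≈-sym (gen-cong≋ (pairs B) doubleArea w₁-evenWeight)))
      (≈-trans (solve 3 (λ f t s → f :* (t :* s) := t :* (f :* s)) ≈-refl (φ B 3) (const (+ 2)) (evenPart spt))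
        (≈-trans (*-congˡ (even-identity B 3)) (≗⇒≈ λ n → trans (⊛-const (+ 2) _ n) (sym (gen-scale (+ 2) (pairs B) doubleArea (evenWeight B 3) n)))))
      (even-coefficients w₁ w₂ triple-divisible)
      where
      open Solver
      gen-scale : ∀ t {A : Set} (xs : List A) e c n → gen xs e (λ x → t * c x) n ≡ t * gen xs e c n
      gen-scale t xs e c n = trans (ΣL-cong′ xs λ x → sym (when-* (e x ≡ᵇ n) t (c x))) (ΣL-* t (λ x → when (e x ≡ᵇ n) (c x)) xs)

    private
      w₀ : ℤ × ℤ → ℤ
      w₀ nd = - oddWeight B 3 nd

      -- Since 2 k² + n d and n d have the same parity, the case distinction in `oddWeight` is
      -- decided by the degree alone.
      odd-coefficients : ∀ n → n ≤ B → + 3 ∣ gen triples (λ (k , nd) → square k ℕ.+ square k ℕ.+ area B nd) (twistedWeight (area B) w₀ (oddWeight B 3)) n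
      odd-coefficients n n≤B = subst (+ 3 ∣_) (sym (gen-on triples e (λ (k , nd) → w k nd (oddWeight B 3 nd)) (λ (k , nd) → w k nd (if evenᵇ n then 0ℤ else proj₂ nd)) n
        λ (k , nd) eq → cong (λ b → w k nd (if b then 0ℤ else proj₂ nd)) (trans (sym (evenᵇ-+ (square k) (area B nd))) (cong evenᵇ eq)))) main
        where
        e : ℤ × (ℤ × ℤ) → ℕ
        e (k , nd) = square k ℕ.+ square k ℕ.+ area B nd
        w : ℤ → ℤ × ℤ → ℤ → ℤ
        w k nd v = σ k * (- v + (+ area B nd + - + (square k ℕ.+ square k)) * v)
        main : + 3 ∣ gen triples e (λ (k , nd) → w k nd (if evenᵇ n then 0ℤ else proj₂ nd)) n
        main with evenᵇ n in eq
        ... | true  = divides 0ℤ (ΣL-zero triples λ x → when-0 (e x ≡ᵇ n) (lem (σ (proj₁ x)) (+ area B (proj₂ x) + - + (square (proj₁ x) ℕ.+ square (proj₁ x)))))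
          where
          lem : ∀ s v → s * (- 0ℤ + v * 0ℤ) ≡ 0ℤ
          lem = solve-∀
          when-0 : ∀ b {z} → z ≡ 0ℤ → when b z ≡ 0ℤ
          when-0 true  z = z
          when-0 false z = refl
        ... | false = subst (+ 3 ∣_) (sym (trans (gen-odd B n n≤B (λ (n , k , d) → w k (n , d) d))
                        (Σ-cong (oddRegion B n n≤B) λ { (n , k , d) (pn , pd , _) → cong (σ k *_) (trans
                          (cong₂ (λ x y → - d + (x + - (y + y)) * d) (sym (abs-product pn pd)) (sym (abs-square k))) (lem n k d)) })))
                        (odd-divisible (sgnℕ-odd n eq) (oddRegion B n n≤B))
          where
          lem : ∀ n k d → - d + (n * d + - (k * k + k * k)) * d ≡ (n * d + - (k * k + k * k) + -1ℤ) * d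
          lem = solve-∀

    odd-relation : ⊝ oddPart spt ⊕ θ (oddPart spt) ≈ 𝟘
    odd-relation = untwist (area B) w₀ (oddWeight B 3)
      (≈-trans (solve 2 (λ f s → f :* (:- s) := :- (f :* s)) ≈-refl (φ B 3) (oddPart spt))
        (≈-trans (⊝-cong (odd-identity B 3)) (≗⇒≈ λ n → trans (⊝-at _ n) (sym (gen-neg (pairs B) (area B) (oddWeight B 3) n)))))
      (odd-identity B 3) odd-coefficients
      where
      open Solver

  -- The correction weight E makes twice the twisted weight of w₁ and w₂ the weight of Mod5.certificate,
  -- while w₁ + w₂ remains congruent to evenWeight because j⁵ ≡ j (mod 5).
  module Five (B : ℕ) where
    open Truncated B 5
    open Units B 5
    open Coefficients 5 {B}
    open Twist B 5
    open Residues 5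

    private
      E w₁ w₂ : ℤ × ℤ → ℤ
      E (n , d) = + 4 * (n * n * n) + onEven n (λ u → + 2 * (u * u * d) + + 2 * (u * u * u) + + 4 * u)
      w₁ (n , d) = σ n * ([ n < d ] * ((d + - n) * (d + - n) * ((d + - n) * (d + - n) * (d + - n) + + 3 * (d + - n))))
        + (+ 3 * n + - onEven n (λ u → u + u)) + - (+ 3 * E (n , d))
      w₂ (n , d) = + 2 * (σ n * ([ n < d ] * ((d + - n) * (d + - n) * (d + - n) + + 3 * (d + - n)))) + + 3 * E (n , d)

      w₁-evenWeight : ∀ nd → + 5 ∣ evenWeight B 5 nd + - w₂ nd + - w₁ nd
      w₁-evenWeight (n , d) = subst (+ 5 ∣_) (lem (d + - n) ((d + - n) * (d + - n)) (Mod5.I.f (d + - n)) (σ n) [ n < d ] (+ 3 * n + - onEven n (λ u → u + u)) (+ 3 * E (n , d)))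
        (∣n⇒∣m*n (σ n * [ n < d ]) (fermat (d + - n)))
        where
        fermat : ∀ j → + 5 ∣ + 2 * j + - (+ 2 * (j * j * j + + 3 * j)) + - (j * j * (j * j * j + + 3 * j))
        fermat j = vanishes (# (+ 2) ⊠ v₀ ⊞ ⊟ (# (+ 2) ⊠ (v₀ ⊠ v₀ ⊠ v₀ ⊞ # (+ 3) ⊠ v₀)) ⊞ ⊟ (v₀ ⊠ v₀ ⊠ (v₀ ⊠ v₀ ⊠ v₀ ⊞ # (+ 3) ⊠ v₀))) tt j 0ℤ 0ℤ
        lem : ∀ j q f s l b e → s * l * (+ 2 * j + - (+ 2 * f) + - (q * f))
          ≡ b + + 2 * (s * (l * j)) + - (+ 2 * (s * (l * f)) + e) + - (s * (l * (q * f)) + b + - e)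
        lem = solve-∀

      triple-divisible : ∀ m m≤B → + 5 ∣ Σ[ tripleRegion B m m≤B ] (weighted λ n k d → w₁ (n , d) + (n * d + n * d + - (k * k + k * k)) * w₂ (n , d))
      -- The certificate concerns twice the sum; 3 inverts 2 modulo 5, as 3 (2 z) - 5 z = z.
      triple-divisible m m≤B = subst (+ 5 ∣_) (six (Σ[ S ] (weighted w)))
        (∣m∣n⇒∣m+n (∣n⇒∣m*n (+ 3) (subst (+ 5 ∣_) doubled (total-divisible Mod5.certificate S)))
                     (∣n⇒∣m*n (- Σ[ S ] (weighted w)) (divides 1ℤ refl)))
        where
        S : Region (InS (+ m))
        S = tripleRegion B m m≤B
        w : ℤ → ℤ → ℤ → ℤ
        w n k d = w₁ (n , d) + (n * d + n * d + - (k * k + k * k)) * w₂ (n , d)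
        six : ∀ z → + 3 * (+ 2 * z) + - z * + 5 ≡ z
        six = solve-∀
        expand : ∀ n k d → + 2 * (σ n * ([ n < d ] * Weights.WF Mod5.weights n k d)) + Weights.a Mod5.weights n k d + onEven n (λ u → Weights.b Mod5.weights u k d)
                 ≡ + 2 * w n k d
        square-gap : ∀ n k d → (d + n) * (d + n) + - (+ 4 * (k * k)) ≡ (d + - n) * (d + - n) + + 4 * (n * d + - (k * k))
        square-gap = solve-∀
        double-gap : ∀ n k d → n * d + - (k * k) + (n * d + - (k * k)) ≡ n * d + n * d + - (k * k + k * k)
        double-gap = solve-∀
        poly : ∀ s l f q X n h t v → + 2 * (s * (l * (f * (q + + 4 * X)))) + + 2 * (+ 3 * n + (+ 6 * X + -[1+ 2 ]) * t) + + 2 * (- h + (+ 6 * X + -[1+ 2 ]) * v)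
          ≡ + 2 * (s * (l * (q * f)) + (+ 3 * n + - h) + - (+ 3 * (t + v)) + (X + X) * (+ 2 * (s * (l * f)) + + 3 * (t + v)))
        poly = solve-∀
        expand-onEven : ∀ n k d h v → + 2 * (σ n * ([ n < d ] * Weights.WF Mod5.weights n k d)) + Weights.a Mod5.weights n k d + + 2 * (- h + (+ 6 * (n * d + - (k * k)) + -[1+ 2 ]) * v)
          ≡ + 2 * (σ n * ([ n < d ] * ((d + - n) * (d + - n) * Mod5.I.f (d + - n))) + (+ 3 * n + - h) + - (+ 3 * (Mod5.I.e n d + v))
              + (n * d + n * d + - (k * k + k * k)) * (+ 2 * (σ n * ([ n < d ] * Mod5.I.f (d + - n))) + + 3 * (Mod5.I.e n d + v)))
        expand-onEven n k d h v = trans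
          (cong (λ y → + 2 * (σ n * ([ n < d ] * (Mod5.I.f (d + - n) * y))) + Weights.a Mod5.weights n k d + + 2 * (- h + (+ 6 * (n * d + - (k * k)) + -[1+ 2 ]) * v)) (square-gap n k d))
          (trans (poly (σ n) [ n < d ] (Mod5.I.f (d + - n)) ((d + - n) * (d + - n)) (n * d + - (k * k)) n h (Mod5.I.e n d) v)
            (cong (λ y → + 2 * (σ n * ([ n < d ] * ((d + - n) * (d + - n) * Mod5.I.f (d + - n))) + (+ 3 * n + - h) + - (+ 3 * (Mod5.I.e n d + v))
              + y * (+ 2 * (σ n * ([ n < d ] * Mod5.I.f (d + - n))) + + 3 * (Mod5.I.e n d + v)))) (double-gap n k d)))
        expand n k d with even? n
        ... | yes e = trans (cong (λ z → + 2 * (σ n * ([ n < d ] * Weights.WF Mod5.weights n k d)) + Weights.a Mod5.weights n k d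
                          + + 2 * (- (half n + half n) + (+ 6 * (z * d + - (k * k)) + -[1+ 2 ]) * Mod5.I.e₂ (half n) d)) (half+half n e))
                        (expand-onEven n k d (half n + half n) (Mod5.I.e₂ (half n) d))
        ... | no _  = trans (cong (λ z → + 2 * (σ n * ([ n < d ] * Weights.WF Mod5.weights n k d)) + Weights.a Mod5.weights n k d + z)
                          (sym (trans (cong (+ 2 *_) (trans (ℤ.+-identityˡ _) (ℤ.*-zeroʳ (+ 6 * (n * d + - (k * k)) + -[1+ 2 ])))) refl)))
                        (expand-onEven n k d 0ℤ 0ℤ)
        doubled : Σ[ S ] (total Mod5.certificate S) ≡ + 2 * Σ[ S ] (weighted w)
        doubled = trans (Σ-cong S λ (n , k , d) _ → trans (cong (σ k *_) (expand n k d)) (lem (σ k) (w n k d))) (Σ-* S (+ 2) (weighted w))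
          where
          lem : ∀ s x → s * (+ 2 * x) ≡ + 2 * (s * x)
          lem = solve-∀

    -- Only its product with φ is explicit, which is all that `untwist` requires. Its coefficients
    -- need not be known: at degrees N ≡ 1 (mod 5) the relation multiplies them by N - 1 ≡ 0.
    correction : Series
    correction = inv (φ B 5) ⊛ gen (pairs B) doubleArea w₂

    even-relation : evenPart spt ⊖ correction ⊕ θ correction ≈ 𝟘
    even-relation = untwist doubleArea w₁ w₂
      (≈-trans (solve 3 (λ f s t → f :* (s :- t) := f :* s :- f :* t) ≈-refl (φ B 5) (evenPart spt) correction)
        (≈-trans (+-cong (even-identity B 5) (⊝-cong φ-correction))
          (≈-trans (≗⇒≈ λ n → trans (⊖-at _ _ n) (trans (cong (λ z → gen (pairs B) doubleArea (evenWeight B 5) n + z) (sym (gen-neg (pairs B) doubleArea w₂ n)))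
              (sym (gen-+ (pairs B) doubleArea (evenWeight B 5) (λ nd → - w₂ nd) n))))
            (gen-cong≋ (pairs B) doubleArea w₁-evenWeight))))
      φ-correction
      (even-coefficients w₁ w₂ triple-divisible)
      where
      open Solver
      φ-correction : φ B 5 ⊛ correction ≈ gen (pairs B) doubleArea w₂
      φ-correction = ≈-trans (≈-sym (*-assoc _ _ _)) (≈-trans (*-congʳ (inv-inverse (φ B 5) φ₀)) (*-identityˡ _))

  odd⇒2∣sum : ∀ n d → σ n ≡ -1ℤ → σ d ≡ -1ℤ → + 2 ∣ n + d
  odd⇒2∣sum n d on od = divides (half (n + d)) (trans (sym (half+half (n + d) (trans (σ-+ n d) (cong₂ _*_ on od)))) (lem (half (n + d))))
    where
    lem : ∀ h → h + h ≡ h * + 2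
    lem = solve-∀

  -- For z = n² the product z (z - 1) is divisible by 3, whereas z = 3 j + 2 leaves the remainder 2.
  ¬square-2-mod-3 : ∀ n j → n * n ≢ + 3 * j + + 2
  ¬square-2-mod-3 n j e = toWitnessFalse {a? = + 3 ∣? + 2} tt (subst (+ 3 ∣_) (trans (cong (λ z → z * (z + -1ℤ) + - ((+ 3 * j * j + + 3 * j) * + 3)) e) (lem j))
    (∣m∣n⇒∣m+n (vanishes (v₀ ⊠ v₀ ⊠ (v₀ ⊠ v₀ ⊞ # -1ℤ)) tt n 0ℤ 0ℤ) (∣m⇒∣-m (divides (+ 3 * j * j + + 3 * j) refl))))
    where
    open Residues 3
    lem : ∀ j → (+ 3 * j + + 2) * (+ 3 * j + + 2 + -1ℤ) + - ((+ 3 * j * j + + 3 * j) * + 3) ≡ + 2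
    lem = solve-∀

  module Two (B : ℕ) where
    open Truncated B 2
    open Units B 2
    open Coefficients 2 {B}
    open Lambert B 2

    private
      two≈𝟘 : two ≈ 𝟘
      two≈𝟘 = upTo λ { zero _ → by 1ℤ refl ; (suc n) _ → ≡⇒≋ refl }

      two-⊛ : ∀ a b → a ⊕ two ⊛ b ≈ a
      two-⊛ a b = ≈-trans (+-congˡ (≈-trans (*-congʳ two≈𝟘) (zeroˡ b))) (+-identityʳ a)

    spt-divisor-sum : spt ≈ gen (pairs B) (area B) proj₂
    spt-divisor-sum = ≈-trans (≈-sym (*-identityˡ spt)) (≈-trans (*-congʳ (≈-sym (two-⊛ 𝟙 (Σ< B λ r → sg (suc r) ⊛ mono (suc r ℕ.* suc r ℕ.+ suc r ℕ.* suc r)))))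
      (≈-trans (spt-identity B 2) (≈-trans (two-⊛ _ _) (≗⇒≈ (lambert-sum B 2)))))

    -- Divisors pair off as n + d with n d = N and both odd. No divisor is left over, because a
    -- number that is 2 modulo 3 is not a square.
    divisor-sum-even : ∀ j N → + N ≡ + 3 * j + + 2 → σ (+ N) ≡ -1ℤ → (R : Region (InPair N)) → + 2 ∣ Σ[ R ] proj₂
    divisor-sum-even j N N≡ oddN R = subst (+ 2 ∣_) (sym split) (Σ-∣ (positive R gap) λ { (n , d) ((_ , _ , e) , _) → odd⇒2∣sum n d (odd-factor n d e) (odd-factor d n (trans (ℤ.*-comm d n) e)) })
      where
      gap : ℤ × ℤ → ℤ
      gap (n , d) = d + - n
      odd-factor : ∀ n d → n * d ≡ + N → σ n ≡ -1ℤ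
      odd-factor n d e = odd n λ ev → case-absurd (trans (sym (σ-even-* n d ev)) (trans (cong σ e) oddN))
        where
        case-absurd : ¬ 1ℤ ≡ -1ℤ
        case-absurd ()
      neg-gap : ∀ n d → - (d + - n) ≡ n + - d
      neg-gap = solve-∀
      no-square : Σ[ vanishing R gap ] proj₂ ≡ 0ℤ
      no-square = Σ-zero (vanishing R gap) λ { (n , d) ((_ , _ , e) , z) → ⊥-elim (¬square-2-mod-3 n j (trans (cong (n *_) (trans (sym (ℤ.+-identityʳ n)) (trans (cong (λ v → n + v) (sym z)) (lem n d)))) (trans e N≡))) }
        where
        lem : ∀ n d → n + (d + - n) ≡ d
        lem = solve-∀
      mirror : Σ[ negative R gap ] proj₂ ≡ Σ[ positive R gap ] proj₁
      mirror = Σ-bij (record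
        { to = λ (n , d) → d , n ; from = λ (n , d) → d , n
        ; to-in = λ { {n , d} ((p , q , e) , r) → (q , p , trans (ℤ.*-comm d n) e) , subst Pos (neg-gap n d) r }
        ; from-in = λ { {n , d} ((p , q , e) , r) → (q , p , trans (ℤ.*-comm d n) e) , subst Pos (sym (neg-gap d n)) r }
        ; from-to = λ _ → refl ; to-from = λ _ → refl })
        (negative R gap) (positive R gap) (λ _ _ → refl)
      split : Σ[ R ] proj₂ ≡ Σ[ positive R gap ] (λ (n , d) → n + d)
      split = trans (Σ-trichotomy R gap proj₂) (trans (cong₂ (λ x y → Σ[ positive R gap ] proj₂ + (x + y)) no-square mirror)
        (trans (lem (Σ[ positive R gap ] proj₂) (Σ[ positive R gap ] proj₁)) (sym (Σ-+ (positive R gap) proj₁ proj₂))))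
        where
        lem : ∀ x y → x + (0ℤ + y) ≡ y + x
        lem = solve-∀

  spt-2 : ∀ j N → + N ≡ + 3 * j + + 2 → evenᵇ N ≡ false → + 2 ∣ spt N
  spt-2 j N N≡ od = ≋0⇒∣ (≋-trans (at spt-divisor-sum N ℕ.≤-refl)
    (∣⇒≋0 (subst (+ 2 ∣_) (sym (gen-pairs N N ℕ.≤-refl proj₂)) (divisor-sum-even j N N≡ (sgnℕ-odd N od) (pairRegion N N ℕ.≤-refl)))))
    where
    open Truncated N 2
    open Coefficients 2 {N}
    open Two N

  evenPart-even : ∀ a n → evenᵇ n ≡ true → evenPart a n ≡ a n
  evenPart-even a n e = cong (λ b → if b then a n else 0ℤ) e

  oddPart-odd : ∀ a n → evenᵇ n ≡ false → oddPart a n ≡ a n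
  oddPart-odd a n e = cong (λ b → if b then 0ℤ else a n) e

  -- The relations multiply the coefficient by 1 + 2 N for even N and by N - 1 for odd N; both
  -- factors are units modulo 3 in the two residue classes considered.
  spt-3 : ∀ j N → + N ≡ + 3 * j ⊎ + N ≡ + 3 * j + + 2 → + 3 ∣ spt N
  spt-3 j N N≡ with evenᵇ N in parity
  ... | true  = even-case N≡ (subst (+ 3 ∣_) (trans (⊕-at (evenPart spt) _ N) (cong₂ _+_ (evenPart-even spt N parity)
                  (cong (+ N *_) (trans (⊛-const (+ 2) (evenPart spt) N) (cong (+ 2 *_) (evenPart-even spt N parity))))))
                  (≋0⇒∣ (at even-relation N ℕ.≤-refl)))
    where
    open Truncated N 3
    open Coefficients 3 {N}
    open Three N
    even-case : + N ≡ + 3 * j ⊎ + N ≡ + 3 * j + + 2 → + 3 ∣ spt N + + N * (+ 2 * spt N) → + 3 ∣ spt N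
    even-case (inj₁ e) d = subst (+ 3 ∣_) (trans (cong (λ v → spt N + v * (+ 2 * spt N) + - (+ 2 * j * spt N) * + 3) e) (lem j (spt N)))
      (∣m∣n⇒∣m+n d (divides (- (+ 2 * j * spt N)) refl))
      where
      lem : ∀ j z → z + + 3 * j * (+ 2 * z) + - (+ 2 * j * z) * + 3 ≡ z
      lem = solve-∀
    even-case (inj₂ e) d = subst (+ 3 ∣_) (trans (cong (λ v → - (spt N + v * (+ 2 * spt N)) + (+ 2 * spt N + + 2 * j * spt N) * + 3) e) (lem j (spt N)))
      (∣m∣n⇒∣m+n (∣m⇒∣-m d) (divides (+ 2 * spt N + + 2 * j * spt N) refl))
      where
      lem : ∀ j z → - (z + (+ 3 * j + + 2) * (+ 2 * z)) + (+ 2 * z + + 2 * j * z) * + 3 ≡ z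
      lem = solve-∀
  ... | false = odd-case N≡ (subst (+ 3 ∣_) (trans (⊕-at (⊝ oddPart spt) _ N) (cong₂ _+_ (trans (⊝-at (oddPart spt) N) (cong -_ (oddPart-odd spt N parity)))
                  (cong (+ N *_) (oddPart-odd spt N parity))))
                  (≋0⇒∣ (at odd-relation N ℕ.≤-refl)))
    where
    open Truncated N 3
    open Coefficients 3 {N}
    open Three N
    odd-case : + N ≡ + 3 * j ⊎ + N ≡ + 3 * j + + 2 → + 3 ∣ - spt N + + N * spt N → + 3 ∣ spt N
    odd-case (inj₁ e) d = subst (+ 3 ∣_) (trans (cong (λ v → - (- spt N + v * spt N) + j * spt N * + 3) e) (lem j (spt N)))
      (∣m∣n⇒∣m+n (∣m⇒∣-m d) (divides (j * spt N) refl))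
      where
      lem : ∀ j z → - (- z + + 3 * j * z) + j * z * + 3 ≡ z
      lem = solve-∀
    odd-case (inj₂ e) d = subst (+ 3 ∣_) (trans (cong (λ v → - spt N + v * spt N + - (j * spt N) * + 3) e) (lem j (spt N)))
      (∣m∣n⇒∣m+n d (divides (- (j * spt N)) refl))
      where
      lem : ∀ j z → - z + (+ 3 * j + + 2) * z + - (j * z) * + 3 ≡ z
      lem = solve-∀

  spt-5 : ∀ j N → + N ≡ + 10 * j + + 6 → evenᵇ N ≡ true → + 5 ∣ spt N
  spt-5 j N e parity = subst (+ 5 ∣_) (trans (cong (λ v → spt N + - c + v * c + - (c + + 2 * j * c) * + 5) e) (lem j (spt N) c))
    (∣m∣n⇒∣m+n (subst (+ 5 ∣_) (trans (⊕-at (evenPart spt ⊖ correction) (θ correction) N) (cong (_+ + N * c) (trans (⊖-at (evenPart spt) correction N) (cong (λ z → z + - c) (evenPart-even spt N parity)))))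
                  (≋0⇒∣ (at even-relation N ℕ.≤-refl)))
      (divides (- (c + + 2 * j * c)) refl))
    where
    open Truncated N 5
    open Units N 5
    open Coefficients 5 {N}
    open Five N
    c : ℤ
    c = correction N
    lem : ∀ j z c → z + - c + (+ 10 * j + + 6) * c + - (c + + 2 * j * c) * + 5 ≡ z
    lem = solve-∀

  2∣∧3∣⇒6∣ : ∀ {z} → + 2 ∣ z → + 3 ∣ z → + 6 ∣ z
  2∣∧3∣⇒6∣ {z} (divides a 2a) (divides b 3b) = divides (a + - b) (trans (lem z) (trans (cong₂ (λ x y → + 3 * x + - (+ 2 * y)) 2a 3b) (lem₂ a b)))
    where
    lem : ∀ z → z ≡ + 3 * z + - (+ 2 * z)
    lem = solve-∀
    lem₂ : ∀ a b → + 3 * (a * + 2) + - (+ 2 * (b * + 3)) ≡ (a + - b) * + 6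
    lem₂ = solve-∀

  spt-6 : ∀ j N → + N ≡ + 6 * j + + 5 → evenᵇ N ≡ false → + 6 ∣ spt N
  spt-6 j N e od = 2∣∧3∣⇒6∣ (spt-2 (+ 2 * j + 1ℤ) N N≡ od) (spt-3 (+ 2 * j + 1ℤ) N (inj₂ N≡))
    where
    lem : ∀ j → + 6 * j + + 5 ≡ + 3 * (+ 2 * j + 1ℤ) + + 2
    lem = solve-∀
    N≡ : + N ≡ + 3 * (+ 2 * j + 1ℤ) + + 2
    N≡ = trans e (lem j)

  evenᵇ-σ : ∀ N → σ (+ N) ≡ 1ℤ → evenᵇ N ≡ true
  evenᵇ-σ N e with evenᵇ N in eq
  ... | true  = refl
  ... | false with trans (sym e) (sgnℕ-odd N eq)
  ...   | ()

  evenᵇ-σ′ : ∀ N → σ (+ N) ≡ -1ℤ → evenᵇ N ≡ false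
  evenᵇ-σ′ N e with evenᵇ N in eq
  ... | false = refl
  ... | true with trans (sym e) (sgnℕ-even N eq)
  ...   | ()

  -- At negative arguments the value is 0 by convention; otherwise z is the image of a natural
  -- number N.
  ∣-sptωℤ : ∀ k z → (∀ N → + N ≡ z → + k ∣ spt N) → k ℕ.∣ sptωℤ z
  ∣-sptωℤ k (+ N)    d = ∣⇒∣ᵤ (d N refl)
  ∣-sptωℤ k -[1+ _ ] d = k ℕ.∣0

open Congruences
open Parity using (σ; σ-+; σ-double)
open import Data.Nat.Divisibility using (_∣_)
open import Data.Integer using (_+_; _*_)

theorem1p5 : (n : ℤ) →
    (3 ∣ sptωℤ (+ 3 * n)) × (3 ∣ sptωℤ (+ 3 * n + + 2)) ×
    (5 ∣ sptωℤ (+ 10 * n + + 6)) × (6 ∣ sptωℤ (+ 6 * n + + 5))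
theorem1p5 n = ∣-sptωℤ 3 (+ 3 * n) (λ N e → spt-3 n N (inj₁ e))
             , ∣-sptωℤ 3 (+ 3 * n + + 2) (λ N e → spt-3 n N (inj₂ e))
             , ∣-sptωℤ 5 (+ 10 * n + + 6) (λ N e → spt-5 n N e (evenᵇ-σ N (trans (cong σ (trans e (lem₅ n))) (σ-double (+ 5 * n + + 3)))))
             , ∣-sptωℤ 6 (+ 6 * n + + 5) (λ N e → spt-6 n N e (evenᵇ-σ′ N (trans (cong σ (trans e (lem₆ n)))
                 (trans (σ-+ 1ℤ (+ 3 * n + + 2 + (+ 3 * n + + 2))) (cong (-1ℤ *_) (σ-double (+ 3 * n + + 2)))))))
  where
  lem₅ : ∀ n → + 10 * n + + 6 ≡ + 5 * n + + 3 + (+ 5 * n + + 3)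
  lem₅ = solve-∀
  lem₆ : ∀ n → + 6 * n + + 5 ≡ 1ℤ + (+ 3 * n + + 2 + (+ 3 * n + + 2))
  lem₆ = solve-∀
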